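{- Let $\mathbb{F}$ be a prime field and let $f \in \mathbb{F}[x_1,\ldots,x_n]$ be a cubic polynomial ($\deg(f)=3$) with $\mathrm{bias}(f)=\delta$. Then there exist $c_1 = O(\log(1/\delta))$ quadratic polynomials $q_1,\ldots,q_{c_1} \in \mathbb{F}[x_1,\ldots,x_n]$ and linear functions $\ell_1,\ldots,\ell_{c_1}\in \mathbb{F}[x_1,\ldots,x_n]$, another $c_2 = O(\log^4(1/\delta))$ linear functions $\ell'_1,\ldots,\ell'_{c_2} \in \mathbb{F}[x_1,\ldots,x_n]$, and a cubic polynomial $g$ in $c_2$ variables such that $$f = \sum_{j=1}^{c_1} \ell_j \cdot q_j + g(\ell'_1,\ldots,\ell'_{c_2}).$$
   Context: For $f:\mathbb{F}^n\to\mathbb{F}$, $\mathrm{bias}(f) = \left|\mathbb{E}_{a \in \mathbb{F}^n}[\omega^{f(a)}]\right|$ with $\omega = e^{2\pi i/|\mathbb{F}|}$ (expectation over uniform $a$). Polynomials are identified with the functions $\mathbb{F}^n\to\mathbb{F}$ they define (i.e. one works modulo $x_i^{p}-x_i$, $p=|\mathbb{F}|$), equality means equality as functions, and the degree of a function is the least degree of a polynomial representing it. In the conclusion, "linear", "quadratic", "cubic" mean degree at most $1,2,3$ (linear functions may have a constant term). The implied constants in $O(\cdot)$ may depend on the fixed field $\mathbb{F}$ but not on $n$, $f$ or $\delta$. -}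

module Defs where

open import Data.Nat.Base as ℕ using (ℕ; zero; suc; NonZero)
import Data.Nat.Properties as ℕP
open import Data.Nat.DivMod using (_mod_)
open import Data.Integer.Base as ℤ using (+_; -[1+_])
import Data.Integer.Properties as ℤP
open import Data.Rational.Base using (ℚ; mkℚ; 0ℚ; 1ℚ; _/_)
import Data.Rational.Base as ℚ
import Data.Rational.Properties as ℚP
import Data.Rational.Unnormalised.Base as ℚᵘ
import Data.Rational.Unnormalised.Properties as ℚᵘP
open import Data.Rational.Solver using (module +-*-Solver)
open import Data.Fin.Base using (Fin; toℕ)
open import Data.List.Base as List using (List; []; _∷_)
open import Data.List.Relation.Unary.All using (All)
open import Data.Product.Base using (∃; ∃-syntax; _×_; _,_; proj₁; proj₂)
open import Data.Sum.Base using (inj₁; inj₂; [_,_]′)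
open import Data.Vec.Base as Vec using (Vec; []; _∷_)
import Data.Vec.Functional as Vector
open import Relation.Binary.PropositionalEquality
  using (_≡_; refl; sym; trans; cong; cong₂; subst)

IsCauchy : (ℕ → ℚ) → Set
IsCauchy s = ∀ ε → 0ℚ ℚ.< ε →
  ∃[ N ] (∀ m n → N ℕ.≤ m → N ℕ.≤ n → ℚ.∣ s m ℚ.- s n ∣ ℚ.≤ ε)

infixr 8 _^ℚ_

_^ℚ_ : ℚ → ℕ → ℚ
q ^ℚ zero  = 1ℚ
q ^ℚ suc k = q ℚ.* q ^ℚ k

fromℕℚ : ℕ → ℚ
fromℕℚ n = + n / 1

1/! : ℕ → ℚ
1/! zero    = 1ℚ
1/! (suc k) = 1/! k ℚ.* (+ 1 / suc k)

partialSum : (ℕ → ℚ) → ℕ → ℚ → ℚ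
partialSum c zero    q = 0ℚ
partialSum c (suc N) q = partialSum c N q ℚ.+ c N ℚ.* q ^ℚ N

module Cauchy where

  open ℚP.≤-Reasoning
  open +-*-Solver using (solve; _:=_; _:+_; _:*_; :-_; con)

  0≤* : ∀ {a b} → 0ℚ ℚ.≤ a → 0ℚ ℚ.≤ b → 0ℚ ℚ.≤ a ℚ.* b
  0≤* {a} {b} a≥0 b≥0 = ℚP.nonNegative⁻¹ (a ℚ.* b)
    {{ℚP.nonNeg*nonNeg⇒nonNeg a {{ℚ.nonNegative a≥0}} b {{ℚ.nonNegative b≥0}}}}

  0≤+ : ∀ {a b} → 0ℚ ℚ.≤ a → 0ℚ ℚ.≤ b → 0ℚ ℚ.≤ a ℚ.+ b
  0≤+ = ℚP.+-mono-≤

  *-monoˡ : ∀ {a c d} → 0ℚ ℚ.≤ a → c ℚ.≤ d → a ℚ.* c ℚ.≤ a ℚ.* d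
  *-monoˡ {a} a≥0 = ℚP.*-monoˡ-≤-nonNeg a {{ℚ.nonNegative a≥0}}

  *-monoʳ : ∀ {a c d} → 0ℚ ℚ.≤ a → c ℚ.≤ d → c ℚ.* a ℚ.≤ d ℚ.* a
  *-monoʳ {a} a≥0 = ℚP.*-monoʳ-≤-nonNeg a {{ℚ.nonNegative a≥0}}

  *-mono : ∀ {a b c d} → 0ℚ ℚ.≤ a → 0ℚ ℚ.≤ d → a ℚ.≤ b → c ℚ.≤ d → a ℚ.* c ℚ.≤ b ℚ.* d
  *-mono a≥0 d≥0 a≤b c≤d = ℚP.≤-trans (*-monoˡ a≥0 c≤d) (*-monoʳ d≥0 a≤b)

  ≤-+ʳ : ∀ {a b c} → a ℚ.≤ b → 0ℚ ℚ.≤ c → a ℚ.≤ b ℚ.+ c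
  ≤-+ʳ {a} a≤b 0≤c = subst (ℚ._≤ _) (ℚP.+-identityʳ a) (ℚP.+-mono-≤ a≤b 0≤c)

  ∣∣-swap : ∀ p q → ℚ.∣ p ℚ.- q ∣ ≡ ℚ.∣ q ℚ.- p ∣
  ∣∣-swap p q = trans (sym (ℚP.∣-p∣≡∣p∣ (p ℚ.- q)))
    (cong ℚ.∣_∣ (solve 2 (λ p q → :- (p :+ :- q) := q :+ :- p) refl p q))

  0≤1 : 0ℚ ℚ.≤ 1ℚ
  0≤1 = ℚP.nonNegative⁻¹ 1ℚ

  0<1 : 0ℚ ℚ.< 1ℚ
  0<1 = ℚP.positive⁻¹ 1ℚ

  fromℕℚ-mono : ∀ {m n} → m ℕ.≤ n → fromℕℚ m ℚ.≤ fromℕℚ n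
  fromℕℚ-mono {m} {n} m≤n = ℚP.toℚᵘ-cancel-≤
    (ℚᵘP.≤-respˡ-≃ (ℚᵘP.≃-sym (ℚP.toℚᵘ-fromℚᵘ (ℚᵘ.mkℚᵘ (+ m) 0)))
    (ℚᵘP.≤-respʳ-≃ (ℚᵘP.≃-sym (ℚP.toℚᵘ-fromℚᵘ (ℚᵘ.mkℚᵘ (+ n) 0)))
    (ℚᵘ.*≤* (ℤP.*-monoʳ-≤-nonNeg (+ 1) (ℤ.+≤+ m≤n)))))

  0≤fromℕℚ : ∀ n → 0ℚ ℚ.≤ fromℕℚ n
  0≤fromℕℚ n = fromℕℚ-mono {0} {n} ℕ.z≤n

  fromℕℚ-suc : ∀ n → fromℕℚ (suc n) ≡ fromℕℚ n ℚ.+ 1ℚ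
  fromℕℚ-suc n = ℚP.toℚᵘ-injective (ℚᵘP.≃-trans
    (ℚP.toℚᵘ-fromℚᵘ (ℚᵘ.mkℚᵘ (+ suc n) 0)) (ℚᵘP.≃-sym (ℚᵘP.≃-trans
    (ℚP.toℚᵘ-homo-+ (fromℕℚ n) 1ℚ) (ℚᵘP.≃-trans
    (ℚᵘP.+-cong (ℚP.toℚᵘ-fromℚᵘ (ℚᵘ.mkℚᵘ (+ n) 0)) ℚᵘP.≃-refl)
    (ℚᵘ.*≡* (cong (ℤ._* + 1) (trans (cong (ℤ._+ + 1) (ℤP.*-identityʳ (+ n)))
                                    (ℤP.+-comm (+ n) (+ 1)))))))))

  fromℕℚ-inverse : ∀ k → fromℕℚ (suc k) ℚ.* (+ 1 / suc k) ≡ 1ℚ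
  fromℕℚ-inverse k = ℚP.toℚᵘ-injective (ℚᵘP.≃-trans
    (ℚP.toℚᵘ-homo-* (fromℕℚ (suc k)) (+ 1 / suc k)) (ℚᵘP.≃-trans
    (ℚᵘP.*-cong (ℚP.toℚᵘ-fromℚᵘ (ℚᵘ.mkℚᵘ (+ suc k) 0)) (ℚP.toℚᵘ-fromℚᵘ (ℚᵘ.mkℚᵘ (+ 1) k)))
    (ℚᵘ.*≡* (trans (cong (ℤ._* + 1) (ℤP.*-identityʳ (+ suc k)))
            (trans (ℤP.*-comm (+ suc k) (+ 1))
                   (cong (λ j → + 1 ℤ.* + suc j) (sym (ℕP.+-identityʳ k))))))))

  0≤inv : ∀ k → 0ℚ ℚ.≤ + 1 / suc k
  0≤inv k = ℚP.nonNegative⁻¹ _ {{ℚP.normalize-nonNeg 1 (suc k)}}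

  archimedean : ∀ q → ∃[ n ] q ℚ.≤ fromℕℚ n
  archimedean q@(mkℚ i d _) = ℤ.∣ i ∣ , ℚP.toℚᵘ-cancel-≤
    (ℚᵘP.≤-respʳ-≃ (ℚᵘP.≃-sym (ℚP.toℚᵘ-fromℚᵘ (ℚᵘ.mkℚᵘ (+ ℤ.∣ i ∣) 0)))
                   (ℚᵘ.*≤* (bound i)))
    where
    bound : ∀ i → i ℤ.* + 1 ℤ.≤ + ℤ.∣ i ∣ ℤ.* + suc d
    bound (+ n)    = subst (ℤ._≤ + n ℤ.* + suc d) refl
      (ℤP.*-monoˡ-≤-nonNeg (+ n) (ℤ.+≤+ (ℕ.s≤s ℕ.z≤n)))
    bound -[1+ n ] = ℤ.-≤+

  archimedean-* : ∀ q ε → 0ℚ ℚ.< ε → ∃[ n ] q ℚ.≤ ε ℚ.* fromℕℚ n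
  archimedean-* q ε 0<ε = n , (begin
    q                     ≡⟨ sym (ℚP.*-identityˡ q) ⟩
    1ℚ ℚ.* q              ≡⟨ cong (ℚ._* q) (sym (ℚP.*-inverseʳ ε)) ⟩
    (ε ℚ.* ε⁻¹) ℚ.* q     ≡⟨ solve 3 (λ a b c → (a :* b) :* c := a :* (c :* b)) refl ε ε⁻¹ q ⟩
    ε ℚ.* (q ℚ.* ε⁻¹)     ≤⟨ *-monoˡ (ℚP.<⇒≤ 0<ε) q≤n ⟩
    ε ℚ.* fromℕℚ n        ∎)
    where
    instance
      ε≢0 : ℚ.NonZero ε
      ε≢0 = ℚ.>-nonZero 0<ε
    ε⁻¹ = ℚ.1/ ε
    n   = proj₁ (archimedean (q ℚ.* ε⁻¹))
    q≤n = proj₂ (archimedean (q ℚ.* ε⁻¹))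

  scaled : ∀ s K → 0ℚ ℚ.≤ K →
    (∀ ε → 0ℚ ℚ.< ε →
      ∃[ N ] (∀ m n → N ℕ.≤ n → n ℕ.≤ m → ℚ.∣ s m ℚ.- s n ∣ ℚ.≤ K ℚ.* ε)) →
    IsCauchy s
  scaled s K 0≤K h ε 0<ε = N , all
    where
    instance
      K′>0 : ℚ.Positive (K ℚ.+ 1ℚ)
      K′>0 = ℚ.positive (ℚP.+-mono-≤-< 0≤K 0<1)
      K′≢0 : ℚ.NonZero (K ℚ.+ 1ℚ)
      K′≢0 = ℚP.pos⇒nonZero (K ℚ.+ 1ℚ)
      ε>0 : ℚ.Positive ε
      ε>0 = ℚ.positive 0<ε
      i>0 : ℚ.Positive (ℚ.1/ (K ℚ.+ 1ℚ))
      i>0 = ℚP.1/pos⇒pos (K ℚ.+ 1ℚ)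
    i  = ℚ.1/ (K ℚ.+ 1ℚ)
    ε′ = i ℚ.* ε
    0<ε′ : 0ℚ ℚ.< ε′
    0<ε′ = ℚP.positive⁻¹ ε′ {{ℚP.pos*pos⇒pos i ε}}
    N  = proj₁ (h ε′ 0<ε′)
    Kε′≤ε : K ℚ.* ε′ ℚ.≤ ε
    Kε′≤ε = begin
      K ℚ.* ε′             ≤⟨ ≤-+ʳ (ℚP.≤-refl {K ℚ.* ε′}) (ℚP.<⇒≤ 0<ε′) ⟩
      K ℚ.* ε′ ℚ.+ ε′      ≡⟨ solve 3 (λ K i ε → K :* (i :* ε) :+ i :* ε
                                := ((K :+ con 1ℚ) :* i) :* ε) refl K i ε ⟩
      (K ℚ.+ 1ℚ) ℚ.* i ℚ.* ε ≡⟨ cong (ℚ._* ε) (ℚP.*-inverseʳ (K ℚ.+ 1ℚ)) ⟩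
      1ℚ ℚ.* ε             ≡⟨ ℚP.*-identityˡ ε ⟩
      ε                    ∎
    all : ∀ m n → N ℕ.≤ m → N ℕ.≤ n → ℚ.∣ s m ℚ.- s n ∣ ℚ.≤ ε
    all m n N≤m N≤n with ℕP.≤-total n m
    ... | inj₁ n≤m = ℚP.≤-trans (proj₂ (h ε′ 0<ε′) m n N≤n n≤m) Kε′≤ε
    ... | inj₂ m≤n = subst (ℚ._≤ ε) (∣∣-swap (s n) (s m))
                       (ℚP.≤-trans (proj₂ (h ε′ 0<ε′) n m N≤m m≤n) Kε′≤ε)

  bounded : ∀ s → IsCauchy s → ∃[ B ] (∀ n → ℚ.∣ s n ∣ ℚ.≤ fromℕℚ B)
  bounded s c = B , all
    where
    N = proj₁ (c 1ℚ 0<1)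
    M : ℕ → ℚ
    M zero    = 0ℚ
    M (suc k) = M k ℚ.+ ℚ.∣ s k ∣
    0≤M : ∀ k → 0ℚ ℚ.≤ M k
    0≤M zero    = ℚP.≤-refl
    0≤M (suc k) = 0≤+ (0≤M k) (ℚP.0≤∣p∣ (s k))
    below : ∀ k n → n ℕ.< k → ℚ.∣ s n ∣ ℚ.≤ M k
    below (suc k) n (ℕ.s≤s n≤k) with ℕP.m≤n⇒m<n∨m≡n n≤k
    ... | inj₁ n<k  = ≤-+ʳ (below k n n<k) (ℚP.0≤∣p∣ (s k))
    ... | inj₂ refl = subst (ℚ._≤ M k ℚ.+ ℚ.∣ s k ∣) (ℚP.+-identityˡ ℚ.∣ s k ∣) (ℚP.+-monoˡ-≤ ℚ.∣ s k ∣ (0≤M k))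
    Q = M N ℚ.+ (1ℚ ℚ.+ ℚ.∣ s N ∣)
    B = proj₁ (archimedean Q)
    small : ∀ n → n ℕ.< N → ℚ.∣ s n ∣ ℚ.≤ Q
    small n n<N = ≤-+ʳ (below N n n<N) (0≤+ 0≤1 (ℚP.0≤∣p∣ (s N)))
    large : ∀ n → N ℕ.≤ n → ℚ.∣ s n ∣ ℚ.≤ Q
    large n N≤n = begin
      ℚ.∣ s n ∣                          ≡⟨ cong ℚ.∣_∣ (solve 2 (λ a b → a := (a :+ :- b) :+ b) refl (s n) (s N)) ⟩
      ℚ.∣ (s n ℚ.- s N) ℚ.+ s N ∣        ≤⟨ ℚP.∣p+q∣≤∣p∣+∣q∣ (s n ℚ.- s N) (s N) ⟩
      ℚ.∣ s n ℚ.- s N ∣ ℚ.+ ℚ.∣ s N ∣    ≤⟨ ℚP.+-monoˡ-≤ ℚ.∣ s N ∣ (proj₂ (c 1ℚ 0<1) n N N≤n ℕP.≤-refl) ⟩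
      1ℚ ℚ.+ ℚ.∣ s N ∣                   ≡⟨ sym (ℚP.+-identityˡ _) ⟩
      0ℚ ℚ.+ (1ℚ ℚ.+ ℚ.∣ s N ∣)          ≤⟨ ℚP.+-monoˡ-≤ _ (0≤M N) ⟩
      Q                                  ∎
    all : ∀ n → ℚ.∣ s n ∣ ℚ.≤ fromℕℚ B
    all n = ℚP.≤-trans ([ small n , large n ]′ (ℕP.<-≤-connex n N)) (proj₂ (archimedean Q))

  const : ∀ q → IsCauchy (λ _ → q)
  const q ε 0<ε = 0 , λ _ _ _ _ →
    subst (ℚ._≤ ε) (sym (cong ℚ.∣_∣ (ℚP.+-inverseʳ q))) (ℚP.<⇒≤ 0<ε)

  neg : ∀ s → IsCauchy s → IsCauchy (λ n → ℚ.- s n)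
  neg s c ε 0<ε = proj₁ (c ε 0<ε) , λ m n N≤m N≤n →
    subst (ℚ._≤ ε)
      (trans (sym (ℚP.∣-p∣≡∣p∣ (s m ℚ.- s n)))
             (cong ℚ.∣_∣ (solve 2 (λ a b → :- (a :+ :- b) := :- a :+ :- (:- b)) refl (s m) (s n))))
      (proj₂ (c ε 0<ε) m n N≤m N≤n)

  add : ∀ s t → IsCauchy s → IsCauchy t → IsCauchy (λ n → s n ℚ.+ t n)
  add s t c d = scaled (λ n → s n ℚ.+ t n) (1ℚ ℚ.+ 1ℚ) (0≤+ 0≤1 0≤1) λ ε 0<ε →
    let (N , f) = c ε 0<ε
        (M , g) = d ε 0<ε
    in N ℕ.⊔ M , λ m n NM≤n n≤m →
      let NM≤m = ℕP.≤-trans NM≤n n≤m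
          le : ∀ {k} → N ℕ.⊔ M ℕ.≤ k → N ℕ.≤ k
          le = ℕP.m⊔n≤o⇒m≤o N M
          re : ∀ {k} → N ℕ.⊔ M ℕ.≤ k → M ℕ.≤ k
          re = ℕP.m⊔n≤o⇒n≤o N M
      in begin
        ℚ.∣ (s m ℚ.+ t m) ℚ.- (s n ℚ.+ t n) ∣
          ≡⟨ cong ℚ.∣_∣ (solve 4 (λ a b c d → (a :+ b) :+ :- (c :+ d) := (a :+ :- c) :+ (b :+ :- d))
               refl (s m) (t m) (s n) (t n)) ⟩
        ℚ.∣ (s m ℚ.- s n) ℚ.+ (t m ℚ.- t n) ∣
          ≤⟨ ℚP.∣p+q∣≤∣p∣+∣q∣ (s m ℚ.- s n) (t m ℚ.- t n) ⟩
        ℚ.∣ s m ℚ.- s n ∣ ℚ.+ ℚ.∣ t m ℚ.- t n ∣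
          ≤⟨ ℚP.+-mono-≤ (f m n (le NM≤m) (le NM≤n)) (g m n (re NM≤m) (re NM≤n)) ⟩
        ε ℚ.+ ε
          ≡⟨ solve 1 (λ e → e :+ e := (con 1ℚ :+ con 1ℚ) :* e) refl ε ⟩
        (1ℚ ℚ.+ 1ℚ) ℚ.* ε ∎

  mul : ∀ s t → IsCauchy s → IsCauchy t → IsCauchy (λ n → s n ℚ.* t n)
  mul s t c d = scaled (λ n → s n ℚ.* t n) (A ℚ.+ B) (0≤+ (0≤fromℕℚ (proj₁ (bounded s c))) (0≤fromℕℚ (proj₁ (bounded t d)))) λ ε 0<ε →
    let (N , f) = c ε 0<ε
        (M , g) = d ε 0<ε
    in N ℕ.⊔ M , λ m n NM≤n n≤m →
      let NM≤m = ℕP.≤-trans NM≤n n≤m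
          le : ∀ {k} → N ℕ.⊔ M ℕ.≤ k → N ℕ.≤ k
          le = ℕP.m⊔n≤o⇒m≤o N M
          re : ∀ {k} → N ℕ.⊔ M ℕ.≤ k → M ℕ.≤ k
          re = ℕP.m⊔n≤o⇒n≤o N M
      in begin
        ℚ.∣ s m ℚ.* t m ℚ.- s n ℚ.* t n ∣
          ≡⟨ cong ℚ.∣_∣ (solve 4 (λ a b c d → a :* b :+ :- (c :* d) := a :* (b :+ :- d) :+ d :* (a :+ :- c))
               refl (s m) (t m) (s n) (t n)) ⟩
        ℚ.∣ s m ℚ.* (t m ℚ.- t n) ℚ.+ t n ℚ.* (s m ℚ.- s n) ∣
          ≤⟨ ℚP.∣p+q∣≤∣p∣+∣q∣ (s m ℚ.* (t m ℚ.- t n)) (t n ℚ.* (s m ℚ.- s n)) ⟩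
        ℚ.∣ s m ℚ.* (t m ℚ.- t n) ∣ ℚ.+ ℚ.∣ t n ℚ.* (s m ℚ.- s n) ∣
          ≡⟨ cong₂ ℚ._+_ (ℚP.∣p*q∣≡∣p∣*∣q∣ (s m) (t m ℚ.- t n)) (ℚP.∣p*q∣≡∣p∣*∣q∣ (t n) (s m ℚ.- s n)) ⟩
        ℚ.∣ s m ∣ ℚ.* ℚ.∣ t m ℚ.- t n ∣ ℚ.+ ℚ.∣ t n ∣ ℚ.* ℚ.∣ s m ℚ.- s n ∣
          ≤⟨ ℚP.+-mono-≤
               (*-mono (ℚP.0≤∣p∣ (s m)) (ℚP.<⇒≤ 0<ε) (proj₂ (bounded s c) m) (g m n (re NM≤m) (re NM≤n)))
               (*-mono (ℚP.0≤∣p∣ (t n)) (ℚP.<⇒≤ 0<ε) (proj₂ (bounded t d) n) (f m n (le NM≤m) (le NM≤n))) ⟩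
        A ℚ.* ε ℚ.+ B ℚ.* ε
          ≡⟨ sym (ℚP.*-distribʳ-+ ε A B) ⟩
        (A ℚ.+ B) ℚ.* ε ∎
    where
    A = fromℕℚ (proj₁ (bounded s c))
    B = fromℕℚ (proj₁ (bounded t d))

  0≤^ : ∀ {b} k → 0ℚ ℚ.≤ b → 0ℚ ℚ.≤ b ^ℚ k
  0≤^ zero    _   = 0≤1
  0≤^ (suc k) 0≤b = 0≤* 0≤b (0≤^ k 0≤b)

  0≤1/! : ∀ k → 0ℚ ℚ.≤ 1/! k
  0≤1/! zero    = 0≤1
  0≤1/! (suc k) = 0≤* (0≤1/! k) (0≤inv k)

  module ExpTail (B : ℕ) where

    b : ℚ
    b = fromℕℚ B

    0≤b : 0ℚ ℚ.≤ b
    0≤b = 0≤fromℕℚ B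

    t : ℕ → ℚ
    t k = 1/! k ℚ.* b ^ℚ k

    e : ℕ → ℚ
    e N = partialSum 1/! N b

    0≤t : ∀ k → 0ℚ ℚ.≤ t k
    0≤t k = 0≤* (0≤1/! k) (0≤^ k 0≤b)

    t-suc : ∀ k → t (suc k) ≡ t k ℚ.* (b ℚ.* (+ 1 / suc k))
    t-suc k = solve 4 (λ f i b p → (f :* i) :* (b :* p) := (f :* p) :* (b :* i)) refl
      (1/! k) (+ 1 / suc k) b (b ^ℚ k)

    N₀ : ℕ
    N₀ = B ℕ.+ B

    fromℕℚ-+ : ∀ m n → fromℕℚ (m ℕ.+ n) ≡ fromℕℚ m ℚ.+ fromℕℚ n
    fromℕℚ-+ zero    n = sym (ℚP.+-identityˡ _)
    fromℕℚ-+ (suc m) n = trans (fromℕℚ-suc (m ℕ.+ n)) (trans (cong (ℚ._+ 1ℚ) (fromℕℚ-+ m n))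
      (trans (solve 2 (λ x y → (x :+ y) :+ con 1ℚ := (x :+ con 1ℚ) :+ y) refl (fromℕℚ m) (fromℕℚ n))
             (cong (ℚ._+ fromℕℚ n) (sym (fromℕℚ-suc m)))))

    half : ∀ k → N₀ ℕ.≤ k → t (suc k) ℚ.+ t (suc k) ℚ.≤ t k
    half k N₀≤k = begin
      t (suc k) ℚ.+ t (suc k)
        ≡⟨ cong₂ ℚ._+_ (t-suc k) (t-suc k) ⟩
      t k ℚ.* (b ℚ.* i) ℚ.+ t k ℚ.* (b ℚ.* i)
        ≡⟨ solve 3 (λ t b i → t :* (b :* i) :+ t :* (b :* i) := t :* ((b :+ b) :* i)) refl (t k) b i ⟩
      t k ℚ.* ((b ℚ.+ b) ℚ.* i)
        ≡⟨ cong (λ z → t k ℚ.* (z ℚ.* i)) (sym (fromℕℚ-+ B B)) ⟩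
      t k ℚ.* (fromℕℚ N₀ ℚ.* i)
        ≤⟨ *-monoˡ (0≤t k) (*-monoʳ (0≤inv k) (fromℕℚ-mono (ℕP.m≤n⇒m≤1+n N₀≤k))) ⟩
      t k ℚ.* (fromℕℚ (suc k) ℚ.* i)
        ≡⟨ cong (t k ℚ.*_) (fromℕℚ-inverse k) ⟩
      t k ℚ.* 1ℚ
        ≡⟨ ℚP.*-identityʳ (t k) ⟩
      t k ∎
      where i = + 1 / suc k

    φ : ℕ → ℚ
    φ n = e n ℚ.+ (t n ℚ.+ t n)

    φ-dec : ∀ {n m} → N₀ ℕ.≤ n → n ℕ.≤′ m → φ m ℚ.≤ φ n
    φ-dec N₀≤n ℕ.≤′-refl = ℚP.≤-refl
    φ-dec {n} {suc m} N₀≤n (ℕ.≤′-step n≤m) = begin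
      (e m ℚ.+ t m) ℚ.+ (t (suc m) ℚ.+ t (suc m))
        ≤⟨ ℚP.+-monoʳ-≤ (e m ℚ.+ t m) (half m (ℕP.≤-trans N₀≤n (ℕP.≤′⇒≤ n≤m))) ⟩
      (e m ℚ.+ t m) ℚ.+ t m
        ≡⟨ ℚP.+-assoc (e m) (t m) (t m) ⟩
      φ m
        ≤⟨ φ-dec N₀≤n n≤m ⟩
      φ n ∎

    e≤φ : ∀ n → e n ℚ.≤ φ n
    e≤φ n = ≤-+ʳ ℚP.≤-refl (0≤+ (0≤t n) (0≤t n))

    e-inc : ∀ {n m} → n ℕ.≤′ m → e n ℚ.≤ e m
    e-inc ℕ.≤′-refl = ℚP.≤-refl
    e-inc {n} {suc m} (ℕ.≤′-step n≤m) = ≤-+ʳ (e-inc n≤m) (0≤t m)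

    K : ℚ
    K = φ N₀

    e≤K : ∀ n → e n ℚ.≤ K
    e≤K n = [ (λ N₀≤n → ℚP.≤-trans (e≤φ n) (φ-dec ℕP.≤-refl (ℕP.≤⇒≤′ N₀≤n)))
            , (λ n≤N₀ → ℚP.≤-trans (e-inc (ℕP.≤⇒≤′ n≤N₀)) (e≤φ N₀))
            ]′ (ℕP.≤-total N₀ n)

    0≤e : ∀ n → 0ℚ ℚ.≤ e n
    0≤e n = e-inc (ℕP.≤⇒≤′ (ℕ.z≤n {n}))

    0≤K : 0ℚ ℚ.≤ K
    0≤K = e≤K 0

    t≤K : ∀ n → t n ℚ.≤ K
    t≤K n = ℚP.≤-trans
      (subst (ℚ._≤ e (suc n)) (ℚP.+-identityˡ (t n)) (ℚP.+-monoˡ-≤ (t n) (0≤e n)))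
      (e≤K (suc n))

    t→0 : ∀ ε → 0ℚ ℚ.< ε → ∃[ N ] (∀ n → N ℕ.≤ n → t n ℚ.≤ ε)
    t→0 ε 0<ε = suc M , small
      where
      M = proj₁ (archimedean-* (K ℚ.* b) ε 0<ε)
      small : ∀ n → suc M ℕ.≤ n → t n ℚ.≤ ε
      small (suc k) (ℕ.s≤s M≤k) = begin
        t (suc k)                        ≡⟨ t-suc k ⟩
        t k ℚ.* (b ℚ.* i)                ≤⟨ *-monoʳ (0≤* 0≤b (0≤inv k)) (t≤K k) ⟩
        K ℚ.* (b ℚ.* i)                  ≡⟨ sym (ℚP.*-assoc K b i) ⟩
        (K ℚ.* b) ℚ.* i                  ≤⟨ *-monoʳ (0≤inv k) (proj₂ (archimedean-* (K ℚ.* b) ε 0<ε)) ⟩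
        (ε ℚ.* fromℕℚ M) ℚ.* i           ≤⟨ *-monoʳ (0≤inv k) (*-monoˡ (ℚP.<⇒≤ 0<ε) (fromℕℚ-mono (ℕP.m≤n⇒m≤1+n M≤k))) ⟩
        (ε ℚ.* fromℕℚ (suc k)) ℚ.* i     ≡⟨ ℚP.*-assoc ε (fromℕℚ (suc k)) i ⟩
        ε ℚ.* (fromℕℚ (suc k) ℚ.* i)     ≡⟨ cong (ε ℚ.*_) (fromℕℚ-inverse k) ⟩
        ε ℚ.* 1ℚ                         ≡⟨ ℚP.*-identityʳ ε ⟩
        ε                                ∎
        where i = + 1 / suc k

    -- D k = k · b ^ (k - 1), the Lipschitz constant of q ↦ q ^ k on [-b , b]
    D : ℕ → ℚ
    D zero    = 0ℚ
    D (suc k) = b ℚ.* D k ℚ.+ b ^ℚ k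

    0≤D : ∀ k → 0ℚ ℚ.≤ D k
    0≤D zero    = ℚP.≤-refl
    0≤D (suc k) = 0≤+ (0≤* 0≤b (0≤D k)) (0≤^ k 0≤b)

    D-suc : ∀ k → D (suc k) ≡ fromℕℚ (suc k) ℚ.* b ^ℚ k
    D-suc zero    = solve 1 (λ b → b :* con 0ℚ :+ con 1ℚ := con 1ℚ :* con 1ℚ) refl b
    D-suc (suc k) = trans (cong (λ z → b ℚ.* z ℚ.+ b ℚ.* b ^ℚ k) (D-suc k))
      (trans (solve 3 (λ b f p → b :* (f :* p) :+ b :* p := (f :+ con 1ℚ) :* (b :* p)) refl
                b (fromℕℚ (suc k)) (b ^ℚ k))
             (cong (ℚ._* (b ℚ.* b ^ℚ k)) (sym (fromℕℚ-suc (suc k)))))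

    L : ℕ → ℚ
    L zero    = 0ℚ
    L (suc m) = L m ℚ.+ 1/! m ℚ.* D m

    L-suc : ∀ m → L (suc m) ≡ e m
    L-suc zero    = refl
    L-suc (suc m) = cong₂ ℚ._+_ (L-suc m)
      (trans (cong ((1/! m ℚ.* i) ℚ.*_) (D-suc m))
      (trans (solve 4 (λ f i s p → (f :* i) :* (s :* p) := (s :* i) :* (f :* p)) refl
                (1/! m) i (fromℕℚ (suc m)) (b ^ℚ m))
      (trans (cong (ℚ._* t m) (fromℕℚ-inverse m)) (ℚP.*-identityˡ (t m)))))
      where i = + 1 / suc m

    L≤K : ∀ m → L m ℚ.≤ K
    L≤K zero    = 0≤K
    L≤K (suc m) = subst (ℚ._≤ K) (sym (L-suc m)) (e≤K m)

    pow≤ : ∀ {q} k → ℚ.∣ q ∣ ℚ.≤ b → ℚ.∣ q ^ℚ k ∣ ℚ.≤ b ^ℚ k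
    pow≤ zero    _   = ℚP.≤-refl
    pow≤ {q} (suc k) q≤b = subst (ℚ._≤ _) (sym (ℚP.∣p*q∣≡∣p∣*∣q∣ q (q ^ℚ k)))
      (*-mono (ℚP.0≤∣p∣ q) (0≤^ k 0≤b) q≤b (pow≤ k q≤b))

    pow-lipschitz : ∀ {q r} k → ℚ.∣ q ∣ ℚ.≤ b → ℚ.∣ r ∣ ℚ.≤ b →
      ℚ.∣ q ^ℚ k ℚ.- r ^ℚ k ∣ ℚ.≤ D k ℚ.* ℚ.∣ q ℚ.- r ∣
    pow-lipschitz {q} {r} zero _ _ = ℚP.≤-reflexive (sym (ℚP.*-zeroˡ ℚ.∣ q ℚ.- r ∣))
    pow-lipschitz {q} {r} (suc k) q≤b r≤b = begin
      ℚ.∣ q ℚ.* Q ℚ.- r ℚ.* R ∣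
        ≡⟨ cong ℚ.∣_∣ (solve 4 (λ q r Q R → q :* Q :+ :- (r :* R)
             := q :* (Q :+ :- R) :+ R :* (q :+ :- r)) refl q r Q R) ⟩
      ℚ.∣ q ℚ.* (Q ℚ.- R) ℚ.+ R ℚ.* (q ℚ.- r) ∣
        ≤⟨ ℚP.∣p+q∣≤∣p∣+∣q∣ (q ℚ.* (Q ℚ.- R)) (R ℚ.* (q ℚ.- r)) ⟩
      ℚ.∣ q ℚ.* (Q ℚ.- R) ∣ ℚ.+ ℚ.∣ R ℚ.* (q ℚ.- r) ∣
        ≡⟨ cong₂ ℚ._+_ (ℚP.∣p*q∣≡∣p∣*∣q∣ q (Q ℚ.- R)) (ℚP.∣p*q∣≡∣p∣*∣q∣ R (q ℚ.- r)) ⟩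
      ℚ.∣ q ∣ ℚ.* ℚ.∣ Q ℚ.- R ∣ ℚ.+ ℚ.∣ R ∣ ℚ.* d
        ≤⟨ ℚP.+-mono-≤
             (*-mono (ℚP.0≤∣p∣ q) (0≤* (0≤D k) 0≤d) q≤b (pow-lipschitz k q≤b r≤b))
             (*-monoʳ 0≤d (pow≤ k r≤b)) ⟩
      b ℚ.* (D k ℚ.* d) ℚ.+ b ^ℚ k ℚ.* d
        ≡⟨ solve 4 (λ b D d p → b :* (D :* d) :+ p :* d := (b :* D :+ p) :* d) refl b (D k) d (b ^ℚ k) ⟩
      D (suc k) ℚ.* d ∎
      where
      Q = q ^ℚ k
      R = r ^ℚ k
      d = ℚ.∣ q ℚ.- r ∣
      0≤d : 0ℚ ℚ.≤ d
      0≤d = ℚP.0≤∣p∣ (q ℚ.- r)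

    module _ (c : ℕ → ℚ) (c≤ : ∀ k → ℚ.∣ c k ∣ ℚ.≤ 1/! k) where

      sum-lipschitz : ∀ {q r} m → ℚ.∣ q ∣ ℚ.≤ b → ℚ.∣ r ∣ ℚ.≤ b →
        ℚ.∣ partialSum c m q ℚ.- partialSum c m r ∣ ℚ.≤ L m ℚ.* ℚ.∣ q ℚ.- r ∣
      sum-lipschitz {q} {r} zero _ _ = ℚP.≤-reflexive (sym (ℚP.*-zeroˡ ℚ.∣ q ℚ.- r ∣))
      sum-lipschitz {q} {r} (suc m) q≤b r≤b = begin
        ℚ.∣ (S ℚ.+ c m ℚ.* Q) ℚ.- (T ℚ.+ c m ℚ.* R) ∣
          ≡⟨ cong ℚ.∣_∣ (solve 5 (λ S T c Q R → (S :+ c :* Q) :+ :- (T :+ c :* R)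
               := (S :+ :- T) :+ c :* (Q :+ :- R)) refl S T (c m) Q R) ⟩
        ℚ.∣ (S ℚ.- T) ℚ.+ c m ℚ.* (Q ℚ.- R) ∣
          ≤⟨ ℚP.∣p+q∣≤∣p∣+∣q∣ (S ℚ.- T) (c m ℚ.* (Q ℚ.- R)) ⟩
        ℚ.∣ S ℚ.- T ∣ ℚ.+ ℚ.∣ c m ℚ.* (Q ℚ.- R) ∣
          ≡⟨ cong (ℚ.∣ S ℚ.- T ∣ ℚ.+_) (ℚP.∣p*q∣≡∣p∣*∣q∣ (c m) (Q ℚ.- R)) ⟩
        ℚ.∣ S ℚ.- T ∣ ℚ.+ ℚ.∣ c m ∣ ℚ.* ℚ.∣ Q ℚ.- R ∣
          ≤⟨ ℚP.+-mono-≤ (sum-lipschitz m q≤b r≤b)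
               (*-mono (ℚP.0≤∣p∣ (c m)) (0≤* (0≤D m) (ℚP.0≤∣p∣ (q ℚ.- r))) (c≤ m)
                 (pow-lipschitz m q≤b r≤b)) ⟩
        L m ℚ.* d ℚ.+ 1/! m ℚ.* (D m ℚ.* d)
          ≡⟨ solve 4 (λ L f D d → L :* d :+ f :* (D :* d) := (L :+ f :* D) :* d) refl (L m) (1/! m) (D m) d ⟩
        L (suc m) ℚ.* d ∎
        where
        S = partialSum c m q
        T = partialSum c m r
        Q = q ^ℚ m
        R = r ^ℚ m
        d = ℚ.∣ q ℚ.- r ∣

      sum-tail : ∀ {q n m} → ℚ.∣ q ∣ ℚ.≤ b → n ℕ.≤′ m →
        ℚ.∣ partialSum c m q ℚ.- partialSum c n q ∣ ℚ.+ e n ℚ.≤ e m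
      sum-tail {q} {n} q≤b ℕ.≤′-refl = ℚP.≤-reflexive
        (trans (cong (λ z → ℚ.∣ z ∣ ℚ.+ e n) (ℚP.+-inverseʳ (partialSum c n q))) (ℚP.+-identityˡ (e n)))
      sum-tail {q} {n} {suc m} q≤b (ℕ.≤′-step n≤m) = begin
        ℚ.∣ (S ℚ.+ x) ℚ.- T ∣ ℚ.+ e n
          ≡⟨ cong (λ z → ℚ.∣ z ∣ ℚ.+ e n) (solve 3 (λ S x T → (S :+ x) :+ :- T := (S :+ :- T) :+ x) refl S x T) ⟩
        ℚ.∣ (S ℚ.- T) ℚ.+ x ∣ ℚ.+ e n
          ≤⟨ ℚP.+-monoˡ-≤ (e n) (ℚP.∣p+q∣≤∣p∣+∣q∣ (S ℚ.- T) x) ⟩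
        (ℚ.∣ S ℚ.- T ∣ ℚ.+ ℚ.∣ x ∣) ℚ.+ e n
          ≡⟨ solve 3 (λ u v w → (u :+ v) :+ w := (u :+ w) :+ v) refl ℚ.∣ S ℚ.- T ∣ ℚ.∣ x ∣ (e n) ⟩
        (ℚ.∣ S ℚ.- T ∣ ℚ.+ e n) ℚ.+ ℚ.∣ x ∣
          ≤⟨ ℚP.+-mono-≤ (sum-tail q≤b n≤m)
               (subst (ℚ._≤ t m) (sym (ℚP.∣p*q∣≡∣p∣*∣q∣ (c m) (q ^ℚ m)))
                 (*-mono (ℚP.0≤∣p∣ (c m)) (0≤^ m 0≤b) (c≤ m) (pow≤ m q≤b))) ⟩
        e m ℚ.+ t m ∎
        where
        S = partialSum c m q
        T = partialSum c n q
        x = c m ℚ.* q ^ℚ m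

      sum-tail′ : ∀ {q n m} → ℚ.∣ q ∣ ℚ.≤ b → N₀ ℕ.≤ n → n ℕ.≤ m →
        ℚ.∣ partialSum c m q ℚ.- partialSum c n q ∣ ℚ.≤ t n ℚ.+ t n
      sum-tail′ {q} {n} {m} q≤b N₀≤n n≤m = begin
        z                        ≡⟨ solve 2 (λ z e → z := (z :+ e) :+ :- e) refl z (e n) ⟩
        (z ℚ.+ e n) ℚ.- e n      ≤⟨ ℚP.+-monoˡ-≤ (ℚ.- e n) (begin
             z ℚ.+ e n             ≤⟨ sum-tail q≤b (ℕP.≤⇒≤′ n≤m) ⟩
             e m                   ≤⟨ e≤φ m ⟩
             φ m                   ≤⟨ φ-dec N₀≤n (ℕP.≤⇒≤′ n≤m) ⟩
             φ n                   ∎) ⟩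
        φ n ℚ.- e n              ≡⟨ solve 2 (λ e t → (e :+ t) :+ :- e := t) refl (e n) (t n ℚ.+ t n) ⟩
        t n ℚ.+ t n              ∎
        where z = ℚ.∣ partialSum c m q ℚ.- partialSum c n q ∣

  powerSeries : ∀ c → (∀ k → ℚ.∣ c k ∣ ℚ.≤ 1/! k) → ∀ s → IsCauchy s →
    IsCauchy (λ n → partialSum c n (s n))
  powerSeries c c≤ s h = scaled (λ n → partialSum c n (s n)) (K ℚ.+ (1ℚ ℚ.+ 1ℚ)) (0≤+ 0≤K (0≤+ 0≤1 0≤1)) λ ε 0<ε →
    let (N , f) = h ε 0<ε
        (M , g) = t→0 ε 0<ε
    in N₀ ℕ.⊔ (N ℕ.⊔ M) , λ m n N≤n n≤m →
      let N₀≤n = ℕP.m⊔n≤o⇒m≤o N₀ (N ℕ.⊔ M) N≤n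
          NM≤n = ℕP.m⊔n≤o⇒n≤o N₀ (N ℕ.⊔ M) N≤n
          N≤n′ = ℕP.m⊔n≤o⇒m≤o N M NM≤n
          M≤n  = ℕP.m⊔n≤o⇒n≤o N M NM≤n
          P    = partialSum c
      in begin
        ℚ.∣ P m (s m) ℚ.- P n (s n) ∣
          ≡⟨ cong ℚ.∣_∣ (solve 3 (λ x y z → x :+ :- z := (x :+ :- y) :+ (y :+ :- z)) refl
               (P m (s m)) (P m (s n)) (P n (s n))) ⟩
        ℚ.∣ (P m (s m) ℚ.- P m (s n)) ℚ.+ (P m (s n) ℚ.- P n (s n)) ∣
          ≤⟨ ℚP.∣p+q∣≤∣p∣+∣q∣ (P m (s m) ℚ.- P m (s n)) (P m (s n) ℚ.- P n (s n)) ⟩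
        ℚ.∣ P m (s m) ℚ.- P m (s n) ∣ ℚ.+ ℚ.∣ P m (s n) ℚ.- P n (s n) ∣
          ≤⟨ ℚP.+-mono-≤
               (ℚP.≤-trans (sum-lipschitz c c≤ m (s≤b m) (s≤b n))
                 (ℚP.≤-trans (*-monoʳ (ℚP.0≤∣p∣ (s m ℚ.- s n)) (L≤K m))
                             (*-monoˡ 0≤K (f m n (ℕP.≤-trans N≤n′ n≤m) N≤n′))))
               (ℚP.≤-trans (sum-tail′ c c≤ (s≤b n) N₀≤n n≤m) (ℚP.+-mono-≤ (g n M≤n) (g n M≤n))) ⟩
        K ℚ.* ε ℚ.+ (ε ℚ.+ ε)
          ≡⟨ solve 2 (λ K e → K :* e :+ (e :+ e) := (K :+ (con 1ℚ :+ con 1ℚ)) :* e) refl K ε ⟩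
        (K ℚ.+ (1ℚ ℚ.+ 1ℚ)) ℚ.* ε ∎
    where
    open ExpTail (proj₁ (bounded s h))
    s≤b = proj₂ (bounded s h)

record ℝ : Set where
  constructor mkℝ
  field
    seq    : ℕ → ℚ
    cauchy : IsCauchy seq
open ℝ public

infix  4 _≈ℝ_ _≤ℝ_ _<ℝ_
infixl 6 _+ℝ_ _-ℝ_
infixl 7 _*ℝ_
infix  8 -ℝ_
infixr 8 _^ℝ_

_≈ℝ_ : ℝ → ℝ → Set
x ≈ℝ y = ∀ ε → 0ℚ ℚ.< ε →
  ∃[ N ] (∀ n → N ℕ.≤ n → ℚ.∣ seq x n ℚ.- seq y n ∣ ℚ.≤ ε)

_≤ℝ_ : ℝ → ℝ → Set
x ≤ℝ y = ∀ ε → 0ℚ ℚ.< ε →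
  ∃[ N ] (∀ n → N ℕ.≤ n → seq x n ℚ.≤ seq y n ℚ.+ ε)

_<ℝ_ : ℝ → ℝ → Set
x <ℝ y = ∃[ ε ] (0ℚ ℚ.< ε ×
  ∃[ N ] (∀ n → N ℕ.≤ n → seq x n ℚ.+ ε ℚ.≤ seq y n))

fromℚ : ℚ → ℝ
fromℚ q = mkℝ (λ _ → q) (Cauchy.const q)

fromℕ : ℕ → ℝ
fromℕ n = fromℚ (+ n / 1)

0ℝ 1ℝ : ℝ
0ℝ = fromℚ 0ℚ
1ℝ = fromℚ 1ℚ

-ℝ_ : ℝ → ℝ
-ℝ x = mkℝ (λ n → ℚ.- seq x n) (Cauchy.neg (seq x) (cauchy x))

_+ℝ_ _-ℝ_ _*ℝ_ : ℝ → ℝ → ℝ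
x +ℝ y = mkℝ (λ n → seq x n ℚ.+ seq y n) (Cauchy.add (seq x) (seq y) (cauchy x) (cauchy y))
x -ℝ y = x +ℝ -ℝ y
x *ℝ y = mkℝ (λ n → seq x n ℚ.* seq y n) (Cauchy.mul (seq x) (seq y) (cauchy x) (cauchy y))

_^ℝ_ : ℝ → ℕ → ℝ
x ^ℝ zero  = 1ℝ
x ^ℝ suc k = x *ℝ x ^ℝ k

-- k-th derivatives at 0 of the cosine and of the sine
cos⁽_⁾ sin⁽_⁾ : ℕ → ℚ
cos⁽ zero ⁾        = 1ℚ
cos⁽ suc zero ⁾    = 0ℚ
cos⁽ suc (suc k) ⁾ = ℚ.- cos⁽ k ⁾
sin⁽ zero ⁾        = 0ℚ
sin⁽ suc zero ⁾    = 1ℚ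
sin⁽ suc (suc k) ⁾ = ℚ.- sin⁽ k ⁾

∣cos⁽_⁾∣≤1 : ∀ k → ℚ.∣ cos⁽ k ⁾ ∣ ℚ.≤ 1ℚ
∣cos⁽ zero ⁾∣≤1        = ℚP.≤-refl
∣cos⁽ suc zero ⁾∣≤1    = Cauchy.0≤1
∣cos⁽ suc (suc k) ⁾∣≤1 = subst (ℚ._≤ 1ℚ) (sym (ℚP.∣-p∣≡∣p∣ cos⁽ k ⁾)) ∣cos⁽ k ⁾∣≤1

∣sin⁽_⁾∣≤1 : ∀ k → ℚ.∣ sin⁽ k ⁾ ∣ ℚ.≤ 1ℚ
∣sin⁽ zero ⁾∣≤1        = Cauchy.0≤1
∣sin⁽ suc zero ⁾∣≤1    = ℚP.≤-refl
∣sin⁽ suc (suc k) ⁾∣≤1 = subst (ℚ._≤ 1ℚ) (sym (ℚP.∣-p∣≡∣p∣ sin⁽ k ⁾)) ∣sin⁽ k ⁾∣≤1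

-- taylor d x = Σ_k (d k / k!) x ^ k.  The n-th rational approximation evaluates
-- the n-th partial sum at the n-th approximation of x.
taylor : (d : ℕ → ℚ) → (∀ k → ℚ.∣ d k ∣ ℚ.≤ 1ℚ) → ℝ → ℝ
taylor d d≤1 x = mkℝ (λ n → partialSum coeff n (seq x n))
                     (Cauchy.powerSeries coeff coeff≤ (seq x) (cauchy x))
  where
  coeff : ℕ → ℚ
  coeff k = d k ℚ.* 1/! k

  coeff≤ : ∀ k → ℚ.∣ coeff k ∣ ℚ.≤ 1/! k
  coeff≤ k = begin
    ℚ.∣ d k ℚ.* 1/! k ∣          ≡⟨ ℚP.∣p*q∣≡∣p∣*∣q∣ (d k) (1/! k) ⟩
    ℚ.∣ d k ∣ ℚ.* ℚ.∣ 1/! k ∣    ≡⟨ cong (ℚ.∣ d k ∣ ℚ.*_) (ℚP.0≤p⇒∣p∣≡p (Cauchy.0≤1/! k)) ⟩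
    ℚ.∣ d k ∣ ℚ.* 1/! k          ≤⟨ Cauchy.*-monoʳ (Cauchy.0≤1/! k) (d≤1 k) ⟩
    1ℚ ℚ.* 1/! k                 ≡⟨ ℚP.*-identityˡ (1/! k) ⟩
    1/! k                        ∎
    where open ℚP.≤-Reasoning

exp cos sin : ℝ → ℝ
exp = taylor (λ _ → 1ℚ) (λ _ → ℚP.≤-refl)
cos = taylor cos⁽_⁾ ∣cos⁽_⁾∣≤1
sin = taylor sin⁽_⁾ ∣sin⁽_⁾∣≤1

-- The least positive zero of the sine; by continuity, having no zero in (0 , π)
-- amounts to being positive there.
IsPi : ℝ → Set
IsPi π = 0ℝ <ℝ π × sin π ≈ℝ 0ℝ × (∀ x → 0ℝ <ℝ x → x <ℝ π → 0ℝ <ℝ sin x)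

record ℂ : Set where
  constructor _+i_
  field
    re im : ℝ
open ℂ public

infixl 6 _+ℂ_
infixl 7 _*ℂ_
infixr 8 _^ℂ_

0ℂ 1ℂ : ℂ
0ℂ = 0ℝ +i 0ℝ
1ℂ = 1ℝ +i 0ℝ

_+ℂ_ _*ℂ_ : ℂ → ℂ → ℂ
w +ℂ z = (re w +ℝ re z) +i (im w +ℝ im z)
w *ℂ z = (re w *ℝ re z -ℝ im w *ℝ im z) +i (re w *ℝ im z +ℝ im w *ℝ re z)

_^ℂ_ : ℂ → ℕ → ℂ
z ^ℂ zero  = 1ℂ
z ^ℂ suc k = z *ℂ z ^ℂ k

expi : ℝ → ℂ
expi θ = cos θ +i sin θ

IsModulus : ℂ → ℝ → Set
IsModulus z r = 0ℝ ≤ℝ r × r ^ℝ 2 ≈ℝ re z ^ℝ 2 +ℝ im z ^ℝ 2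

F : ℕ → Set
F p = Fin p

Fun : ℕ → ℕ → Set
Fun p n = Vec (F p) n → F p

module _ {p : ℕ} .{{_ : NonZero p}} where

  infixl 6 _+F_
  infixl 7 _*F_
  infixr 8 _^F_

  0F 1F : F p
  0F = 0 mod p
  1F = 1 mod p

  _+F_ _*F_ : F p → F p → F p
  x +F y = (toℕ x ℕ.+ toℕ y) mod p
  x *F y = (toℕ x ℕ.* toℕ y) mod p

  _^F_ : F p → ℕ → F p
  x ^F zero  = 1F
  x ^F suc k = x *F x ^F k

  ∑F : ∀ {c} → (Fin c → F p) → F p
  ∑F = Vector.foldr _+F_ 0F

-- Lists of terms (coefficient , exponents).  Repeated exponents and zero
-- coefficients are allowed: they can only raise the formal degree, so the least
-- degree of a polynomial representing a given function is unaffected.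
Poly : ℕ → ℕ → Set
Poly p n = List (F p × Vec ℕ n)

totalDegree≤ : ∀ {p n} → Poly p n → ℕ → Set
totalDegree≤ P d = All (λ (_ , e) → Vec.sum e ℕ.≤ d) P

module _ {p : ℕ} .{{_ : NonZero p}} where

  evalMonomial : ∀ {n} → Vec ℕ n → Fun p n
  evalMonomial []       []       = 1F
  evalMonomial (e ∷ es) (x ∷ xs) = x ^F e *F evalMonomial es xs

  eval : ∀ {n} → Poly p n → Fun p n
  eval []            a = 0F
  eval ((c , e) ∷ P) a = c *F evalMonomial e a +F eval P a

  DegreeAtMost : ∀ {n} → ℕ → Fun p n → Set
  DegreeAtMost {n} d f =
    ∃[ P ] (totalDegree≤ {p} {n} P d × (∀ a → f a ≡ eval P a))

  HasDegree : ∀ {n} → ℕ → Fun p n → Set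
  HasDegree d f = DegreeAtMost d f × (∀ e → DegreeAtMost e f → d ℕ.≤ e)

points : ∀ p n → List (Vec (F p) n)
points p zero    = [] ∷ []
points p (suc n) = List.cartesianProductWith _∷_ (List.allFin p) (points p n)

module _ {p : ℕ} .{{_ : NonZero p}} where

  mean : ∀ {n} → (Vec (F p) n → ℂ) → ℂ
  mean {n} h = (fromℚ (_/_ (+ 1) (p ℕ.^ n) {{ℕP.m^n≢0 p n}}) +i 0ℝ)
            *ℂ List.foldr (λ a s → h a +ℂ s) 0ℂ (points p n)

  -- δ = | 𝔼_a ω ^ f(a) | with ω = e^(2πi/p)
  IsBias : ∀ {n} → Fun p n → ℝ → Set
  IsBias f δ = ∃[ π ] (IsPi π ×
    IsModulus (mean λ a → expi (fromℚ (+ 2 / p) *ℝ π) ^ℂ toℕ (f a)) δ)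

-- L = log (1 / δ)
IsLogInverse : ℝ → ℝ → Set
IsLogInverse δ L = exp L *ℝ δ ≈ℝ 1ℝ

-- c ≤ C · (log (1 / δ)) ^ k.  If δ = 0 there is no L as above and the bound is
-- void, in accordance with log (1 / 0) = ∞.
LogBound : (c C k : ℕ) → ℝ → Set
LogBound c C k δ = ∀ L → IsLogInverse δ L → fromℕ c ≤ℝ fromℕ C *ℝ L ^ℝ k

{-# OPTIONS --safe #-}
-- The trilinear form T of third differences of f satisfies δ⁴ ≤ Pr[T(h , k , ·) = 0] by two
-- applications of Cauchy-Schwarz, so a dense set A of directions h has a form T(h , · , ·) of
-- rank r₀ = O(log (1/δ)).  Covering greedily by translates yields a subspace W ⊆ (3 r₀ + 2) A of
-- codimension O(r₀), hence every T(h , · , ·) with h ∈ W has rank O(r₀²).  Passing to the radical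
-- of a member of maximal rank at least halves the maximal rank of such a family, so some U of
-- codimension O(r₀²) in W has T(W , U , U) = 0.  Then f is quadratic along every coset of U, and
-- δ² is at most the density in U of the radical U′ of one of these quadratics, on the coset of b
-- say.  Finally f is affine along U′ on b + W: dividing by the linear equations of b + W gives the
-- terms ℓ q, and f on b + W is a cubic in the coordinates mⱼ of W / U′ plus Σ μ(m) λ_μ with the
-- λ_μ linear, for the O(codim² U′) monomials μ of degree at most 2.
module Submission where

open import Defs
open import Algebra.Bundles using (CommutativeRing; CommutativeMonoid)
import Algebra.Solver.Ring.AlmostCommutativeRing as ACR
open import Data.Empty using (⊥-elim)
open import Data.Fin.Base using (Fin; zero; suc; toℕ; combine; remQuot; splitAt; _↑ˡ_; _↑ʳ_)
open import Data.Fin.Permutation using (Permutation′; _⟨$⟩ʳ_; permutation)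
import Data.Fin.Properties as FinP
open import Data.Integer.Base as ℤ using (ℤ; +_; -[1+_]; _⊖_)
import Data.Integer.Properties as ℤP
open import Data.List.Base as List using (List; []; _∷_; _++_)
open import Data.List.Membership.Propositional using (_∈_; find; lose)
open import Data.List.Membership.Propositional.Properties using (∈-cartesianProductWith⁺; ∈-allFin)
import Data.List.Properties as ListP
open import Data.List.Relation.Unary.All as All using (All; []; _∷_)
import Data.List.Relation.Unary.All.Properties as AllP
open import Data.List.Relation.Unary.Any using (here; there; any?)
open import Data.Maybe.Base using (Maybe; just; nothing)
open import Data.Nat.Base as ℕ using (ℕ; NonZero; zero; suc; ⌊_/2⌋)
open import Data.Nat.Coprimality using (prime⇒coprime; coprime-Bézout)
open import Data.Nat.DivMod
  using (_mod_; _%_; m%n<n; m<n⇒m%n≡m; %-distribˡ-+; %-distribˡ-*; n%n≡0; m*n%n≡0; m≡m%n+[m/n]*n) renaming (_/_ to _div_)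
open import Data.Nat.GCD using (module Bézout)
open import Data.Nat.Primality using (Prime; prime⇒nonTrivial)
import Data.Nat.Properties as ℕP
open import Data.Nat.Solver using (module +-*-Solver)
open import Data.Product.Base using (∃-syntax; Σ-syntax; _×_; _,_; proj₁; proj₂)
open import Data.Rational.Base as ℚ using (ℚ; 0ℚ; 1ℚ; ½; _/_)
import Data.Rational.Properties as ℚP
import Data.Rational.Unnormalised.Base as ℚᵘ
import Data.Rational.Unnormalised.Properties as ℚᵘP
open import Data.Sum.Base using (_⊎_; inj₁; inj₂; [_,_]′)
open import Data.Unit.Base using (⊤; tt)
open import Data.Vec.Base as Vec using (Vec; tabulate; []; _∷_; lookup)
import Data.Vec.Properties as VecP
open import Level using (0ℓ)
open import Relation.Binary.PropositionalEquality
  using (_≡_; refl; cong; sym; trans; cong₂; subst; module ≡-Reasoning; _≢_; isEquivalence)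
open import Relation.Nullary using (yes; no; Dec; ¬_; ¬?; _×-dec_; _→-dec_)
open import Relation.Nullary.Decidable using (toWitness; map′)
open import Relation.Nullary.Negation using (contradiction)
open import Relation.Unary using (Decidable)

-- Only the codimension of `W` counts towards the terms `ℓ q`, so the covering has to keep it linear
-- in r₀; the loss is moved to the ranks on `W`, which reach r₀² and enter only the number of
-- coordinates `mⱼ`. Squaring that number for the monomials gives the fourth power of the logarithm.
-- The estimates must also hold for δ near 1, where log (1/δ) is small while r₀ is a rounded-up
-- exponent. Here the exact degree 3 enters: T is nonzero, so Pr[T(h , k , ·) = 0] ≤ 3/4 and δ⁴ ≤
-- 3/4, which bounds log (1/δ) from below and absorbs the rounding. Finite differences stand in for
-- derivatives, so T makes sense in characteristics 2 and 3, where one cannot divide by 6. Ranks and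
-- dimensions are expressed by cardinalities: rank at most r means that pʳ times the kernel is at
-- least the whole space. The combinatorics thus lives in the natural numbers; reals occur only in
-- the exponential sums and in the final comparison, where one integer m controls all parameters and
-- 2ᵐ ≤ (1/δ)¹⁸ yields m ≤ 108 log (1/δ).

module IntegerCoefficients {c ℓ} (R : CommutativeRing c ℓ) where

  open CommutativeRing R renaming (refl to ≈refl; sym to ≈sym; trans to ≈trans)
  open import Algebra.Properties.Ring ring using (-‿distribˡ-*; -‿distribʳ-*; -0#≈0#; -‿involutive; -‿+-comm)
  open import Algebra.Properties.Semiring.Mult.TCOptimised semiring using (×-homo-+; ×1-homo-*; 1+×) renaming (_×_ to _×ᴿ_)
  open import Relation.Binary.Reasoning.Setoid setoid

  -- The solver takes integers as coefficients because their equality is decidable, which that of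
  -- the reals is not; one solver then serves the rationals, the reals and `F p`. With the optimised
  -- multiple, `+ 1` denotes `1#` itself.
  ⟦_⟧ : ℤ → Carrier
  ⟦ + n ⟧ = n ×ᴿ 1#
  ⟦ -[1+ n ] ⟧ = - (suc n ×ᴿ 1#)

  ⟦⟧-⊖ : ∀ m n → ⟦ m ⊖ n ⟧ ≈ m ×ᴿ 1# - n ×ᴿ 1#
  ⟦⟧-⊖ zero zero = ≈sym (-‿inverseʳ 0#)
  ⟦⟧-⊖ zero (suc n) = ≈sym (+-identityˡ _)
  ⟦⟧-⊖ (suc m) zero = ≈sym (≈trans (+-congˡ -0#≈0#) (+-identityʳ _))
  ⟦⟧-⊖ (suc m) (suc n) = begin
    ⟦ suc m ⊖ suc n ⟧                       ≡⟨ cong ⟦_⟧ (ℤP.[1+m]⊖[1+n]≡m⊖n m n) ⟩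
    ⟦ m ⊖ n ⟧                               ≈⟨ ⟦⟧-⊖ m n ⟩
    m ×ᴿ 1# - n ×ᴿ 1#                         ≈⟨ ≈sym (+-identityˡ _) ⟩
    0# + (m ×ᴿ 1# - n ×ᴿ 1#)                  ≈⟨ +-congʳ (≈sym (-‿inverseʳ 1#)) ⟩
    (1# - 1#) + (m ×ᴿ 1# - n ×ᴿ 1#)           ≈⟨ +-assoc _ _ _ ⟩
    1# + (- 1# + (m ×ᴿ 1# - n ×ᴿ 1#))         ≈⟨ +-congˡ (≈sym (+-assoc _ _ _)) ⟩
    1# + (- 1# + m ×ᴿ 1# - n ×ᴿ 1#)           ≈⟨ +-congˡ (+-congʳ (+-comm _ _)) ⟩
    1# + (m ×ᴿ 1# + - 1# - n ×ᴿ 1#)           ≈⟨ +-congˡ (+-assoc _ _ _) ⟩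
    1# + (m ×ᴿ 1# + (- 1# - n ×ᴿ 1#))         ≈⟨ +-congˡ (+-congˡ (-‿+-comm 1# _)) ⟩
    1# + (m ×ᴿ 1# - (1# + n ×ᴿ 1#))           ≈⟨ ≈sym (+-assoc _ _ _) ⟩
    (1# + m ×ᴿ 1#) - (1# + n ×ᴿ 1#)           ≈⟨ +-cong (≈sym (1+× m 1#)) (-‿cong (≈sym (1+× n 1#))) ⟩
    suc m ×ᴿ 1# - suc n ×ᴿ 1#                 ∎

  ⟦⟧-neg : ∀ i → ⟦ ℤ.- i ⟧ ≈ - ⟦ i ⟧
  ⟦⟧-neg (+ zero) = ≈sym -0#≈0#
  ⟦⟧-neg (+ suc n) = ≈refl
  ⟦⟧-neg -[1+ n ] = ≈sym (-‿involutive _)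

  ⟦⟧-+ : ∀ i j → ⟦ i ℤ.+ j ⟧ ≈ ⟦ i ⟧ + ⟦ j ⟧
  ⟦⟧-+ (+ m) (+ n) = ×-homo-+ 1# m n
  ⟦⟧-+ (+ m) -[1+ n ] = ⟦⟧-⊖ m (suc n)
  ⟦⟧-+ -[1+ m ] (+ n) = ≈trans (⟦⟧-⊖ n (suc m)) (+-comm _ _)
  ⟦⟧-+ -[1+ m ] -[1+ n ] = begin
    - (suc (suc (m ℕ.+ n)) ×ᴿ 1#)           ≡⟨ cong (λ k → - (suc k ×ᴿ 1#)) (sym (ℕP.+-suc m n)) ⟩
    - ((suc m ℕ.+ suc n) ×ᴿ 1#)             ≈⟨ -‿cong (×-homo-+ 1# (suc m) (suc n)) ⟩
    - (suc m ×ᴿ 1# + suc n ×ᴿ 1#)            ≈⟨ ≈sym (-‿+-comm _ _) ⟩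
    - (suc m ×ᴿ 1#) - suc n ×ᴿ 1#            ∎

  ⟦⟧-*-pos : ∀ m i → ⟦ + m ℤ.* i ⟧ ≈ ⟦ + m ⟧ * ⟦ i ⟧
  ⟦⟧-*-pos m (+ n) = ≈trans (reflexive (cong ⟦_⟧ (sym (ℤP.pos-* m n)))) (×1-homo-* m n)
  ⟦⟧-*-pos m -[1+ n ] = begin
    ⟦ + m ℤ.* -[1+ n ] ⟧         ≡⟨ cong ⟦_⟧ (sym (ℤP.neg-distribʳ-* (+ m) (+ suc n))) ⟩
    ⟦ ℤ.- (+ m ℤ.* + suc n) ⟧    ≈⟨ ⟦⟧-neg (+ m ℤ.* + suc n) ⟩
    - ⟦ + m ℤ.* + suc n ⟧        ≈⟨ -‿cong (⟦⟧-*-pos m (+ suc n)) ⟩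
    - (⟦ + m ⟧ * ⟦ + suc n ⟧)    ≈⟨ -‿distribʳ-* _ _ ⟩
    ⟦ + m ⟧ * ⟦ -[1+ n ] ⟧       ∎

  ⟦⟧-* : ∀ i j → ⟦ i ℤ.* j ⟧ ≈ ⟦ i ⟧ * ⟦ j ⟧
  ⟦⟧-* (+ m) j = ⟦⟧-*-pos m j
  ⟦⟧-* -[1+ m ] j = begin
    ⟦ -[1+ m ] ℤ.* j ⟧           ≡⟨ cong ⟦_⟧ (sym (ℤP.neg-distribˡ-* (+ suc m) j)) ⟩
    ⟦ ℤ.- (+ suc m ℤ.* j) ⟧      ≈⟨ ⟦⟧-neg (+ suc m ℤ.* j) ⟩
    - ⟦ + suc m ℤ.* j ⟧          ≈⟨ -‿cong (⟦⟧-*-pos (suc m) j) ⟩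
    - (⟦ + suc m ⟧ * ⟦ j ⟧)      ≈⟨ -‿distribˡ-* _ _ ⟩
    ⟦ -[1+ m ] ⟧ * ⟦ j ⟧         ∎

  almost : ACR.AlmostCommutativeRing c ℓ
  almost = ACR.fromCommutativeRing R

  morphism : ℤ.+-*-rawRing ACR.-Raw-AlmostCommutative⟶ almost
  morphism = record
    { ⟦_⟧ = ⟦_⟧ ; +-homo = ⟦⟧-+ ; *-homo = ⟦⟧-* ; -‿homo = ⟦⟧-neg
    ; 0-homo = ≈refl ; 1-homo = ≈refl }

  equal? : ∀ i j → Maybe (⟦ i ⟧ ≈ ⟦ j ⟧)
  equal? i j with i ℤP.≟ j
  ... | yes refl = just ≈refl
  ... | no  _    = nothing

  open import Algebra.Solver.Ring ℤ.+-*-rawRing almost morphism equal? public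
    using (solve; _:=_; _:+_; _:*_; _:-_; :-_; con)

-- Finite sums over lists, and indicators of decidable propositions.

module Sums where

  module ListSum {c ℓ} (M : CommutativeMonoid c ℓ) where

    open CommutativeMonoid M renaming (refl to ≈refl; sym to ≈sym; trans to ≈trans)
    open import Algebra.Properties.CommutativeSemigroup commutativeSemigroup using (interchange)
    open import Algebra.Properties.CommutativeMonoid.Sum M using (sum; sum-permute)

    ∑ : ∀ {a} {A : Set a} → List A → (A → Carrier) → Carrier
    ∑ xs g = List.foldr (λ a s → g a ∙ s) ε xs

    module _ {a} {A : Set a} where

      ∑-cong : ∀ {g h : A → Carrier} xs → (∀ x → g x ≈ h x) → ∑ xs g ≈ ∑ xs h
      ∑-cong []       e = ≈refl
      ∑-cong (x ∷ xs) e = ∙-cong (e x) (∑-cong xs e)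

      ∑-distrib : ∀ (g h : A → Carrier) xs → ∑ xs (λ x → g x ∙ h x) ≈ ∑ xs g ∙ ∑ xs h
      ∑-distrib g h []       = ≈sym (identityˡ ε)
      ∑-distrib g h (x ∷ xs) = ≈trans (∙-congˡ (∑-distrib g h xs)) (interchange _ _ _ _)

      ∑-ε : ∀ (xs : List A) → ∑ xs (λ _ → ε) ≈ ε
      ∑-ε []       = ≈refl
      ∑-ε (x ∷ xs) = ≈trans (identityˡ _) (∑-ε xs)

      ∑-++ : ∀ (g : A → Carrier) xs ys → ∑ (xs ++ ys) g ≈ ∑ xs g ∙ ∑ ys g
      ∑-++ g []       ys = ≈sym (identityˡ _)
      ∑-++ g (x ∷ xs) ys = ≈trans (∙-congˡ (∑-++ g xs ys)) (≈sym (assoc _ _ _))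

    ∑-map : ∀ {a b} {A : Set a} {B : Set b} (f : A → B) (g : B → Carrier) xs →
      ∑ (List.map f xs) g ≡ ∑ xs (λ x → g (f x))
    ∑-map f g []       = refl
    ∑-map f g (x ∷ xs) = cong (g (f x) ∙_) (∑-map f g xs)

    ∑-swap : ∀ {a b} {A : Set a} {B : Set b} (g : A → B → Carrier) xs ys →
      ∑ xs (λ x → ∑ ys (g x)) ≈ ∑ ys (λ y → ∑ xs (λ x → g x y))
    ∑-swap g []       ys = ≈sym (∑-ε ys)
    ∑-swap g (x ∷ xs) ys = ≈trans (∙-congˡ (∑-swap g xs ys)) (≈sym (∑-distrib (g x) _ ys))

    ∑-cartesianProductWith : ∀ {a b d} {A : Set a} {B : Set b} {D : Set d}
      (f : A → B → D) (g : D → Carrier) xs ys →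
      ∑ (List.cartesianProductWith f xs ys) g ≈ ∑ xs (λ x → ∑ ys (λ y → g (f x y)))
    ∑-cartesianProductWith f g []       ys = ≈refl
    ∑-cartesianProductWith f g (x ∷ xs) ys = ≈trans (∑-++ g (List.map (f x) ys) _)
      (∙-cong (reflexive (∑-map (f x) g ys)) (∑-cartesianProductWith f g xs ys))

    ∑-tabulate : ∀ {a} {A : Set a} {n} (f : Fin n → A) (g : A → Carrier) →
      ∑ (List.tabulate f) g ≡ sum (λ i → g (f i))
    ∑-tabulate {n = zero}  f g = refl
    ∑-tabulate {n = suc n} f g = cong (g (f zero) ∙_) (∑-tabulate (λ i → f (suc i)) g)

    ∑-permute : ∀ {n} (g : Fin n → Carrier) (π : Permutation′ n) →
      ∑ (List.allFin n) (λ i → g (π ⟨$⟩ʳ i)) ≈ ∑ (List.allFin n) g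
    ∑-permute {n} g π = ≈trans (reflexive (∑-tabulate {n = n} (λ i → i) (λ i → g (π ⟨$⟩ʳ i))))
      (≈trans (≈sym (sum-permute g π)) (≈sym (reflexive (∑-tabulate {n = n} (λ i → i) g))))

  open ListSum ℕP.+-0-commutativeMonoid using () renaming
    ( ∑ to ∑ℕ; ∑-cong to ∑ℕ-cong; ∑-distrib to ∑ℕ-distrib; ∑-ε to ∑ℕ-0; ∑-swap to ∑ℕ-swap ) public

  module _ {a} {A : Set a} where

    ∑ℕ-mono : ∀ {g h : A → ℕ} xs → (∀ x → g x ℕ.≤ h x) → ∑ℕ xs g ℕ.≤ ∑ℕ xs h
    ∑ℕ-mono []       e = ℕ.z≤n
    ∑ℕ-mono (x ∷ xs) e = ℕP.+-mono-≤ (e x) (∑ℕ-mono xs e)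

    ∑ℕ-*ˡ : ∀ k (g : A → ℕ) xs → k ℕ.* ∑ℕ xs g ≡ ∑ℕ xs (λ x → k ℕ.* g x)
    ∑ℕ-*ˡ k g []       = ℕP.*-zeroʳ k
    ∑ℕ-*ˡ k g (x ∷ xs) = trans (ℕP.*-distribˡ-+ k (g x) _) (cong (k ℕ.* g x ℕ.+_) (∑ℕ-*ˡ k g xs))

    ∑ℕ-const : ∀ k (xs : List A) → ∑ℕ xs (λ _ → k) ≡ List.length xs ℕ.* k
    ∑ℕ-const k []       = refl
    ∑ℕ-const k (x ∷ xs) = cong (k ℕ.+_) (∑ℕ-const k xs)

  𝟙 : ∀ {a} {P : Set a} → Dec P → ℕ
  𝟙 (yes _) = 1
  𝟙 (no _)  = 0

  𝟙-mono : ∀ {a b} {P : Set a} {Q : Set b} (P? : Dec P) (Q? : Dec Q) → (P → Q) → 𝟙 P? ℕ.≤ 𝟙 Q?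
  𝟙-mono (yes p) (yes q) f = ℕP.≤-refl
  𝟙-mono (yes p) (no ¬q) f = contradiction (f p) ¬q
  𝟙-mono (no ¬p) Q?      f = ℕ.z≤n

  𝟙-cong : ∀ {a b} {P : Set a} {Q : Set b} (P? : Dec P) (Q? : Dec Q) → (P → Q) → (Q → P) → 𝟙 P? ≡ 𝟙 Q?
  𝟙-cong P? Q? f g = ℕP.≤-antisym (𝟙-mono P? Q? f) (𝟙-mono Q? P? g)

  𝟙-yes : ∀ {a} {P : Set a} (P? : Dec P) → P → 𝟙 P? ≡ 1
  𝟙-yes (yes _) p = refl
  𝟙-yes (no ¬p) p = contradiction p ¬p

  𝟙-no : ∀ {a} {P : Set a} (P? : Dec P) → ¬ P → 𝟙 P? ≡ 0
  𝟙-no (yes p) ¬p = contradiction p ¬p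
  𝟙-no (no _)  ¬p = refl

-- The Cauchy reals as an ordered commutative ring, and the Cauchy-Schwarz inequality.

module Reals where

  open Sums

  open ℚP.≤-Reasoning

  module QS = IntegerCoefficients ℚP.+-*-commutativeRing

  p≤∣p∣ : ∀ p → p ℚ.≤ ℚ.∣ p ∣
  p≤∣p∣ p with ℚP.≤-total 0ℚ p
  ... | inj₁ 0≤p = ℚP.≤-reflexive (sym (ℚP.0≤p⇒∣p∣≡p 0≤p))
  ... | inj₂ p≤0 = ℚP.≤-trans p≤0 (ℚP.0≤∣p∣ p)

  Null : (ℕ → ℚ) → Set
  Null s = ∀ ε → 0ℚ ℚ.< ε → ∃[ N ] (∀ n → N ℕ.≤ n → ℚ.∣ s n ∣ ℚ.≤ ε)

  Null-cong : ∀ {s t} → (∀ n → s n ≡ t n) → Null s → Null t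
  Null-cong e h ε 0<ε = let (N , f) = h ε 0<ε in N , λ n N≤n → subst (λ z → ℚ.∣ z ∣ ℚ.≤ ε) (e n) (f n N≤n)

  Null-0 : ∀ {s} → (∀ n → s n ≡ 0ℚ) → Null s
  Null-0 e ε 0<ε = 0 , λ n _ → subst (λ z → ℚ.∣ z ∣ ℚ.≤ ε) (sym (e n)) (ℚP.<⇒≤ 0<ε)

  0<½* : ∀ {ε} → 0ℚ ℚ.< ε → 0ℚ ℚ.< ½ ℚ.* ε
  0<½* {ε} 0<ε = ℚP.positive⁻¹ (½ ℚ.* ε) {{ℚP.pos*pos⇒pos ½ ε {{ℚ.positive 0<ε}}}}

  ½+½ : ∀ ε → ½ ℚ.* ε ℚ.+ ½ ℚ.* ε ≡ ε
  ½+½ ε = trans (sym (ℚP.*-distribʳ-+ ε ½ ½)) (ℚP.*-identityˡ ε)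

  Null-+ : ∀ {s t} → Null s → Null t → Null (λ n → s n ℚ.+ t n)
  Null-+ {s} {t} h k ε 0<ε =
    let (N , f) = h (½ ℚ.* ε) (0<½* 0<ε) ; (M , g) = k (½ ℚ.* ε) (0<½* 0<ε)
    in N ℕ.⊔ M , λ n le → begin
      ℚ.∣ s n ℚ.+ t n ∣            ≤⟨ ℚP.∣p+q∣≤∣p∣+∣q∣ (s n) (t n) ⟩
      ℚ.∣ s n ∣ ℚ.+ ℚ.∣ t n ∣      ≤⟨ ℚP.+-mono-≤ (f n (ℕP.m⊔n≤o⇒m≤o N M le)) (g n (ℕP.m⊔n≤o⇒n≤o N M le)) ⟩
      ½ ℚ.* ε ℚ.+ ½ ℚ.* ε          ≡⟨ ½+½ ε ⟩
      ε                            ∎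

  Null-neg : ∀ {s} → Null s → Null (λ n → ℚ.- s n)
  Null-neg {s} h ε 0<ε = let (N , f) = h ε 0<ε in N , λ n le → subst (ℚ._≤ ε) (sym (ℚP.∣-p∣≡∣p∣ (s n))) (f n le)

  -- Division is by `K + 1` instead of `K`, so that `K = 0` is covered.
  shrink : ∀ K ε → 0ℚ ℚ.≤ K → 0ℚ ℚ.< ε → ∃[ ε′ ] (0ℚ ℚ.< ε′ × K ℚ.* ε′ ℚ.≤ ε)
  shrink K ε 0≤K 0<ε = i ℚ.* ε , 0<ε′ , (begin
      K ℚ.* (i ℚ.* ε)                  ≤⟨ Cauchy.≤-+ʳ ℚP.≤-refl (ℚP.<⇒≤ 0<ε′) ⟩
      K ℚ.* (i ℚ.* ε) ℚ.+ i ℚ.* ε      ≡⟨ QS.solve 3 (λ K i ε → K QS.:* (i QS.:* ε) QS.:+ i QS.:* ε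
                                             QS.:= ((K QS.:+ QS.con (+ 1)) QS.:* i) QS.:* ε) refl K i ε ⟩
      (K ℚ.+ 1ℚ) ℚ.* i ℚ.* ε           ≡⟨ cong (ℚ._* ε) (ℚP.*-inverseʳ (K ℚ.+ 1ℚ)) ⟩
      1ℚ ℚ.* ε                         ≡⟨ ℚP.*-identityˡ ε ⟩
      ε                                ∎)
    where
    instance
      K′>0 : ℚ.Positive (K ℚ.+ 1ℚ)
      K′>0 = ℚ.positive (ℚP.+-mono-≤-< 0≤K Cauchy.0<1)
      K′≢0 : ℚ.NonZero (K ℚ.+ 1ℚ)
      K′≢0 = ℚP.pos⇒nonZero (K ℚ.+ 1ℚ)
      ε>0 : ℚ.Positive ε
      ε>0 = ℚ.positive 0<ε
      i>0 : ℚ.Positive (ℚ.1/ (K ℚ.+ 1ℚ))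
      i>0 = ℚP.1/pos⇒pos (K ℚ.+ 1ℚ)
    i = ℚ.1/ (K ℚ.+ 1ℚ)
    0<ε′ : 0ℚ ℚ.< i ℚ.* ε
    0<ε′ = ℚP.positive⁻¹ (i ℚ.* ε) {{ℚP.pos*pos⇒pos i ε}}

  Null-* : ∀ {s t : ℕ → ℚ} B → (∀ n → ℚ.∣ s n ∣ ℚ.≤ fromℕℚ B) → Null t → Null (λ n → s n ℚ.* t n)
  Null-* {s} {t} B b h ε 0<ε =
    let (ε′ , 0<ε′ , le) = shrink (fromℕℚ B) ε (Cauchy.0≤fromℕℚ B) 0<ε ; (N , f) = h ε′ 0<ε′
    in N , λ n N≤n → begin
      ℚ.∣ s n ℚ.* t n ∣            ≡⟨ ℚP.∣p*q∣≡∣p∣*∣q∣ (s n) (t n) ⟩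
      ℚ.∣ s n ∣ ℚ.* ℚ.∣ t n ∣      ≤⟨ Cauchy.*-mono (ℚP.0≤∣p∣ (s n)) (ℚP.<⇒≤ 0<ε′) (b n) (f n N≤n) ⟩
      fromℕℚ B ℚ.* ε′              ≤⟨ le ⟩
      ε                            ∎

  Null-*ʳ : ∀ {t : ℕ → ℚ} x → Null t → Null (λ n → seq x n ℚ.* t n)
  Null-*ʳ {t} x h = let (B , b) = Cauchy.bounded (seq x) (cauchy x) in Null-* {seq x} {t} B b h

  infix 4 _≋_
  -- Wrapped in a record so that unification recovers both reals: the bare relation unfolds to a
  -- statement about `seq`, from which the Cauchy proofs cannot be inferred.
  record _≋_ (x y : ℝ) : Set where
    constructor equal
    field difference→0 : x ≈ℝ y
  open _≋_ public

  pointwise : ∀ {x y} → (∀ n → seq x n ≡ seq y n) → x ≋ y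
  pointwise {x} {y} e = equal (Null-0 λ n → trans (cong (ℚ._- seq y n) (e n)) (ℚP.+-inverseʳ (seq y n)))

  ≋-refl : ∀ {x} → x ≋ x
  ≋-refl = pointwise λ n → refl

  ≋-sym : ∀ {x y} → x ≋ y → y ≋ x
  ≋-sym {x} {y} (equal h) = equal (Null-cong (λ n → QS.solve 2 (λ a b → QS.:- (a QS.:- b) QS.:= b QS.:- a) refl (seq x n) (seq y n)) (Null-neg h))

  ≋-trans : ∀ {x y z} → x ≋ y → y ≋ z → x ≋ z
  ≋-trans {x} {y} {z} (equal h) (equal k) = equal (Null-cong
    (λ n → QS.solve 3 (λ a b c → (a QS.:- b) QS.:+ (b QS.:- c) QS.:= a QS.:- c) refl (seq x n) (seq y n) (seq z n)) (Null-+ h k))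

  infixl 6 _+ʳ_ _-ʳ_
  infixl 7 _*ʳ_
  infix  8 -ʳ_

  -- Opaque copies of the operations keep the Cauchy proofs out of conversion checking.
  opaque

    _+ʳ_ _*ʳ_ : ℝ → ℝ → ℝ
    _+ʳ_ = _+ℝ_
    _*ʳ_ = _*ℝ_

    -ʳ_ : ℝ → ℝ
    -ʳ_ = -ℝ_

    rat : ℚ → ℝ
    rat = fromℚ

  _-ʳ_ : ℝ → ℝ → ℝ
  x -ʳ y = x +ʳ -ʳ y

  0ʳ 1ʳ : ℝ
  0ʳ = rat 0ℚ
  1ʳ = rat 1ℚ

  nat : ℕ → ℝ
  nat n = rat (fromℕℚ n)

  opaque
    unfolding _+ʳ_ _*ʳ_ -ʳ_ rat

    rat≡ : ∀ q → rat q ≡ fromℚ q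
    rat≡ q = refl

    +ʳ-cong : ∀ {x y u v} → x ≋ y → u ≋ v → x +ʳ u ≋ y +ʳ v
    +ʳ-cong {x} {y} {u} {v} (equal h) (equal k) = equal (Null-cong
      (λ n → QS.solve 4 (λ a b c d → (a QS.:- b) QS.:+ (c QS.:- d) QS.:= (a QS.:+ c) QS.:- (b QS.:+ d)) refl (seq x n) (seq y n) (seq u n) (seq v n)) (Null-+ h k))

    -ʳ-cong : ∀ {x y} → x ≋ y → -ʳ x ≋ -ʳ y
    -ʳ-cong {x} {y} (equal h) = equal (Null-cong (λ n → QS.solve 2 (λ a b → QS.:- (a QS.:- b) QS.:= (QS.:- a) QS.:- (QS.:- b)) refl (seq x n) (seq y n)) (Null-neg h))

    *ʳ-cong : ∀ {x y u v} → x ≋ y → u ≋ v → x *ʳ u ≋ y *ʳ v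
    *ʳ-cong {x} {y} {u} {v} (equal h) (equal k) = equal (Null-cong
      (λ n → QS.solve 4 (λ a b c d → c QS.:* (a QS.:- b) QS.:+ b QS.:* (c QS.:- d) QS.:= (a QS.:* c) QS.:- (b QS.:* d)) refl (seq x n) (seq y n) (seq u n) (seq v n))
      (Null-+ {λ n → seq u n ℚ.* (seq x n ℚ.- seq y n)} {λ n → seq y n ℚ.* (seq u n ℚ.- seq v n)}
        (Null-*ʳ u h) (Null-*ʳ y k)))

    +ʳ-assoc : ∀ x y z → (x +ʳ y) +ʳ z ≋ x +ʳ (y +ʳ z)
    +ʳ-assoc x y z = pointwise λ n → ℚP.+-assoc (seq x n) (seq y n) (seq z n)

    +ʳ-comm : ∀ x y → x +ʳ y ≋ y +ʳ x
    +ʳ-comm x y = pointwise λ n → ℚP.+-comm (seq x n) (seq y n)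

    +ʳ-identityˡ : ∀ x → 0ʳ +ʳ x ≋ x
    +ʳ-identityˡ x = pointwise λ n → ℚP.+-identityˡ (seq x n)

    -ʳ-inverseˡ : ∀ x → -ʳ x +ʳ x ≋ 0ʳ
    -ʳ-inverseˡ x = pointwise λ n → ℚP.+-inverseˡ (seq x n)

    *ʳ-assoc : ∀ x y z → (x *ʳ y) *ʳ z ≋ x *ʳ (y *ʳ z)
    *ʳ-assoc x y z = pointwise λ n → ℚP.*-assoc (seq x n) (seq y n) (seq z n)

    *ʳ-comm : ∀ x y → x *ʳ y ≋ y *ʳ x
    *ʳ-comm x y = pointwise λ n → ℚP.*-comm (seq x n) (seq y n)

    *ʳ-identityˡ : ∀ x → 1ʳ *ʳ x ≋ x
    *ʳ-identityˡ x = pointwise λ n → ℚP.*-identityˡ (seq x n)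

    *ʳ-distribˡ : ∀ x y z → x *ʳ (y +ʳ z) ≋ x *ʳ y +ʳ x *ʳ z
    *ʳ-distribˡ x y z = pointwise λ n → ℚP.*-distribˡ-+ (seq x n) (seq y n) (seq z n)

  ℝ-commutativeRing : CommutativeRing 0ℓ 0ℓ
  ℝ-commutativeRing = record
    { Carrier = ℝ ; _≈_ = _≋_ ; _+_ = _+ʳ_ ; _*_ = _*ʳ_ ; -_ = λ x → -ʳ x ; 0# = 0ʳ ; 1# = 1ʳ
    ; isCommutativeRing = record
      { isRing = record
        { +-isAbelianGroup = record
          { isGroup = record
            { isMonoid = record
              { isSemigroup = record
                { isMagma = record { isEquivalence = record { refl = ≋-refl ; sym = ≋-sym ; trans = ≋-trans } ; ∙-cong = +ʳ-cong }
                ; assoc = +ʳ-assoc }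
              ; identity = +ʳ-identityˡ , (λ x → ≋-trans (+ʳ-comm x 0ʳ) (+ʳ-identityˡ x)) }
            ; inverse = -ʳ-inverseˡ , (λ x → ≋-trans (+ʳ-comm x (-ʳ x)) (-ʳ-inverseˡ x))
            ; ⁻¹-cong = -ʳ-cong }
          ; comm = +ʳ-comm }
        ; *-cong = *ʳ-cong
        ; *-assoc = *ʳ-assoc
        ; *-identity = *ʳ-identityˡ , (λ x → ≋-trans (*ʳ-comm x 1ʳ) (*ʳ-identityˡ x))
        ; distrib = *ʳ-distribˡ
                  , (λ x y z → ≋-trans (*ʳ-comm (y +ʳ z) x) (≋-trans (*ʳ-distribˡ x y z) (+ʳ-cong (*ʳ-comm x y) (*ʳ-comm x z)))) }
      ; *-comm = *ʳ-comm } }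

  module R = CommutativeRing ℝ-commutativeRing
  module RS = IntegerCoefficients ℝ-commutativeRing

  infix 4 _≼_
  record _≼_ (x y : ℝ) : Set where
    constructor below
    field eventually-≤ : x ≤ℝ y
  open _≼_ public

  ≼-reflexive : ∀ {x y} → x ≋ y → x ≼ y
  ≼-reflexive {x} {y} (equal h) = below λ ε 0<ε → let (N , f) = h ε 0<ε in N , λ n le → begin
    seq x n                                ≡⟨ QS.solve 2 (λ a b → a QS.:= b QS.:+ (a QS.:- b)) refl (seq x n) (seq y n) ⟩
    seq y n ℚ.+ (seq x n ℚ.- seq y n)      ≤⟨ ℚP.+-monoʳ-≤ (seq y n) (ℚP.≤-trans (p≤∣p∣ (seq x n ℚ.- seq y n)) (f n le)) ⟩
    seq y n ℚ.+ ε                          ∎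

  ≼-refl : ∀ {x} → x ≼ x
  ≼-refl = ≼-reflexive ≋-refl

  pointwise-≼ : ∀ {x y} → (∀ n → seq x n ℚ.≤ seq y n) → x ≼ y
  pointwise-≼ h = below λ ε 0<ε → 0 , λ n _ → Cauchy.≤-+ʳ (h n) (ℚP.<⇒≤ 0<ε)

  opaque
    unfolding _+ʳ_ _*ʳ_ -ʳ_ rat

    +ʳ-mono : ∀ {x y u v} → x ≼ y → u ≼ v → x +ʳ u ≼ y +ʳ v
    +ʳ-mono {x} {y} {u} {v} (below h) (below k) = below λ ε 0<ε →
      let (N , f) = h (½ ℚ.* ε) (0<½* 0<ε) ; (M , g) = k (½ ℚ.* ε) (0<½* 0<ε)
      in N ℕ.⊔ M , λ n le → begin
        seq x n ℚ.+ seq u n                                        ≤⟨ ℚP.+-mono-≤ (f n (ℕP.m⊔n≤o⇒m≤o N M le)) (g n (ℕP.m⊔n≤o⇒n≤o N M le)) ⟩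
        (seq y n ℚ.+ ½ ℚ.* ε) ℚ.+ (seq v n ℚ.+ ½ ℚ.* ε)            ≡⟨ QS.solve 3 (λ a b e → (a QS.:+ e) QS.:+ (b QS.:+ e) QS.:= (a QS.:+ b) QS.:+ (e QS.:+ e)) refl (seq y n) (seq v n) (½ ℚ.* ε) ⟩
        (seq y n ℚ.+ seq v n) ℚ.+ (½ ℚ.* ε ℚ.+ ½ ℚ.* ε)            ≡⟨ cong ((seq y n ℚ.+ seq v n) ℚ.+_) (½+½ ε) ⟩
        (seq y n ℚ.+ seq v n) ℚ.+ ε                                ∎

    ≼-trans : ∀ {x y z} → x ≼ y → y ≼ z → x ≼ z
    ≼-trans {x} {y} {z} h k = below λ ε 0<ε →
      let (N , f) = eventually-≤ (+ʳ-mono h k) ε 0<ε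
      in N , λ n le → begin
        seq x n                                                    ≡⟨ QS.solve 2 (λ a b → a QS.:= (a QS.:+ b) QS.:- b) refl (seq x n) (seq y n) ⟩
        (seq x n ℚ.+ seq y n) ℚ.- seq y n                          ≤⟨ ℚP.+-monoˡ-≤ (ℚ.- seq y n) (f n le) ⟩
        (seq y n ℚ.+ seq z n) ℚ.+ ε ℚ.- seq y n                    ≡⟨ QS.solve 3 (λ b c e → (b QS.:+ c) QS.:+ e QS.:- b QS.:= c QS.:+ e) refl (seq y n) (seq z n) ε ⟩
        seq z n ℚ.+ ε                                              ∎

  ≼-resp : ∀ {x y u v} → x ≋ u → y ≋ v → x ≼ y → u ≼ v
  ≼-resp e f h = ≼-trans (≼-reflexive (≋-sym e)) (≼-trans h (≼-reflexive f))

  ≈-resp-nonNegative : ∀ {x y} → x ≋ y → 0ʳ ≼ x → 0ʳ ≼ y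
  ≈-resp-nonNegative e h = ≼-trans h (≼-reflexive e)

  ≼⇒0≼- : ∀ {x y} → x ≼ y → 0ʳ ≼ y -ʳ x
  ≼⇒0≼- {x} {y} h = ≼-resp (R.-‿inverseʳ x) ≋-refl (+ʳ-mono h (≼-refl { -ʳ x}))

  0≼-⇒≼ : ∀ {x y} → 0ʳ ≼ y -ʳ x → x ≼ y
  0≼-⇒≼ {x} {y} h = ≼-resp (R.+-identityˡ x) (RS.solve 2 (λ x y → (y RS.:- x) RS.:+ x RS.:= y) ≋-refl x y) (+ʳ-mono h (≼-refl {x}))

  -- Approximations to nonnegative reals may dip down to `- e`, so the signs are split. If both
  -- factors are negative, the product is nonnegative outright; otherwise the nonnegative factor
  -- multiplies the slack of the other one, which costs at most `B e`.
  product-≥ : ∀ {B a b e} → 0ℚ ℚ.≤ B → 0ℚ ℚ.≤ a ℚ.+ e → 0ℚ ℚ.≤ b ℚ.+ e →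
    ℚ.∣ a ∣ ℚ.≤ B → ℚ.∣ b ∣ ℚ.≤ B → 0ℚ ℚ.≤ e → 0ℚ ℚ.≤ a ℚ.* b ℚ.+ B ℚ.* e
  product-≥ {B} {a} {b} {e} 0≤B ha hb a≤B b≤B 0≤e = by-sign (ℚP.≤-total 0ℚ a) (ℚP.≤-total 0ℚ b)
    where
    one-sided : ∀ {a b} → 0ℚ ℚ.≤ a → 0ℚ ℚ.≤ b ℚ.+ e → ℚ.∣ a ∣ ℚ.≤ B → 0ℚ ℚ.≤ a ℚ.* b ℚ.+ B ℚ.* e
    one-sided {a} {b} 0≤a 0≤b+e a≤B = begin
      0ℚ                          ≤⟨ Cauchy.0≤* 0≤a 0≤b+e ⟩
      a ℚ.* (b ℚ.+ e)             ≡⟨ ℚP.*-distribˡ-+ a b e ⟩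
      a ℚ.* b ℚ.+ a ℚ.* e         ≤⟨ ℚP.+-monoʳ-≤ (a ℚ.* b) (Cauchy.*-monoʳ 0≤e (subst (ℚ._≤ B) (ℚP.0≤p⇒∣p∣≡p 0≤a) a≤B)) ⟩
      a ℚ.* b ℚ.+ B ℚ.* e         ∎
    by-sign : 0ℚ ℚ.≤ a ⊎ a ℚ.≤ 0ℚ → 0ℚ ℚ.≤ b ⊎ b ℚ.≤ 0ℚ → 0ℚ ℚ.≤ a ℚ.* b ℚ.+ B ℚ.* e
    by-sign (inj₁ 0≤a) _ = one-sided 0≤a hb a≤B
    by-sign (inj₂ a≤0) (inj₁ 0≤b) = subst (λ z → 0ℚ ℚ.≤ z ℚ.+ B ℚ.* e) (ℚP.*-comm b a) (one-sided 0≤b ha b≤B)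
    by-sign (inj₂ a≤0) (inj₂ b≤0) = Cauchy.0≤+ (subst (0ℚ ℚ.≤_) (QS.solve 2 (λ a b → (QS.:- a) QS.:* (QS.:- b) QS.:= a QS.:* b) refl a b)
        (Cauchy.0≤* (ℚP.neg-antimono-≤ a≤0) (ℚP.neg-antimono-≤ b≤0))) (Cauchy.0≤* 0≤B 0≤e)

  opaque
    unfolding _+ʳ_ _*ʳ_ -ʳ_ rat

    0≼* : ∀ {x y} → 0ʳ ≼ x → 0ʳ ≼ y → 0ʳ ≼ x *ʳ y
    0≼* {x} {y} (below h) (below k) = by-bounds (Cauchy.bounded (seq x) (cauchy x)) (Cauchy.bounded (seq y) (cauchy y))
      where
      by-bounds : ∃[ B ] (∀ n → ℚ.∣ seq x n ∣ ℚ.≤ fromℕℚ B) → ∃[ B ] (∀ n → ℚ.∣ seq y n ∣ ℚ.≤ fromℕℚ B) → 0ʳ ≼ x *ʳ y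
      by-bounds (B₁ , bx) (B₂ , by) = below λ ε 0<ε →
        let (ε′ , 0<ε′ , le) = shrink (fromℕℚ (B₁ ℕ.⊔ B₂)) ε (Cauchy.0≤fromℕℚ (B₁ ℕ.⊔ B₂)) 0<ε
            (N , f) = h ε′ 0<ε′ ; (M , g) = k ε′ 0<ε′
        in N ℕ.⊔ M , λ n n≥ → ℚP.≤-trans
             (product-≥ (Cauchy.0≤fromℕℚ (B₁ ℕ.⊔ B₂)) (f n (ℕP.m⊔n≤o⇒m≤o N M n≥)) (g n (ℕP.m⊔n≤o⇒n≤o N M n≥))
               (ℚP.≤-trans (bx n) (Cauchy.fromℕℚ-mono (ℕP.m≤m⊔n B₁ B₂))) (ℚP.≤-trans (by n) (Cauchy.fromℕℚ-mono (ℕP.m≤n⊔m B₁ B₂))) (ℚP.<⇒≤ 0<ε′))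
             (ℚP.+-monoʳ-≤ (seq x n ℚ.* seq y n) le)

  *ʳ-monoˡ : ∀ {c x y} → 0ʳ ≼ c → x ≼ y → c *ʳ x ≼ c *ʳ y
  *ʳ-monoˡ {c} {x} {y} 0≤c h = 0≼-⇒≼ (≈-resp-nonNegative
    (RS.solve 3 (λ c x y → c RS.:* (y RS.:- x) RS.:= c RS.:* y RS.:- c RS.:* x) ≋-refl c x y) (0≼* 0≤c (≼⇒0≼- h)))

  *ʳ-monoʳ : ∀ {c x y} → 0ʳ ≼ c → x ≼ y → x *ʳ c ≼ y *ʳ c
  *ʳ-monoʳ {c} {x} {y} 0≤c h = ≼-resp (R.*-comm c x) (R.*-comm c y) (*ʳ-monoˡ 0≤c h)

  *ʳ-mono : ∀ {x y u v} → 0ʳ ≼ x → 0ʳ ≼ v → x ≼ y → u ≼ v → x *ʳ u ≼ y *ʳ v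
  *ʳ-mono 0≤x 0≤v h k = ≼-trans (*ʳ-monoˡ 0≤x k) (*ʳ-monoʳ 0≤v h)

  0≼+ : ∀ {x y} → 0ʳ ≼ x → 0ʳ ≼ y → 0ʳ ≼ x +ʳ y
  0≼+ h k = ≼-resp (R.+-identityˡ 0ʳ) ≋-refl (+ʳ-mono h k)

  opaque
    unfolding _+ʳ_ _*ʳ_ -ʳ_ rat

    0≼square : ∀ x → 0ʳ ≼ x *ʳ x
    0≼square x = pointwise-≼ λ n → square (seq x n)
      where
      square : ∀ a → 0ℚ ℚ.≤ a ℚ.* a
      square a with ℚP.≤-total 0ℚ a
      ... | inj₁ 0≤a = Cauchy.0≤* 0≤a 0≤a
      ... | inj₂ a≤0 = subst (0ℚ ℚ.≤_) (QS.solve 1 (λ a → (QS.:- a) QS.:* (QS.:- a) QS.:= a QS.:* a) refl a)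
          (Cauchy.0≤* (ℚP.neg-antimono-≤ a≤0) (ℚP.neg-antimono-≤ a≤0))

    rat-mono : ∀ {a b} → a ℚ.≤ b → rat a ≼ rat b
    rat-mono h = pointwise-≼ λ _ → h

  nat-mono : ∀ {a b} → a ℕ.≤ b → nat a ≼ nat b
  nat-mono {a} {b} h = rat-mono (Cauchy.fromℕℚ-mono {a} {b} h)

  0≼nat : ∀ a → 0ʳ ≼ nat a
  0≼nat a = nat-mono {0} {a} ℕ.z≤n

  fromℕℚ-+ : ∀ m n → fromℕℚ (m ℕ.+ n) ≡ fromℕℚ m ℚ.+ fromℕℚ n
  fromℕℚ-+ = Cauchy.ExpTail.fromℕℚ-+ 0

  fromℕℚ-* : ∀ m n → fromℕℚ (m ℕ.* n) ≡ fromℕℚ m ℚ.* fromℕℚ n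
  fromℕℚ-* zero    n = sym (ℚP.*-zeroˡ (fromℕℚ n))
  fromℕℚ-* (suc m) n = trans (fromℕℚ-+ n (m ℕ.* n)) (trans (cong (fromℕℚ n ℚ.+_) (fromℕℚ-* m n))
    (trans (QS.solve 2 (λ m n → n QS.:+ m QS.:* n QS.:= (m QS.:+ QS.con (+ 1)) QS.:* n) refl (fromℕℚ m) (fromℕℚ n))
      (cong (ℚ._* fromℕℚ n) (sym (Cauchy.fromℕℚ-suc m)))))

  opaque
    unfolding _+ʳ_ _*ʳ_ -ʳ_ rat

    rat-+ : ∀ p q → rat (p ℚ.+ q) ≋ rat p +ʳ rat q
    rat-+ p q = pointwise λ _ → refl

    rat-* : ∀ p q → rat (p ℚ.* q) ≋ rat p *ʳ rat q
    rat-* p q = pointwise λ _ → refl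

    nat-+ : ∀ m n → nat (m ℕ.+ n) ≋ nat m +ʳ nat n
    nat-+ m n = pointwise λ _ → fromℕℚ-+ m n

    nat-* : ∀ m n → nat (m ℕ.* n) ≋ nat m *ʳ nat n
    nat-* m n = pointwise λ _ → fromℕℚ-* m n

  reciprocal : ℕ → ℝ
  reciprocal k = rat (+ 1 / suc k)

  0≼reciprocal : ∀ k → 0ʳ ≼ reciprocal k
  0≼reciprocal k = rat-mono (Cauchy.0≤inv k)

  opaque
    unfolding _+ʳ_ _*ʳ_ -ʳ_ rat

    reciprocal-inverse : ∀ k → reciprocal k *ʳ nat (suc k) ≋ 1ʳ
    reciprocal-inverse k = pointwise λ _ → trans (ℚP.*-comm (+ 1 / suc k) (fromℕℚ (suc k))) (Cauchy.fromℕℚ-inverse k)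

  cancel-≼ : ∀ k .{{_ : ℕ.NonZero k}} {x y} → nat k *ʳ x ≼ nat k *ʳ y → x ≼ y
  cancel-≼ (suc k) {x} {y} h = ≼-resp (undo x) (undo y) (*ʳ-monoˡ (0≼reciprocal k) h)
    where
    undo : ∀ x → reciprocal k *ʳ (nat (suc k) *ʳ x) ≋ x
    undo x = ≋-trans (≋-sym (R.*-assoc (reciprocal k) (nat (suc k)) x)) (≋-trans (*ʳ-cong (reciprocal-inverse k) ≋-refl) (R.*-identityˡ x))

  cancel-≋0 : ∀ k .{{_ : ℕ.NonZero k}} {x} → nat k *ʳ x ≋ 0ʳ → x ≋ 0ʳ
  cancel-≋0 (suc k) {x} h = ≋-trans (≋-sym (≋-trans (≋-sym (R.*-assoc (reciprocal k) (nat (suc k)) x))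
    (≋-trans (*ʳ-cong (reciprocal-inverse k) ≋-refl) (R.*-identityˡ x)))) (≋-trans (*ʳ-cong ≋-refl h) (R.zeroʳ (reciprocal k)))

  open ListSum R.+-commutativeMonoid using () renaming
    ( ∑ to ∑ʳ; ∑-cong to ∑ʳ-cong; ∑-distrib to ∑ʳ-distrib; ∑-ε to ∑ʳ-0; ∑-swap to ∑ʳ-swap ) public

  module _ {a} {A : Set a} where

    ∑ʳ-mono : ∀ {g h : A → ℝ} xs → (∀ x → g x ≼ h x) → ∑ʳ xs g ≼ ∑ʳ xs h
    ∑ʳ-mono []       e = ≼-refl
    ∑ʳ-mono (x ∷ xs) e = +ʳ-mono (e x) (∑ʳ-mono xs e)

    ∑ʳ-*ˡ : ∀ k (g : A → ℝ) xs → k *ʳ ∑ʳ xs g ≋ ∑ʳ xs (λ x → k *ʳ g x)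
    ∑ʳ-*ˡ k g []       = R.zeroʳ k
    ∑ʳ-*ˡ k g (x ∷ xs) = ≋-trans (R.distribˡ k (g x) (∑ʳ xs g)) (+ʳ-cong ≋-refl (∑ʳ-*ˡ k g xs))

    ∑ʳ-*ʳ : ∀ k (g : A → ℝ) xs → ∑ʳ xs g *ʳ k ≋ ∑ʳ xs (λ x → g x *ʳ k)
    ∑ʳ-*ʳ k g []       = R.zeroˡ k
    ∑ʳ-*ʳ k g (x ∷ xs) = ≋-trans (R.distribʳ k (g x) (∑ʳ xs g)) (+ʳ-cong ≋-refl (∑ʳ-*ʳ k g xs))

    ∑ʳ-const : ∀ k (xs : List A) → ∑ʳ xs (λ _ → k) ≋ nat (List.length xs) *ʳ k
    ∑ʳ-const k []       = ≋-sym (R.zeroˡ k)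
    ∑ʳ-const k (x ∷ xs) = ≋-trans (+ʳ-cong (≋-sym (R.*-identityˡ k)) (∑ʳ-const k xs))
      (≋-trans (≋-sym (R.distribʳ k 1ʳ (nat (List.length xs)))) (*ʳ-cong (≋-sym (nat-+ 1 (List.length xs))) ≋-refl))

    nat-∑ : ∀ (g : A → ℕ) xs → nat (∑ℕ xs g) ≋ ∑ʳ xs (λ x → nat (g x))
    nat-∑ g []       = ≋-refl
    nat-∑ g (x ∷ xs) = ≋-trans (nat-+ (g x) (∑ℕ xs g)) (+ʳ-cong ≋-refl (nat-∑ g xs))

    ∑ʳ-product : ∀ (g h : A → ℝ) xs ys →
      ∑ʳ xs g *ʳ ∑ʳ ys h ≋ ∑ʳ xs (λ x → ∑ʳ ys (λ y → g x *ʳ h y))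
    ∑ʳ-product g h xs ys = ≋-trans (∑ʳ-*ʳ (∑ʳ ys h) g xs) (∑ʳ-cong xs (λ x → ∑ʳ-*ˡ (g x) h ys))

    -- Sum `a b ≤ (a² + b²) / 2` over all pairs of entries: the right side adds up to the length of
    -- the list times the sum of the squares.
    cauchy-schwarz : ∀ (g : A → ℝ) xs → ∑ʳ xs g *ʳ ∑ʳ xs g ≼ nat (List.length xs) *ʳ ∑ʳ xs (λ x → g x *ʳ g x)
    cauchy-schwarz g xs = ≼-resp (≋-sym (∑ʳ-product g g xs xs)) total
      (∑ʳ-mono xs (λ x → ∑ʳ-mono xs (λ y → am-gm (g x) (g y))))
      where
      h = rat ½
      halves : ∀ x → (h +ʳ h) *ʳ x ≋ x
      halves x = ≋-trans (*ʳ-cong (≋-sym (rat-+ ½ ½)) ≋-refl) (R.*-identityˡ x)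
      Q = ∑ʳ xs (λ x → g x *ʳ g x)
      am-gm : ∀ a b → a *ʳ b ≼ h *ʳ (a *ʳ a) +ʳ h *ʳ (b *ʳ b)
      am-gm a b = 0≼-⇒≼ (≈-resp-nonNegative (≋-trans
        (RS.solve 3 (λ a b h → h RS.:* ((a RS.:- b) RS.:* (a RS.:- b)) RS.:= (h RS.:* (a RS.:* a) RS.:+ h RS.:* (b RS.:* b)) RS.:- (h RS.:+ h) RS.:* (a RS.:* b)) ≋-refl a b h)
        (+ʳ-cong ≋-refl (-ʳ-cong (halves (a *ʳ b)))))
        (0≼* (rat-mono (ℚP.nonNegative⁻¹ ½)) (0≼square (a -ʳ b))))
      n = nat (List.length xs)
      hg : A → ℝ
      hg x = h *ʳ (g x *ʳ g x)
      inner : ∀ x → ∑ʳ xs (λ y → hg x +ʳ hg y) ≋ n *ʳ hg x +ʳ h *ʳ Q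
      inner x = ≋-trans (∑ʳ-distrib (λ _ → hg x) hg xs)
        (+ʳ-cong (∑ʳ-const (hg x) xs) (≋-sym (∑ʳ-*ˡ h (λ y → g y *ʳ g y) xs)))
      outer : ∑ʳ xs (λ x → n *ʳ hg x +ʳ h *ʳ Q) ≋ n *ʳ (h *ʳ Q) +ʳ n *ʳ (h *ʳ Q)
      outer = ≋-trans (∑ʳ-distrib (λ x → n *ʳ hg x) (λ _ → h *ʳ Q) xs)
        (+ʳ-cong (≋-trans (≋-sym (∑ʳ-*ˡ n hg xs)) (*ʳ-cong ≋-refl (≋-sym (∑ʳ-*ˡ h (λ x → g x *ʳ g x) xs))))
                 (∑ʳ-const (h *ʳ Q) xs))
      twice : n *ʳ (h *ʳ Q) +ʳ n *ʳ (h *ʳ Q) ≋ n *ʳ ((h +ʳ h) *ʳ Q)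
      twice = RS.solve 3 (λ n h q → n RS.:* (h RS.:* q) RS.:+ n RS.:* (h RS.:* q) RS.:= n RS.:* ((h RS.:+ h) RS.:* q)) ≋-refl n h Q
      total : ∑ʳ xs (λ x → ∑ʳ xs (λ y → hg x +ʳ hg y)) ≋ n *ʳ Q
      total = ≋-trans (∑ʳ-cong xs inner) (≋-trans outer (≋-trans twice (*ʳ-cong ≋-refl (halves Q))))

-- Cauchy products of series of exponential type.

module ExponentialSeries where

  open Sums
  open Reals

  sumTo : ℕ → (ℕ → ℚ) → ℚ
  sumTo zero    g = 0ℚ
  sumTo (suc N) g = sumTo N g ℚ.+ g N

  sumTo-cong : ∀ {g h : ℕ → ℚ} N → (∀ k → g k ≡ h k) → sumTo N g ≡ sumTo N h
  sumTo-cong zero    e = refl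
  sumTo-cong (suc N) e = cong₂ ℚ._+_ (sumTo-cong N e) (e N)

  sumTo-+ : ∀ g h N → sumTo N (λ k → g k ℚ.+ h k) ≡ sumTo N g ℚ.+ sumTo N h
  sumTo-+ g h zero    = refl
  sumTo-+ g h (suc N) = trans (cong (ℚ._+ (g N ℚ.+ h N)) (sumTo-+ g h N))
    (QS.solve 4 (λ a b c d → (a QS.:+ b) QS.:+ (c QS.:+ d) QS.:= (a QS.:+ c) QS.:+ (b QS.:+ d)) refl (sumTo N g) (sumTo N h) (g N) (h N))

  sumTo-* : ∀ c g N → sumTo N (λ k → c ℚ.* g k) ≡ c ℚ.* sumTo N g
  sumTo-* c g zero    = sym (ℚP.*-zeroʳ c)
  sumTo-* c g (suc N) = trans (cong (ℚ._+ c ℚ.* g N) (sumTo-* c g N)) (sym (ℚP.*-distribˡ-+ c (sumTo N g) (g N)))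

  sumTo-shift : ∀ g N → sumTo (suc N) g ≡ g 0 ℚ.+ sumTo N (λ k → g (suc k))
  sumTo-shift g zero    = trans (ℚP.+-identityˡ (g 0)) (sym (ℚP.+-identityʳ (g 0)))
  sumTo-shift g (suc N) = trans (cong (ℚ._+ g (suc N)) (sumTo-shift g N)) (ℚP.+-assoc (g 0) (sumTo N (λ k → g (suc k))) (g (suc N)))

  sumTo-mono : ∀ g → (∀ k → 0ℚ ℚ.≤ g k) → ∀ {K M} → K ℕ.≤′ M → sumTo K g ℚ.≤ sumTo M g
  sumTo-mono g 0≤g ℕ.≤′-refl = ℚP.≤-refl
  sumTo-mono g 0≤g {M = suc M} (ℕ.≤′-step K≤M) = Cauchy.≤-+ʳ (sumTo-mono g 0≤g K≤M) (0≤g M)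

  -- The sums of w (j + k) f j g k over the rectangle j < N, k < M and over the triangle j + k < N.
  rectangle : ℕ → ℕ → (w f g : ℕ → ℚ) → ℚ
  rectangle zero    M w f g = 0ℚ
  rectangle (suc N) M w f g = sumTo M (λ k → w k ℚ.* (f 0 ℚ.* g k)) ℚ.+ rectangle N M (λ k → w (suc k)) (λ j → f (suc j)) g

  triangle : ℕ → (w f g : ℕ → ℚ) → ℚ
  triangle zero    w f g = 0ℚ
  triangle (suc N) w f g = sumTo (suc N) (λ k → w k ℚ.* (f 0 ℚ.* g k)) ℚ.+ triangle N (λ k → w (suc k)) (λ j → f (suc j)) g

  one : ℕ → ℚ
  one _ = 1ℚ

  abs : (ℕ → ℚ) → ℕ → ℚ
  abs f k = ℚ.∣ f k ∣

  -- The triangle lies in the rectangle, so the difference consists of the terms with `j + k ≥ N`,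
  -- and weights bounded by 1 let the absolute values dominate it. The error for sine and cosine is
  -- thereby reduced to that of the exponential at nonnegative arguments.
  rectangle-triangle : ∀ N M → N ℕ.≤ M → ∀ w f g → (∀ k → ℚ.∣ w k ∣ ℚ.≤ 1ℚ) →
    ℚ.∣ rectangle N M w f g ℚ.- triangle N w f g ∣ ℚ.≤ rectangle N M one (abs f) (abs g) ℚ.- triangle N one (abs f) (abs g)
  rectangle-triangle zero M N≤M w f g w≤1 = ℚP.≤-refl
  rectangle-triangle (suc N) M N≤M w f g w≤1 = begin
    ℚ.∣ (A ℚ.+ B) ℚ.- (C ℚ.+ D) ∣                  ≡⟨ cong ℚ.∣_∣ (regroup A B C D) ⟩
    ℚ.∣ (A ℚ.- C) ℚ.+ (B ℚ.- D) ∣                  ≤⟨ ℚP.∣p+q∣≤∣p∣+∣q∣ (A ℚ.- C) (B ℚ.- D) ⟩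
    ℚ.∣ A ℚ.- C ∣ ℚ.+ ℚ.∣ B ℚ.- D ∣                ≤⟨ ℚP.+-mono-≤ row (rectangle-triangle N M (ℕP.≤-trans (ℕP.n≤1+n N) N≤M) (λ k → w (suc k)) (λ j → f (suc j)) g (λ k → w≤1 (suc k))) ⟩
    (A′ ℚ.- C′) ℚ.+ (B′ ℚ.- D′)                    ≡⟨ sym (regroup A′ B′ C′ D′) ⟩
    (A′ ℚ.+ B′) ℚ.- (C′ ℚ.+ D′)                    ∎
    where
    open ℚP.≤-Reasoning
    regroup : ∀ a b c d → (a ℚ.+ b) ℚ.- (c ℚ.+ d) ≡ (a ℚ.- c) ℚ.+ (b ℚ.- d)
    regroup = QS.solve 4 (λ a b c d → (a QS.:+ b) QS.:- (c QS.:+ d) QS.:= (a QS.:- c) QS.:+ (b QS.:- d)) refl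
    u u′ : ℕ → ℚ
    u k  = w k ℚ.* (f 0 ℚ.* g k)
    u′ k = 1ℚ ℚ.* (abs f 0 ℚ.* abs g k)
    A = sumTo M u
    B = rectangle N M (λ k → w (suc k)) (λ j → f (suc j)) g
    C = sumTo (suc N) u
    D = triangle N (λ k → w (suc k)) (λ j → f (suc j)) g
    A′ = sumTo M u′
    B′ = rectangle N M one (λ j → abs f (suc j)) (abs g)
    C′ = sumTo (suc N) u′
    D′ = triangle N one (λ j → abs f (suc j)) (abs g)
    -- Only the terms beyond the triangle count, so bounding them termwise suffices.
    tail-≤ : ∀ {K M} → K ℕ.≤′ M → ℚ.∣ sumTo M u ℚ.- sumTo K u ∣ ℚ.≤ sumTo M u′ ℚ.- sumTo K u′
    tail-≤ {K} ℕ.≤′-refl = ℚP.≤-reflexive (trans (cong ℚ.∣_∣ (ℚP.+-inverseʳ (sumTo K u))) (sym (ℚP.+-inverseʳ (sumTo K u′))))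
    tail-≤ {K} {suc M} (ℕ.≤′-step K≤M) = begin
      ℚ.∣ (sumTo M u ℚ.+ u M) ℚ.- sumTo K u ∣      ≡⟨ cong ℚ.∣_∣ (move (sumTo M u) (u M) (sumTo K u)) ⟩
      ℚ.∣ (sumTo M u ℚ.- sumTo K u) ℚ.+ u M ∣      ≤⟨ ℚP.∣p+q∣≤∣p∣+∣q∣ (sumTo M u ℚ.- sumTo K u) (u M) ⟩
      ℚ.∣ sumTo M u ℚ.- sumTo K u ∣ ℚ.+ ℚ.∣ u M ∣  ≤⟨ ℚP.+-mono-≤ (tail-≤ K≤M) (term M) ⟩
      (sumTo M u′ ℚ.- sumTo K u′) ℚ.+ u′ M         ≡⟨ sym (move (sumTo M u′) (u′ M) (sumTo K u′)) ⟩
      (sumTo M u′ ℚ.+ u′ M) ℚ.- sumTo K u′         ∎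
      where
      move : ∀ a x b → (a ℚ.+ x) ℚ.- b ≡ (a ℚ.- b) ℚ.+ x
      move = QS.solve 3 (λ a x b → (a QS.:+ x) QS.:- b QS.:= (a QS.:- b) QS.:+ x) refl
      term : ∀ k → ℚ.∣ u k ∣ ℚ.≤ u′ k
      term k = begin
        ℚ.∣ w k ℚ.* (f 0 ℚ.* g k) ∣               ≡⟨ ℚP.∣p*q∣≡∣p∣*∣q∣ (w k) (f 0 ℚ.* g k) ⟩
        ℚ.∣ w k ∣ ℚ.* ℚ.∣ f 0 ℚ.* g k ∣           ≤⟨ Cauchy.*-monoʳ (ℚP.0≤∣p∣ (f 0 ℚ.* g k)) (w≤1 k) ⟩
        1ℚ ℚ.* ℚ.∣ f 0 ℚ.* g k ∣                  ≡⟨ cong (1ℚ ℚ.*_) (ℚP.∣p*q∣≡∣p∣*∣q∣ (f 0) (g k)) ⟩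
        u′ k                                      ∎
    row : ℚ.∣ A ℚ.- C ∣ ℚ.≤ A′ ℚ.- C′
    row = tail-≤ (ℕP.≤⇒≤′ N≤M)

  -- All terms are nonnegative, and `j < N`, `k < M` force `j + k < K`. Together with the previous
  -- bound this squeezes the product of two partial sums between partial sums of lengths `N` and
  -- `2 N`.
  rectangle-≤-triangle : ∀ N M K → N ℕ.+ M ℕ.≤ K → ∀ f g → (∀ k → 0ℚ ℚ.≤ f k) → (∀ k → 0ℚ ℚ.≤ g k) →
    rectangle N M one f g ℚ.≤ triangle K one f g
  rectangle-≤-triangle zero M K le f g 0≤f 0≤g = 0≤triangle K f 0≤f
    where
    0≤sumTo : ∀ N {h} → (∀ k → 0ℚ ℚ.≤ h k) → 0ℚ ℚ.≤ sumTo N h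
    0≤sumTo zero    p = ℚP.≤-refl
    0≤sumTo (suc N) p = Cauchy.0≤+ (0≤sumTo N p) (p N)
    0≤triangle : ∀ K f → (∀ k → 0ℚ ℚ.≤ f k) → 0ℚ ℚ.≤ triangle K one f g
    0≤triangle zero    f 0≤f = ℚP.≤-refl
    0≤triangle (suc K) f 0≤f = Cauchy.0≤+ (0≤sumTo (suc K) (λ k → Cauchy.0≤* Cauchy.0≤1 (Cauchy.0≤* (0≤f 0) (0≤g k))))
      (0≤triangle K (λ j → f (suc j)) (λ k → 0≤f (suc k)))
  rectangle-≤-triangle (suc N) M (suc K) (ℕ.s≤s le) f g 0≤f 0≤g = ℚP.+-mono-≤
    (sumTo-mono (λ k → 1ℚ ℚ.* (f 0 ℚ.* g k)) (λ k → Cauchy.0≤* Cauchy.0≤1 (Cauchy.0≤* (0≤f 0) (0≤g k)))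
      (ℕP.≤⇒≤′ (ℕP.≤-trans (ℕP.≤-trans (ℕP.m≤n+m M N) le) (ℕP.n≤1+n K))))
    (rectangle-≤-triangle N M K le (λ j → f (suc j)) g (λ k → 0≤f (suc k)) 0≤g)

  -- A weight of `j + k` that separates into two products makes the double sum separate likewise.
  -- For the derivatives of cosine and sine at 0 the separation is their addition theorem; for the
  -- exponential it is `1 = 1 · 1 + 0 · 0`.
  rectangle-product : ∀ N M (w u v u′ v′ : ℕ → ℚ) → (∀ j k → w (j ℕ.+ k) ≡ u j ℚ.* v k ℚ.+ u′ j ℚ.* v′ k) → ∀ f g →
    rectangle N M w f g ≡ sumTo N (λ j → u j ℚ.* f j) ℚ.* sumTo M (λ k → v k ℚ.* g k)
                      ℚ.+ sumTo N (λ j → u′ j ℚ.* f j) ℚ.* sumTo M (λ k → v′ k ℚ.* g k)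
  rectangle-product zero M w u v u′ v′ e f g = sym (trans (cong₂ ℚ._+_ (ℚP.*-zeroˡ V) (ℚP.*-zeroˡ V′)) refl)
    where
    V = sumTo M (λ k → v k ℚ.* g k)
    V′ = sumTo M (λ k → v′ k ℚ.* g k)
  rectangle-product (suc N) M w u v u′ v′ e f g = begin
    sumTo M (λ k → w k ℚ.* (f 0 ℚ.* g k)) ℚ.+ rectangle N M (λ k → w (suc k)) (λ j → f (suc j)) g
      ≡⟨ cong₂ ℚ._+_ row (rectangle-product N M (λ k → w (suc k)) (λ j → u (suc j)) v (λ j → u′ (suc j)) v′ (λ j k → e (suc j) k) (λ j → f (suc j)) g) ⟩
    ((u 0 ℚ.* f 0) ℚ.* V ℚ.+ (u′ 0 ℚ.* f 0) ℚ.* V′) ℚ.+ (U ℚ.* V ℚ.+ U′ ℚ.* V′)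
      ≡⟨ QS.solve 6 (λ a b V V′ U U′ → (a QS.:* V QS.:+ b QS.:* V′) QS.:+ (U QS.:* V QS.:+ U′ QS.:* V′)
           QS.:= (a QS.:+ U) QS.:* V QS.:+ (b QS.:+ U′) QS.:* V′) refl (u 0 ℚ.* f 0) (u′ 0 ℚ.* f 0) V V′ U U′ ⟩
    (u 0 ℚ.* f 0 ℚ.+ U) ℚ.* V ℚ.+ (u′ 0 ℚ.* f 0 ℚ.+ U′) ℚ.* V′
      ≡⟨ sym (cong₂ (λ a b → a ℚ.* V ℚ.+ b ℚ.* V′) (sumTo-shift (λ j → u j ℚ.* f j) N) (sumTo-shift (λ j → u′ j ℚ.* f j) N)) ⟩
    sumTo (suc N) (λ j → u j ℚ.* f j) ℚ.* V ℚ.+ sumTo (suc N) (λ j → u′ j ℚ.* f j) ℚ.* V′ ∎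
    where
    open ≡-Reasoning
    V = sumTo M (λ k → v k ℚ.* g k)
    V′ = sumTo M (λ k → v′ k ℚ.* g k)
    U = sumTo N (λ j → u (suc j) ℚ.* f (suc j))
    U′ = sumTo N (λ j → u′ (suc j) ℚ.* f (suc j))
    row : sumTo M (λ k → w k ℚ.* (f 0 ℚ.* g k)) ≡ (u 0 ℚ.* f 0) ℚ.* V ℚ.+ (u′ 0 ℚ.* f 0) ℚ.* V′
    row = trans (sumTo-cong M (λ k → trans (cong (ℚ._* (f 0 ℚ.* g k)) (e 0 k))
        (QS.solve 6 (λ u v u′ v′ f g → (u QS.:* v QS.:+ u′ QS.:* v′) QS.:* (f QS.:* g)
          QS.:= (u QS.:* f) QS.:* (v QS.:* g) QS.:+ (u′ QS.:* f) QS.:* (v′ QS.:* g)) refl (u 0) (v k) (u′ 0) (v′ k) (f 0) (g k))))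
      (trans (sumTo-+ (λ k → (u 0 ℚ.* f 0) ℚ.* (v k ℚ.* g k)) (λ k → (u′ 0 ℚ.* f 0) ℚ.* (v′ k ℚ.* g k)) M)
        (cong₂ ℚ._+_ (sumTo-* (u 0 ℚ.* f 0) (λ k → v k ℚ.* g k) M) (sumTo-* (u′ 0 ℚ.* f 0) (λ k → v′ k ℚ.* g k) M)))

  convolution : (f g : ℕ → ℚ) → ℕ → ℚ
  convolution f g zero    = f 0 ℚ.* g 0
  convolution f g (suc m) = f 0 ℚ.* g (suc m) ℚ.+ convolution (λ j → f (suc j)) g m

  triangle-convolution : ∀ N w f g → triangle N w f g ≡ sumTo N (λ m → w m ℚ.* convolution f g m)
  triangle-convolution zero w f g = refl
  triangle-convolution (suc N) w f g = begin
    sumTo (suc N) h ℚ.+ triangle N w⁺ f⁺ g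
      ≡⟨ cong₂ ℚ._+_ (sumTo-shift h N) (triangle-convolution N w⁺ f⁺ g) ⟩
    (h 0 ℚ.+ sumTo N (λ k → h (suc k))) ℚ.+ sumTo N (λ m → w (suc m) ℚ.* convolution f⁺ g m)
      ≡⟨ ℚP.+-assoc (h 0) (sumTo N (λ k → h (suc k))) (sumTo N (λ m → w (suc m) ℚ.* convolution f⁺ g m)) ⟩
    h 0 ℚ.+ (sumTo N (λ k → h (suc k)) ℚ.+ sumTo N (λ m → w (suc m) ℚ.* convolution f⁺ g m))
      ≡⟨ cong (h 0 ℚ.+_) (sym (sumTo-+ (λ k → h (suc k)) (λ m → w (suc m) ℚ.* convolution f⁺ g m) N)) ⟩
    h 0 ℚ.+ sumTo N (λ k → h (suc k) ℚ.+ w (suc k) ℚ.* convolution f⁺ g k)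
      ≡⟨ cong (h 0 ℚ.+_) (sumTo-cong N (λ k → sym (ℚP.*-distribˡ-+ (w (suc k)) (f 0 ℚ.* g (suc k)) (convolution f⁺ g k)))) ⟩
    h 0 ℚ.+ sumTo N (λ k → w (suc k) ℚ.* convolution f g (suc k))
      ≡⟨ sym (sumTo-shift (λ m → w m ℚ.* convolution f g m) N) ⟩
    sumTo (suc N) (λ m → w m ℚ.* convolution f g m) ∎
    where
    open ≡-Reasoning
    h f⁺ w⁺ : ℕ → ℚ
    w⁺ k = w (suc k)
    h k = w k ℚ.* (f 0 ℚ.* g k)
    f⁺ j = f (suc j)

  convolution-cong : ∀ {f f′ : ℕ → ℚ} g m → (∀ j → f j ≡ f′ j) → convolution f g m ≡ convolution f′ g m
  convolution-cong g zero    e = cong (ℚ._* g 0) (e 0)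
  convolution-cong g (suc m) e = cong₂ ℚ._+_ (cong (ℚ._* g (suc m)) (e 0)) (convolution-cong g m (λ j → e (suc j)))

  convolution-congʳ : ∀ f {g g′ : ℕ → ℚ} m → (∀ j → g j ≡ g′ j) → convolution f g m ≡ convolution f g′ m
  convolution-congʳ f zero    e = cong (f 0 ℚ.*_) (e 0)
  convolution-congʳ f (suc m) e = cong₂ ℚ._+_ (cong (f 0 ℚ.*_) (e (suc m))) (convolution-congʳ (λ j → f (suc j)) m e)

  convolution-+ : ∀ f f′ g m → convolution (λ j → f j ℚ.+ f′ j) g m ≡ convolution f g m ℚ.+ convolution f′ g m
  convolution-+ f f′ g zero    = ℚP.*-distribʳ-+ (g 0) (f 0) (f′ 0)
  convolution-+ f f′ g (suc m) = trans (cong ((f 0 ℚ.+ f′ 0) ℚ.* g (suc m) ℚ.+_) (convolution-+ (λ j → f (suc j)) (λ j → f′ (suc j)) g m))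
    (QS.solve 5 (λ a b g x y → (a QS.:+ b) QS.:* g QS.:+ (x QS.:+ y) QS.:= (a QS.:* g QS.:+ x) QS.:+ (b QS.:* g QS.:+ y)) refl
      (f 0) (f′ 0) (g (suc m)) (convolution (λ j → f (suc j)) g m) (convolution (λ j → f′ (suc j)) g m))

  convolution-* : ∀ c f g m → convolution (λ j → c ℚ.* f j) g m ≡ c ℚ.* convolution f g m
  convolution-* c f g zero    = ℚP.*-assoc c (f 0) (g 0)
  convolution-* c f g (suc m) = trans (cong ((c ℚ.* f 0) ℚ.* g (suc m) ℚ.+_) (convolution-* c (λ j → f (suc j)) g m))
    (QS.solve 4 (λ c f g x → (c QS.:* f) QS.:* g QS.:+ c QS.:* x QS.:= c QS.:* (f QS.:* g QS.:+ x)) refl c (f 0) (g (suc m)) (convolution (λ j → f (suc j)) g m))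

  convolution-*ʳ : ∀ c f g m → convolution f (λ j → c ℚ.* g j) m ≡ c ℚ.* convolution f g m
  convolution-*ʳ c f g zero    = QS.solve 3 (λ c f g → f QS.:* (c QS.:* g) QS.:= c QS.:* (f QS.:* g)) refl c (f 0) (g 0)
  convolution-*ʳ c f g (suc m) = trans (cong (f 0 ℚ.* (c ℚ.* g (suc m)) ℚ.+_) (convolution-*ʳ c (λ j → f (suc j)) g m))
    (QS.solve 4 (λ c f g x → f QS.:* (c QS.:* g) QS.:+ c QS.:* x QS.:= c QS.:* (f QS.:* g QS.:+ x)) refl c (f 0) (g (suc m)) (convolution (λ j → f (suc j)) g m))

  -- The formal derivative of the power series with coefficients `f`; `leibniz` is its product rule,
  -- read off coefficientwise.
  derivative : (ℕ → ℚ) → ℕ → ℚ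
  derivative f j = fromℕℚ (suc j) ℚ.* f (suc j)

  leibniz : ∀ m f g → fromℕℚ (suc m) ℚ.* convolution f g (suc m) ≡ convolution (derivative f) g m ℚ.+ convolution f (derivative g) m
  leibniz zero f g = QS.solve 4 (λ f g f′ g′ → QS.con (+ 1) QS.:* (f QS.:* g′ QS.:+ f′ QS.:* g)
      QS.:= (QS.con (+ 1) QS.:* f′) QS.:* g QS.:+ f QS.:* (QS.con (+ 1) QS.:* g′)) refl (f 0) (g 0) (f 1) (g 1)
  leibniz (suc m) f g = begin
    fromℕℚ (suc (suc m)) ℚ.* (a ℚ.* b ℚ.+ c)
      ≡⟨ cong (ℚ._* (a ℚ.* b ℚ.+ c)) (Cauchy.fromℕℚ-suc (suc m)) ⟩
    (s ℚ.+ 1ℚ) ℚ.* (a ℚ.* b ℚ.+ c)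
      ≡⟨ QS.solve 4 (λ s a b c → (s QS.:+ QS.con (+ 1)) QS.:* (a QS.:* b QS.:+ c)
           QS.:= c QS.:+ (s QS.:* c QS.:+ a QS.:* ((s QS.:+ QS.con (+ 1)) QS.:* b))) refl s a b c ⟩
    c ℚ.+ (s ℚ.* c ℚ.+ a ℚ.* ((s ℚ.+ 1ℚ) ℚ.* b))
      ≡⟨ cong₂ (λ x y → c ℚ.+ (x ℚ.+ a ℚ.* (y ℚ.* b))) (leibniz m f⁺ g) (sym (Cauchy.fromℕℚ-suc (suc m))) ⟩
    c ℚ.+ ((d ℚ.+ e) ℚ.+ a ℚ.* derivative g (suc m))
      ≡⟨ QS.solve 4 (λ c d e x → c QS.:+ ((d QS.:+ e) QS.:+ x) QS.:= (c QS.:+ d) QS.:+ (x QS.:+ e)) refl c d e (a ℚ.* derivative g (suc m)) ⟩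
    (c ℚ.+ d) ℚ.+ (a ℚ.* derivative g (suc m) ℚ.+ e)
      ≡⟨ cong (ℚ._+ (a ℚ.* derivative g (suc m) ℚ.+ e)) (sym head) ⟩
    convolution (derivative f) g (suc m) ℚ.+ convolution f (derivative g) (suc m) ∎
    where
    open ≡-Reasoning
    f⁺ : ℕ → ℚ
    f⁺ j = f (suc j)
    s = fromℕℚ (suc m)
    a = f 0
    b = g (suc (suc m))
    c = convolution f⁺ g (suc m)
    d = convolution (derivative f⁺) g m
    e = convolution f⁺ (derivative g) m
    head : convolution (derivative f) g (suc m) ≡ c ℚ.+ d
    head = trans (cong (derivative f 0 ℚ.* g (suc m) ℚ.+_)
        (trans (convolution-cong g m (λ j → trans (cong (ℚ._* f (suc (suc j))) (Cauchy.fromℕℚ-suc (suc j)))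
            (QS.solve 2 (λ s x → (s QS.:+ QS.con (+ 1)) QS.:* x QS.:= x QS.:+ s QS.:* x) refl (fromℕℚ (suc j)) (f (suc (suc j))))))
          (convolution-+ (λ j → f (suc (suc j))) (derivative f⁺) g m)))
      (QS.solve 4 (λ x g y d → (QS.con (+ 1) QS.:* x) QS.:* g QS.:+ (y QS.:+ d) QS.:= (x QS.:* g QS.:+ y) QS.:+ d) refl
        (f 1) (g (suc m)) (convolution (λ j → f (suc (suc j))) g m) d)

  term : ℚ → ℕ → ℚ
  term x k = 1/! k ℚ.* x ^ℚ k

  derivative-term : ∀ x j → derivative (term x) j ≡ x ℚ.* term x j
  derivative-term x j = trans
    (QS.solve 5 (λ s i f x p → s QS.:* ((f QS.:* i) QS.:* (x QS.:* p)) QS.:= (s QS.:* i) QS.:* (x QS.:* (f QS.:* p))) refl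
      (fromℕℚ (suc j)) (+ 1 / suc j) (1/! j) x (x ^ℚ j))
    (trans (cong (ℚ._* (x ℚ.* term x j)) (Cauchy.fromℕℚ-inverse j)) (ℚP.*-identityˡ (x ℚ.* term x j)))

  fromℕℚ-cancel : ∀ k {x y} → fromℕℚ (suc k) ℚ.* x ≡ fromℕℚ (suc k) ℚ.* y → x ≡ y
  fromℕℚ-cancel k {x} {y} e = trans (undo x) (trans (cong (+ 1 / suc k ℚ.*_) e) (sym (undo y)))
    where
    undo : ∀ x → x ≡ (+ 1 / suc k) ℚ.* (fromℕℚ (suc k) ℚ.* x)
    undo x = sym (trans (sym (ℚP.*-assoc (+ 1 / suc k) (fromℕℚ (suc k)) x))
      (trans (cong (ℚ._* x) (trans (ℚP.*-comm (+ 1 / suc k) (fromℕℚ (suc k))) (Cauchy.fromℕℚ-inverse k))) (ℚP.*-identityˡ x)))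

  -- The term series of `x` satisfies `f′ = x f`, so by the product rule the convolution satisfies
  -- the differential equation of the term series of `x + y`. Comparing coefficients gives the
  -- induction step after cancelling `m + 1`.
  binomial : ∀ x y m → convolution (term x) (term y) m ≡ term (x ℚ.+ y) m
  binomial x y zero    = refl
  binomial x y (suc m) = fromℕℚ-cancel m (begin
    fromℕℚ (suc m) ℚ.* convolution (term x) (term y) (suc m)
      ≡⟨ leibniz m (term x) (term y) ⟩
    convolution (derivative (term x)) (term y) m ℚ.+ convolution (term x) (derivative (term y)) m
      ≡⟨ cong₂ ℚ._+_ (trans (convolution-cong (term y) m (derivative-term x)) (convolution-* x (term x) (term y) m))
                     (trans (convolution-congʳ (term x) m (derivative-term y)) (convolution-*ʳ y (term x) (term y) m)) ⟩
    x ℚ.* convolution (term x) (term y) m ℚ.+ y ℚ.* convolution (term x) (term y) m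
      ≡⟨ sym (ℚP.*-distribʳ-+ (convolution (term x) (term y) m) x y) ⟩
    (x ℚ.+ y) ℚ.* convolution (term x) (term y) m
      ≡⟨ cong ((x ℚ.+ y) ℚ.*_) (binomial x y m) ⟩
    (x ℚ.+ y) ℚ.* term (x ℚ.+ y) m
      ≡⟨ sym (derivative-term (x ℚ.+ y) m) ⟩
    fromℕℚ (suc m) ℚ.* term (x ℚ.+ y) (suc m) ∎)
    where open ≡-Reasoning

  abs-^ : ∀ x k → ℚ.∣ x ^ℚ k ∣ ≡ ℚ.∣ x ∣ ^ℚ k
  abs-^ x zero    = refl
  abs-^ x (suc k) = trans (ℚP.∣p*q∣≡∣p∣*∣q∣ x (x ^ℚ k)) (cong (ℚ.∣ x ∣ ℚ.*_) (abs-^ x k))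

  abs-term : ∀ x k → ℚ.∣ term x k ∣ ≡ term ℚ.∣ x ∣ k
  abs-term x k = trans (ℚP.∣p*q∣≡∣p∣*∣q∣ (1/! k) (x ^ℚ k)) (cong₂ ℚ._*_ (ℚP.0≤p⇒∣p∣≡p (Cauchy.0≤1/! k)) (abs-^ x k))

  0≤term : ∀ {x} → 0ℚ ℚ.≤ x → ∀ k → 0ℚ ℚ.≤ term x k
  0≤term 0≤x k = Cauchy.0≤* (Cauchy.0≤1/! k) (Cauchy.0≤^ k 0≤x)

  rectangle-cong : ∀ N M w {f f′ g g′ : ℕ → ℚ} → (∀ j → f j ≡ f′ j) → (∀ k → g k ≡ g′ k) → rectangle N M w f g ≡ rectangle N M w f′ g′
  rectangle-cong zero M w e e′ = refl
  rectangle-cong (suc N) M w e e′ = cong₂ ℚ._+_ (sumTo-cong M (λ k → cong (w k ℚ.*_) (cong₂ ℚ._*_ (e 0) (e′ k))))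
    (rectangle-cong N M (λ k → w (suc k)) (λ j → e (suc j)) e′)

  triangle-term : ∀ N w x y → triangle N w (term x) (term y) ≡ sumTo N (λ m → w m ℚ.* term (x ℚ.+ y) m)
  triangle-term N w x y = trans (triangle-convolution N w (term x) (term y)) (sumTo-cong N (λ m → cong (w m ℚ.*_) (binomial x y m)))

  triangle-cong : ∀ N w {f f′ g g′ : ℕ → ℚ} → (∀ j → f j ≡ f′ j) → (∀ k → g k ≡ g′ k) → triangle N w f g ≡ triangle N w f′ g′
  triangle-cong zero w e e′ = refl
  triangle-cong (suc N) w e e′ = cong₂ ℚ._+_ (sumTo-cong (suc N) (λ k → cong (w k ℚ.*_) (cong₂ ℚ._*_ (e 0) (e′ k))))
    (triangle-cong N (λ k → w (suc k)) (λ j → e (suc j)) e′)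

  exp-partial : ℚ → ℕ → ℚ
  exp-partial x N = sumTo N (λ m → 1ℚ ℚ.* term x m)

  -- The terms outside the triangle are bounded by those of the exponential series of
  -- `∣ x ∣ + ∣ y ∣` between `N` and `2 N`, and this tail tends to 0.
  product-error : ∀ N w → (∀ k → ℚ.∣ w k ∣ ℚ.≤ 1ℚ) → ∀ x y →
    ℚ.∣ rectangle N N w (term x) (term y) ℚ.- sumTo N (λ m → w m ℚ.* term (x ℚ.+ y) m) ∣
      ℚ.≤ exp-partial (ℚ.∣ x ∣ ℚ.+ ℚ.∣ y ∣) (N ℕ.+ N) ℚ.- exp-partial (ℚ.∣ x ∣ ℚ.+ ℚ.∣ y ∣) N
  product-error N w w≤1 x y = begin
    ℚ.∣ rectangle N N w (term x) (term y) ℚ.- sumTo N (λ m → w m ℚ.* term (x ℚ.+ y) m) ∣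
      ≡⟨ cong (λ z → ℚ.∣ rectangle N N w (term x) (term y) ℚ.- z ∣) (sym (triangle-term N w x y)) ⟩
    ℚ.∣ rectangle N N w (term x) (term y) ℚ.- triangle N w (term x) (term y) ∣
      ≤⟨ rectangle-triangle N N ℕP.≤-refl w (term x) (term y) w≤1 ⟩
    rectangle N N one (abs (term x)) (abs (term y)) ℚ.- triangle N one (abs (term x)) (abs (term y))
      ≡⟨ cong₂ ℚ._-_ (rectangle-cong N N one (abs-term x) (abs-term y)) (trans (triangle-cong N one (abs-term x) (abs-term y)) (triangle-term N one ℚ.∣ x ∣ ℚ.∣ y ∣)) ⟩
    rectangle N N one (term ℚ.∣ x ∣) (term ℚ.∣ y ∣) ℚ.- exp-partial (ℚ.∣ x ∣ ℚ.+ ℚ.∣ y ∣) N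
      ≤⟨ ℚP.+-monoˡ-≤ (ℚ.- exp-partial (ℚ.∣ x ∣ ℚ.+ ℚ.∣ y ∣) N) (rectangle-≤-triangle N N (N ℕ.+ N) ℕP.≤-refl (term ℚ.∣ x ∣) (term ℚ.∣ y ∣)
           (0≤term (ℚP.0≤∣p∣ x)) (0≤term (ℚP.0≤∣p∣ y))) ⟩
    triangle (N ℕ.+ N) one (term ℚ.∣ x ∣) (term ℚ.∣ y ∣) ℚ.- exp-partial (ℚ.∣ x ∣ ℚ.+ ℚ.∣ y ∣) N
      ≡⟨ cong (ℚ._- exp-partial (ℚ.∣ x ∣ ℚ.+ ℚ.∣ y ∣) N) (triangle-term (N ℕ.+ N) one ℚ.∣ x ∣ ℚ.∣ y ∣) ⟩
    exp-partial (ℚ.∣ x ∣ ℚ.+ ℚ.∣ y ∣) (N ℕ.+ N) ℚ.- exp-partial (ℚ.∣ x ∣ ℚ.+ ℚ.∣ y ∣) N ∎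
    where open ℚP.≤-Reasoning

  partialSum≡sumTo : ∀ c {d : ℕ → ℚ} → (∀ k → c k ≡ d k ℚ.* 1/! k) → ∀ q N → partialSum c N q ≡ sumTo N (λ k → d k ℚ.* term q k)
  partialSum≡sumTo c e q zero = refl
  partialSum≡sumTo c {d} e q (suc N) = cong₂ ℚ._+_ (partialSum≡sumTo c {d} e q N)
    (trans (cong (ℚ._* q ^ℚ N) (e N)) (ℚP.*-assoc (d N) (1/! N) (q ^ℚ N)))

  exp-tail : ∀ B (z : ℕ → ℚ) → (∀ n → ℚ.∣ z n ∣ ℚ.≤ fromℕℚ B) → Null (λ n → exp-partial (z n) (n ℕ.+ n) ℚ.- exp-partial (z n) n)
  exp-tail B z z≤ ε 0<ε = let (N , f) = t→0 (½ ℚ.* ε) (0<½* 0<ε) in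
    N ℕ.⊔ N₀ , λ n le → begin
      ℚ.∣ exp-partial (z n) (n ℕ.+ n) ℚ.- exp-partial (z n) n ∣
        ≡⟨ cong₂ (λ a b → ℚ.∣ a ℚ.- b ∣) (convert (z n) (n ℕ.+ n)) (convert (z n) n) ⟩
      ℚ.∣ partialSum 1/! (n ℕ.+ n) (z n) ℚ.- partialSum 1/! n (z n) ∣
        ≤⟨ sum-tail′ 1/! (λ k → ℚP.≤-reflexive (ℚP.0≤p⇒∣p∣≡p (Cauchy.0≤1/! k))) (z≤ n) (ℕP.m⊔n≤o⇒n≤o N N₀ le) (ℕP.m≤m+n n n) ⟩
      t n ℚ.+ t n
        ≤⟨ ℚP.+-mono-≤ (f n (ℕP.m⊔n≤o⇒m≤o N N₀ le)) (f n (ℕP.m⊔n≤o⇒m≤o N N₀ le)) ⟩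
      ½ ℚ.* ε ℚ.+ ½ ℚ.* ε
        ≡⟨ ½+½ ε ⟩
      ε ∎
    where
    open Cauchy.ExpTail B
    open ℚP.≤-Reasoning
    convert : ∀ q N → exp-partial q N ≡ partialSum 1/! N q
    convert q N = sym (partialSum≡sumTo 1/! {one} (λ k → sym (ℚP.*-identityˡ (1/! k))) q N)

  -- The common source of the addition laws of exponential, cosine and sine, which differ only in
  -- the choice of the weights.
  addition-formula : ∀ (x y : ℝ) (w u v u′ v′ : ℕ → ℚ) → (∀ k → ℚ.∣ w k ∣ ℚ.≤ 1ℚ) →
    (∀ j k → w (j ℕ.+ k) ≡ u j ℚ.* v k ℚ.+ u′ j ℚ.* v′ k) →
    Null (λ n → (sumTo n (λ k → u k ℚ.* term (seq x n) k) ℚ.* sumTo n (λ k → v k ℚ.* term (seq y n) k)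
               ℚ.+ sumTo n (λ k → u′ k ℚ.* term (seq x n) k) ℚ.* sumTo n (λ k → v′ k ℚ.* term (seq y n) k))
               ℚ.- sumTo n (λ k → w k ℚ.* term (seq x n ℚ.+ seq y n) k))
  addition-formula x y w u v u′ v′ w≤1 e ε 0<ε =
    let (N , f) = exp-tail (B₁ ℕ.+ B₂) (λ n → ℚ.∣ seq x n ∣ ℚ.+ ℚ.∣ seq y n ∣) bound ε 0<ε in
    N , λ n le → begin
      ℚ.∣ (U n ℚ.* V n ℚ.+ U′ n ℚ.* V′ n) ℚ.- W n ∣
        ≡⟨ cong (λ z → ℚ.∣ z ℚ.- W n ∣) (sym (rectangle-product n n w u v u′ v′ e (term (seq x n)) (term (seq y n)))) ⟩
      ℚ.∣ rectangle n n w (term (seq x n)) (term (seq y n)) ℚ.- W n ∣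
        ≤⟨ product-error n w w≤1 (seq x n) (seq y n) ⟩
      tail n
        ≤⟨ p≤∣p∣ (tail n) ⟩
      ℚ.∣ tail n ∣
        ≤⟨ f n le ⟩
      ε ∎
    where
    open ℚP.≤-Reasoning
    U V U′ V′ W tail : ℕ → ℚ
    U n  = sumTo n (λ k → u k ℚ.* term (seq x n) k)
    V n  = sumTo n (λ k → v k ℚ.* term (seq y n) k)
    U′ n = sumTo n (λ k → u′ k ℚ.* term (seq x n) k)
    V′ n = sumTo n (λ k → v′ k ℚ.* term (seq y n) k)
    W n  = sumTo n (λ k → w k ℚ.* term (seq x n ℚ.+ seq y n) k)
    tail n = exp-partial (ℚ.∣ seq x n ∣ ℚ.+ ℚ.∣ seq y n ∣) (n ℕ.+ n) ℚ.- exp-partial (ℚ.∣ seq x n ∣ ℚ.+ ℚ.∣ seq y n ∣) n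
    B₁ = proj₁ (Cauchy.bounded (seq x) (cauchy x))
    B₂ = proj₁ (Cauchy.bounded (seq y) (cauchy y))
    bound : ∀ n → ℚ.∣ ℚ.∣ seq x n ∣ ℚ.+ ℚ.∣ seq y n ∣ ∣ ℚ.≤ fromℕℚ (B₁ ℕ.+ B₂)
    bound n = begin
      ℚ.∣ ℚ.∣ seq x n ∣ ℚ.+ ℚ.∣ seq y n ∣ ∣    ≡⟨ ℚP.0≤p⇒∣p∣≡p (Cauchy.0≤+ (ℚP.0≤∣p∣ (seq x n)) (ℚP.0≤∣p∣ (seq y n))) ⟩
      ℚ.∣ seq x n ∣ ℚ.+ ℚ.∣ seq y n ∣          ≤⟨ ℚP.+-mono-≤ (proj₂ (Cauchy.bounded (seq x) (cauchy x)) n) (proj₂ (Cauchy.bounded (seq y) (cauchy y)) n) ⟩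
      fromℕℚ B₁ ℚ.+ fromℕℚ B₂                  ≡⟨ sym (fromℕℚ-+ B₁ B₂) ⟩
      fromℕℚ (B₁ ℕ.+ B₂)                       ∎

-- Exponential, cosine and sine: addition laws, parity and values at 0.

module Trigonometry where

  open Sums
  open Reals
  open ExponentialSeries

  cos-suc : ∀ k → cos⁽ suc k ⁾ ≡ ℚ.- sin⁽ k ⁾
  cos-suc zero          = refl
  cos-suc (suc zero)    = refl
  cos-suc (suc (suc k)) = cong ℚ.-_ (cos-suc k)

  sin-suc : ∀ k → sin⁽ suc k ⁾ ≡ cos⁽ k ⁾
  sin-suc zero          = refl
  sin-suc (suc zero)    = refl
  sin-suc (suc (suc k)) = cong ℚ.-_ (sin-suc k)

  cos⁽+⁾ : ∀ j k → cos⁽ j ℕ.+ k ⁾ ≡ cos⁽ j ⁾ ℚ.* cos⁽ k ⁾ ℚ.+ sin⁽ j ⁾ ℚ.* (ℚ.- sin⁽ k ⁾)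
  cos⁽+⁾ zero k = QS.solve 2 (λ c s → c QS.:= QS.con (+ 1) QS.:* c QS.:+ QS.con (+ 0) QS.:* (QS.:- s)) refl cos⁽ k ⁾ sin⁽ k ⁾
  cos⁽+⁾ (suc zero) k = trans (cos-suc k)
    (QS.solve 2 (λ c s → QS.:- s QS.:= QS.con (+ 0) QS.:* c QS.:+ QS.con (+ 1) QS.:* (QS.:- s)) refl cos⁽ k ⁾ sin⁽ k ⁾)
  cos⁽+⁾ (suc (suc j)) k = trans (cong ℚ.-_ (cos⁽+⁾ j k))
    (QS.solve 4 (λ c s c′ s′ → QS.:- (c QS.:* c′ QS.:+ s QS.:* (QS.:- s′)) QS.:= (QS.:- c) QS.:* c′ QS.:+ (QS.:- s) QS.:* (QS.:- s′)) refl
      cos⁽ j ⁾ sin⁽ j ⁾ cos⁽ k ⁾ sin⁽ k ⁾)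

  sin⁽+⁾ : ∀ j k → sin⁽ j ℕ.+ k ⁾ ≡ sin⁽ j ⁾ ℚ.* cos⁽ k ⁾ ℚ.+ cos⁽ j ⁾ ℚ.* sin⁽ k ⁾
  sin⁽+⁾ zero k = QS.solve 2 (λ c s → s QS.:= QS.con (+ 0) QS.:* c QS.:+ QS.con (+ 1) QS.:* s) refl cos⁽ k ⁾ sin⁽ k ⁾
  sin⁽+⁾ (suc zero) k = trans (sin-suc k)
    (QS.solve 2 (λ c s → c QS.:= QS.con (+ 1) QS.:* c QS.:+ QS.con (+ 0) QS.:* s) refl cos⁽ k ⁾ sin⁽ k ⁾)
  sin⁽+⁾ (suc (suc j)) k = trans (cong ℚ.-_ (sin⁽+⁾ j k))
    (QS.solve 4 (λ c s c′ s′ → QS.:- (s QS.:* c′ QS.:+ c QS.:* s′) QS.:= (QS.:- s) QS.:* c′ QS.:+ (QS.:- c) QS.:* s′) refl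
      cos⁽ j ⁾ sin⁽ j ⁾ cos⁽ k ⁾ sin⁽ k ⁾)

  series : (ℕ → ℚ) → ℚ → ℕ → ℚ
  series d q N = sumTo N (λ k → d k ℚ.* term q k)

  series-neg : ∀ d q N → series (λ k → ℚ.- d k) q N ≡ ℚ.- series d q N
  series-neg d q N = trans (sumTo-cong N (λ k → QS.solve 2 (λ d t → (QS.:- d) QS.:* t QS.:= (QS.:- QS.con (+ 1)) QS.:* (d QS.:* t)) refl (d k) (term q k)))
    (trans (sumTo-* (ℚ.- 1ℚ) (λ k → d k ℚ.* term q k) N)
      (QS.solve 1 (λ x → (QS.:- QS.con (+ 1)) QS.:* x QS.:= QS.:- x) refl (series d q N)))

  ^ℚ-neg² : ∀ q k → (ℚ.- q) ℚ.* ((ℚ.- q) ℚ.* (ℚ.- q) ^ℚ k) ≡ q ℚ.* (q ℚ.* (ℚ.- q) ^ℚ k)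
  ^ℚ-neg² q k = QS.solve 2 (λ q x → (QS.:- q) QS.:* ((QS.:- q) QS.:* x) QS.:= q QS.:* (q QS.:* x)) refl q ((ℚ.- q) ^ℚ k)

  -- Induction in steps of two: the odd coefficients of the cosine vanish, and a pair of factors
  -- `- q` equals a pair of factors `q`.
  cos-even : ∀ q k → cos⁽ k ⁾ ℚ.* (ℚ.- q) ^ℚ k ≡ cos⁽ k ⁾ ℚ.* q ^ℚ k
  cos-even q zero = refl
  cos-even q (suc zero) = trans (ℚP.*-zeroˡ ((ℚ.- q) ^ℚ 1)) (sym (ℚP.*-zeroˡ (q ^ℚ 1)))
  cos-even q (suc (suc k)) = trans (cong (ℚ.- cos⁽ k ⁾ ℚ.*_) (^ℚ-neg² q k))
    (trans (QS.solve 3 (λ c q x → (QS.:- c) QS.:* (q QS.:* (q QS.:* x)) QS.:= (QS.:- (q QS.:* q)) QS.:* (c QS.:* x)) refl cos⁽ k ⁾ q ((ℚ.- q) ^ℚ k))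
    (trans (cong ((ℚ.- (q ℚ.* q)) ℚ.*_) (cos-even q k))
    (QS.solve 3 (λ c q x → (QS.:- (q QS.:* q)) QS.:* (c QS.:* x) QS.:= (QS.:- c) QS.:* (q QS.:* (q QS.:* x))) refl cos⁽ k ⁾ q (q ^ℚ k))))

  sin-odd : ∀ q k → sin⁽ k ⁾ ℚ.* (ℚ.- q) ^ℚ k ≡ (ℚ.- sin⁽ k ⁾) ℚ.* q ^ℚ k
  sin-odd q zero = refl
  sin-odd q (suc zero) = QS.solve 1 (λ q → QS.con (+ 1) QS.:* ((QS.:- q) QS.:* QS.con (+ 1)) QS.:= (QS.:- QS.con (+ 1)) QS.:* (q QS.:* QS.con (+ 1))) refl q
  sin-odd q (suc (suc k)) = trans (cong (ℚ.- sin⁽ k ⁾ ℚ.*_) (^ℚ-neg² q k))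
    (trans (QS.solve 3 (λ c q x → (QS.:- c) QS.:* (q QS.:* (q QS.:* x)) QS.:= (QS.:- (q QS.:* q)) QS.:* (c QS.:* x)) refl sin⁽ k ⁾ q ((ℚ.- q) ^ℚ k))
    (trans (cong ((ℚ.- (q ℚ.* q)) ℚ.*_) (sin-odd q k))
    (QS.solve 3 (λ c q x → (QS.:- (q QS.:* q)) QS.:* ((QS.:- c) QS.:* x) QS.:= (QS.:- (QS.:- c)) QS.:* (q QS.:* (q QS.:* x))) refl sin⁽ k ⁾ q (q ^ℚ k))))

  swap-factor : ∀ a b c → a ℚ.* (b ℚ.* c) ≡ b ℚ.* (a ℚ.* c)
  swap-factor = QS.solve 3 (λ a b c → a QS.:* (b QS.:* c) QS.:= b QS.:* (a QS.:* c)) refl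

  series-cos-neg : ∀ q N → series cos⁽_⁾ (ℚ.- q) N ≡ series cos⁽_⁾ q N
  series-cos-neg q N = sumTo-cong N (λ k → trans (swap-factor cos⁽ k ⁾ (1/! k) ((ℚ.- q) ^ℚ k))
    (trans (cong (1/! k ℚ.*_) (cos-even q k)) (sym (swap-factor cos⁽ k ⁾ (1/! k) (q ^ℚ k)))))

  series-sin-neg : ∀ q N → series sin⁽_⁾ (ℚ.- q) N ≡ ℚ.- series sin⁽_⁾ q N
  series-sin-neg q N = trans (sumTo-cong N (λ k → trans (swap-factor sin⁽ k ⁾ (1/! k) ((ℚ.- q) ^ℚ k))
    (trans (cong (1/! k ℚ.*_) (sin-odd q k)) (sym (swap-factor (ℚ.- sin⁽ k ⁾) (1/! k) (q ^ℚ k)))))) (series-neg sin⁽_⁾ q N)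

  series-0 : ∀ d N → series d 0ℚ (suc N) ≡ d 0
  series-0 d zero    = QS.solve 1 (λ d → QS.con (+ 0) QS.:+ d QS.:* (QS.con (+ 1) QS.:* QS.con (+ 1)) QS.:= d) refl (d 0)
  series-0 d (suc N) = trans (cong₂ ℚ._+_ (series-0 d N) (trans (cong (d (suc N) ℚ.*_) (trans (cong (1/! (suc N) ℚ.*_) (ℚP.*-zeroˡ (0ℚ ^ℚ N))) (ℚP.*-zeroʳ (1/! (suc N))))) (ℚP.*-zeroʳ (d (suc N)))))
    (ℚP.+-identityʳ (d 0))

  opaque

    expʳ cosʳ sinʳ : ℝ → ℝ
    expʳ = exp
    cosʳ = cos
    sinʳ = sin

  opaque
    unfolding expʳ cosʳ sinʳ

    sinʳ≡ : ∀ x → sinʳ x ≡ sin x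
    sinʳ≡ x = refl

    seq-exp : ∀ x n → seq (expʳ x) n ≡ series one (seq x n) n
    seq-exp x n = partialSum≡sumTo _ {one} (λ k → refl) (seq x n) n

    seq-cos : ∀ x n → seq (cosʳ x) n ≡ series cos⁽_⁾ (seq x n) n
    seq-cos x n = partialSum≡sumTo _ {cos⁽_⁾} (λ k → refl) (seq x n) n

    seq-sin : ∀ x n → seq (sinʳ x) n ≡ series sin⁽_⁾ (seq x n) n
    seq-sin x n = partialSum≡sumTo _ {sin⁽_⁾} (λ k → refl) (seq x n) n

  opaque
    unfolding _+ʳ_ _*ʳ_ -ʳ_ rat

    seq-+ : ∀ x y n → seq (x +ʳ y) n ≡ seq x n ℚ.+ seq y n
    seq-+ x y n = refl

    seq-* : ∀ x y n → seq (x *ʳ y) n ≡ seq x n ℚ.* seq y n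
    seq-* x y n = refl

    seq-neg : ∀ x n → seq (-ʳ x) n ≡ ℚ.- seq x n
    seq-neg x n = refl

    seq-rat : ∀ q n → seq (rat q) n ≡ q
    seq-rat q n = refl

  exp-+ : ∀ x y → expʳ x *ʳ expʳ y ≋ expʳ (x +ʳ y)
  exp-+ x y = equal (Null-cong (λ n → cong₂ ℚ._-_ (lhs n) (sym (trans (seq-exp (x +ʳ y) n) (cong (λ q → series one q n) (seq-+ x y n)))))
    (addition-formula x y one one one (λ _ → 0ℚ) (λ _ → 0ℚ) (λ k → ℚP.≤-refl) (λ j k → refl)))
    where
    zeros : ∀ q N → series (λ _ → 0ℚ) q N ≡ 0ℚ
    zeros q zero    = refl
    zeros q (suc N) = cong₂ ℚ._+_ (zeros q N) (ℚP.*-zeroˡ (term q N))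
    lhs : ∀ n → series one (seq x n) n ℚ.* series one (seq y n) n ℚ.+ series (λ _ → 0ℚ) (seq x n) n ℚ.* series (λ _ → 0ℚ) (seq y n) n
      ≡ seq (expʳ x *ʳ expʳ y) n
    lhs n = trans (cong (series one (seq x n) n ℚ.* series one (seq y n) n ℚ.+_) (cong₂ ℚ._*_ (zeros (seq x n) n) (zeros (seq y n) n)))
      (trans (ℚP.+-identityʳ _) (trans (sym (cong₂ ℚ._*_ (seq-exp x n) (seq-exp y n))) (sym (seq-* (expʳ x) (expʳ y) n))))

  cos-+ : ∀ x y → cosʳ x *ʳ cosʳ y -ʳ sinʳ x *ʳ sinʳ y ≋ cosʳ (x +ʳ y)
  cos-+ x y = equal (Null-cong (λ n → cong₂ ℚ._-_ (lhs n) (sym (trans (seq-cos (x +ʳ y) n) (cong (λ q → series cos⁽_⁾ q n) (seq-+ x y n)))))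
    (addition-formula x y cos⁽_⁾ cos⁽_⁾ cos⁽_⁾ sin⁽_⁾ (λ k → ℚ.- sin⁽ k ⁾) ∣cos⁽_⁾∣≤1 cos⁽+⁾))
    where
    lhs : ∀ n → series cos⁽_⁾ (seq x n) n ℚ.* series cos⁽_⁾ (seq y n) n ℚ.+ series sin⁽_⁾ (seq x n) n ℚ.* series (λ k → ℚ.- sin⁽ k ⁾) (seq y n) n
      ≡ seq (cosʳ x *ʳ cosʳ y -ʳ sinʳ x *ʳ sinʳ y) n
    lhs n = trans (cong (λ z → series cos⁽_⁾ (seq x n) n ℚ.* series cos⁽_⁾ (seq y n) n ℚ.+ series sin⁽_⁾ (seq x n) n ℚ.* z) (series-neg sin⁽_⁾ (seq y n) n))
      (trans (QS.solve 4 (λ a b c d → a QS.:* b QS.:+ c QS.:* (QS.:- d) QS.:= a QS.:* b QS.:- c QS.:* d) refl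
        (series cos⁽_⁾ (seq x n) n) (series cos⁽_⁾ (seq y n) n) (series sin⁽_⁾ (seq x n) n) (series sin⁽_⁾ (seq y n) n))
      (trans (sym (cong₂ ℚ._-_ (trans (seq-* (cosʳ x) (cosʳ y) n) (cong₂ ℚ._*_ (seq-cos x n) (seq-cos y n)))
                               (trans (seq-* (sinʳ x) (sinʳ y) n) (cong₂ ℚ._*_ (seq-sin x n) (seq-sin y n)))))
        (sym (trans (seq-+ (cosʳ x *ʳ cosʳ y) (-ʳ (sinʳ x *ʳ sinʳ y)) n) (cong (seq (cosʳ x *ʳ cosʳ y) n ℚ.+_) (seq-neg (sinʳ x *ʳ sinʳ y) n))))))

  sin-+ : ∀ x y → sinʳ x *ʳ cosʳ y +ʳ cosʳ x *ʳ sinʳ y ≋ sinʳ (x +ʳ y)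
  sin-+ x y = equal (Null-cong (λ n → cong₂ ℚ._-_ (lhs n) (sym (trans (seq-sin (x +ʳ y) n) (cong (λ q → series sin⁽_⁾ q n) (seq-+ x y n)))))
    (addition-formula x y sin⁽_⁾ sin⁽_⁾ cos⁽_⁾ cos⁽_⁾ sin⁽_⁾ ∣sin⁽_⁾∣≤1 sin⁽+⁾))
    where
    lhs : ∀ n → series sin⁽_⁾ (seq x n) n ℚ.* series cos⁽_⁾ (seq y n) n ℚ.+ series cos⁽_⁾ (seq x n) n ℚ.* series sin⁽_⁾ (seq y n) n
      ≡ seq (sinʳ x *ʳ cosʳ y +ʳ cosʳ x *ʳ sinʳ y) n
    lhs n = trans (sym (cong₂ ℚ._+_ (trans (seq-* (sinʳ x) (cosʳ y) n) (cong₂ ℚ._*_ (seq-sin x n) (seq-cos y n)))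
                                    (trans (seq-* (cosʳ x) (sinʳ y) n) (cong₂ ℚ._*_ (seq-cos x n) (seq-sin y n)))))
      (sym (seq-+ (sinʳ x *ʳ cosʳ y) (cosʳ x *ʳ sinʳ y) n))

  -- Congruence is claimed here and in the next two lemmas only for equal approximating sequences,
  -- which spares a proof of continuity. The arguments rewritten later, such as `x + - x` or
  -- multiples of an angle, do agree in this strong sense.
  exp-pointwise : ∀ {x y} → (∀ n → seq x n ≡ seq y n) → expʳ x ≋ expʳ y
  exp-pointwise {x} {y} e = pointwise λ n → trans (seq-exp x n) (trans (cong (λ q → series one q n) (e n)) (sym (seq-exp y n)))

  cos-pointwise : ∀ {x y} → (∀ n → seq x n ≡ seq y n) → cosʳ x ≋ cosʳ y
  cos-pointwise {x} {y} e = pointwise λ n → trans (seq-cos x n) (trans (cong (λ q → series cos⁽_⁾ q n) (e n)) (sym (seq-cos y n)))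

  sin-pointwise : ∀ {x y} → (∀ n → seq x n ≡ seq y n) → sinʳ x ≋ sinʳ y
  sin-pointwise {x} {y} e = pointwise λ n → trans (seq-sin x n) (trans (cong (λ q → series sin⁽_⁾ q n) (e n)) (sym (seq-sin y n)))

  cos-neg : ∀ x → cosʳ (-ʳ x) ≋ cosʳ x
  cos-neg x = pointwise λ n → trans (seq-cos (-ʳ x) n) (trans (cong (λ q → series cos⁽_⁾ q n) (seq-neg x n))
    (trans (series-cos-neg (seq x n) n) (sym (seq-cos x n))))

  sin-neg : ∀ x → sinʳ (-ʳ x) ≋ -ʳ sinʳ x
  sin-neg x = pointwise λ n → trans (seq-sin (-ʳ x) n) (trans (cong (λ q → series sin⁽_⁾ q n) (seq-neg x n))
    (trans (series-sin-neg (seq x n) n) (trans (cong ℚ.-_ (sym (seq-sin x n))) (sym (seq-neg (sinʳ x) n)))))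

  -- Index 0 is left out because the empty partial sum of a series is 0, not its constant term.
  eventually-equal : ∀ {x y} → (∀ n → seq x (suc n) ≡ seq y (suc n)) → x ≋ y
  eventually-equal {x} {y} e = equal λ ε 0<ε → 1 , λ { (suc n) _ →
    subst (λ z → ℚ.∣ z ∣ ℚ.≤ ε) (sym (trans (cong (ℚ._- seq y (suc n)) (e n)) (ℚP.+-inverseʳ (seq y (suc n))))) (ℚP.<⇒≤ 0<ε) }

  exp-0 : expʳ 0ʳ ≋ 1ʳ
  exp-0 = eventually-equal λ n → trans (seq-exp 0ʳ (suc n)) (trans (cong (λ q → series one q (suc n)) (seq-rat 0ℚ (suc n))) (trans (series-0 one n) (sym (seq-rat 1ℚ (suc n)))))

  cos-0 : cosʳ 0ʳ ≋ 1ʳ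
  cos-0 = eventually-equal λ n → trans (seq-cos 0ʳ (suc n)) (trans (cong (λ q → series cos⁽_⁾ q (suc n)) (seq-rat 0ℚ (suc n))) (trans (series-0 cos⁽_⁾ n) (sym (seq-rat 1ℚ (suc n)))))

  sin-0 : sinʳ 0ʳ ≋ 0ʳ
  sin-0 = eventually-equal λ n → trans (seq-sin 0ʳ (suc n)) (trans (cong (λ q → series sin⁽_⁾ q (suc n)) (seq-rat 0ℚ (suc n))) (trans (series-0 sin⁽_⁾ n) (sym (seq-rat 0ℚ (suc n)))))

  x-x : ∀ x n → seq (x +ʳ -ʳ x) n ≡ seq 0ʳ n
  x-x x n = trans (seq-+ x (-ʳ x) n) (trans (cong (seq x n ℚ.+_) (seq-neg x n)) (trans (ℚP.+-inverseʳ (seq x n)) (sym (seq-rat 0ℚ n))))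

  exp-inverse : ∀ x → expʳ x *ʳ expʳ (-ʳ x) ≋ 1ʳ
  exp-inverse x = ≋-trans (exp-+ x (-ʳ x)) (≋-trans (exp-pointwise {x +ʳ -ʳ x} {0ʳ} (x-x x)) exp-0)

  -- The addition law of the cosine at `x + - x`.
  pythagoras : ∀ x → cosʳ x *ʳ cosʳ x +ʳ sinʳ x *ʳ sinʳ x ≋ 1ʳ
  pythagoras x = ≋-trans (RS.solve 2 (λ c s → c RS.:* c RS.:+ s RS.:* s RS.:= c RS.:* c RS.:- s RS.:* (RS.:- s)) ≋-refl (cosʳ x) (sinʳ x))
    (≋-trans (+ʳ-cong (*ʳ-cong ≋-refl (≋-sym (cos-neg x))) (-ʳ-cong (*ʳ-cong ≋-refl (≋-sym (sin-neg x)))))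
    (≋-trans (cos-+ x (-ʳ x)) (≋-trans (cos-pointwise {x +ʳ -ʳ x} {0ʳ} (x-x x)) cos-0)))

-- From powers of 2 below a power of the exponential to bounds on its argument.

module Logarithm where

  open Sums
  open Reals
  open ExponentialSeries
  open Trigonometry

  open ℚP.≤-Reasoning

  ^ℚ-mono : ∀ {a b} k → 0ℚ ℚ.≤ a → a ℚ.≤ b → a ^ℚ k ℚ.≤ b ^ℚ k
  ^ℚ-mono zero    0≤a a≤b = ℚP.≤-refl
  ^ℚ-mono (suc k) 0≤a a≤b = Cauchy.*-mono 0≤a (Cauchy.0≤^ k (ℚP.≤-trans 0≤a a≤b)) a≤b (^ℚ-mono k 0≤a a≤b)

  ^ℚ-* : ∀ a b k → (a ℚ.* b) ^ℚ k ≡ a ^ℚ k ℚ.* b ^ℚ k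
  ^ℚ-* a b zero    = refl
  ^ℚ-* a b (suc k) = trans (cong ((a ℚ.* b) ℚ.*_) (^ℚ-* a b k))
    (QS.solve 4 (λ a b x y → (a QS.:* b) QS.:* (x QS.:* y) QS.:= (a QS.:* x) QS.:* (b QS.:* y)) refl a b (a ^ℚ k) (b ^ℚ k))

  ^ℚ-swap : ∀ a m k → (a ^ℚ m) ^ℚ k ≡ (a ^ℚ k) ^ℚ m
  ^ℚ-swap a zero    k = ones k
    where
    ones : ∀ k → 1ℚ ^ℚ k ≡ 1ℚ
    ones zero    = refl
    ones (suc k) = trans (ℚP.*-identityˡ (1ℚ ^ℚ k)) (ones k)
  ^ℚ-swap a (suc m) k = trans (^ℚ-* a (a ^ℚ m) k) (cong (a ^ℚ k ℚ.*_) (^ℚ-swap a m k))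

  ^ℚ-abs : ∀ a k → a ^ℚ k ℚ.≤ ℚ.∣ a ∣ ^ℚ k
  ^ℚ-abs a k = ℚP.≤-trans (p≤∣p∣ (a ^ℚ k)) (ℚP.≤-reflexive (abs-^ a k))

  1≤^ℚ : ∀ {b} → 1ℚ ℚ.≤ b → ∀ k → 1ℚ ℚ.≤ b ^ℚ k
  1≤^ℚ 1≤b zero    = ℚP.≤-refl
  1≤^ℚ {b} 1≤b (suc k) = ℚP.≤-trans (ℚP.≤-reflexive refl) (Cauchy.*-mono Cauchy.0≤1 (Cauchy.0≤^ k (ℚP.≤-trans Cauchy.0≤1 1≤b)) 1≤b (1≤^ℚ 1≤b k))

  -- Induction with `(1 + a) (1 - (k + 1) a) = 1 - k a - (k + 1) a²`. In this multiplied form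
  -- Bernoulli's inequality bounds a power from above.
  bernoulli : ∀ {a} → 0ℚ ℚ.≤ a → ∀ k → (1ℚ ℚ.+ a) ^ℚ k ℚ.* (1ℚ ℚ.- fromℕℚ k ℚ.* a) ℚ.≤ 1ℚ
  bernoulli {a} 0≤a zero = ℚP.≤-reflexive (QS.solve 1 (λ a → QS.con (+ 1) QS.:* (QS.con (+ 1) QS.:- QS.con (+ 0) QS.:* a) QS.:= QS.con (+ 1)) refl a)
  bernoulli {a} 0≤a (suc k) = begin
    (1ℚ ℚ.+ a) ℚ.* P ℚ.* (1ℚ ℚ.- fromℕℚ (suc k) ℚ.* a)
      ≡⟨ cong (λ n → (1ℚ ℚ.+ a) ℚ.* P ℚ.* (1ℚ ℚ.- n ℚ.* a)) (Cauchy.fromℕℚ-suc k) ⟩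
    (1ℚ ℚ.+ a) ℚ.* P ℚ.* (1ℚ ℚ.- (K ℚ.+ 1ℚ) ℚ.* a)
      ≤⟨ Cauchy.≤-+ʳ ℚP.≤-refl (Cauchy.0≤* (Cauchy.0≤^ k 0≤1+a) (Cauchy.0≤* (Cauchy.0≤+ (Cauchy.0≤fromℕℚ k) Cauchy.0≤1) (Cauchy.0≤* 0≤a 0≤a))) ⟩
    (1ℚ ℚ.+ a) ℚ.* P ℚ.* (1ℚ ℚ.- (K ℚ.+ 1ℚ) ℚ.* a) ℚ.+ P ℚ.* ((K ℚ.+ 1ℚ) ℚ.* (a ℚ.* a))
      ≡⟨ QS.solve 3 (λ a P K → (QS.con (+ 1) QS.:+ a) QS.:* P QS.:* (QS.con (+ 1) QS.:- (K QS.:+ QS.con (+ 1)) QS.:* a) QS.:+ P QS.:* ((K QS.:+ QS.con (+ 1)) QS.:* (a QS.:* a))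
           QS.:= P QS.:* (QS.con (+ 1) QS.:- K QS.:* a)) refl a P K ⟩
    P ℚ.* (1ℚ ℚ.- K ℚ.* a)
      ≤⟨ bernoulli 0≤a k ⟩
    1ℚ ∎
    where
    P = (1ℚ ℚ.+ a) ^ℚ k
    K = fromℕℚ k
    0≤1+a : 0ℚ ℚ.≤ 1ℚ ℚ.+ a
    0≤1+a = Cauchy.0≤+ Cauchy.0≤1 0≤a

  -- The partial sum at `x + y` is a triangle sum, the product of partial sums is the surrounding
  -- rectangle, and all terms are nonnegative.
  series-+-≤ : ∀ {x y} → 0ℚ ℚ.≤ x → 0ℚ ℚ.≤ y → ∀ N → series one (x ℚ.+ y) N ℚ.≤ series one x N ℚ.* series one y N
  series-+-≤ {x} {y} 0≤x 0≤y N = begin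
    series one (x ℚ.+ y) N                          ≡⟨ sym (triangle-term N one x y) ⟩
    triangle N one (term x) (term y)                ≡⟨ sym (triangle-cong N one (abs-id 0≤x) (abs-id 0≤y)) ⟩
    T                                               ≡⟨ QS.solve 2 (λ T R → T QS.:= R QS.:- (R QS.:- T)) refl T R ⟩
    R ℚ.- (R ℚ.- T)                                 ≤⟨ ℚP.+-monoʳ-≤ R (ℚP.neg-antimono-≤ (ℚP.≤-trans (ℚP.0≤∣p∣ _) (rectangle-triangle N N ℕP.≤-refl one (term x) (term y) (λ k → ℚP.≤-refl)))) ⟩
    R ℚ.- 0ℚ                                        ≡⟨ ℚP.+-identityʳ R ⟩
    R                                               ≡⟨ rectangle-cong N N one (abs-id 0≤x) (abs-id 0≤y) ⟩
    rectangle N N one (term x) (term y)             ≡⟨ rectangle-product N N one one one (λ _ → 0ℚ) (λ _ → 0ℚ) (λ j k → refl) (term x) (term y) ⟩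
    series one x N ℚ.* series one y N ℚ.+ series (λ _ → 0ℚ) x N ℚ.* series (λ _ → 0ℚ) y N
      ≡⟨ cong (series one x N ℚ.* series one y N ℚ.+_) (trans (cong (ℚ._* series (λ _ → 0ℚ) y N) (zeros N)) (ℚP.*-zeroˡ (series (λ _ → 0ℚ) y N))) ⟩
    series one x N ℚ.* series one y N ℚ.+ 0ℚ        ≡⟨ ℚP.+-identityʳ _ ⟩
    series one x N ℚ.* series one y N               ∎
    where
    T = triangle N one (abs (term x)) (abs (term y))
    R = rectangle N N one (abs (term x)) (abs (term y))
    abs-id : ∀ {x} → 0ℚ ℚ.≤ x → ∀ j → abs (term x) j ≡ term x j
    abs-id {x} 0≤x j = ℚP.0≤p⇒∣p∣≡p (0≤term 0≤x j)
    zeros : ∀ N → series (λ _ → 0ℚ) x N ≡ 0ℚ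
    zeros zero    = refl
    zeros (suc N) = cong₂ ℚ._+_ (zeros N) (ℚP.*-zeroˡ (term x N))

  series-mono : ∀ {x y} → 0ℚ ℚ.≤ x → x ℚ.≤ y → ∀ N → series one x N ℚ.≤ series one y N
  series-mono 0≤x x≤y zero    = ℚP.≤-refl
  series-mono 0≤x x≤y (suc N) = ℚP.+-mono-≤ (series-mono 0≤x x≤y N)
    (Cauchy.*-monoˡ Cauchy.0≤1 (Cauchy.*-monoˡ (Cauchy.0≤1/! N) (^ℚ-mono N 0≤x x≤y)))

  0≤one-term : ∀ {x} → 0ℚ ℚ.≤ x → ∀ k → 0ℚ ℚ.≤ 1ℚ ℚ.* term x k
  0≤one-term 0≤x k = Cauchy.0≤* Cauchy.0≤1 (0≤term 0≤x k)

  0≤series : ∀ {x} → 0ℚ ℚ.≤ x → ∀ N → 0ℚ ℚ.≤ series one x N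
  0≤series 0≤x zero    = ℚP.≤-refl
  0≤series 0≤x (suc N) = Cauchy.0≤+ (0≤series 0≤x N) (0≤one-term 0≤x N)

  1≤series : ∀ {x} → 0ℚ ℚ.≤ x → ∀ N → 1ℚ ℚ.≤ series one x (suc N)
  1≤series 0≤x zero    = ℚP.≤-refl
  1≤series 0≤x (suc N) = Cauchy.≤-+ʳ (1≤series 0≤x N) (0≤one-term 0≤x (suc N))

  series-small : ∀ {y} → 0ℚ ℚ.≤ y → y ℚ.≤ ½ → ∀ N → series one y N ℚ.≤ 1ℚ ℚ.+ (y ℚ.+ y)
  series-small {y} 0≤y y≤½ zero = Cauchy.0≤+ Cauchy.0≤1 (Cauchy.0≤+ 0≤y 0≤y)
  series-small {y} 0≤y y≤½ (suc N) = ℚP.≤-trans (Cauchy.≤-+ʳ ℚP.≤-refl (Cauchy.0≤+ (0≤term 0≤y (suc N)) (0≤term 0≤y (suc N)))) (decreasing N)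
    where
    -- Since `y ≤ ½`, each term from the constant one onwards is at least twice its successor. Hence
    -- the partial sum plus twice the next term decreases from `N = 1` on, where it is `1 + 2 y`.
    φ : ℕ → ℚ
    φ N = series one y N ℚ.+ (term y N ℚ.+ term y N)
    inv≤1 : ∀ k → + 1 / suc k ℚ.≤ 1ℚ
    inv≤1 k = begin
      + 1 / suc k                            ≡⟨ sym (ℚP.*-identityˡ _) ⟩
      fromℕℚ 1 ℚ.* (+ 1 / suc k)             ≤⟨ Cauchy.*-monoʳ (Cauchy.0≤inv k) (Cauchy.fromℕℚ-mono {1} {suc k} (ℕ.s≤s ℕ.z≤n)) ⟩
      fromℕℚ (suc k) ℚ.* (+ 1 / suc k)       ≡⟨ Cauchy.fromℕℚ-inverse k ⟩
      1ℚ                                     ∎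
    half : ∀ k → term y (suc k) ℚ.+ term y (suc k) ℚ.≤ term y k
    half k = begin
      term y (suc k) ℚ.+ term y (suc k)
        ≡⟨ QS.solve 4 (λ f i y p → (f QS.:* i) QS.:* (y QS.:* p) QS.:+ (f QS.:* i) QS.:* (y QS.:* p) QS.:= (f QS.:* p) QS.:* (i QS.:* (y QS.:+ y))) refl
             (1/! k) (+ 1 / suc k) y (y ^ℚ k) ⟩
      term y k ℚ.* ((+ 1 / suc k) ℚ.* (y ℚ.+ y))
        ≤⟨ Cauchy.*-monoˡ (0≤term 0≤y k) (Cauchy.*-mono (Cauchy.0≤inv k) Cauchy.0≤1 (inv≤1 k) (ℚP.+-mono-≤ y≤½ y≤½)) ⟩
      term y k ℚ.* (1ℚ ℚ.* 1ℚ)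
        ≡⟨ ℚP.*-identityʳ (term y k) ⟩
      term y k ∎
    decreasing : ∀ N → φ (suc N) ℚ.≤ 1ℚ ℚ.+ (y ℚ.+ y)
    decreasing zero = ℚP.≤-reflexive (QS.solve 1 (λ y → QS.con (+ 0) QS.:+ QS.con (+ 1) QS.:* (QS.con (+ 1) QS.:* QS.con (+ 1)) QS.:+ ((QS.con (+ 1) QS.:* QS.con (+ 1)) QS.:* (y QS.:* QS.con (+ 1)) QS.:+ (QS.con (+ 1) QS.:* QS.con (+ 1)) QS.:* (y QS.:* QS.con (+ 1)))
      QS.:= QS.con (+ 1) QS.:+ (y QS.:+ y)) refl y)
    decreasing (suc N) = ℚP.≤-trans (begin
      series one y (suc N) ℚ.+ 1ℚ ℚ.* term y (suc N) ℚ.+ (term y (suc (suc N)) ℚ.+ term y (suc (suc N)))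
        ≤⟨ ℚP.+-monoʳ-≤ (series one y (suc N) ℚ.+ 1ℚ ℚ.* term y (suc N)) (half (suc N)) ⟩
      series one y (suc N) ℚ.+ 1ℚ ℚ.* term y (suc N) ℚ.+ term y (suc N)
        ≡⟨ QS.solve 2 (λ s t → s QS.:+ QS.con (+ 1) QS.:* t QS.:+ t QS.:= s QS.:+ (t QS.:+ t)) refl (series one y (suc N)) (term y (suc N)) ⟩
      φ (suc N) ∎) (decreasing N)

  series-multiple : ∀ {y} → 0ℚ ℚ.≤ y → y ℚ.≤ ½ → ∀ m N → series one (fromℕℚ m ℚ.* y) N ℚ.≤ (1ℚ ℚ.+ (y ℚ.+ y)) ^ℚ m
  series-multiple {y} 0≤y y≤½ zero N = ℚP.≤-trans (ℚP.≤-reflexive (cong (λ q → series one q N) (ℚP.*-zeroˡ y))) (at-0 N)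
    where
    at-0 : ∀ N → series one 0ℚ N ℚ.≤ 1ℚ
    at-0 zero    = Cauchy.0≤1
    at-0 (suc N) = ℚP.≤-reflexive (series-0 one N)
  series-multiple {y} 0≤y y≤½ (suc m) N = begin
    series one (fromℕℚ (suc m) ℚ.* y) N
      ≡⟨ cong (λ q → series one q N) (trans (cong (ℚ._* y) (Cauchy.fromℕℚ-suc m)) (QS.solve 2 (λ m y → (m QS.:+ QS.con (+ 1)) QS.:* y QS.:= y QS.:+ m QS.:* y) refl (fromℕℚ m) y)) ⟩
    series one (y ℚ.+ fromℕℚ m ℚ.* y) N
      ≤⟨ series-+-≤ 0≤y 0≤my N ⟩
    series one y N ℚ.* series one (fromℕℚ m ℚ.* y) N
      ≤⟨ Cauchy.*-mono (0≤series 0≤y N) (Cauchy.0≤^ m (Cauchy.0≤+ Cauchy.0≤1 (Cauchy.0≤+ 0≤y 0≤y))) (series-small 0≤y y≤½ N) (series-multiple 0≤y y≤½ m N) ⟩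
    (1ℚ ℚ.+ (y ℚ.+ y)) ^ℚ suc m ∎
    where
    0≤my : 0ℚ ℚ.≤ fromℕℚ m ℚ.* y
    0≤my = Cauchy.0≤* (Cauchy.0≤fromℕℚ m) 0≤y

  infixr 8 _^ʳ_
  _^ʳ_ : ℝ → ℕ → ℝ
  x ^ʳ zero  = 1ʳ
  x ^ʳ suc k = x *ʳ x ^ʳ k

  seq-^ : ∀ x k n → seq (x ^ʳ k) n ≡ seq x n ^ℚ k
  seq-^ x zero    n = seq-rat 1ℚ n
  seq-^ x (suc k) n = trans (seq-* x (x ^ʳ k) n) (cong (seq x n ℚ.*_) (seq-^ x k n))

  3/2 : ℚ
  3/2 = + 3 / 2

  -- The gap `½` leaves room for the tolerance `¼` with which `log-bound` reads its hypothesis at a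
  -- finite index.
  3/2^+½≤2^ : ∀ m → 3/2 ^ℚ suc m ℚ.+ ½ ℚ.≤ fromℕℚ (2 ℕ.^ suc m)
  3/2^+½≤2^ zero    = ℚP.≤-reflexive refl
  3/2^+½≤2^ (suc m) = begin
    3/2 ℚ.* P ℚ.+ ½
      ≤⟨ Cauchy.≤-+ʳ ℚP.≤-refl (Cauchy.0≤+ (Cauchy.0≤* (ℚP.nonNegative⁻¹ ½) (Cauchy.0≤^ (suc m) (ℚP.nonNegative⁻¹ 3/2))) (ℚP.nonNegative⁻¹ ½)) ⟩
    3/2 ℚ.* P ℚ.+ ½ ℚ.+ (½ ℚ.* P ℚ.+ ½)
      ≡⟨ QS.solve 3 (λ t h P → t QS.:* P QS.:+ h QS.:+ (h QS.:* P QS.:+ h) QS.:= (t QS.:+ h) QS.:* P QS.:+ (h QS.:+ h)) refl 3/2 ½ P ⟩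
    (1ℚ ℚ.+ 1ℚ) ℚ.* P ℚ.+ (½ ℚ.+ ½)
      ≡⟨ QS.solve 2 (λ P h → (QS.con (+ 1) QS.:+ QS.con (+ 1)) QS.:* P QS.:+ (h QS.:+ h) QS.:= (QS.con (+ 1) QS.:+ QS.con (+ 1)) QS.:* (P QS.:+ h)) refl P ½ ⟩
    fromℕℚ 2 ℚ.* (P ℚ.+ ½)
      ≤⟨ Cauchy.*-monoˡ (Cauchy.0≤fromℕℚ 2) (3/2^+½≤2^ m) ⟩
    fromℕℚ 2 ℚ.* fromℕℚ (2 ℕ.^ suc m)
      ≡⟨ sym (fromℕℚ-* 2 (2 ℕ.^ suc m)) ⟩
    fromℕℚ (2 ℕ.^ suc (suc m)) ∎
    where P = 3/2 ^ℚ suc m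

  -- y = 1/108 and β = 1 + 1/54, so that 1 - 18 (β - 1) = 2/3 and β ^ 18 ≤ 3/2 by Bernoulli.
  y β : ℚ
  y = + 1 / 108
  β = 1ℚ ℚ.+ (y ℚ.+ y)

  0≤y : 0ℚ ℚ.≤ y
  0≤y = ℚP.nonNegative⁻¹ y

  1≤β : 1ℚ ℚ.≤ β
  1≤β = Cauchy.≤-+ʳ ℚP.≤-refl (Cauchy.0≤+ 0≤y 0≤y)

  0≤β : 0ℚ ℚ.≤ β
  0≤β = ℚP.≤-trans Cauchy.0≤1 1≤β

  β^18≤3/2 : β ^ℚ 18 ℚ.≤ 3/2
  β^18≤3/2 = begin
    B                         ≡⟨ sym (trans (ℚP.*-assoc B (+ 2 / 3) 3/2) (ℚP.*-identityʳ B)) ⟩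
    B ℚ.* (+ 2 / 3) ℚ.* 3/2   ≤⟨ Cauchy.*-monoʳ (ℚP.nonNegative⁻¹ 3/2) (bernoulli (Cauchy.0≤+ 0≤y 0≤y) 18) ⟩
    1ℚ ℚ.* 3/2                ≡⟨ ℚP.*-identityˡ 3/2 ⟩
    3/2                       ∎
    where
    B = β ^ℚ 18

  power-bound : ∀ {e} m → ℚ.∣ e ∣ ℚ.≤ β ^ℚ m → e ^ℚ 18 ℚ.≤ 3/2 ^ℚ m
  power-bound {e} m h = begin
    e ^ℚ 18                   ≤⟨ ^ℚ-abs e 18 ⟩
    ℚ.∣ e ∣ ^ℚ 18             ≤⟨ ^ℚ-mono 18 (ℚP.0≤∣p∣ e) h ⟩
    (β ^ℚ m) ^ℚ 18            ≡⟨ ^ℚ-swap β m 18 ⟩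
    (β ^ℚ 18) ^ℚ m            ≤⟨ ^ℚ-mono m (Cauchy.0≤^ 18 0≤β) β^18≤3/2 ⟩
    3/2 ^ℚ m                  ∎

  -- Contraposition at each late index, which is constructive because the order of the rationals is
  -- decidable. If `108 L` fell below `m + 1` there, then `L ≤ (m + 1) y`; the partial sum of the
  -- exponential would be at most `β ^ (m + 1)` and its 18th power at most `(3/2) ^ (m + 1)`, which
  -- misses `2 ^ (m + 1)` by at least `½`.
  log-bound : ∀ L m → nat (2 ℕ.^ suc m) ≼ expʳ L ^ʳ 18 → nat (suc m) ≼ nat 108 *ʳ L
  log-bound L m h = below λ ε 0<ε → N₁ ℕ.⊔ (N₂ ℕ.⊔ 1) , λ n le →
    subst (λ z → z ℚ.≤ seq (nat 108 *ʳ L) n ℚ.+ ε) (sym (seq-rat (fromℕℚ (suc m)) n))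
      (Cauchy.≤-+ʳ (subst (fromℕℚ (suc m) ℚ.≤_) (sym (trans (seq-* (nat 108) L n) (cong (ℚ._* seq L n) (seq-rat (fromℕℚ 108) n))))
        (bound n (ℕP.m⊔n≤o⇒m≤o N₁ (N₂ ℕ.⊔ 1) le) (ℕP.m⊔n≤o⇒m≤o N₂ 1 (ℕP.m⊔n≤o⇒n≤o N₁ (N₂ ℕ.⊔ 1) le)) (ℕP.m⊔n≤o⇒n≤o N₂ 1 (ℕP.m⊔n≤o⇒n≤o N₁ (N₂ ℕ.⊔ 1) le))))
        (ℚP.<⇒≤ 0<ε))
    where
    ¼ = ½ ℚ.* ½
    ¼<½ : ¼ ℚ.< ½
    ¼<½ = toWitness {a? = ¼ ℚP.<? ½} _
    H₁ = eventually-≤ h ¼ (ℚP.positive⁻¹ ¼)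
    -- With tolerance `y + y` the product of the partial sums at `L` and `- L` is at most
    -- `1 + 2 y = β` in absolute value.
    H₂ = difference→0 (exp-inverse L) (y ℚ.+ y) (ℚP.positive⁻¹ (y ℚ.+ y))
    N₁ = proj₁ H₁
    N₂ = proj₁ H₂
    contradictory : ∀ n → N₁ ℕ.≤ n → ¬ (ℚ.∣ series one (seq L n) n ∣ ℚ.≤ β ^ℚ suc m)
    contradictory n N₁≤n small = (λ le → ℚP.<-irrefl refl (ℚP.<-≤-trans ¼<½ le)) (begin
      ½                                             ≡⟨ QS.solve 2 (λ t h → h QS.:= (t QS.:+ h) QS.:- t) refl T ½ ⟩
      (T ℚ.+ ½) ℚ.- T                               ≤⟨ ℚP.+-monoˡ-≤ (ℚ.- T) (3/2^+½≤2^ m) ⟩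
      fromℕℚ (2 ℕ.^ suc m) ℚ.- T                    ≡⟨ cong (ℚ._- T) (sym (seq-rat (fromℕℚ (2 ℕ.^ suc m)) n)) ⟩
      seq (nat (2 ℕ.^ suc m)) n ℚ.- T               ≤⟨ ℚP.+-monoˡ-≤ (ℚ.- T) (proj₂ H₁ n N₁≤n) ⟩
      seq (expʳ L ^ʳ 18) n ℚ.+ ¼ ℚ.- T              ≡⟨ cong (λ z → z ℚ.+ ¼ ℚ.- T) (trans (seq-^ (expʳ L) 18 n) (cong (_^ℚ 18) (seq-exp L n))) ⟩
      series one (seq L n) n ^ℚ 18 ℚ.+ ¼ ℚ.- T      ≤⟨ ℚP.+-monoˡ-≤ (ℚ.- T) (ℚP.+-monoˡ-≤ ¼ (power-bound (suc m) small)) ⟩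
      T ℚ.+ ¼ ℚ.- T                                 ≡⟨ QS.solve 2 (λ t q → t QS.:+ q QS.:- t QS.:= q) refl T ¼ ⟩
      ¼                                             ∎)
      where
      T = 3/2 ^ℚ suc m
    bound : ∀ n → N₁ ℕ.≤ n → N₂ ℕ.≤ n → 1 ℕ.≤ n → fromℕℚ (suc m) ℚ.≤ fromℕℚ 108 ℚ.* seq L n
    bound (suc n′) N₁≤n N₂≤n _ = decide (fromℕℚ (suc m) ℚP.≤? fromℕℚ 108 ℚ.* l)
      where
      n = suc n′
      l = seq L n
      E = series one l n
      E′ = series one (ℚ.- l) n
      product : ℚ.∣ E ℚ.* E′ ℚ.- 1ℚ ∣ ℚ.≤ y ℚ.+ y
      product = subst (λ z → ℚ.∣ z ∣ ℚ.≤ y ℚ.+ y)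
        (cong₂ ℚ._-_ (trans (seq-* (expʳ L) (expʳ (-ʳ L)) n) (cong₂ ℚ._*_ (seq-exp L n)
          (trans (seq-exp (-ʳ L) n) (cong (λ q → series one q n) (seq-neg L n))))) (seq-rat 1ℚ n)) (proj₂ H₂ n N₂≤n)
      from-sign : l ℚ.≤ fromℕℚ (suc m) ℚ.* y → 0ℚ ℚ.≤ l ⊎ l ℚ.≤ 0ℚ → ℚ.∣ E ∣ ℚ.≤ β ^ℚ suc m
      from-sign l≤ (inj₁ 0≤l) = begin
        ℚ.∣ E ∣                                  ≡⟨ ℚP.0≤p⇒∣p∣≡p (0≤series 0≤l n) ⟩
        E                                        ≤⟨ series-mono 0≤l l≤ n ⟩
        series one (fromℕℚ (suc m) ℚ.* y) n      ≤⟨ series-multiple 0≤y (toWitness {a? = y ℚP.≤? ½} _) (suc m) n ⟩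
        β ^ℚ suc m                               ∎
      -- For negative `l` the terms alternate, so the size of `E` is controlled through `E′` at
      -- `- l`: it is at least 1, the index being positive, and `∣ E E′ ∣ ≤ β`.
      from-sign l≤ (inj₂ l≤0) = begin
        ℚ.∣ E ∣                                  ≡⟨ sym (ℚP.*-identityʳ ℚ.∣ E ∣) ⟩
        ℚ.∣ E ∣ ℚ.* 1ℚ                           ≤⟨ Cauchy.*-monoˡ (ℚP.0≤∣p∣ E) (1≤series (ℚP.neg-antimono-≤ l≤0) n′) ⟩
        ℚ.∣ E ∣ ℚ.* E′                           ≡⟨ cong (ℚ.∣ E ∣ ℚ.*_) (sym (ℚP.0≤p⇒∣p∣≡p (0≤series (ℚP.neg-antimono-≤ l≤0) n))) ⟩
        ℚ.∣ E ∣ ℚ.* ℚ.∣ E′ ∣                     ≡⟨ sym (ℚP.∣p*q∣≡∣p∣*∣q∣ E E′) ⟩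
        ℚ.∣ E ℚ.* E′ ∣                           ≡⟨ cong ℚ.∣_∣ (QS.solve 1 (λ p → p QS.:= QS.con (+ 1) QS.:+ (p QS.:- QS.con (+ 1))) refl (E ℚ.* E′)) ⟩
        ℚ.∣ 1ℚ ℚ.+ (E ℚ.* E′ ℚ.- 1ℚ) ∣           ≤⟨ ℚP.∣p+q∣≤∣p∣+∣q∣ 1ℚ (E ℚ.* E′ ℚ.- 1ℚ) ⟩
        1ℚ ℚ.+ ℚ.∣ E ℚ.* E′ ℚ.- 1ℚ ∣             ≤⟨ ℚP.+-monoʳ-≤ 1ℚ product ⟩
        β                                        ≡⟨ sym (ℚP.*-identityʳ β) ⟩
        β ℚ.* 1ℚ                                 ≤⟨ Cauchy.*-monoˡ 0≤β (1≤^ℚ 1≤β m) ⟩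
        β ^ℚ suc m                               ∎
      decide : Dec (fromℕℚ (suc m) ℚ.≤ fromℕℚ 108 ℚ.* l) → fromℕℚ (suc m) ℚ.≤ fromℕℚ 108 ℚ.* l
      decide (yes h) = h
      decide (no ¬h) = ⊥-elim (contradictory n N₁≤n (from-sign l≤ (ℚP.≤-total 0ℚ l)))
        where
        l≤ : l ℚ.≤ fromℕℚ (suc m) ℚ.* y
        l≤ = begin
          l                              ≡⟨ sym (ℚP.*-identityˡ l) ⟩
          (fromℕℚ 108 ℚ.* y) ℚ.* l       ≡⟨ QS.solve 3 (λ a y l → (a QS.:* y) QS.:* l QS.:= (a QS.:* l) QS.:* y) refl (fromℕℚ 108) y l ⟩
          (fromℕℚ 108 ℚ.* l) ℚ.* y       ≤⟨ Cauchy.*-monoʳ 0≤y (ℚP.<⇒≤ (ℚP.≰⇒> ¬h)) ⟩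
          fromℕℚ (suc m) ℚ.* y           ∎

module Proof (p : ℕ) .{{nz : NonZero p}} (prime : Prime p) where

  -- The field of `p` elements on residues.

  module PrimeField where

    residue : ℕ → F p
    residue m = m mod p

    toℕ-residue : ∀ m → toℕ (residue m) ≡ m % p
    toℕ-residue m = FinP.toℕ-fromℕ< (m%n<n m p)

    residue-cong-% : ∀ m n → m % p ≡ n % p → residue m ≡ residue n
    residue-cong-% m n eq = FinP.toℕ-injective (trans (toℕ-residue m) (trans eq (sym (toℕ-residue n))))

    residue-toℕ : (x : F p) → residue (toℕ x) ≡ x
    residue-toℕ x = FinP.toℕ-injective (trans (toℕ-residue (toℕ x)) (m<n⇒m%n≡m (FinP.toℕ<n x)))

    residue-+ : ∀ m n → residue m +F residue n ≡ residue (m ℕ.+ n)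
    residue-+ m n = residue-cong-% (toℕ (residue m) ℕ.+ toℕ (residue n)) (m ℕ.+ n)
      (trans (cong (_% p) (cong₂ ℕ._+_ (toℕ-residue m) (toℕ-residue n))) (sym (%-distribˡ-+ m n p)))

    residue-* : ∀ m n → residue m *F residue n ≡ residue (m ℕ.* n)
    residue-* m n = residue-cong-% (toℕ (residue m) ℕ.* toℕ (residue n)) (m ℕ.* n)
      (trans (cong (_% p) (cong₂ ℕ._*_ (toℕ-residue m) (toℕ-residue n))) (sym (%-distribˡ-* m n p)))

    residue-p : residue p ≡ 0F
    residue-p = residue-cong-% p 0 (trans (n%n≡0 p) (sym (m*n%n≡0 0 p)))

    +F-comm : (x y : F p) → x +F y ≡ y +F x
    +F-comm x y = cong residue (ℕP.+-comm (toℕ x) (toℕ y))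

    *F-comm : (x y : F p) → x *F y ≡ y *F x
    *F-comm x y = cong residue (ℕP.*-comm (toℕ x) (toℕ y))

    +F-assoc : (x y z : F p) → (x +F y) +F z ≡ x +F (y +F z)
    +F-assoc x y z = begin
      residue (a ℕ.+ b) +F z             ≡⟨ cong (residue (a ℕ.+ b) +F_) (sym (residue-toℕ z)) ⟩
      residue (a ℕ.+ b) +F residue c     ≡⟨ residue-+ (a ℕ.+ b) c ⟩
      residue (a ℕ.+ b ℕ.+ c)            ≡⟨ cong residue (ℕP.+-assoc a b c) ⟩
      residue (a ℕ.+ (b ℕ.+ c))          ≡⟨ sym (residue-+ a (b ℕ.+ c)) ⟩
      residue a +F residue (b ℕ.+ c)     ≡⟨ cong (_+F residue (b ℕ.+ c)) (residue-toℕ x) ⟩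
      x +F residue (b ℕ.+ c)             ∎
      where
      open ≡-Reasoning
      a = toℕ x ; b = toℕ y ; c = toℕ z

    *F-assoc : (x y z : F p) → (x *F y) *F z ≡ x *F (y *F z)
    *F-assoc x y z = begin
      residue (a ℕ.* b) *F z             ≡⟨ cong (residue (a ℕ.* b) *F_) (sym (residue-toℕ z)) ⟩
      residue (a ℕ.* b) *F residue c     ≡⟨ residue-* (a ℕ.* b) c ⟩
      residue (a ℕ.* b ℕ.* c)            ≡⟨ cong residue (ℕP.*-assoc a b c) ⟩
      residue (a ℕ.* (b ℕ.* c))          ≡⟨ sym (residue-* a (b ℕ.* c)) ⟩
      residue a *F residue (b ℕ.* c)     ≡⟨ cong (_*F residue (b ℕ.* c)) (residue-toℕ x) ⟩
      x *F residue (b ℕ.* c)             ∎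
      where
      open ≡-Reasoning
      a = toℕ x ; b = toℕ y ; c = toℕ z

    *F-distribˡ-+F : (x y z : F p) → x *F (y +F z) ≡ x *F y +F x *F z
    *F-distribˡ-+F x y z = begin
      x *F residue (b ℕ.+ c)               ≡⟨ cong (_*F residue (b ℕ.+ c)) (sym (residue-toℕ x)) ⟩
      residue a *F residue (b ℕ.+ c)       ≡⟨ residue-* a (b ℕ.+ c) ⟩
      residue (a ℕ.* (b ℕ.+ c))            ≡⟨ cong residue (ℕP.*-distribˡ-+ a b c) ⟩
      residue (a ℕ.* b ℕ.+ a ℕ.* c)        ≡⟨ sym (residue-+ (a ℕ.* b) (a ℕ.* c)) ⟩
      residue (a ℕ.* b) +F residue (a ℕ.* c) ∎
      where
      open ≡-Reasoning
      a = toℕ x ; b = toℕ y ; c = toℕ z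

    +F-identityˡ : (x : F p) → 0F +F x ≡ x
    +F-identityˡ x = trans (cong (0F +F_) (sym (residue-toℕ x)))
      (trans (residue-+ 0 (toℕ x)) (residue-toℕ x))

    +F-identityʳ : (x : F p) → x +F 0F ≡ x
    +F-identityʳ x = trans (+F-comm x 0F) (+F-identityˡ x)

    *F-identityˡ : (x : F p) → 1F *F x ≡ x
    *F-identityˡ x = trans (cong (1F *F_) (sym (residue-toℕ x)))
      (trans (residue-* 1 (toℕ x)) (trans (cong residue (ℕP.*-identityˡ (toℕ x))) (residue-toℕ x)))

    infix 8 -F_
    infixl 6 _⊖F_

    -F_ : F p → F p
    -F x = residue (p ℕ.∸ toℕ x)

    _⊖F_ : F p → F p → F p
    x ⊖F y = x +F -F y

    -F-inverseˡ : (x : F p) → -F x +F x ≡ 0F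
    -F-inverseˡ x = begin
      residue (p ℕ.∸ toℕ x) +F x                   ≡⟨ cong (residue (p ℕ.∸ toℕ x) +F_) (sym (residue-toℕ x)) ⟩
      residue (p ℕ.∸ toℕ x) +F residue (toℕ x)     ≡⟨ residue-+ (p ℕ.∸ toℕ x) (toℕ x) ⟩
      residue (p ℕ.∸ toℕ x ℕ.+ toℕ x)              ≡⟨ cong residue (ℕP.m∸n+n≡m (ℕP.<⇒≤ (FinP.toℕ<n x))) ⟩
      residue p                                    ≡⟨ residue-p ⟩
      0F                                           ∎
      where open ≡-Reasoning

    Fp-commutativeRing : CommutativeRing 0ℓ 0ℓ
    Fp-commutativeRing = record
      { Carrier = F p ; _≈_ = _≡_ ; _+_ = _+F_ ; _*_ = _*F_ ; -_ = λ x → -F x ; 0# = 0F ; 1# = 1F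
      ; isCommutativeRing = record
        { isRing = record
          { +-isAbelianGroup = record
            { isGroup = record
              { isMonoid = record
                { isSemigroup = record
                  { isMagma = record { isEquivalence = isEquivalence ; ∙-cong = cong₂ _+F_ }
                  ; assoc = +F-assoc }
                ; identity = +F-identityˡ , +F-identityʳ }
              ; inverse = -F-inverseˡ , (λ x → trans (+F-comm x (-F x)) (-F-inverseˡ x))
              ; ⁻¹-cong = cong (λ x → -F x) }
            ; comm = +F-comm }
          ; *-cong = cong₂ _*F_
          ; *-assoc = *F-assoc
          ; *-identity = *F-identityˡ , (λ x → trans (*F-comm x 1F) (*F-identityˡ x))
          ; distrib = *F-distribˡ-+F
                    , (λ x y z → trans (*F-comm (y +F z) x)
                        (trans (*F-distribˡ-+F x y z) (cong₂ _+F_ (*F-comm x y) (*F-comm x z)))) }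
        ; *-comm = *F-comm } }

    module Fp = CommutativeRing Fp-commutativeRing
    module FS = IntegerCoefficients Fp-commutativeRing

    1<p : 1 ℕ.< p
    1<p = ℕ.nonTrivial⇒n>1 p {{prime⇒nonTrivial prime}}

    toℕ-0F : toℕ (0F {p}) ≡ 0
    toℕ-0F = trans (toℕ-residue 0) (m<n⇒m%n≡m (ℕP.<-trans (ℕ.s≤s ℕ.z≤n) 1<p))

    toℕ-1F : toℕ (1F {p}) ≡ 1
    toℕ-1F = trans (toℕ-residue 1) (m<n⇒m%n≡m 1<p)

    inverse : (x : F p) → x ≢ 0F → ∃[ y ] y *F x ≡ 1F
    inverse x x≢0 = go (toℕ x) refl
      where
      go : ∀ m → toℕ x ≡ m → ∃[ y ] y *F x ≡ 1F
      go zero eq = ⊥-elim (x≢0 (FinP.toℕ-injective (trans eq (sym toℕ-0F))))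
      go m@(suc _) eq with coprime-Bézout (prime⇒coprime prime (subst (ℕ._< p) eq (FinP.toℕ<n x)))
      -- Here Bézout's identity reads `1 + v m = u p`, so the inverse of `m` is `- v`; in the other
      -- case it is `v`.
      ... | Bézout.+- u v e = -F residue v , (begin
        -F residue v *F x                        ≡⟨ lemma (residue v) x ⟩
        1F ⊖F (1F +F residue v *F x)             ≡⟨ cong (1F ⊖F_) (begin
          1F +F residue v *F x                   ≡⟨ cong (λ z → 1F +F residue v *F z) (sym x≡) ⟩
          1F +F residue v *F residue m           ≡⟨ cong (1F +F_) (residue-* v m) ⟩
          1F +F residue (v ℕ.* m)                ≡⟨ residue-+ 1 (v ℕ.* m) ⟩
          residue (1 ℕ.+ v ℕ.* m)                ≡⟨ cong residue e ⟩
          residue (u ℕ.* p)                      ≡⟨ sym (residue-* u p) ⟩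
          residue u *F residue p                 ≡⟨ cong (residue u *F_) residue-p ⟩
          residue u *F 0F                        ≡⟨ Fp.zeroʳ (residue u) ⟩
          0F                                     ∎) ⟩
        1F ⊖F 0F                                 ≡⟨ lemma₀ ⟩
        1F                                       ∎)
        where
        open ≡-Reasoning
        x≡ : residue m ≡ x
        x≡ = trans (cong residue (sym eq)) (residue-toℕ x)
        lemma : ∀ v x → -F v *F x ≡ 1F ⊖F (1F +F v *F x)
        lemma v x = FS.solve 3 (λ v x i → FS.:- v FS.:* x FS.:= i FS.:- (i FS.:+ v FS.:* x)) refl v x 1F
        lemma₀ : 1F ⊖F 0F ≡ 1F
        lemma₀ = FS.solve 1 (λ i → i FS.:- FS.con (+ 0) FS.:= i) refl 1F
          where import Data.Integer.Base
      ... | Bézout.-+ u v e = residue v , (begin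
        residue v *F x                           ≡⟨ cong (residue v *F_) (sym x≡) ⟩
        residue v *F residue m                   ≡⟨ residue-* v m ⟩
        residue (v ℕ.* m)                        ≡⟨ cong residue (sym e) ⟩
        residue (1 ℕ.+ u ℕ.* p)                  ≡⟨ sym (residue-+ 1 (u ℕ.* p)) ⟩
        1F +F residue (u ℕ.* p)                  ≡⟨ cong (1F +F_) (sym (residue-* u p)) ⟩
        1F +F residue u *F residue p             ≡⟨ cong (λ z → 1F +F residue u *F z) residue-p ⟩
        1F +F residue u *F 0F                    ≡⟨ cong (1F +F_) (Fp.zeroʳ (residue u)) ⟩
        1F +F 0F                                 ≡⟨ +F-identityʳ 1F ⟩
        1F                                       ∎)
        where
        open ≡-Reasoning
        x≡ : residue m ≡ x
        x≡ = trans (cong residue (sym eq)) (residue-toℕ x)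

  -- Vectors over the field, their enumeration, and translation invariance of sums.

  module Vectors where

    open Sums
    open PrimeField

    V : ℕ → Set
    V n = Vec (F p) n

    infixl 6 _+ᵛ_ _⊖ᵛ_
    infixr 7 _·ᵛ_
    infix 8 -ᵛ_

    0ᵛ : ∀ {n} → V n
    0ᵛ = Vec.replicate _ 0F

    _+ᵛ_ _⊖ᵛ_ : ∀ {n} → V n → V n → V n
    x +ᵛ y = Vec.zipWith _+F_ x y

    -ᵛ_ : ∀ {n} → V n → V n
    -ᵛ x = Vec.map (λ a → -F a) x
    x ⊖ᵛ y = x +ᵛ -ᵛ y

    _·ᵛ_ : ∀ {n} → F p → V n → V n
    t ·ᵛ x = Vec.map (t *F_) x

    +ᵛ-comm : ∀ {n} (x y : V n) → x +ᵛ y ≡ y +ᵛ x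
    +ᵛ-comm []      []      = refl
    +ᵛ-comm (x ∷ xs) (y ∷ ys) = cong₂ _∷_ (+F-comm x y) (+ᵛ-comm xs ys)

    +ᵛ-assoc : ∀ {n} (x y z : V n) → (x +ᵛ y) +ᵛ z ≡ x +ᵛ (y +ᵛ z)
    +ᵛ-assoc [] [] [] = refl
    +ᵛ-assoc (x ∷ xs) (y ∷ ys) (z ∷ zs) = cong₂ _∷_ (+F-assoc x y z) (+ᵛ-assoc xs ys zs)

    +ᵛ-identityˡ : ∀ {n} (x : V n) → 0ᵛ +ᵛ x ≡ x
    +ᵛ-identityˡ [] = refl
    +ᵛ-identityˡ (x ∷ xs) = cong₂ _∷_ (+F-identityˡ x) (+ᵛ-identityˡ xs)

    +ᵛ-identityʳ : ∀ {n} (x : V n) → x +ᵛ 0ᵛ ≡ x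
    +ᵛ-identityʳ x = trans (+ᵛ-comm x 0ᵛ) (+ᵛ-identityˡ x)

    -ᵛ-inverseʳ : ∀ {n} (x : V n) → x ⊖ᵛ x ≡ 0ᵛ
    -ᵛ-inverseʳ [] = refl
    -ᵛ-inverseʳ (x ∷ xs) = cong₂ _∷_ (Fp.-‿inverseʳ x) (-ᵛ-inverseʳ xs)

    x-y+y : ∀ {n} (x y : V n) → (x ⊖ᵛ y) +ᵛ y ≡ x
    x-y+y [] [] = refl
    x-y+y (x ∷ xs) (y ∷ ys) = cong₂ _∷_ (FS.solve 2 (λ x y → x FS.:- y FS.:+ y FS.:= x) refl x y) (x-y+y xs ys)

    x+y-y : ∀ {n} (x y : V n) → (x +ᵛ y) ⊖ᵛ y ≡ x
    x+y-y [] [] = refl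
    x+y-y (x ∷ xs) (y ∷ ys) = cong₂ _∷_ (FS.solve 2 (λ x y → x FS.:+ y FS.:- y FS.:= x) refl x y) (x+y-y xs ys)

    ·ᵛ-zeroˡ : ∀ {n} (x : V n) → 0F ·ᵛ x ≡ 0ᵛ
    ·ᵛ-zeroˡ [] = refl
    ·ᵛ-zeroˡ (x ∷ xs) = cong₂ _∷_ (Fp.zeroˡ x) (·ᵛ-zeroˡ xs)

    ·ᵛ-identityˡ : ∀ {n} (x : V n) → 1F ·ᵛ x ≡ x
    ·ᵛ-identityˡ [] = refl
    ·ᵛ-identityˡ (x ∷ xs) = cong₂ _∷_ (Fp.*-identityˡ x) (·ᵛ-identityˡ xs)

    ·ᵛ-distribʳ : ∀ {n} s t (x : V n) → (s +F t) ·ᵛ x ≡ s ·ᵛ x +ᵛ t ·ᵛ x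
    ·ᵛ-distribʳ s t [] = refl
    ·ᵛ-distribʳ s t (x ∷ xs) = cong₂ _∷_ (Fp.distribʳ x s t) (·ᵛ-distribʳ s t xs)

    ·ᵛ-assoc : ∀ {n} s t (x : V n) → (s *F t) ·ᵛ x ≡ s ·ᵛ (t ·ᵛ x)
    ·ᵛ-assoc s t [] = refl
    ·ᵛ-assoc s t (x ∷ xs) = cong₂ _∷_ (*F-assoc s t x) (·ᵛ-assoc s t xs)

    -ᵛ≡-1· : ∀ {n} (x : V n) → -ᵛ x ≡ (-F 1F) ·ᵛ x
    -ᵛ≡-1· [] = refl
    -ᵛ≡-1· (x ∷ xs) = cong₂ _∷_
      (sym (trans (FS.solve 2 (λ i x → (FS.:- i) FS.:* x FS.:= FS.:- (i FS.:* x)) refl 1F x)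
                  (cong (λ a → -F a) (*F-identityˡ x)))) (-ᵛ≡-1· xs)

    length-points : ∀ n → List.length (points p n) ≡ p ℕ.^ n
    length-points zero    = refl
    length-points (suc n) = trans (length-cartesian (List.allFin p))
      (cong₂ ℕ._*_ (ListP.length-tabulate {n = p} (λ i → i)) (length-points n))
      where
      length-cartesian : (xs : List (F p)) →
        List.length (List.cartesianProductWith {C = V (suc n)} _∷_ xs (points p n)) ≡ List.length xs ℕ.* List.length (points p n)
      length-cartesian [] = refl
      length-cartesian (x ∷ xs) = trans (ListP.length-++ (List.map (Vec._∷_ x) (points p n)))
        (cong₂ ℕ._+_ (ListP.length-map (Vec._∷_ x) (points p n)) (length-cartesian xs))

    ∈-points : ∀ {n} (x : V n) → x ∈ points p n
    ∈-points []       = here refl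
    ∈-points (x ∷ xs) = ∈-cartesianProductWith⁺ _∷_ (∈-allFin x) (∈-points xs)

    -- Decidable quantifiers over the finite space make the later arguments by cases and by
    -- contradiction constructive.
    ∃? : ∀ {n} {P : V n → Set} → Decidable P → Dec (∃[ x ] P x)
    ∃? {n} P? with any? P? (points p n)
    ... | yes a = let (x , _ , px) = find a in yes (x , px)
    ... | no ¬a = no λ (x , px) → ¬a (lose (∈-points x) px)

    ∀? : ∀ {n} {P : V n → Set} → Decidable P → Dec (∀ x → P x)
    ∀? P? with ∃? (λ x → ¬? (P? x))
    ... | yes (x , ¬px) = no λ all → ¬px (all x)
    ... | no ¬e = yes λ x → decide (P? x) (λ ¬px → ¬e (x , ¬px))
      where
      decide : ∀ {A : Set} → Dec A → ¬ ¬ A → A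
      decide (yes a) _ = a
      decide (no ¬a) ¬¬a = ⊥-elim (¬¬a ¬a)

    shift : F p → Permutation′ p
    shift c = permutation (_+F c) (_⊖F c)
      (λ x → FS.solve 2 (λ x c → x FS.:- c FS.:+ c FS.:= x) refl x c)
      (λ x → FS.solve 2 (λ x c → x FS.:+ c FS.:- c FS.:= x) refl x c)

    module PointSum {c ℓ} (M : CommutativeMonoid c ℓ) where
      open CommutativeMonoid M using (Carrier; _≈_) renaming (sym to ≈sym; trans to ≈trans)
      open ListSum M

      ∑-shift : (g : F p → Carrier) (c : F p) →
        ∑ (List.allFin p) (λ x → g (x +F c)) ≈ ∑ (List.allFin p) g
      ∑-shift g c = ∑-permute g (shift c)

      ∑-translate : ∀ {n} (g : V n → Carrier) (h : V n) →
        ∑ (points p n) (λ x → g (x +ᵛ h)) ≈ ∑ (points p n) g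
      ∑-translate g []       = CommutativeMonoid.refl M
      ∑-translate g (h ∷ hs) =
        ≈trans (∑-cartesianProductWith _∷_ _ (List.allFin p) _)
        (≈trans (∑-cong (List.allFin p) (λ x → ∑-translate (λ xs → g ((x +F h) ∷ xs)) hs))
        (≈trans (∑-shift (λ x → ∑ (points p _) (λ xs → g (x ∷ xs))) h)
                (≈sym (∑-cartesianProductWith _∷_ g (List.allFin p) _))))

    open PointSum ℕP.+-0-commutativeMonoid using () renaming
      (∑-translate to ∑ℕ-translate; ∑-shift to ∑ℕ-shift) public

  -- Decidable subspaces, their sizes, and complements.

  module Subspaces where

    open Sums
    open PrimeField
    open Vectors

    -- Every element of a prime field is a sum of ones. This is why closure under addition suffices
    -- for a subspace and why additive maps are linear.
    F-induction : (P : F p → Set) → P 0F → (∀ t → P t → P (1F +F t)) → ∀ t → P t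
    F-induction P z s t = subst P (residue-toℕ t) (go (toℕ t))
      where
      go : ∀ m → P (residue m)
      go zero    = z
      go (suc m) = subst P (residue-+ 1 m) (s (residue m) (go m))

    record Sub (n : ℕ) : Set₁ where
      field
        Mem  : V n → Set
        mem? : Decidable Mem
        0∈   : Mem 0ᵛ
        +∈   : ∀ {x y} → Mem x → Mem y → Mem (x +ᵛ y)

      ·∈ : ∀ t {x} → Mem x → Mem (t ·ᵛ x)
      ·∈ t {x} x∈ = F-induction (λ t → Mem (t ·ᵛ x)) (subst Mem (sym (·ᵛ-zeroˡ x)) 0∈)
        (λ t tx∈ → subst Mem (sym (trans (·ᵛ-distribʳ 1F t x) (cong (_+ᵛ t ·ᵛ x) (·ᵛ-identityˡ x)))) (+∈ x∈ tx∈)) t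

      ⊖∈ : ∀ {x y} → Mem x → Mem y → Mem (x ⊖ᵛ y)
      ⊖∈ {y = y} x∈ y∈ = +∈ x∈ (subst Mem (sym (-ᵛ≡-1· y)) (·∈ (-F 1F) y∈))

    open Sub public

    count : ∀ {n} {P : V n → Set} → Decidable P → ℕ
    count {n} P? = ∑ℕ (points p n) (λ x → 𝟙 (P? x))

    count-mono : ∀ {n} {P Q : V n → Set} (P? : Decidable P) (Q? : Decidable Q) → (∀ {x} → P x → Q x) → count P? ℕ.≤ count Q?
    count-mono {n} P? Q? f = ∑ℕ-mono (points p n) (λ x → 𝟙-mono (P? x) (Q? x) f)

    count-translate : ∀ {n} {P : V n → Set} (P? : Decidable P) h → count (λ x → P? (x +ᵛ h)) ≡ count P?
    count-translate P? h = ∑ℕ-translate (λ x → 𝟙 (P? x)) h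

    count≤p^n : ∀ {n} {P : V n → Set} (P? : Decidable P) → count P? ℕ.≤ p ℕ.^ n
    count≤p^n {n} P? = ℕP.≤-trans (∑ℕ-mono (points p n) (λ x → 𝟙≤1 (P? x)))
      (ℕP.≤-reflexive (trans (∑ℕ-const 1 (points p n)) (trans (ℕP.*-identityʳ _) (length-points n))))
      where
      𝟙≤1 : ∀ {P : Set} (d : Dec P) → 𝟙 d ℕ.≤ 1
      𝟙≤1 (yes _) = ℕP.≤-refl
      𝟙≤1 (no _)  = ℕ.z≤n

    count-all : ∀ {n} {P : V n → Set} (P? : Decidable P) → (∀ x → P x) → count P? ≡ p ℕ.^ n
    count-all {n} P? f = trans (∑ℕ-cong (points p n) (λ x → 𝟙-yes (P? x) (f x)))
      (trans (∑ℕ-const 1 (points p n)) (trans (ℕP.*-identityʳ _) (length-points n)))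

    fiber-≤ : ∀ {c} {Q : Fin c → Set} {R : Set} (Q? : Decidable Q) (R? : Dec R) →
      (∀ i j → Q i → Q j → i ≡ j) → (∀ i → Q i → R) →
      ∑ℕ (List.allFin c) (λ i → 𝟙 (Q? i)) ℕ.≤ 𝟙 R?
    fiber-≤ {c} {Q} {R} Q? R? u f = subst (ℕ._≤ 𝟙 R?) (sym (ListSum.∑-tabulate ℕP.+-0-commutativeMonoid {n = c} (λ i → i) (λ i → 𝟙 (Q? i)))) (go Q? u f)
      where
      import Algebra.Properties.CommutativeMonoid.Sum ℕP.+-0-commutativeMonoid as S
      vanish : ∀ {c} {Q : Fin c → Set} (Q? : Decidable Q) → (∀ i → ¬ Q i) → S.sum (λ i → 𝟙 (Q? i)) ≡ 0
      vanish {zero}  Q? ¬q = refl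
      vanish {suc c} Q? ¬q = cong₂ ℕ._+_ (𝟙-no (Q? zero) (¬q zero)) (vanish (λ i → Q? (suc i)) (λ i → ¬q (suc i)))
      go : ∀ {c} {Q : Fin c → Set} (Q? : Decidable Q) → (∀ i j → Q i → Q j → i ≡ j) → (∀ i → Q i → R) →
        S.sum (λ i → 𝟙 (Q? i)) ℕ.≤ 𝟙 R?
      go {zero} Q? u f = ℕ.z≤n
      go {suc c} Q? u f with Q? zero
      ... | yes q = ℕP.≤-trans
        (ℕP.≤-reflexive (cong suc (vanish (λ i → Q? (suc i)) (λ i qi → FinP.0≢1+n (u zero (suc i) q qi)))))
        (ℕP.≤-reflexive (sym (𝟙-yes R? (f zero q))))
      ... | no _ = go (λ i → Q? (suc i)) (λ i j qi qj → FinP.suc-injective (u (suc i) (suc j) qi qj)) (λ i → f (suc i))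

    fiber-≥ : ∀ {c} {Q : Fin c → Set} {R : Set} (Q? : Decidable Q) (R? : Dec R) →
      (R → ∃[ i ] Q i) → 𝟙 R? ℕ.≤ ∑ℕ (List.allFin c) (λ i → 𝟙 (Q? i))
    fiber-≥ {c} {Q} Q? (no _) f = ℕ.z≤n
    fiber-≥ {c} {Q} Q? (yes r) f = subst (1 ℕ.≤_) (sym (ListSum.∑-tabulate ℕP.+-0-commutativeMonoid {n = c} (λ i → i) (λ i → 𝟙 (Q? i)))) (let (i , qi) = f r in go Q? i qi)
      where
      import Algebra.Properties.CommutativeMonoid.Sum ℕP.+-0-commutativeMonoid as S
      go : ∀ {c} {Q : Fin c → Set} (Q? : Decidable Q) i → Q i → 1 ℕ.≤ S.sum (λ i → 𝟙 (Q? i))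
      go Q? zero q = ℕP.≤-trans (ℕP.≤-reflexive (sym (𝟙-yes (Q? zero) q))) (ℕP.m≤m+n _ _)
      go Q? (suc i) q = ℕP.≤-trans (go (λ i → Q? (suc i)) i q) (ℕP.m≤n+m _ _)

    -- Each of the `p` translates of `B` along `e` has the same count; exchanging the sums counts,
    -- for every `x`, the scalars `t` with `x - t e` in `B`.
    p*count≡ : ∀ {n} {B : V n → Set} (B? : Decidable B) e →
      p ℕ.* count B? ≡ ∑ℕ (points p n) (λ x → ∑ℕ (List.allFin p) (λ t → 𝟙 (B? (x ⊖ᵛ t ·ᵛ e))))
    p*count≡ {n} B? e = begin
      p ℕ.* count B?                                        ≡⟨ cong (ℕ._* count B?) (sym (ListP.length-tabulate {n = p} (λ i → i))) ⟩
      List.length (List.allFin p) ℕ.* count B?              ≡⟨ sym (∑ℕ-const (count B?) (List.allFin p)) ⟩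
      ∑ℕ (List.allFin p) (λ t → count B?)                   ≡⟨ ∑ℕ-cong (List.allFin p) (λ t → sym (count-translate B? (-ᵛ (t ·ᵛ e)))) ⟩
      ∑ℕ (List.allFin p) (λ t → count (λ x → B? (x ⊖ᵛ t ·ᵛ e))) ≡⟨ ∑ℕ-swap (λ t x → 𝟙 (B? (x ⊖ᵛ t ·ᵛ e))) (List.allFin p) (points p n) ⟩
      _ ∎
      where open ≡-Reasoning

    -- The translates of `B` along `e` are disjoint by the first hypothesis and lie in `C` by the
    -- second.
    grow-≤ : ∀ {n} {B C : V n → Set} (B? : Decidable B) (C? : Decidable C) e →
      (∀ x s t → B (x ⊖ᵛ s ·ᵛ e) → B (x ⊖ᵛ t ·ᵛ e) → s ≡ t) →
      (∀ x t → B (x ⊖ᵛ t ·ᵛ e) → C x) → p ℕ.* count B? ℕ.≤ count C?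
    grow-≤ {n} B? C? e u f = ℕP.≤-trans (ℕP.≤-reflexive (p*count≡ B? e))
      (∑ℕ-mono (points p n) (λ x → fiber-≤ (λ t → B? (x ⊖ᵛ t ·ᵛ e)) (C? x) (u x) (f x)))

    grow-≥ : ∀ {n} {B C : V n → Set} (B? : Decidable B) (C? : Decidable C) e →
      (∀ x → C x → ∃[ t ] B (x ⊖ᵛ t ·ᵛ e)) → count C? ℕ.≤ p ℕ.* count B?
    grow-≥ {n} B? C? e f = ℕP.≤-trans
      (∑ℕ-mono (points p n) (λ x → fiber-≥ (λ t → B? (x ⊖ᵛ t ·ᵛ e)) (C? x) (f x)))
      (ℕP.≤-reflexive (sym (p*count≡ B? e)))

    module _ {n} (D : Sub n) where

      0<count : 0 ℕ.< count (mem? D)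
      0<count = ℕP.≤-trans (ℕP.m^n>0 p 0) (ℕP.≤-trans (ℕP.≤-reflexive (sym (𝟙-yes (mem? D 0ᵛ) (0∈ D)))) (point (∈-points 0ᵛ)))
        where
        point : ∀ {xs x} → x ∈ xs → 𝟙 (mem? D x) ℕ.≤ ∑ℕ xs (λ x → 𝟙 (mem? D x))
        point (here refl) = ℕP.m≤m+n _ _
        point (there i)   = ℕP.≤-trans (point i) (ℕP.m≤n+m _ _)

      Sub-· : ∀ t {x} → t ≢ 0F → Mem D (t ·ᵛ x) → Mem D x
      Sub-· t {x} t≢0 tx∈ = let (s , st≡1) = inverse t t≢0 in
        subst (Mem D) (trans (sym (·ᵛ-assoc s t x)) (trans (cong (_·ᵛ x) st≡1) (·ᵛ-identityˡ x))) (·∈ D s tx∈)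

      difference : ∀ {m} (x : V m) s t (e : V m) → (x ⊖ᵛ s ·ᵛ e) ⊖ᵛ (x ⊖ᵛ t ·ᵛ e) ≡ (t ⊖F s) ·ᵛ e
      difference [] s t [] = refl
      difference (x ∷ xs) s t (e ∷ es) = cong₂ _∷_
        (FS.solve 4 (λ x s t e → (x FS.:- s FS.:* e) FS.:- (x FS.:- t FS.:* e) FS.:= (t FS.:- s) FS.:* e) refl x s t e)
        (difference xs s t es)

      ⊖F≡0⇒≡ : ∀ {s t} → t ⊖F s ≡ 0F → s ≡ t
      ⊖F≡0⇒≡ {s} {t} eq = trans (sym (+F-identityˡ s)) (trans (cong (_+F s) (sym eq))
        (FS.solve 2 (λ s t → (t FS.:- s) FS.:+ s FS.:= t) refl s t))

      coset-unique : ∀ {e} → ¬ Mem D e → ∀ x s t → Mem D (x ⊖ᵛ s ·ᵛ e) → Mem D (x ⊖ᵛ t ·ᵛ e) → s ≡ t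
      coset-unique {e} e∉ x s t xs∈ xt∈ with t ⊖F s FinP.≟ 0F
      ... | yes eq = ⊖F≡0⇒≡ eq
      ... | no neq = ⊥-elim (e∉ (Sub-· (t ⊖F s) neq (subst (Mem D) (difference x s t e) (⊖∈ D xs∈ xt∈))))

      adjoin : V n → Sub n
      adjoin e = record
        { Mem = λ x → ∃[ t ] Mem D (x ⊖ᵛ t ·ᵛ e)
        ; mem? = λ x → FinP.any? (λ t → mem? D (x ⊖ᵛ t ·ᵛ e))
        ; 0∈ = 0F , subst (Mem D) (sym (trans (cong (0ᵛ ⊖ᵛ_) (·ᵛ-zeroˡ e)) (-ᵛ-inverseʳ 0ᵛ))) (0∈ D)
        ; +∈ = λ {x} {y} (s , xs) (t , yt) → s +F t , subst (Mem D) (sum-of x y s t e) (+∈ D xs yt)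
        }
        where
        sum-of : ∀ {m} (x y : V m) s t (e : V m) →
          (x ⊖ᵛ s ·ᵛ e) +ᵛ (y ⊖ᵛ t ·ᵛ e) ≡ (x +ᵛ y) ⊖ᵛ (s +F t) ·ᵛ e
        sum-of [] [] s t [] = refl
        sum-of (x ∷ xs) (y ∷ ys) s t (e ∷ es) = cong₂ _∷_
          (FS.solve 5 (λ x y s t e → (x FS.:- s FS.:* e) FS.:+ (y FS.:- t FS.:* e)
            FS.:= (x FS.:+ y) FS.:- (s FS.:+ t) FS.:* e) refl x y s t e)
          (sum-of xs ys s t es)

      adjoin-⊆ : ∀ (K : Sub n) e → (∀ {x} → Mem D x → Mem K x) → Mem K e → ∀ {x} → Mem (adjoin e) x → Mem K x
      adjoin-⊆ K e D⊆K e∈ {x} (t , h) = subst (Mem K) (x-y+y x (t ·ᵛ e)) (+∈ K (D⊆K h) (·∈ K t e∈))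

      count-adjoin : ∀ {e} → ¬ Mem D e → count (mem? (adjoin e)) ≡ p ℕ.* count (mem? D)
      count-adjoin {e} e∉ = ℕP.≤-antisym
        (grow-≥ (mem? D) (mem? (adjoin e)) e (λ x h → h))
        (grow-≤ (mem? D) (mem? (adjoin e)) e (coset-unique e∉) (λ x t h → t , h))

    comb : ∀ {c n} → (Fin c → F p) → (Fin c → V n) → V n
    comb {zero}  t e = 0ᵛ
    comb {suc c} t e = t zero ·ᵛ e zero +ᵛ comb (λ j → t (suc j)) (λ j → e (suc j))

    comb-cong : ∀ {c n} {s t : Fin c → F p} (e : Fin c → V n) → (∀ j → s j ≡ t j) → comb s e ≡ comb t e
    comb-cong {zero}  e h = refl
    comb-cong {suc c} e h = cong₂ _+ᵛ_ (cong (_·ᵛ e zero) (h zero)) (comb-cong (λ j → e (suc j)) (λ j → h (suc j)))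

    interchangeᵛ : ∀ {n} (a b c d : V n) → (a +ᵛ b) +ᵛ (c +ᵛ d) ≡ (a +ᵛ c) +ᵛ (b +ᵛ d)
    interchangeᵛ [] [] [] [] = refl
    interchangeᵛ (a ∷ as) (b ∷ bs) (c ∷ cs) (d ∷ ds) = cong₂ _∷_
      (FS.solve 4 (λ a b c d → (a FS.:+ b) FS.:+ (c FS.:+ d) FS.:= (a FS.:+ c) FS.:+ (b FS.:+ d)) refl a b c d)
      (interchangeᵛ as bs cs ds)

    comb-+ : ∀ {c n} (s t : Fin c → F p) (e : Fin c → V n) → comb (λ j → s j +F t j) e ≡ comb s e +ᵛ comb t e
    comb-+ {zero} s t e = sym (+ᵛ-identityˡ 0ᵛ)
    comb-+ {suc c} s t e = trans (cong₂ _+ᵛ_ (·ᵛ-distribʳ (s zero) (t zero) (e zero)) (comb-+ {c} (λ j → s (suc j)) (λ j → t (suc j)) (λ j → e (suc j)))) (interchangeᵛ _ _ _ _)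

    comb-∈ : ∀ {c n} (K : Sub n) (t : Fin c → F p) {e : Fin c → V n} → (∀ j → Mem K (e j)) → Mem K (comb t e)
    comb-∈ {zero}  K t e∈ = 0∈ K
    comb-∈ {suc c} K t e∈ = +∈ K (·∈ K (t zero) (e∈ zero)) (comb-∈ K (λ j → t (suc j)) (λ j → e∈ (suc j)))

    _⊆_ : ∀ {n} → Sub n → Sub n → Set
    D ⊆ K = ∀ {x} → Mem D x → Mem K x

    _⊆?_ : ∀ {n} (D K : Sub n) → D ⊆ K ⊎ (∃[ e ] (Mem D e × ¬ Mem K e))
    D ⊆? K with ∃? (λ x → mem? D x ×-dec ¬? (mem? K x))
    ... | yes h = inj₂ h
    ... | no ¬h = inj₁ λ {x} x∈ → go x x∈
      where
      go : ∀ x → Mem D x → Mem K x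
      go x x∈ with mem? K x
      ... | yes h = h
      ... | no ∉ = ⊥-elim (¬h (x , x∈ , ∉))

    -- A basis of a complement of `D` in `K` with its coordinate functions. These are total but
    -- additive on `K` only; `size` is the dimension formula in multiplicative form, through which
    -- codimensions are compared with counts.
    record Complement {n} (D K : Sub n) : Set where
      field
        codim     : ℕ
        basis     : Fin codim → V n
        basis∈    : ∀ j → Mem K (basis j)
        coord     : Fin codim → V n → F p
        coord-+   : ∀ j {x y} → Mem K x → Mem K y → coord j (x +ᵛ y) ≡ coord j x +F coord j y
        remainder : ∀ {x} → Mem K x → Mem D (x ⊖ᵛ comb (λ j → coord j x) basis)
        size      : p ℕ.^ codim ℕ.* count (mem? D) ≡ count (mem? K)

    open Complement public

    complement : ∀ {n} (D K : Sub n) → D ⊆ K → Complement D K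
    complement {n} D K D⊆K = go (count (mem? K)) D D⊆K (ℕP.m≤m+n _ _)
      where
      -- The fuel bounds how much `D` can still grow inside `K`; adjoining an outside vector
      -- multiplies its size by `p`.
      go : ∀ fuel (D : Sub n) → D ⊆ K → count (mem? K) ℕ.≤ fuel ℕ.+ count (mem? D) → Complement D K
      go fuel D D⊆K bound with K ⊆? D
      ... | inj₁ K⊆D = record
        { codim = 0 ; basis = λ () ; basis∈ = λ () ; coord = λ () ; coord-+ = λ ()
        ; remainder = λ {x} x∈ → ⊖∈ D (K⊆D x∈) (0∈ D)
        ; size = trans (ℕP.*-identityˡ _)
            (ℕP.≤-antisym (count-mono (mem? D) (mem? K) D⊆K) (count-mono (mem? K) (mem? D) K⊆D)) }
      ... | inj₂ (e , e∈K , e∉D) = extend fuel bound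
        where
        D′ = adjoin D e
        2count≤ : count (mem? D) ℕ.+ count (mem? D) ℕ.≤ count (mem? D′)
        2count≤ = ℕP.≤-trans (ℕP.≤-reflexive (cong (count (mem? D) ℕ.+_) (sym (ℕP.+-identityʳ _))))
          (ℕP.≤-trans (ℕP.*-monoˡ-≤ (count (mem? D)) 1<p) (ℕP.≤-reflexive (sym (count-adjoin D e∉D))))
        count< : suc (count (mem? D)) ℕ.≤ count (mem? D′)
        count< = ℕP.≤-trans (ℕP.+-monoˡ-≤ (count (mem? D)) (0<count D)) 2count≤
        D′⊆K : D′ ⊆ K
        D′⊆K = adjoin-⊆ D K e D⊆K e∈K
        extend : ∀ fuel → count (mem? K) ℕ.≤ fuel ℕ.+ count (mem? D) → Complement D K
        extend zero bound = ⊥-elim (ℕP.<-irrefl refl (ℕP.≤-trans count< (ℕP.≤-trans (count-mono (mem? D′) (mem? K) D′⊆K) bound)))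
        extend (suc fuel) bound = record
          { codim = suc (codim C)
          ; basis = λ { zero → e ; (suc j) → basis C j }
          ; basis∈ = λ { zero → e∈K ; (suc j) → basis∈ C j }
          ; coord = λ { zero x → τ (rem x) ; (suc j) x → coord C j x }
          ; coord-+ = λ { zero x∈ y∈ → τ-+ x∈ y∈ ; (suc j) x∈ y∈ → coord-+ C j x∈ y∈ }
          ; remainder = λ {x} x∈ → subst (Mem D) (regroup x (τ (rem x) ·ᵛ e) _) (τ-spec (remainder C x∈))
          ; size = trans (ℕP.*-assoc p (p ℕ.^ codim C) (count (mem? D)))
              (trans (ℕP.*-comm p _) (trans (ℕP.*-assoc (p ℕ.^ codim C) (count (mem? D)) p)
              (trans (cong (p ℕ.^ codim C ℕ.*_) (trans (ℕP.*-comm (count (mem? D)) p) (sym (count-adjoin D e∉D)))) (size C)))) }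
          where
          C = go fuel D′ D′⊆K (ℕP.≤-trans bound (ℕP.≤-trans (ℕP.≤-reflexive (sym (ℕP.+-suc fuel _))) (ℕP.+-monoʳ-≤ fuel count<)))
          rem : V n → V n
          rem x = x ⊖ᵛ comb (λ j → coord C j x) (basis C)
          -- The coefficient of `e` is read off from what the other coordinates leave over. The
          -- default `0F` is never met for a member of `K`, whose remainder lies in `D′`.
          τ : V n → F p
          τ z with mem? D′ z
          ... | yes (t , _) = t
          ... | no _        = 0F
          τ-spec : ∀ {z} → Mem D′ z → Mem D (z ⊖ᵛ τ z ·ᵛ e)
          τ-spec {z} z∈ with mem? D′ z
          ... | yes (t , h) = h
          ... | no z∉       = ⊥-elim (z∉ z∈)
          regroup : ∀ {m} (x y z : V m) → (x ⊖ᵛ z) ⊖ᵛ y ≡ x ⊖ᵛ (y +ᵛ z)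
          regroup [] [] [] = refl
          regroup (x ∷ xs) (y ∷ ys) (z ∷ zs) = cong₂ _∷_
            (FS.solve 3 (λ x y z → (x FS.:- z) FS.:- y FS.:= x FS.:- (y FS.:+ z)) refl x y z) (regroup xs ys zs)
          split : ∀ {m} (x y a b : V m) s t (e : V m) →
            ((x ⊖ᵛ a) ⊖ᵛ s ·ᵛ e) +ᵛ ((y ⊖ᵛ b) ⊖ᵛ t ·ᵛ e) ≡ ((x +ᵛ y) ⊖ᵛ (a +ᵛ b)) ⊖ᵛ (s +F t) ·ᵛ e
          split [] [] [] [] s t [] = refl
          split (x ∷ xs) (y ∷ ys) (a ∷ as) (b ∷ bs) s t (e ∷ es) = cong₂ _∷_
            (FS.solve 7 (λ x y a b s t e → ((x FS.:- a) FS.:- s FS.:* e) FS.:+ ((y FS.:- b) FS.:- t FS.:* e)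
              FS.:= ((x FS.:+ y) FS.:- (a FS.:+ b)) FS.:- (s FS.:+ t) FS.:* e) refl x y a b s t e)
            (split xs ys as bs s t es)
          -- The value of `τ` is a chosen witness, so additivity comes from uniqueness: both sides
          -- are coefficients of `e` that bring the same vector into `D`.
          τ-+ : ∀ {x y} → Mem K x → Mem K y → τ (rem (x +ᵛ y)) ≡ τ (rem x) +F τ (rem y)
          τ-+ {x} {y} x∈ y∈ = coset-unique D e∉D (rem (x +ᵛ y)) _ _ (τ-spec (remainder C (+∈ K x∈ y∈)))
            (subst (Mem D) (trans (split x y _ _ (τ (rem x)) (τ (rem y)) e)
                (cong (λ w → ((x +ᵛ y) ⊖ᵛ w) ⊖ᵛ (τ (rem x) +F τ (rem y)) ·ᵛ e)
                  (trans (sym (comb-+ (λ j → coord C j x) (λ j → coord C j y) (basis C))) (comb-cong (basis C) (λ j → sym (coord-+ C j x∈ y∈))))))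
              (+∈ D (τ-spec (remainder C x∈)) (τ-spec (remainder C y∈))))

  -- Counting with sums of subspaces, hyperplanes and bilinear forms.

  module Counting where

    open Sums
    open PrimeField
    open Vectors
    open Subspaces

    infixr 7 _∩_
    _∩_ : ∀ {n} → Sub n → Sub n → Sub n
    A ∩ B = record
      { Mem = λ x → Mem A x × Mem B x ; mem? = λ x → mem? A x ×-dec mem? B x
      ; 0∈ = 0∈ A , 0∈ B ; +∈ = λ (a , b) (c , d) → +∈ A a c , +∈ B b d }

    whole : ∀ {n} → Sub n
    whole = record { Mem = λ _ → ⊤ ; mem? = λ _ → yes tt ; 0∈ = tt ; +∈ = λ _ _ → tt }

    zeroSub : ∀ {n} → Sub n
    zeroSub = record { Mem = _≡ 0ᵛ ; mem? = λ x → VecP.≡-dec FinP._≟_ x 0ᵛ ; 0∈ = refl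
      ; +∈ = λ { refl refl → +ᵛ-identityˡ 0ᵛ } }

    -- The nonempty fibres of (a , b) ↦ a + b on A × B are translates of A ∩ B.
    count-sum-∩ : ∀ {n} (A B : Sub n) {S : V n → Set} (S? : Decidable S) →
      (∀ {x y} → Mem A x → Mem B y → S (x +ᵛ y)) →
      count (mem? A) ℕ.* count (mem? B) ℕ.≤ count S? ℕ.* count (mem? (A ∩ B))
    count-sum-∩ {n} A B {S} S? f = begin
      count (mem? A) ℕ.* count (mem? B)
        ≡⟨ trans (ℕP.*-comm (count (mem? A)) _) (∑ℕ-*ˡ (count (mem? B)) _ pts) ⟩
      ∑ℕ pts (λ x → count (mem? B) ℕ.* 𝟙 (mem? A x))
        ≡⟨ ∑ℕ-cong pts (λ x → trans (ℕP.*-comm (count (mem? B)) _) (trans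
             (cong (𝟙 (mem? A x) ℕ.*_) (sym (count-translate (mem? B) (-ᵛ x))))
             (∑ℕ-*ˡ (𝟙 (mem? A x)) _ pts))) ⟩
      ∑ℕ pts (λ x → ∑ℕ pts (λ z → 𝟙 (mem? A x) ℕ.* 𝟙 (mem? B (z ⊖ᵛ x))))
        ≡⟨ ∑ℕ-swap _ pts pts ⟩
      ∑ℕ pts (λ z → ∑ℕ pts (λ x → 𝟙 (mem? A x) ℕ.* 𝟙 (mem? B (z ⊖ᵛ x))))
        ≤⟨ ∑ℕ-mono pts fibre ⟩
      ∑ℕ pts (λ z → count (mem? (A ∩ B)) ℕ.* 𝟙 (S? z))
        ≡⟨ trans (sym (∑ℕ-*ˡ (count (mem? (A ∩ B))) _ pts)) (ℕP.*-comm (count (mem? (A ∩ B))) _) ⟩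
      count S? ℕ.* count (mem? (A ∩ B)) ∎
      where
      open ℕP.≤-Reasoning
      pts = points p n
      𝟙* : ∀ {P Q : Set} (d : Dec P) (d′ : Dec Q) → 𝟙 d ℕ.* 𝟙 d′ ≡ 𝟙 (d ×-dec d′)
      𝟙* (yes _) (yes _) = refl
      𝟙* (yes _) (no _)  = refl
      𝟙* (no _)  d′      = refl
      recombine : ∀ {m} (x z : V m) → x +ᵛ (z ⊖ᵛ x) ≡ z
      recombine x z = trans (+ᵛ-comm x _) (x-y+y z x)
      swap-diff : ∀ {m} (x y z : V m) → (z ⊖ᵛ y) ⊖ᵛ (z ⊖ᵛ x) ≡ x ⊖ᵛ y
      swap-diff [] [] [] = refl
      swap-diff (x ∷ xs) (y ∷ ys) (z ∷ zs) = cong₂ _∷_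
        (FS.solve 3 (λ x y z → (z FS.:- y) FS.:- (z FS.:- x) FS.:= x FS.:- y) refl x y z) (swap-diff xs ys zs)
      fibre : ∀ z → ∑ℕ pts (λ x → 𝟙 (mem? A x) ℕ.* 𝟙 (mem? B (z ⊖ᵛ x))) ℕ.≤ count (mem? (A ∩ B)) ℕ.* 𝟙 (S? z)
      fibre z with ∃? (λ x → mem? A x ×-dec mem? B (z ⊖ᵛ x))
      ... | yes (y , ay , by) = begin
        ∑ℕ pts (λ x → 𝟙 (mem? A x) ℕ.* 𝟙 (mem? B (z ⊖ᵛ x)))
          ≡⟨ ∑ℕ-cong pts (λ x → 𝟙* (mem? A x) (mem? B (z ⊖ᵛ x))) ⟩
        ∑ℕ pts (λ x → 𝟙 (mem? A x ×-dec mem? B (z ⊖ᵛ x)))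
          ≤⟨ ∑ℕ-mono pts (λ x → 𝟙-mono (mem? A x ×-dec mem? B (z ⊖ᵛ x)) (mem? (A ∩ B) (x ⊖ᵛ y))
               (λ (ax , bx) → ⊖∈ A ax ay , subst (Mem B) (swap-diff x y z) (⊖∈ B by bx))) ⟩
        count (λ x → mem? (A ∩ B) (x ⊖ᵛ y))
          ≡⟨ count-translate (mem? (A ∩ B)) (-ᵛ y) ⟩
        count (mem? (A ∩ B))
          ≡⟨ sym (ℕP.*-identityʳ _) ⟩
        count (mem? (A ∩ B)) ℕ.* 1
          ≡⟨ cong (count (mem? (A ∩ B)) ℕ.*_) (sym (𝟙-yes (S? z) (subst S (recombine y z) (f ay by)))) ⟩
        count (mem? (A ∩ B)) ℕ.* 𝟙 (S? z) ∎
      ... | no ¬h = ℕP.≤-trans (ℕP.≤-reflexive (trans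
        (∑ℕ-cong pts (λ x → trans (𝟙* (mem? A x) (mem? B (z ⊖ᵛ x)))
          (𝟙-no (mem? A x ×-dec mem? B (z ⊖ᵛ x)) (λ h → ¬h (x , h)))))
        (∑ℕ-0 pts))) ℕ.z≤n

    AdditiveOn : ∀ {n} → Sub n → (V n → F p) → Set
    AdditiveOn K φ = ∀ {x y} → Mem K x → Mem K y → φ (x +ᵛ y) ≡ φ x +F φ y

    module _ {n} (K : Sub n) {φ : V n → F p} (φ-+ : AdditiveOn K φ) where

      additive-0 : φ 0ᵛ ≡ 0F
      additive-0 = trans (sym (+F-identityʳ _)) (trans (cong (φ 0ᵛ +F_) (sym (Fp.-‿inverseʳ (φ 0ᵛ))))
        (trans (sym (+F-assoc (φ 0ᵛ) (φ 0ᵛ) (-F φ 0ᵛ)))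
        (trans (cong (_+F -F φ 0ᵛ) (trans (sym (φ-+ (0∈ K) (0∈ K))) (cong φ (+ᵛ-identityˡ 0ᵛ)))) (Fp.-‿inverseʳ (φ 0ᵛ)))))

      additive-· : ∀ t {x} → Mem K x → φ (t ·ᵛ x) ≡ t *F φ x
      additive-· t {x} x∈ = F-induction (λ t → φ (t ·ᵛ x) ≡ t *F φ x)
        (trans (cong φ (·ᵛ-zeroˡ x)) (trans additive-0 (sym (Fp.zeroˡ (φ x)))))
        (λ t ih → begin
          φ ((1F +F t) ·ᵛ x)            ≡⟨ cong φ (·ᵛ-distribʳ 1F t x) ⟩
          φ (1F ·ᵛ x +ᵛ t ·ᵛ x)         ≡⟨ φ-+ (·∈ K 1F x∈) (·∈ K t x∈) ⟩
          φ (1F ·ᵛ x) +F φ (t ·ᵛ x)     ≡⟨ cong₂ _+F_ (trans (cong φ (·ᵛ-identityˡ x)) (sym (Fp.*-identityˡ (φ x)))) ih ⟩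
          1F *F φ x +F t *F φ x         ≡⟨ sym (Fp.distribʳ (φ x) 1F t) ⟩
          (1F +F t) *F φ x              ∎) t
        where open ≡-Reasoning

      normalise : ∀ {h} → Mem K h → φ h ≢ 0F → ∃[ k ] (Mem K k × φ k ≡ 1F)
      normalise {h} h∈ φh≢0 = let (t , tφ≡1) = inverse (φ h) φh≢0 in
        t ·ᵛ h , ·∈ K t h∈ , trans (additive-· t h∈) tφ≡1

      zeros? : Decidable (λ x → Mem K x × φ x ≡ 0F)
      zeros? x = mem? K x ×-dec (φ x FinP.≟ 0F)

      -- For a vector `k` of `K` with `φ k = 1`, the translates of the kernel by the multiples of
      -- `k` partition `K`.
      count-zeros : ∀ {h} → Mem K h → φ h ≢ 0F → p ℕ.* count zeros? ≡ count (mem? K)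
      count-zeros h∈ φh≢0 with normalise h∈ φh≢0
      ... | (k , k∈ , φk≡1) = ℕP.≤-antisym
        (grow-≤ zeros? (mem? K) k
          (λ { x s t (xs , es) (xt , et) → trans (sym (determined x s (in-K x s xs) es)) (determined x t (in-K x s xs) et) })
          (λ x t (xt , _) → in-K x t xt))
        (grow-≥ zeros? (mem? K) k (λ x x∈ → φ x , ⊖∈ K x∈ (·∈ K (φ x) k∈) , vanish x x∈))
        where
        in-K : ∀ x t → Mem K (x ⊖ᵛ t ·ᵛ k) → Mem K x
        in-K x t h = subst (Mem K) (x-y+y x (t ·ᵛ k)) (+∈ K h (·∈ K t k∈))
        decompose : ∀ x t → Mem K x → φ x ≡ φ (x ⊖ᵛ t ·ᵛ k) +F t
        decompose x t x∈ = begin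
          φ x                                     ≡⟨ cong φ (sym (x-y+y x (t ·ᵛ k))) ⟩
          φ ((x ⊖ᵛ t ·ᵛ k) +ᵛ t ·ᵛ k)             ≡⟨ φ-+ (⊖∈ K x∈ (·∈ K t k∈)) (·∈ K t k∈) ⟩
          φ (x ⊖ᵛ t ·ᵛ k) +F φ (t ·ᵛ k)           ≡⟨ cong (φ (x ⊖ᵛ t ·ᵛ k) +F_)
              (trans (additive-· t k∈) (trans (cong (t *F_) φk≡1) (Fp.*-identityʳ t))) ⟩
          φ (x ⊖ᵛ t ·ᵛ k) +F t                    ∎
          where open ≡-Reasoning
        determined : ∀ x t → Mem K x → φ (x ⊖ᵛ t ·ᵛ k) ≡ 0F → φ x ≡ t
        determined x t x∈ e = trans (decompose x t x∈) (trans (cong (_+F t) e) (+F-identityˡ t))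
        vanish : ∀ x → Mem K x → φ (x ⊖ᵛ φ x ·ᵛ k) ≡ 0F
        vanish x x∈ = begin
          w                        ≡⟨ FS.solve 2 (λ w y → w FS.:= (w FS.:+ y) FS.:- y) refl w (φ x) ⟩
          (w +F φ x) ⊖F φ x        ≡⟨ cong (_⊖F φ x) (sym (decompose x (φ x) x∈)) ⟩
          φ x ⊖F φ x               ≡⟨ Fp.-‿inverseʳ (φ x) ⟩
          0F                       ∎
          where
          open ≡-Reasoning
          w = φ (x ⊖ᵛ φ x ·ᵛ k)

    record Biadditive {n} (β : V n → V n → F p) : Set where
      field
        +ˡ : ∀ x y z → β (x +ᵛ y) z ≡ β x z +F β y z
        +ʳ : ∀ x y z → β x (y +ᵛ z) ≡ β x y +F β x z

    module _ {n} {β : V n → V n → F p} (bi : Biadditive β) where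
      open Biadditive bi

      private
        0ˡ : ∀ z → β 0ᵛ z ≡ 0F
        0ˡ z = additive-0 whole {λ x → β x z} (λ _ _ → +ˡ _ _ z)

      perp? : (U K : Sub n) → Decidable (λ u → Mem U u × (∀ k → Mem K k → β u k ≡ 0F))
      perp? U K u = mem? U u ×-dec ∀? (λ k → mem? K k →-dec (β u k FinP.≟ 0F))

      -- The annihilator is taken inside `U`, so `perp U U` is the radical of the form on `U`.
      perp : (U K : Sub n) → Sub n
      perp U K = record
        { Mem = λ u → Mem U u × (∀ k → Mem K k → β u k ≡ 0F)
        ; mem? = perp? U K
        ; 0∈ = 0∈ U , λ k _ → 0ˡ k
        ; +∈ = λ {x} {y} (x∈ , fx) (y∈ , fy) → +∈ U x∈ y∈ ,
            λ k k∈ → trans (+ˡ x y k) (trans (cong₂ _+F_ (fx k k∈) (fy k k∈)) (+F-identityˡ 0F)) }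

      pair-zeros : (U K : Sub n) → ℕ
      pair-zeros U K = ∑ℕ (points p n) (λ u → ∑ℕ (points p n) (λ k →
        𝟙 (mem? U u ×-dec (mem? K k ×-dec (β u k FinP.≟ 0F)))))

      -- For fixed `u` in `U` the map `β u` vanishes on all of `K` if `u` annihilates `K`, and on a
      -- fraction `1 / p` of it otherwise. Times `p`, the row of `u` contributes the size of `K`
      -- with factor `p` or 1, that is, 1 plus `p - 1` times the indicator.
      count-pair-zeros : ∀ (U K : Sub n) →
        p ℕ.* pair-zeros U K ≡ count (mem? K) ℕ.* (count (mem? U) ℕ.+ ℕ.pred p ℕ.* count (perp? U K))
      count-pair-zeros U K = begin
        p ℕ.* pair-zeros U K
          ≡⟨ ∑ℕ-*ˡ p _ pts ⟩
        ∑ℕ pts (λ u → p ℕ.* ∑ℕ pts (λ k → 𝟙 (mem? U u ×-dec (mem? K k ×-dec (β u k FinP.≟ 0F)))))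
          ≡⟨ ∑ℕ-cong pts row ⟩
        ∑ℕ pts (λ u → count (mem? K) ℕ.* (𝟙 (mem? U u) ℕ.+ ℕ.pred p ℕ.* 𝟙 (perp? U K u)))
          ≡⟨ sym (∑ℕ-*ˡ (count (mem? K)) _ pts) ⟩
        count (mem? K) ℕ.* ∑ℕ pts (λ u → 𝟙 (mem? U u) ℕ.+ ℕ.pred p ℕ.* 𝟙 (perp? U K u))
          ≡⟨ cong (count (mem? K) ℕ.*_) (trans (∑ℕ-distrib _ _ pts) (cong (count (mem? U) ℕ.+_) (sym (∑ℕ-*ˡ (ℕ.pred p) _ pts)))) ⟩
        count (mem? K) ℕ.* (count (mem? U) ℕ.+ ℕ.pred p ℕ.* count (perp? U K)) ∎
        where
        open ≡-Reasoning
        pts = points p n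
        row : ∀ u → p ℕ.* ∑ℕ pts (λ k → 𝟙 (mem? U u ×-dec (mem? K k ×-dec (β u k FinP.≟ 0F))))
            ≡ count (mem? K) ℕ.* (𝟙 (mem? U u) ℕ.+ ℕ.pred p ℕ.* 𝟙 (perp? U K u))
        row u with mem? U u
        ... | no _ = trans (cong (p ℕ.*_) (∑ℕ-0 pts)) (trans (ℕP.*-zeroʳ p)
          (sym (trans (cong (count (mem? K) ℕ.*_) (ℕP.*-zeroʳ (ℕ.pred p))) (ℕP.*-zeroʳ (count (mem? K))))))
        ... | yes u∈ with ∀? (λ k → mem? K k →-dec (β u k FinP.≟ 0F))
        ...   | yes all = trans (cong (p ℕ.*_) (∑ℕ-cong pts (λ k → strip (mem? K k ×-dec (β u k FinP.≟ 0F)) (mem? K k) proj₁ (λ k∈ → k∈ , all k k∈))))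
          (trans (ℕP.*-comm p _) (cong (count (mem? K) ℕ.*_) (trans (sym (ℕP.suc-pred p)) (cong suc (sym (ℕP.*-identityʳ (ℕ.pred p)))))))
          where
          strip : ∀ {P Q : Set} (d : Dec P) (e : Dec Q) → (P → Q) → (Q → P) → 𝟙 (yes u∈ ×-dec d) ≡ 𝟙 e
          strip d e f g = 𝟙-cong (yes u∈ ×-dec d) e (λ (_ , x) → f x) (λ y → u∈ , g y)
        ...   | no ¬all with ∃? (λ k → mem? K k ×-dec ¬? (β u k FinP.≟ 0F))
        ...     | no ¬ex = ⊥-elim (¬all λ k k∈ → force k k∈)
          where
          force : ∀ k → Mem K k → β u k ≡ 0F
          force k k∈ with β u k FinP.≟ 0F
          ... | yes e = e
          ... | no ne = ⊥-elim (¬ex (k , k∈ , ne))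
        ...     | yes (k , k∈ , ne) = trans
          (cong (p ℕ.*_) (∑ℕ-cong pts (λ k → 𝟙-cong (yes u∈ ×-dec (mem? K k ×-dec (β u k FinP.≟ 0F)))
            (zeros? K {β u} (λ _ _ → +ʳ u _ _) k) proj₂ (λ h → u∈ , h))))
          (trans (count-zeros K {β u} (λ _ _ → +ʳ u _ _) k∈ ne)
            (sym (trans (cong (λ z → count (mem? K) ℕ.* suc z) (ℕP.*-zeroʳ (ℕ.pred p))) (ℕP.*-identityʳ _))))

    module _ {n} {β : V n → V n → F p} (bi : Biadditive β) (β-sym : ∀ x y → β x y ≡ β y x) where

      -- Row rank equals column rank, by counting {(u , k) : β u k = 0} in both orders.
      count-perp : ∀ (U K : Sub n) →
        count (mem? K) ℕ.* count (perp? bi U K) ≡ count (mem? U) ℕ.* count (perp? bi K U)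
      count-perp U K = ℕP.*-cancelˡ-≡ _ _ (ℕ.pred p) {{ℕ.>-nonZero (ℕP.<⇒≤pred 1<p)}} (ℕP.+-cancelˡ-≡ (u ℕ.* k) _ _ (begin
        u ℕ.* k ℕ.+ q ℕ.* (k ℕ.* a)         ≡⟨ solve 4 (λ u k q a → u :* k :+ q :* (k :* a) := k :* (u :+ q :* a)) refl u k q a ⟩
        k ℕ.* (u ℕ.+ q ℕ.* a)               ≡⟨ sym (count-pair-zeros bi U K) ⟩
        p ℕ.* pair-zeros bi U K             ≡⟨ cong (p ℕ.*_) symmetric ⟩
        p ℕ.* pair-zeros bi K U             ≡⟨ count-pair-zeros bi K U ⟩
        u ℕ.* (k ℕ.+ q ℕ.* b)               ≡⟨ solve 4 (λ u k q b → u :* (k :+ q :* b) := u :* k :+ q :* (u :* b)) refl u k q b ⟩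
        u ℕ.* k ℕ.+ q ℕ.* (u ℕ.* b)         ∎))
        where
        open ≡-Reasoning
        open +-*-Solver
        q = ℕ.pred p
        u = count (mem? U)
        k = count (mem? K)
        a = count (perp? bi U K)
        b = count (perp? bi K U)
        symmetric : pair-zeros bi U K ≡ pair-zeros bi K U
        symmetric = trans (∑ℕ-swap _ (points p n) (points p n)) (∑ℕ-cong (points p n) λ k → ∑ℕ-cong (points p n) λ u →
          𝟙-cong (mem? U u ×-dec (mem? K k ×-dec (β u k FinP.≟ 0F))) (mem? K k ×-dec (mem? U u ×-dec (β k u FinP.≟ 0F)))
            (λ (x , y , e) → y , x , trans (β-sym k u) e) (λ (y , x , e) → x , y , trans (β-sym u k) e))

    opaque

      -- An opaque copy of `count`: in the arithmetic that follows, cardinalities stay symbols and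
      -- do not unfold into sums over all points.
      # : ∀ {n} {P : V n → Set} → Decidable P → ℕ
      # = count

      #≡count : ∀ {n} {P : V n → Set} (P? : Decidable P) → # P? ≡ count P?
      #≡count P? = refl

      #-mono : ∀ {n} {P Q : V n → Set} (P? : Decidable P) (Q? : Decidable Q) → (∀ {x} → P x → Q x) → # P? ℕ.≤ # Q?
      #-mono = count-mono

      #≤p^n : ∀ {n} {P : V n → Set} (P? : Decidable P) → # P? ℕ.≤ p ℕ.^ n
      #≤p^n = count≤p^n

      #-all : ∀ {n} {P : V n → Set} (P? : Decidable P) → (∀ x → P x) → # P? ≡ p ℕ.^ n
      #-all = count-all

      grow : ∀ {n} {B C : V n → Set} (B? : Decidable B) (C? : Decidable C) e →
        (∀ x s t → B (x ⊖ᵛ s ·ᵛ e) → B (x ⊖ᵛ t ·ᵛ e) → s ≡ t) →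
        (∀ x t → B (x ⊖ᵛ t ·ᵛ e) → C x) → p ℕ.* # B? ℕ.≤ # C?
      grow = grow-≤

      0<# : ∀ {n} (D : Sub n) → 0 ℕ.< # (mem? D)
      0<# = 0<count

      #-adjoin : ∀ {n} (D : Sub n) {e} → ¬ Mem D e → # (mem? (adjoin D e)) ≡ p ℕ.* # (mem? D)
      #-adjoin = count-adjoin

      index : ∀ {n} {D K : Sub n} (C : Complement D K) → p ℕ.^ codim C ℕ.* # (mem? D) ≡ # (mem? K)
      index = size

      #-sum-∩ : ∀ {n} (A B : Sub n) {S : V n → Set} (S? : Decidable S) →
        (∀ {x y} → Mem A x → Mem B y → S (x +ᵛ y)) →
        # (mem? A) ℕ.* # (mem? B) ℕ.≤ # S? ℕ.* # (mem? (A ∩ B))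
      #-sum-∩ = count-sum-∩

      #-perp : ∀ {n} {β : V n → V n → F p} (bi : Biadditive β) (β-sym : ∀ x y → β x y ≡ β y x) (U K : Sub n) →
        # (mem? K) ℕ.* # (perp? bi U K) ≡ # (mem? U) ℕ.* # (perp? bi K U)
      #-perp = count-perp

  -- Trilinear forms: many slices of low rank, covering, isotropic subspaces.

  module TrilinearForms where

    open Sums
    open PrimeField
    open Vectors
    open Subspaces
    open Counting

    p^-cancel-≤ : ∀ {i j} → p ℕ.^ i ℕ.≤ p ℕ.^ j → i ℕ.≤ j
    p^-cancel-≤ {i} {j} h with ℕP.≤-<-connex i j
    ... | inj₁ i≤j = i≤j
    ... | inj₂ j<i = ⊥-elim (ℕP.<-irrefl refl (ℕP.<-≤-trans (ℕP.^-monoʳ-< p 1<p j<i) h))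

    p^-mono : ∀ {i j} → i ℕ.≤ j → p ℕ.^ i ℕ.≤ p ℕ.^ j
    p^-mono = ℕP.^-monoʳ-≤ p

    p^>0 : ∀ i → 0 ℕ.< p ℕ.^ i
    p^>0 = ℕP.m^n>0 p

    cancelʳ : ∀ {a b c} → 0 ℕ.< c → a ℕ.* c ℕ.≤ b ℕ.* c → a ℕ.≤ b
    cancelʳ {a} {b} {c} 0<c = ℕP.*-cancelʳ-≤ a b c {{ℕ.>-nonZero 0<c}}

    equal-size : ∀ {n} (D K : Sub n) → D ⊆ K → # (mem? K) ℕ.≤ # (mem? D) → K ⊆ D
    equal-size D K D⊆K le with K ⊆? D
    ... | inj₁ K⊆D = K⊆D
    ... | inj₂ (e , e∈K , e∉D) = ⊥-elim (ℕP.<-irrefl refl (begin-strict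
      # (mem? D)                  ≡⟨ sym (ℕP.*-identityˡ _) ⟩
      1 ℕ.* # (mem? D)            <⟨ ℕP.*-monoˡ-< (# (mem? D)) {{ℕ.>-nonZero (0<# D)}} 1<p ⟩
      p ℕ.* # (mem? D)            ≡⟨ sym (#-adjoin D e∉D) ⟩
      # (mem? (adjoin D e))       ≤⟨ #-mono (mem? (adjoin D e)) (mem? K) (adjoin-⊆ D K e D⊆K e∈K) ⟩
      # (mem? K)                  ≤⟨ le ⟩
      # (mem? D)                  ∎))
      where open ℕP.≤-Reasoning

    argmin : ∀ {n} (W : Sub n) (g : V n → ℕ) → ∃[ a ] (Mem W a × (∀ h → Mem W h → g a ℕ.≤ g h))
    argmin W g = go (g 0ᵛ) 0ᵛ (0∈ W) ℕP.≤-refl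
      where
      go : ∀ fuel a → Mem W a → g a ℕ.≤ fuel → ∃[ a ] (Mem W a × (∀ h → Mem W h → g a ℕ.≤ g h))
      go fuel a a∈ le with ∃? (λ h → mem? W h ×-dec (g h ℕP.<? g a))
      go fuel a a∈ le | no ¬h = a , a∈ , λ h h∈ → ℕP.≮⇒≥ λ lt → ¬h (h , h∈ , lt)
      go zero a a∈ le | yes (h , h∈ , lt) = ⊥-elim (ℕP.n≮0 (ℕP.<-≤-trans lt le))
      go (suc fuel) a a∈ le | yes (h , h∈ , lt) = go fuel h h∈ (ℕP.≤-pred (ℕP.<-≤-trans lt le))

    -- The two adjacent transpositions generate all permutations of the arguments, so additivity in
    -- one slot gives it in every slot.
    record Trilinear {n} (T : V n → V n → V n → F p) : Set where
      field
        +₁  : ∀ x y h k → T (x +ᵛ y) h k ≡ T x h k +F T y h k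
        s₁₂ : ∀ x y z → T x y z ≡ T y x z
        s₂₃ : ∀ x y z → T x y z ≡ T x z y

      biadditive : ∀ h → Biadditive (T h)
      biadditive h = record
        { +ˡ = λ x y z → trans (s₁₂ h _ z) (trans (+₁ x y h z) (cong₂ _+F_ (s₁₂ x h z) (s₁₂ y h z)))
        ; +ʳ = λ x y z → trans (s₂₃ h x _) (trans (s₁₂ h _ x) (trans (+₁ y z h x)
            (cong₂ _+F_ (trans (s₁₂ y h x) (s₂₃ h y x)) (trans (s₁₂ z h x) (s₂₃ h z x))))) }

      +ˣ : ∀ h k → AdditiveOn whole (λ x → T x h k)
      +ˣ h k _ _ = +₁ _ _ h k

    module Structure {n} {T : V n → V n → V n → F p} (tri : Trilinear T) where
      open Trilinear tri

      N : ℕ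
      N = p ℕ.^ n

      rad : V n → Sub n → Sub n
      rad h U = perp (biadditive h) U U

      ker : V n → Sub n
      ker h = rad h whole

      -- This is the condition that `T h` has rank at most `r`, the rank being the codimension of
      -- the kernel. As a record it keeps `r` and `h` inferable.
      record Low (r : ℕ) (h : V n) : Set where
        constructor low
        field #ker-≥ : N ℕ.≤ p ℕ.^ r ℕ.* # (mem? (ker h))

      Low? : ∀ r → Decidable (Low r)
      Low? r h = map′ low Low.#ker-≥ (N ℕP.≤? p ℕ.^ r ℕ.* # (mem? (ker h)))

      Low-mono : ∀ {r s h} → r ℕ.≤ s → Low r h → Low s h
      Low-mono r≤s (low l) = low (ℕP.≤-trans l (ℕP.*-monoˡ-≤ _ (p^-mono r≤s)))

      Low-· : ∀ {r h} t → Low r h → Low r (t ·ᵛ h)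
      Low-· {r} {h} t (low l) = low (ℕP.≤-trans l (ℕP.*-monoʳ-≤ (p ℕ.^ r) (#-mono (mem? (ker h)) (mem? (ker (t ·ᵛ h)))
        (λ {x} (_ , f) → tt , λ k _ → trans (additive-· whole {λ h → T h x k} (+ˣ x k) t {h} tt)
          (trans (cong (t *F_) (f k tt)) (Fp.zeroʳ t))))))

      Low-0 : Low 0 0ᵛ
      Low-0 = low (ℕP.≤-reflexive (sym (trans (ℕP.*-identityˡ _) (#-all (mem? (ker 0ᵛ))
        (λ x → tt , λ k _ → additive-0 whole {λ h → T h x k} (+ˣ x k))))))

      -- The two kernels meet inside the kernel of the sum, and the codimension of an intersection
      -- is at most the sum of the codimensions.
      Low-+ : ∀ {r s h k} → Low r h → Low s k → Low (r ℕ.+ s) (h +ᵛ k)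
      Low-+ {r} {s} {h} {k} (low lh) (low lk) = low (cancelʳ (p^>0 n) (begin
        N ℕ.* N
          ≤⟨ ℕP.*-mono-≤ lh lk ⟩
        (p ℕ.^ r ℕ.* a) ℕ.* (p ℕ.^ s ℕ.* b)
          ≡⟨ solve 4 (λ q a w b → (q :* a) :* (w :* b) := (q :* w) :* (a :* b)) refl (p ℕ.^ r) a (p ℕ.^ s) b ⟩
        (p ℕ.^ r ℕ.* p ℕ.^ s) ℕ.* (a ℕ.* b)
          ≤⟨ ℕP.*-monoʳ-≤ (p ℕ.^ r ℕ.* p ℕ.^ s) (#-sum-∩ (ker h) (ker k) (mem? whole) (λ _ _ → tt)) ⟩
        (p ℕ.^ r ℕ.* p ℕ.^ s) ℕ.* (# {n} (mem? whole) ℕ.* # (mem? (ker h ∩ ker k)))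
          ≤⟨ ℕP.*-monoʳ-≤ (p ℕ.^ r ℕ.* p ℕ.^ s) (ℕP.*-mono-≤ (#≤p^n (mem? (whole {n}))) (#-mono (mem? (ker h ∩ ker k)) (mem? (ker (h +ᵛ k)))
               (λ {x} ((_ , f) , (_ , g)) → tt , λ y _ →
                 trans (+₁ h k x y) (trans (cong₂ _+F_ (f y tt) (g y tt)) (+F-identityˡ 0F))))) ⟩
        (p ℕ.^ r ℕ.* p ℕ.^ s) ℕ.* (N ℕ.* c)
          ≡⟨ solve 3 (λ q N c → q :* (N :* c) := (q :* c) :* N) refl (p ℕ.^ r ℕ.* p ℕ.^ s) N c ⟩
        (p ℕ.^ r ℕ.* p ℕ.^ s) ℕ.* c ℕ.* N
          ≡⟨ cong (λ z → z ℕ.* c ℕ.* N) (sym (ℕP.^-distribˡ-+-* p r s)) ⟩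
        p ℕ.^ (r ℕ.+ s) ℕ.* c ℕ.* N ∎))
        where
        open ℕP.≤-Reasoning
        open +-*-Solver
        a = # (mem? (ker h))
        b = # (mem? (ker k))
        c = # (mem? (ker (h +ᵛ k)))

      -- Greedy covering: as long as some e ∈ 3A lies outside 2A + X, replacing X by
      -- X + ⟨e⟩ multiplies |A + X| by p; when it stops, 2A + X is a subspace.
      module Cover (r : ℕ) (dense : N ℕ.≤ p ℕ.^ r ℕ.* # (Low? r)) where

        A = Low r

        0A : A 0ᵛ
        0A = Low-mono ℕ.z≤n Low-0

        0<#A : 0 ℕ.< # (Low? r)
        0<#A = ℕP.n≢0⇒n>0 λ eq → ℕP.<-irrefl refl
          (ℕP.<-≤-trans (p^>0 n) (ℕP.≤-trans dense (ℕP.≤-reflexive (trans (cong (p ℕ.^ r ℕ.*_) eq) (ℕP.*-zeroʳ (p ℕ.^ r))))))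

        A+ : Sub n → V n → Set
        A+ X x = ∃[ a ] (A a × Mem X (x ⊖ᵛ a))

        A+? : ∀ X → Decidable (A+ X)
        A+? X x = ∃? (λ a → Low? r a ×-dec mem? X (x ⊖ᵛ a))

        2A+ : Sub n → V n → Set
        2A+ X x = ∃[ a ] ∃[ b ] (A a × A b × Mem X (x ⊖ᵛ (a +ᵛ b)))

        2A+? : ∀ X → Decidable (2A+ X)
        2A+? X x = ∃? (λ a → ∃? (λ b → Low? r a ×-dec (Low? r b ×-dec mem? X (x ⊖ᵛ (a +ᵛ b)))))

        Result : Set₁
        Result = Σ[ W ∈ Sub n ] (N ℕ.≤ p ℕ.^ r ℕ.* # (mem? W) × (∀ h → Mem W h → Low ((3 ℕ.* r ℕ.+ 2) ℕ.* r) h))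

        -- The invariant that `A + X` has at least `p ^ j` times the size of `A` allows at most `r`
        -- steps, because `N` is at most `p ^ r` times that size. Each step adjoins a vector of rank
        -- at most `3 r`; the two summands from `A` at the end raise `3 r · r` to `(3 r + 2) r`.
        cover : ∀ fuel j → r ℕ.≤ fuel ℕ.+ j → (X : Sub n) → (∀ x → Mem X x → Low (3 ℕ.* j ℕ.* r) x) →
          p ℕ.^ j ℕ.* # (Low? r) ℕ.≤ # (A+? X) → Result
        cover fuel j r≤ X X-low size with
          ∃? (λ a → ∃? (λ b → ∃? (λ c → (Low? r a ×-dec (Low? r b ×-dec Low? r c)) ×-dec ¬? (2A+? X ((a +ᵛ b) +ᵛ c)))))
        ... | no ¬e = W , ℕP.≤-trans dense (ℕP.*-monoʳ-≤ (p ℕ.^ r) (#-mono (Low? r) (2A+? X) A⊆W)) , W-low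
          where
          j≤r : j ℕ.≤ r
          j≤r = p^-cancel-≤ (cancelʳ 0<#A (ℕP.≤-trans size (ℕP.≤-trans (#≤p^n (A+? X)) dense)))
          3A⊆ : ∀ {a b c} → A a → A b → A c → 2A+ X ((a +ᵛ b) +ᵛ c)
          3A⊆ {a} {b} {c} aA bA cA with 2A+? X ((a +ᵛ b) +ᵛ c)
          ... | yes h = h
          ... | no ¬h = ⊥-elim (¬e (a , b , c , (aA , bA , cA) , ¬h))
          telescope : ∀ {m} (x y ab cd c d ab′ ab″ : V m) → cd ≡ c +ᵛ d →
            ((x ⊖ᵛ ab) +ᵛ (y ⊖ᵛ cd)) +ᵛ (((ab +ᵛ c) ⊖ᵛ ab′) +ᵛ ((ab′ +ᵛ d) ⊖ᵛ ab″)) ≡ (x +ᵛ y) ⊖ᵛ ab″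
          telescope [] [] [] [] [] [] [] [] e = refl
          telescope (x ∷ xs) (y ∷ ys) (a ∷ as) (_ ∷ _) (c ∷ cs) (d ∷ ds) (b ∷ bs) (w ∷ ws) refl = cong₂ _∷_
            (FS.solve 7 (λ x y a c d b w → ((x FS.:- a) FS.:+ (y FS.:- (c FS.:+ d))) FS.:+
                (((a FS.:+ c) FS.:- b) FS.:+ ((b FS.:+ d) FS.:- w)) FS.:= (x FS.:+ y) FS.:- w) refl x y a c d b w)
            (telescope xs ys as _ cs ds bs ws refl)
          W : Sub n
          W = record
            { Mem = 2A+ X ; mem? = 2A+? X
            ; 0∈ = 0ᵛ , 0ᵛ , 0A , 0A , subst (Mem X) (sym (trans (cong (0ᵛ ⊖ᵛ_) (+ᵛ-identityˡ 0ᵛ)) (-ᵛ-inverseʳ 0ᵛ))) (0∈ X)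
            -- In `a + b + c + d` the part `a + b + c` is replaced modulo `X` by some `a′ + b′`, and
            -- then `a′ + b′ + d` by `a″ + b″`: the inclusion of `3A` in `2A + X` is used twice.
            ; +∈ = λ {x} {y} (a , b , aA , bA , h) (c , d , cA , dA , k) →
                let (a′ , b′ , a′A , b′A , h′) = 3A⊆ aA bA cA
                    (a″ , b″ , a″A , b″A , h″) = 3A⊆ a′A b′A dA
                in a″ , b″ , a″A , b″A , subst (Mem X)
                     (telescope x y (a +ᵛ b) (c +ᵛ d) c d (a′ +ᵛ b′) (a″ +ᵛ b″) refl)
                     (+∈ X (+∈ X h k) (+∈ X h′ h″)) }
          A⊆W : ∀ {x} → A x → 2A+ X x
          A⊆W {x} xA = x , 0ᵛ , xA , 0A , subst (Mem X) (sym (trans (cong (x ⊖ᵛ_) (+ᵛ-identityʳ x)) (-ᵛ-inverseʳ x))) (0∈ X)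
          bound : 3 ℕ.* j ℕ.* r ℕ.+ (r ℕ.+ r) ℕ.≤ (3 ℕ.* r ℕ.+ 2) ℕ.* r
          bound = ℕP.≤-trans (ℕP.+-monoˡ-≤ (r ℕ.+ r) (ℕP.*-monoˡ-≤ r (ℕP.*-monoʳ-≤ 3 j≤r)))
            (ℕP.≤-reflexive (solve 1 (λ r → con 3 :* r :* r :+ (r :+ r) := (con 3 :* r :+ con 2) :* r) refl r))
            where open +-*-Solver
          W-low : ∀ h → 2A+ X h → Low ((3 ℕ.* r ℕ.+ 2) ℕ.* r) h
          W-low h (a , b , aA , bA , h∈) = subst (Low _) (x-y+y h (a +ᵛ b)) (Low-mono bound (Low-+ (X-low _ h∈) (Low-+ aA bA)))
        ... | yes (a , b , c , (aA , bA , cA) , e∉) = next fuel r≤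
          where
          e = (a +ᵛ b) +ᵛ c
          X′ = adjoin X e
          e-low : Low (r ℕ.+ r ℕ.+ r) e
          e-low = Low-+ (Low-+ aA bA) cA
          X′-low : ∀ x → Mem X′ x → Low (3 ℕ.* suc j ℕ.* r) x
          X′-low x (t , h) = subst (Low _) (x-y+y x (t ·ᵛ e))
            (Low-mono (ℕP.≤-reflexive (solve 2 (λ j r → con 3 :* j :* r :+ (r :+ r :+ r) := con 3 :* (con 1 :+ j) :* r) refl j r))
              (Low-+ (X-low _ h) (Low-· t e-low)))
            where open +-*-Solver
          identity : ∀ {m} (x : V m) s t (e a b : V m) v →
            v ·ᵛ (((x ⊖ᵛ s ·ᵛ e) ⊖ᵛ a) ⊖ᵛ ((x ⊖ᵛ t ·ᵛ e) ⊖ᵛ b)) ≡ (v *F (t ⊖F s)) ·ᵛ e ⊖ᵛ (v ·ᵛ a +ᵛ (-F v) ·ᵛ b)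
          identity [] s t [] [] [] v = refl
          identity (x ∷ xs) s t (e ∷ es) (a ∷ as) (b ∷ bs) v = cong₂ _∷_
            (FS.solve 7 (λ x s t e a b v → v FS.:* (((x FS.:- s FS.:* e) FS.:- a) FS.:- ((x FS.:- t FS.:* e) FS.:- b))
              FS.:= (v FS.:* (t FS.:- s)) FS.:* e FS.:- (v FS.:* a FS.:+ (FS.:- v) FS.:* b)) refl x s t e a b v)
            (identity xs s t es as bs v)
          -- If two translates of `A + X` along `e` met, a nonzero multiple of `e` would be a
          -- difference of members of `A` modulo `X`. As `A` is closed under scalars, dividing would
          -- put `e` into `2A + X`.
          unique : ∀ x s t → A+ X (x ⊖ᵛ s ·ᵛ e) → A+ X (x ⊖ᵛ t ·ᵛ e) → s ≡ t
          unique x s t (a₁ , a₁A , h₁) (a₂ , a₂A , h₂) with t ⊖F s FinP.≟ 0F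
          ... | yes eq = ⊖F≡0⇒≡ X eq
          ... | no neq = let (v , v1) = inverse (t ⊖F s) neq in
            ⊥-elim (e∉ (v ·ᵛ a₁ , (-F v) ·ᵛ a₂ , Low-· v a₁A , Low-· (-F v) a₂A ,
              subst (Mem X) (trans (identity x s t e a₁ a₂ v)
                  (cong (_⊖ᵛ (v ·ᵛ a₁ +ᵛ (-F v) ·ᵛ a₂)) (trans (cong (_·ᵛ e) v1) (·ᵛ-identityˡ e))))
                (·∈ X v (⊖∈ X h₁ h₂))))
          commute : ∀ {m} (x y z : V m) → (x ⊖ᵛ y) ⊖ᵛ z ≡ (x ⊖ᵛ z) ⊖ᵛ y
          commute [] [] [] = refl
          commute (x ∷ xs) (y ∷ ys) (z ∷ zs) = cong₂ _∷_
            (FS.solve 3 (λ x y z → (x FS.:- y) FS.:- z FS.:= (x FS.:- z) FS.:- y) refl x y z) (commute xs ys zs)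
          size′ : p ℕ.^ suc j ℕ.* # (Low? r) ℕ.≤ # (A+? X′)
          size′ = ℕP.≤-trans (ℕP.≤-reflexive (ℕP.*-assoc p (p ℕ.^ j) _)) (ℕP.≤-trans (ℕP.*-monoʳ-≤ p size)
            (grow (A+? X) (A+? X′) e unique
              (λ x t (a , aA , h) → a , aA , t , subst (Mem X) (commute x (t ·ᵛ e) a) h)))
          next : ∀ fuel → r ℕ.≤ fuel ℕ.+ j → Result
          next zero r≤ = ⊥-elim (ℕP.<-irrefl refl (ℕP.<-≤-trans (ℕ.s≤s r≤)
            (p^-cancel-≤ (cancelʳ 0<#A (ℕP.≤-trans size′ (ℕP.≤-trans (#≤p^n (A+? X′)) dense))))))
          next (suc fuel) r≤ = cover fuel (suc j) (ℕP.≤-trans r≤ (ℕP.≤-reflexive (sym (ℕP.+-suc fuel j)))) X′ X′-low size′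

        result : Result
        result = cover r 0 (ℕP.m≤m+n r 0) zeroSub
          (λ { x refl → Low-mono ℕ.z≤n Low-0 })
          (ℕP.≤-trans (ℕP.≤-reflexive (ℕP.*-identityˡ _)) (#-mono (Low? r) (A+? zeroSub)
            (λ {x} xA → x , xA , -ᵛ-inverseʳ x)))

      -- Restriction to `W` does not raise the rank: `ker h ∩ W` has codimension at most `r` in `W`
      -- and lies in the radical there.
      Low⇒rad : ∀ {r h} (W : Sub n) → Low r h → # (mem? W) ℕ.≤ p ℕ.^ r ℕ.* # (mem? (rad h W))
      Low⇒rad {r} {h} W (low l) = cancelʳ (p^>0 n) (begin
        w ℕ.* N                             ≤⟨ ℕP.*-monoʳ-≤ w l ⟩
        w ℕ.* (p ℕ.^ r ℕ.* k)               ≡⟨ solve 3 (λ w q k → w :* (q :* k) := q :* (k :* w)) refl w (p ℕ.^ r) k ⟩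
        p ℕ.^ r ℕ.* (k ℕ.* w)               ≤⟨ ℕP.*-monoʳ-≤ (p ℕ.^ r) (#-sum-∩ (ker h) W (mem? whole) (λ _ _ → tt)) ⟩
        p ℕ.^ r ℕ.* (# {n} (mem? whole) ℕ.* # (mem? (ker h ∩ W)))
          ≤⟨ ℕP.*-monoʳ-≤ (p ℕ.^ r) (ℕP.*-mono-≤ (#≤p^n (mem? (whole {n}))) (#-mono (mem? (ker h ∩ W)) (mem? (rad h W))
               (λ ((_ , f) , x∈) → x∈ , λ y _ → f y tt))) ⟩
        p ℕ.^ r ℕ.* (N ℕ.* d)               ≡⟨ solve 3 (λ q N d → q :* (N :* d) := (q :* d) :* N) refl (p ℕ.^ r) N d ⟩
        p ℕ.^ r ℕ.* d ℕ.* N                 ∎)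
        where
        open ℕP.≤-Reasoning
        open +-*-Solver
        w = # (mem? W)
        k = # (mem? (ker h))
        d = # (mem? (rad h W))

      -- If K is the radical on U of a member a of a family of forms chosen with |K| minimal,
      -- then every form h of the family pairs K with U in rank at most half the rank of a:
      -- the radicals of h and h + a both annihilate K, and meet inside K.
      half-rank : (U : Sub n) (a h : V n) →
        # (mem? (rad a U)) ℕ.≤ # (mem? (rad h U)) → # (mem? (rad a U)) ℕ.≤ # (mem? (rad (h +ᵛ a) U)) →
        # (mem? (rad a U)) ℕ.* # (mem? (rad a U)) ℕ.* # (mem? (rad a U))
          ℕ.≤ # (mem? U) ℕ.* (# (perp? (biadditive h) (rad a U) U) ℕ.* # (perp? (biadditive h) (rad a U) U))
      half-rank U a h k≤ k≤′ = begin
        k ℕ.* k ℕ.* k                       ≤⟨ ℕP.*-monoˡ-≤ k (ℕP.*-mono-≤ k≤ k≤′) ⟩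
        # (mem? (rad h U)) ℕ.* # (mem? (rad (h +ᵛ a) U)) ℕ.* k
          ≤⟨ ℕP.*-monoˡ-≤ k (#-sum-∩ (rad h U) (rad (h +ᵛ a) U) (perp? (biadditive h) U K) annihilate) ⟩
        c ℕ.* # (mem? (rad h U ∩ rad (h +ᵛ a) U)) ℕ.* k
          ≤⟨ ℕP.*-monoˡ-≤ k (ℕP.*-monoʳ-≤ c (#-mono (mem? (rad h U ∩ rad (h +ᵛ a) U)) (perp? (biadditive h) K U) meet)) ⟩
        c ℕ.* d ℕ.* k                       ≡⟨ solve 3 (λ c d k → c :* d :* k := (k :* c) :* d) refl c d k ⟩
        -- Equality of row and column rank trades `k c` for `d` times the size of `U`; the third
        -- factor `k` was carried along for this exchange.
        (k ℕ.* c) ℕ.* d                     ≡⟨ cong (ℕ._* d) (#-perp (biadditive h) (s₂₃ h) U K) ⟩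
        (# (mem? U) ℕ.* d) ℕ.* d            ≡⟨ ℕP.*-assoc (# (mem? U)) d d ⟩
        # (mem? U) ℕ.* (d ℕ.* d)            ∎
        where
        open ℕP.≤-Reasoning
        open +-*-Solver
        K = rad a U
        k = # (mem? K)
        c = # (perp? (biadditive h) U K)
        d = # (perp? (biadditive h) K U)
        cancel₁ : ∀ u v → T (h +ᵛ a) u v ≡ 0F → T a u v ≡ 0F → T h u v ≡ 0F
        cancel₁ u v e e′ = trans (sym (+F-identityʳ _)) (trans (cong (T h u v +F_) (sym e′)) (trans (sym (+₁ h a u v)) e))
        cancel₂ : ∀ u v → T (h +ᵛ a) u v ≡ 0F → T h u v ≡ 0F → T a u v ≡ 0F
        cancel₂ u v e e′ = trans (sym (+F-identityˡ _)) (trans (cong (_+F T a u v) (sym e′)) (trans (sym (+₁ h a u v)) e))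
        annihilate : ∀ {x y} → Mem (rad h U) x → Mem (rad (h +ᵛ a) U) y → Mem (perp (biadditive h) U K) (x +ᵛ y)
        annihilate (x∈ , f) (y∈ , g) = +∈ (perp (biadditive h) U K)
          (x∈ , λ v v∈ → f v (proj₁ v∈))
          (y∈ , λ v v∈ → cancel₁ _ v (g v (proj₁ v∈)) (trans (s₂₃ a _ v) (proj₂ v∈ _ y∈)))
        meet : ∀ {x} → Mem (rad h U ∩ rad (h +ᵛ a) U) x → Mem (perp (biadditive h) K U) x
        meet ((x∈ , f) , (_ , g)) = (x∈ , λ v v∈ → cancel₂ _ v (g v v∈) (f v v∈)) , f

      Isotropic : Sub n → Sub n → Set
      Isotropic W U = ∀ {h u v} → Mem W h → Mem U u → Mem U v → T h u v ≡ 0F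

      -- With `K = p ^ d D` and `U = p ^ i K` the inequality `K³ ≤ U D²` becomes
      -- `p ^ (2 d) ≤ p ^ i`.
      halved-codim : ∀ {i d D K U} → p ℕ.^ i ℕ.* K ≡ U → p ℕ.^ d ℕ.* D ≡ K → 0 ℕ.< D → 0 ℕ.< K →
        K ℕ.* K ℕ.* K ℕ.≤ U ℕ.* (D ℕ.* D) → d ℕ.≤ ⌊ i /2⌋
      halved-codim {i} {d} {D} {K} {U} refl dD≡K 0<D 0<K h =
        ℕP.≤-trans (ℕP.≤-reflexive (ℕP.n≡⌊n+n/2⌋ d)) (ℕP.⌊n/2⌋-mono
          (p^-cancel-≤ (cancelʳ (ℕP.*-mono-< (ℕP.*-mono-< 0<D 0<D) 0<K) square)))
        where
        open +-*-Solver
        open ℕP.≤-Reasoning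
        square : p ℕ.^ (d ℕ.+ d) ℕ.* (D ℕ.* D ℕ.* K) ℕ.≤ p ℕ.^ i ℕ.* (D ℕ.* D ℕ.* K)
        square = begin
          p ℕ.^ (d ℕ.+ d) ℕ.* (D ℕ.* D ℕ.* K)
            ≡⟨ cong (ℕ._* (D ℕ.* D ℕ.* K)) (ℕP.^-distribˡ-+-* p d d) ⟩
          p ℕ.^ d ℕ.* p ℕ.^ d ℕ.* (D ℕ.* D ℕ.* K)
            ≡⟨ solve 3 (λ q D K → q :* q :* (D :* D :* K) := (q :* D) :* (q :* D) :* K) refl (p ℕ.^ d) D K ⟩
          (p ℕ.^ d ℕ.* D) ℕ.* (p ℕ.^ d ℕ.* D) ℕ.* K
            ≡⟨ cong (λ z → z ℕ.* z ℕ.* K) dD≡K ⟩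
          K ℕ.* K ℕ.* K
            ≤⟨ h ⟩
          (p ℕ.^ i ℕ.* K) ℕ.* (D ℕ.* D)
            ≡⟨ solve 3 (λ q D K → (q :* K) :* (D :* D) := q :* (D :* D :* K)) refl (p ℕ.^ i) D K ⟩
          p ℕ.^ i ℕ.* (D ℕ.* D ℕ.* K) ∎

      halved : (W U : Sub n) (a : V n) → Mem W a →
        (∀ h → Mem W h → # (mem? (rad a U)) ℕ.≤ # (mem? (rad h U))) →
        ∀ i → p ℕ.^ i ℕ.* # (mem? (rad a U)) ≡ # (mem? U) → ∀ h → Mem W h →
        # (mem? (rad a U)) ℕ.≤ p ℕ.^ ⌊ i /2⌋ ℕ.* # (mem? (rad h (rad a U)))
      halved W U a a∈ min i eq h h∈ = bound (complement D K proj₁)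
        where
        K = rad a U
        D = perp (biadditive h) K U
        bound : Complement D K → # (mem? K) ℕ.≤ p ℕ.^ ⌊ i /2⌋ ℕ.* # (mem? (rad h K))
        bound C = ℕP.≤-trans (ℕP.≤-reflexive (sym (index C)))
          (ℕP.*-mono-≤
            (p^-mono {codim C} {⌊ i /2⌋} (halved-codim {i} {codim C} {# (mem? D)} {# (mem? K)} {# (mem? U)}
              eq (index C) (0<# D) (0<# K) (half-rank U a h (min h h∈) (min (h +ᵛ a) (+∈ W h∈ a∈)))))
            (#-mono (mem? D) (mem? (rad h K)) (λ (x∈ , f) → x∈ , λ y y∈ → f y (proj₁ y∈))))

      -- The exponent `2 r` is the bound for the total codimension `r + r / 2 + r / 4 + …` spent on
      -- repeated halving.
      IsotropicIn : Sub n → Sub n → ℕ → Set₁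
      IsotropicIn W U r = Σ[ U′ ∈ Sub n ] (U′ ⊆ U × # (mem? U) ℕ.≤ p ℕ.^ (2 ℕ.* r) ℕ.* # (mem? U′) × Isotropic W U′)

      codim-0 : (W U : Sub n) (a : V n) → ∀ r →
        (∀ h → Mem W h → # (mem? (rad a U)) ℕ.≤ # (mem? (rad h U))) →
        # (mem? U) ℕ.≤ # (mem? (rad a U)) → IsotropicIn W U r
      codim-0 W U a r min le = U , (λ x∈ → x∈)
        , ℕP.≤-trans (ℕP.≤-reflexive (sym (ℕP.*-identityˡ _))) (ℕP.*-monoˡ-≤ _ (p^>0 (2 ℕ.* r)))
        , λ {h} {u} {v} h∈ u∈ v∈ → proj₂ (equal-size (rad h U) U proj₁ (ℕP.≤-trans le (min h h∈)) u∈) v v∈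

      2*half≤ : ∀ i → 2 ℕ.* ⌊ i /2⌋ ℕ.≤ i
      2*half≤ i = ℕP.≤-trans (ℕP.+-monoʳ-≤ ⌊ i /2⌋ (ℕP.≤-trans (ℕP.≤-reflexive (ℕP.+-identityʳ ⌊ i /2⌋)) (ℕP.⌊n/2⌋≤⌈n/2⌉ i)))
        (ℕP.≤-reflexive (ℕP.⌊n/2⌋+⌈n/2⌉≡n i))

      deepen : (W U K : Sub n) → K ⊆ U → ∀ {i r} → i ℕ.≤ r → p ℕ.^ i ℕ.* # (mem? K) ≡ # (mem? U) →
        IsotropicIn W K ⌊ i /2⌋ → IsotropicIn W U r
      deepen W U K K⊆U {i} {r} i≤r eq (U′ , U′⊆K , size′ , iso) = U′ , (λ x∈ → K⊆U (U′⊆K x∈)) , (begin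
            # (mem? U)                                         ≡⟨ sym eq ⟩
            p ℕ.^ i ℕ.* # (mem? K)                             ≤⟨ ℕP.*-monoʳ-≤ (p ℕ.^ i) size′ ⟩
            p ℕ.^ i ℕ.* (p ℕ.^ (2 ℕ.* s) ℕ.* # (mem? U′))      ≡⟨ sym (ℕP.*-assoc (p ℕ.^ i) _ _) ⟩
            p ℕ.^ i ℕ.* p ℕ.^ (2 ℕ.* s) ℕ.* # (mem? U′)        ≡⟨ cong (ℕ._* # (mem? U′)) (sym (ℕP.^-distribˡ-+-* p i (2 ℕ.* s))) ⟩
            p ℕ.^ (i ℕ.+ 2 ℕ.* s) ℕ.* # (mem? U′)              ≤⟨ ℕP.*-monoˡ-≤ (# (mem? U′)) (p^-mono (ℕP.≤-trans (ℕP.+-mono-≤ i≤r (ℕP.≤-trans (2*half≤ i) i≤r))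
                                                                      (ℕP.≤-reflexive (cong (r ℕ.+_) (sym (ℕP.+-identityʳ r)))))) ⟩
            p ℕ.^ (2 ℕ.* r) ℕ.* # (mem? U′)                    ∎) , iso
          where
          open ℕP.≤-Reasoning
          s = ⌊ i /2⌋

      isotropic : (W : Sub n) → ∀ fuel r → r ℕ.≤ fuel → (U : Sub n) →
        (∀ h → Mem W h → # (mem? U) ℕ.≤ p ℕ.^ r ℕ.* # (mem? (rad h U))) → IsotropicIn W U r
      isotropic W fuel r r≤ U U-low = minimal (argmin W (λ h → # (mem? (rad h U))))
        where
        minimal : ∃[ a ] (Mem W a × (∀ h → Mem W h → # (mem? (rad a U)) ℕ.≤ # (mem? (rad h U)))) → IsotropicIn W U r
        minimal (a , a∈ , min) = from (complement (rad a U) U proj₁)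
          where
          -- Here `i` is the maximal rank of the family on `U`. For `i = 0` all its forms vanish
          -- there; otherwise the fuel suffices for the next round since half of `i` is below
          -- `i ≤ r`.
          by-codim : ∀ fuel → r ℕ.≤ fuel → ∀ i → i ℕ.≤ r → p ℕ.^ i ℕ.* # (mem? (rad a U)) ≡ # (mem? U) → IsotropicIn W U r
          by-codim fuel r≤ zero i≤r eq = codim-0 W U a r min (ℕP.≤-reflexive (trans (sym eq) (ℕP.*-identityˡ _)))
          by-codim zero r≤ (suc i) i≤r eq = ⊥-elim (ℕP.n≮0 (ℕP.≤-trans i≤r r≤))
          by-codim (suc fuel) r≤ (suc i) i≤r eq = deepen W U (rad a U) proj₁ {suc i} i≤r eq
            (isotropic W fuel ⌊ suc i /2⌋ (ℕP.≤-trans (ℕP.≤-pred (ℕP.⌊n/2⌋<n i)) (ℕP.≤-pred (ℕP.≤-trans i≤r r≤)))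
              (rad a U) (halved W U a a∈ min (suc i) eq))
          from : Complement (rad a U) U → IsotropicIn W U r
          from C = by-codim fuel r≤ (codim C)
            (p^-cancel-≤ (cancelʳ (0<# (rad a U)) (ℕP.≤-trans (ℕP.≤-reflexive (index C)) (U-low a a∈)))) (index C)

      -- The number of pairs `(h , x)` with `T h x` identically zero, so `Z / N²` is the probability
      -- that bounds δ⁴.
      Z : ℕ
      Z = ∑ℕ (points p n) (λ h → # (mem? (ker h)))

      -- Markov's inequality: each `h` of rank above `k + 2` has a kernel smaller than
      -- `N / p ^ (k + 2)`. The exponent exceeds that of the hypothesis by one, and the gained
      -- factor `p ≥ 2` leaves at least half of `Z` to the forms of low rank.
      dense-low : ∀ k → N ℕ.* N ℕ.≤ Z ℕ.* p ℕ.^ suc k → N ℕ.≤ p ℕ.^ suc (suc k) ℕ.* # (Low? (suc (suc k)))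
      dense-low k h = cancelʳ (p^>0 n) (ℕP.+-cancelʳ-≤ (N ℕ.* N) _ _ (begin
        N ℕ.* N ℕ.+ N ℕ.* N               ≡⟨ solve 1 (λ x → x :+ x := con 2 :* x) refl (N ℕ.* N) ⟩
        2 ℕ.* (N ℕ.* N)                   ≤⟨ ℕP.*-mono-≤ 1<p h ⟩
        p ℕ.* (Z ℕ.* p ℕ.^ suc k)         ≡⟨ solve 3 (λ p Z q → p :* (Z :* q) := (p :* q) :* Z) refl p Z (p ℕ.^ suc k) ⟩
        Q ℕ.* Z                           ≡⟨ ∑ℕ-*ˡ Q _ pts ⟩
        ∑ℕ pts (λ h → Q ℕ.* # (mem? (ker h)))  ≤⟨ ∑ℕ-mono pts bound ⟩
        ∑ℕ pts (λ h → Q ℕ.* N ℕ.* 𝟙 (Low? r h) ℕ.+ N)  ≡⟨ ∑ℕ-distrib _ _ pts ⟩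
        ∑ℕ pts (λ h → Q ℕ.* N ℕ.* 𝟙 (Low? r h)) ℕ.+ ∑ℕ pts (λ _ → N)
          ≡⟨ cong₂ ℕ._+_ (trans (sym (∑ℕ-*ˡ (Q ℕ.* N) _ pts)) (cong (Q ℕ.* N ℕ.*_) (sym (#≡count (Low? r))))) (trans (∑ℕ-const N pts) (cong (ℕ._* N) (length-points n))) ⟩
        Q ℕ.* N ℕ.* # (Low? r) ℕ.+ N ℕ.* N  ≡⟨ cong (ℕ._+ N ℕ.* N) (solve 3 (λ q N a → q :* N :* a := q :* a :* N) refl Q N (# (Low? r))) ⟩
        Q ℕ.* # (Low? r) ℕ.* N ℕ.+ N ℕ.* N  ∎))
        where
        open ℕP.≤-Reasoning
        open +-*-Solver
        pts = points p n
        r = suc (suc k)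
        Q = p ℕ.^ r
        bound : ∀ h → Q ℕ.* # (mem? (ker h)) ℕ.≤ Q ℕ.* N ℕ.* 𝟙 (Low? r h) ℕ.+ N
        bound h with Low? r h
        ... | yes _ = ℕP.≤-trans (ℕP.*-monoʳ-≤ Q (#≤p^n (mem? (ker h)))) (ℕP.≤-trans (ℕP.≤-reflexive (sym (ℕP.*-identityʳ _))) (ℕP.m≤m+n _ N))
        ... | no ¬l = ℕP.≤-trans (ℕP.<⇒≤ (ℕP.≰⇒> (λ le → ¬l (low le)))) (ℕP.m≤n+m N _)

      structure : ∀ k → N ℕ.* N ℕ.≤ Z ℕ.* p ℕ.^ suc k → let r = suc (suc k) in
        Σ[ W ∈ Sub n ] Σ[ U ∈ Sub n ] (U ⊆ W × N ℕ.≤ p ℕ.^ r ℕ.* # (mem? W) ×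
          # (mem? W) ℕ.≤ p ℕ.^ (2 ℕ.* ((3 ℕ.* r ℕ.+ 2) ℕ.* r)) ℕ.* # (mem? U) × Isotropic W U)
      structure k h =
        let (W , W-size , W-low) = Cover.result (suc (suc k)) (dense-low k h)
            r = (3 ℕ.* suc (suc k) ℕ.+ 2) ℕ.* suc (suc k)
            (U , U⊆W , U-size , iso) = isotropic W r r ℕP.≤-refl W (λ h h∈ → Low⇒rad {h = h} W (W-low h h∈))
        in W , U , U⊆W , W-size , U-size , iso

      -- The `h` with `T h = 0` form a proper subspace, hence at most half of the space, and for
      -- every other `h` the kernel is at most half: `1/2 + 1/2 · 1/2 = 3/4`. This keeps δ away from
      -- 1.
      Z-gap : ∀ {x y z} → T x y z ≢ 0F → 4 ℕ.* Z ℕ.≤ 3 ℕ.* (N ℕ.* N)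
      Z-gap {x} {y} {z} T≢0 = begin
        4 ℕ.* Z                                                 ≡⟨ ∑ℕ-*ˡ 4 _ pts ⟩
        ∑ℕ pts (λ h → 4 ℕ.* # (mem? (ker h)))                   ≤⟨ ∑ℕ-mono pts bound ⟩
        ∑ℕ pts (λ h → 2 ℕ.* N ℕ.* 𝟙 (mem? H h) ℕ.+ 2 ℕ.* N)     ≡⟨ ∑ℕ-distrib _ _ pts ⟩
        ∑ℕ pts (λ h → 2 ℕ.* N ℕ.* 𝟙 (mem? H h)) ℕ.+ ∑ℕ pts (λ _ → 2 ℕ.* N)
          ≡⟨ cong₂ ℕ._+_ (trans (sym (∑ℕ-*ˡ (2 ℕ.* N) _ pts)) (cong (2 ℕ.* N ℕ.*_) (sym (#≡count (mem? H))))) (trans (∑ℕ-const (2 ℕ.* N) pts) (cong (ℕ._* (2 ℕ.* N)) (length-points n))) ⟩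
        2 ℕ.* N ℕ.* # (mem? H) ℕ.+ N ℕ.* (2 ℕ.* N)
          ≡⟨ solve 2 (λ N a → con 2 :* N :* a :+ N :* (con 2 :* N) := N :* (con 2 :* a) :+ con 2 :* (N :* N)) refl N (# (mem? H)) ⟩
        N ℕ.* (2 ℕ.* # (mem? H)) ℕ.+ 2 ℕ.* (N ℕ.* N)
          ≤⟨ ℕP.+-monoˡ-≤ _ (ℕP.*-monoʳ-≤ N (proper H {x} (λ x∈ → T≢0 (x∈ y z)))) ⟩
        N ℕ.* N ℕ.+ 2 ℕ.* (N ℕ.* N)                             ∎
        where
        open ℕP.≤-Reasoning
        open +-*-Solver
        pts = points p n
        H : Sub n
        H = record
          { Mem = λ h → ∀ u v → T h u v ≡ 0F
          ; mem? = λ h → ∀? (λ u → ∀? (λ v → T h u v FinP.≟ 0F))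
          ; 0∈ = λ u v → additive-0 whole {λ h → T h u v} (+ˣ u v)
          ; +∈ = λ f g u v → trans (+₁ _ _ u v) (trans (cong₂ _+F_ (f u v) (g u v)) (+F-identityˡ 0F)) }
        proper : (D : Sub n) → ∀ {e} → ¬ Mem D e → 2 ℕ.* # (mem? D) ℕ.≤ N
        proper D {e} e∉ = ℕP.≤-trans (ℕP.*-monoˡ-≤ (# (mem? D)) 1<p)
          (ℕP.≤-trans (ℕP.≤-reflexive (sym (#-adjoin D e∉))) (#≤p^n (mem? (adjoin D e))))
        bound : ∀ h → 4 ℕ.* # (mem? (ker h)) ℕ.≤ 2 ℕ.* N ℕ.* 𝟙 (mem? H h) ℕ.+ 2 ℕ.* N
        bound h with mem? H h
        ... | yes _ = ℕP.≤-trans (ℕP.*-monoʳ-≤ 4 (#≤p^n (mem? (ker h))))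
          (ℕP.≤-reflexive (solve 1 (λ N → con 4 :* N := con 2 :* N :* con 1 :+ con 2 :* N) refl N))
        ... | no h∉ with whole ⊆? ker h
        ...   | inj₁ all = ⊥-elim (h∉ (λ u v → proj₂ (all {u} tt) v tt))
        ...   | inj₂ (e , _ , e∉) = ℕP.≤-trans (ℕP.≤-reflexive (ℕP.*-assoc 2 2 (# (mem? (ker h)))))
          (ℕP.≤-trans (ℕP.*-monoʳ-≤ 2 (proper (ker h) e∉)) (ℕP.m≤n+m (2 ℕ.* N) (2 ℕ.* N ℕ.* 0)))

  -- Degrees of functions and finite differences.

  module Polynomials where

    open Sums
    open PrimeField
    open Vectors
    open Subspaces
    open Counting
    open TrilinearForms

    -- An inductive counterpart of `DegreeAtMost`, with conversions in both directions below.
    -- Statements on degrees become inductions on derivations; `ext` accounts for equality of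
    -- functions.
    data Deg {n : ℕ} : ℕ → Fun p n → Set where
      const : ∀ {d} c → Deg d (λ _ → c)
      var*  : ∀ {d g} i → Deg d g → Deg (suc d) (λ x → lookup x i *F g x)
      add   : ∀ {d f g} → Deg d f → Deg d g → Deg d (λ x → f x +F g x)
      ext   : ∀ {d f g} → (∀ x → f x ≡ g x) → Deg d f → Deg d g

    module _ {n : ℕ} where

      Deg-mono : ∀ {d e} {f : Fun p n} → d ℕ.≤ e → Deg d f → Deg e f
      Deg-mono d≤e       (const c)  = const c
      Deg-mono (ℕ.s≤s d≤e) (var* i D) = var* i (Deg-mono d≤e D)
      Deg-mono d≤e       (add D E)  = add (Deg-mono d≤e D) (Deg-mono d≤e E)
      Deg-mono d≤e       (ext h D)  = ext h (Deg-mono d≤e D)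

      Deg-scale : ∀ {d} {f : Fun p n} c → Deg d f → Deg d (λ x → c *F f x)
      Deg-scale c (const c′) = const (c *F c′)
      Deg-scale c (var* {g = g} i D) = ext
        (λ x → FS.solve 3 (λ v c g → v FS.:* (c FS.:* g) FS.:= c FS.:* (v FS.:* g)) refl (lookup x i) c (g x))
        (var* i (Deg-scale c D))
      Deg-scale c (add {f = f} {g} D E) = ext (λ x → sym (Fp.distribˡ c (f x) (g x))) (add (Deg-scale c D) (Deg-scale c E))
      Deg-scale c (ext h D) = ext (λ x → cong (c *F_) (h x)) (Deg-scale c D)

      Deg-* : ∀ {d e} {f g : Fun p n} → Deg d f → Deg e g → Deg (d ℕ.+ e) (λ x → f x *F g x)
      Deg-* {d} (const c) E = Deg-mono (ℕP.m≤n+m _ d) (Deg-scale c E)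
      Deg-* {g = g} (var* {g = f} i D) E = ext (λ x → sym (*F-assoc (lookup x i) (f x) (g x))) (var* i (Deg-* D E))
      Deg-* {g = g} (add {f = f} {f′} D D′) E = ext (λ x → sym (Fp.distribʳ (g x) (f x) (f′ x))) (add (Deg-* D E) (Deg-* D′ E))
      Deg-* {g = g} (ext h D) E = ext (λ x → cong (_*F g x) (h x)) (Deg-* D E)

      Deg-var : ∀ i → Deg {n} 1 (λ x → lookup x i)
      Deg-var i = ext (λ x → Fp.*-identityʳ (lookup x i)) (var* i (const 1F))

      Deg-neg : ∀ {d} {f : Fun p n} → Deg d f → Deg d (λ x → -F f x)
      Deg-neg {f = f} D = ext (λ x → trans (FS.solve 2 (λ i y → (FS.:- i) FS.:* y FS.:= FS.:- (i FS.:* y)) refl 1F (f x))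
        (cong (λ y → -F y) (*F-identityˡ (f x)))) (Deg-scale (-F 1F) D)

      Deg-0-constant : ∀ {f : Fun p n} → Deg 0 f → ∀ x y → f x ≡ f y
      Deg-0-constant (const c) x y = refl
      Deg-0-constant (add D E) x y = cong₂ _+F_ (Deg-0-constant D x y) (Deg-0-constant E x y)
      Deg-0-constant (ext h D) x y = trans (sym (h x)) (trans (Deg-0-constant D x y) (h y))

    Deg-∘ : ∀ {m n d} {f : Fun p n} (ψ : V m → V n) → (∀ i → Deg 1 (λ x → lookup (ψ x) i)) → Deg d f → Deg d (λ x → f (ψ x))
    Deg-∘ ψ L (const c) = const c
    Deg-∘ ψ L (var* i D) = Deg-* (L i) (Deg-∘ ψ L D)
    Deg-∘ ψ L (add D E) = add (Deg-∘ ψ L D) (Deg-∘ ψ L E)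
    Deg-∘ ψ L (ext h D) = ext (λ x → h (ψ x)) (Deg-∘ ψ L D)

    Coordinatewise : ∀ {m n} → ℕ → (V m → V n) → Set
    Coordinatewise d ψ = ∀ i → Deg d (λ x → lookup (ψ x) i)

    lookup-+ᵛ : ∀ {n} (x y : V n) i → lookup (x +ᵛ y) i ≡ lookup x i +F lookup y i
    lookup-+ᵛ x y i = VecP.lookup-zipWith _+F_ i x y

    lookup-·ᵛ : ∀ {n} t (x : V n) i → lookup (t ·ᵛ x) i ≡ t *F lookup x i
    lookup-·ᵛ t x i = VecP.lookup-map i (t *F_) x

    lookup-⊖ᵛ : ∀ {n} (x y : V n) i → lookup (x ⊖ᵛ y) i ≡ lookup x i ⊖F lookup y i
    lookup-⊖ᵛ x y i = trans (lookup-+ᵛ x (-ᵛ y) i) (cong (lookup x i +F_) (VecP.lookup-map i (λ a → -F a) y))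

    module _ {m n : ℕ} where

      affine-+ : ∀ (ψ χ : V m → V n) → Coordinatewise 1 ψ → Coordinatewise 1 χ → Coordinatewise 1 (λ x → ψ x +ᵛ χ x)
      affine-+ ψ χ L M i = ext (λ x → sym (lookup-+ᵛ (ψ x) (χ x) i)) (add (L i) (M i))

      affine-⊖ : ∀ (ψ χ : V m → V n) → Coordinatewise 1 ψ → Coordinatewise 1 χ → Coordinatewise 1 (λ x → ψ x ⊖ᵛ χ x)
      affine-⊖ ψ χ L M i = ext (λ x → sym (lookup-⊖ᵛ (ψ x) (χ x) i)) (add (L i) (Deg-neg (M i)))

      affine-· : ∀ {ℓ : Fun p m} (e : V n) → Deg 1 ℓ → Coordinatewise 1 (λ x → ℓ x ·ᵛ e)
      affine-· {ℓ} e D i = ext (λ x → trans (*F-comm (lookup e i) (ℓ x)) (sym (lookup-·ᵛ (ℓ x) e i))) (Deg-scale (lookup e i) D)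

      affine-const : ∀ (e : V n) → Coordinatewise 1 (λ (x : V m) → e)
      affine-const e i = const (lookup e i)

    affine-id : ∀ {n} → Coordinatewise 1 (λ (x : V n) → x)
    affine-id i = Deg-var i

    affine-comb : ∀ {m n c} {ℓ : Fin c → Fun p m} (e : Fin c → V n) → (∀ j → Deg 1 (ℓ j)) →
      Coordinatewise 1 (λ x → comb (λ j → ℓ j x) e)
    affine-comb {c = zero}  e D = affine-const 0ᵛ
    affine-comb {c = suc c} {ℓ} e D = affine-+ (λ x → ℓ zero x ·ᵛ e zero) (λ x → comb (λ j → ℓ (suc j) x) (λ j → e (suc j))) (affine-· (e zero) (D zero)) (affine-comb (λ j → e (suc j)) (λ j → D (suc j)))

    additive⇒Deg-1 : ∀ {n} {φ : V n → F p} → AdditiveOn whole φ → Deg 1 φ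
    additive⇒Deg-1 {zero} {φ} φ-+ = ext (λ { [] → refl }) (const (φ []))
    additive⇒Deg-1 {suc n} {φ} φ-+ = ext split
      (add (Deg-scale (φ (1F ∷ 0ᵛ)) (Deg-var zero))
        (Deg-∘ Vec.tail (λ i → ext (λ { (x ∷ xs) → refl }) (Deg-var (suc i)))
          (additive⇒Deg-1 {n} {λ xs → φ (0F ∷ xs)}
            (λ {x} {y} _ _ → trans (cong (λ z → φ (z ∷ (x +ᵛ y))) (sym (+F-identityˡ 0F))) (φ-+ {0F ∷ x} {0F ∷ y} tt tt)))))
      where
      split : ∀ x → φ (1F ∷ 0ᵛ) *F lookup x zero +F φ (0F ∷ Vec.tail x) ≡ φ x
      split (x ∷ xs) = begin
        φ (1F ∷ 0ᵛ) *F x +F φ (0F ∷ xs)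
          ≡⟨ cong (_+F φ (0F ∷ xs)) (trans (*F-comm _ x) (sym (additive-· whole {φ} φ-+ x {1F ∷ 0ᵛ} tt))) ⟩
        φ (x ·ᵛ (1F ∷ 0ᵛ)) +F φ (0F ∷ xs)
          ≡⟨ sym (φ-+ tt tt) ⟩
        φ (x ·ᵛ (1F ∷ 0ᵛ) +ᵛ (0F ∷ xs))
          ≡⟨ cong φ (cong₂ _∷_ (trans (+F-identityʳ _) (Fp.*-identityʳ x)) (trans (cong (_+ᵛ xs) (·-0 x)) (+ᵛ-identityˡ xs))) ⟩
        φ (x ∷ xs) ∎
        where
        open ≡-Reasoning
        ·-0 : ∀ {m} t → t ·ᵛ 0ᵛ {m} ≡ 0ᵛ
        ·-0 {zero}  t = refl
        ·-0 {suc m} t = cong₂ _∷_ (Fp.zeroʳ t) (·-0 t)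

    Deg-^ : ∀ {n} (i : Fin n) e → Deg e (λ x → lookup x i ^F e)
    Deg-^ i zero    = const 1F
    Deg-^ i (suc e) = var* i (Deg-^ i e)

    Deg-monomial : ∀ {n} (es : Vec ℕ n) → Deg (Vec.sum es) (evalMonomial es)
    Deg-monomial [] = ext (λ { [] → refl }) (const 1F)
    Deg-monomial (e ∷ es) = ext (λ { (x ∷ xs) → refl })
      (Deg-* (Deg-^ zero e) (Deg-∘ Vec.tail (λ i → ext (λ { (x ∷ xs) → refl }) (Deg-var (suc i))) (Deg-monomial es)))

    DegreeAtMost⇒Deg : ∀ {n d} {f : Fun p n} → DegreeAtMost d f → Deg d f
    DegreeAtMost⇒Deg {n} {d} (P , P≤ , eq) = ext (λ x → sym (eq x)) (Deg-eval P P≤)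
      where
      Deg-eval : ∀ P → totalDegree≤ P d → Deg d (eval P)
      Deg-eval [] [] = const 0F
      Deg-eval ((c , es) ∷ P) (le ∷ les) = add (Deg-scale c (Deg-mono le (Deg-monomial es))) (Deg-eval P les)

    Deg⇒DegreeAtMost : ∀ {n d} {f : Fun p n} → Deg d f → DegreeAtMost d f
    Deg⇒DegreeAtMost {n} {d} (const c) = ((c , Vec.replicate n 0) ∷ []) , (ℕP.≤-trans (ℕP.≤-reflexive (sum-zeros n)) ℕ.z≤n ∷ [])
      , λ a → sym (trans (+F-identityʳ _) (trans (cong (c *F_) (monomial-zeros n a)) (Fp.*-identityʳ c)))
      where
      sum-zeros : ∀ n → Vec.sum (Vec.replicate n 0) ≡ 0
      sum-zeros zero    = refl
      sum-zeros (suc n) = sum-zeros n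
      monomial-zeros : ∀ n (a : V n) → evalMonomial (Vec.replicate n 0) a ≡ 1F
      monomial-zeros zero    []      = refl
      monomial-zeros (suc n) (a ∷ as) = trans (cong (1F *F_) (monomial-zeros n as)) (*F-identityˡ 1F)
    Deg⇒DegreeAtMost {n} {suc d} (var* {g = g} i D) = let (P , P≤ , eq) = Deg⇒DegreeAtMost D in
      List.map bump P , AllP.map⁺ (All.map (λ {t} le → ℕP.≤-trans (ℕP.≤-reflexive (sum-bump (proj₂ t) i)) (ℕ.s≤s le)) P≤) ,
      λ a → trans (cong (lookup a i *F_) (eq a)) (sym (eval-bump P a))
      where
      bump : F p × Vec ℕ n → F p × Vec ℕ n
      bump (c , es) = c , Vec.updateAt es i suc
      sum-bump : ∀ {n} (es : Vec ℕ n) i → Vec.sum (Vec.updateAt es i suc) ≡ suc (Vec.sum es)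
      sum-bump (e ∷ es) zero    = refl
      sum-bump (e ∷ es) (suc i) = trans (cong (e ℕ.+_) (sum-bump es i)) (ℕP.+-suc e _)
      monomial-bump : ∀ {n} (es : Vec ℕ n) i (a : V n) → evalMonomial (Vec.updateAt es i suc) a ≡ lookup a i *F evalMonomial es a
      monomial-bump (e ∷ es) zero (a ∷ as) = *F-assoc a (a ^F e) (evalMonomial es as)
      monomial-bump (e ∷ es) (suc i) (a ∷ as) = trans (cong (a ^F e *F_) (monomial-bump es i as))
        (FS.solve 3 (λ x v m → x FS.:* (v FS.:* m) FS.:= v FS.:* (x FS.:* m)) refl (a ^F e) (lookup as i) (evalMonomial es as))
      eval-bump : ∀ P a → eval (List.map bump P) a ≡ lookup a i *F eval P a
      eval-bump [] a = sym (Fp.zeroʳ (lookup a i))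
      eval-bump ((c , es) ∷ P) a = trans (cong₂ _+F_ (cong (c *F_) (monomial-bump es i a)) (eval-bump P a))
        (FS.solve 4 (λ c v m r → c FS.:* (v FS.:* m) FS.:+ v FS.:* r FS.:= v FS.:* (c FS.:* m FS.:+ r)) refl
          c (lookup a i) (evalMonomial es a) (eval P a))
    Deg⇒DegreeAtMost (add D E) = let (P , P≤ , eq) = Deg⇒DegreeAtMost D ; (Q , Q≤ , eq′) = Deg⇒DegreeAtMost E in
      P ++ Q , AllP.++⁺ P≤ Q≤ , λ a → trans (cong₂ _+F_ (eq a) (eq′ a)) (sym (eval-++ P Q a))
      where
      eval-++ : ∀ {n} (P Q : Poly p n) a → eval (P ++ Q) a ≡ eval P a +F eval Q a
      eval-++ [] Q a = sym (+F-identityˡ _)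
      eval-++ ((c , es) ∷ P) Q a = trans (cong (c *F evalMonomial es a +F_) (eval-++ P Q a)) (sym (+F-assoc (c *F evalMonomial es a) (eval P a) (eval Q a)))
    Deg⇒DegreeAtMost (ext h D) = let (P , P≤ , eq) = Deg⇒DegreeAtMost D in P , P≤ , λ a → trans (sym (h a)) (eq a)

    Δ : ∀ {n} → V n → Fun p n → Fun p n
    Δ h f x = f (x +ᵛ h) ⊖F f x

    module _ {n : ℕ} where

      Δ-cong : ∀ {f g : Fun p n} h → (∀ x → f x ≡ g x) → ∀ x → Δ h f x ≡ Δ h g x
      Δ-cong h e x = cong₂ _⊖F_ (e (x +ᵛ h)) (e x)

      Deg-translate : ∀ {d} {f : Fun p n} h → Deg d f → Deg d (λ x → f (x +ᵛ h))
      Deg-translate h D = Deg-∘ (_+ᵛ h) (affine-+ (λ x → x) (λ _ → h) affine-id (affine-const h)) D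

      Deg-Δ : ∀ {d} {f : Fun p n} h → Deg (suc d) f → Deg d (Δ h f)
      Deg-Δ h (const c) = ext (λ x → sym (Fp.-‿inverseʳ c)) (const 0F)
      Deg-Δ {d} h (var* {g = g} i D) = ext
        (λ x → sym (trans (cong (λ w → w *F g (x +ᵛ h) ⊖F lookup x i *F g x) (lookup-+ᵛ x h i))
          (FS.solve 4 (λ x h g′ g → (x FS.:+ h) FS.:* g′ FS.:- x FS.:* g FS.:= x FS.:* (g′ FS.:- g) FS.:+ h FS.:* g′) refl
            (lookup x i) (lookup h i) (g (x +ᵛ h)) (g x))))
        (add (by-degree d D) (Deg-scale (lookup h i) (Deg-translate h D)))
        where
        -- For `d = 0` multiplying by the variable would exceed the degree allowed, but then `g` is
        -- constant and its difference is zero.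
        by-degree : ∀ d → Deg d g → Deg d (λ x → lookup x i *F Δ h g x)
        by-degree zero D = ext (λ x → sym (trans (cong (lookup x i *F_)
          (trans (cong (_⊖F g x) (Deg-0-constant D (x +ᵛ h) x)) (Fp.-‿inverseʳ (g x)))) (Fp.zeroʳ (lookup x i)))) (const 0F)
        by-degree (suc d) D = var* i (Deg-Δ h D)
      Deg-Δ h (add {f = f} {g} D E) = ext
        (λ x → FS.solve 4 (λ a b c d → (a FS.:- b) FS.:+ (c FS.:- d) FS.:= (a FS.:+ c) FS.:- (b FS.:+ d)) refl
          (f (x +ᵛ h)) (f x) (g (x +ᵛ h)) (g x))
        (add (Deg-Δ h D) (Deg-Δ h E))
      Deg-Δ h (ext e D) = ext (Δ-cong h e) (Deg-Δ h D)

      +ᵛ-swap : ∀ (x y z : V n) → (x +ᵛ y) +ᵛ z ≡ (x +ᵛ z) +ᵛ y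
      +ᵛ-swap x y z = trans (+ᵛ-assoc x y z) (trans (cong (x +ᵛ_) (+ᵛ-comm y z)) (sym (+ᵛ-assoc x z y)))

      Δ-comm : ∀ (g : Fun p n) h k a → Δ h (Δ k g) a ≡ Δ k (Δ h g) a
      Δ-comm g h k a = trans
        (FS.solve 4 (λ w x y z → (w FS.:- x) FS.:- (y FS.:- z) FS.:= (w FS.:- y) FS.:- (x FS.:- z)) refl
          (g ((a +ᵛ h) +ᵛ k)) (g (a +ᵛ h)) (g (a +ᵛ k)) (g a))
        (cong (λ w → (w ⊖F g (a +ᵛ k)) ⊖F (g (a +ᵛ h) ⊖F g a)) (cong g (+ᵛ-swap a h k)))

      Δ-+ : ∀ (g : Fun p n) h k a → Δ (h +ᵛ k) g a ≡ Δ h g a +F Δ k g (a +ᵛ h)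
      Δ-+ g h k a = trans (cong (λ w → g w ⊖F g a) (sym (+ᵛ-assoc a h k)))
        (FS.solve 3 (λ x y z → x FS.:- z FS.:= (y FS.:- z) FS.:+ (x FS.:- y)) refl (g ((a +ᵛ h) +ᵛ k)) (g (a +ᵛ h)) (g a))

    third : ∀ {n} → Fun p n → V n → V n → V n → F p
    third f x y z = Δ x (Δ y (Δ z f)) 0ᵛ

    module Third {n} {f : Fun p n} (third-const : ∀ x y z a b → Δ x (Δ y (Δ z f)) a ≡ Δ x (Δ y (Δ z f)) b) where

      -- A second difference is affine in its base point with slope `third f`. The module assumes
      -- constant third differences and no degree, so that it also applies where the degree is yet
      -- to be derived.
      Δ²-+ : ∀ h k a l → Δ h (Δ k f) (a +ᵛ l) ≡ Δ h (Δ k f) a +F third f l h k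
      Δ²-+ h k a l = trans (FS.solve 2 (λ x y → x FS.:= y FS.:+ (x FS.:- y)) refl (Δ h (Δ k f) (a +ᵛ l)) (Δ h (Δ k f) a))
        (cong (Δ h (Δ k f) a +F_) (third-const l h k a 0ᵛ))

      trilinear : Trilinear (third f)
      trilinear = record
        { +₁  = λ x y h k → trans (Δ-+ (Δ h (Δ k f)) x y 0ᵛ) (cong (third f x h k +F_) (third-const y h k (0ᵛ +ᵛ x) 0ᵛ))
        ; s₁₂ = λ x y z → Δ-comm (Δ z f) x y 0ᵛ
        ; s₂₃ = λ x y z → Δ-cong x (Δ-comm f y z) 0ᵛ }

    third-constant : ∀ {n} {f : Fun p n} → Deg 3 f → ∀ x y z a b → Δ x (Δ y (Δ z f)) a ≡ Δ x (Δ y (Δ z f)) b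
    third-constant D x y z = Deg-0-constant (Deg-Δ x (Deg-Δ y (Deg-Δ z D)))

    -- Newton's formula `γ 0 + δ 0 t + b t (t - 1) / 2`. In characteristic 2, where 2 has no
    -- inverse, the field has just the points 0 and 1, and affine interpolation does it.
    Deg-2-univariate : ∀ {γ δ : F p → F p} {b} → (∀ t → γ (1F +F t) ≡ γ t +F δ t) → (∀ t → δ (1F +F t) ≡ δ t +F b) →
      ∀ {n} (i : Fin n) → Deg 2 (λ x → γ (lookup x i))
    Deg-2-univariate {γ} {δ} {b} γ-step δ-step i with 1F +F 1F FinP.≟ 0F
    ... | yes 2≡0 = ext (λ x → sym (formula (lookup x i)))
      (add (const (γ 0F)) (Deg-mono (ℕ.s≤s ℕ.z≤n) (Deg-scale (γ 1F ⊖F γ 0F) (Deg-var i))))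
      where
      0∨1 : ∀ t → t ≡ 0F ⊎ t ≡ 1F
      0∨1 = F-induction _ (inj₁ refl) λ { t (inj₁ refl) → inj₂ (+F-identityʳ 1F) ; t (inj₂ refl) → inj₁ 2≡0 }
      formula : ∀ t → γ t ≡ γ 0F +F (γ 1F ⊖F γ 0F) *F t
      formula t with 0∨1 t
      ... | inj₁ refl = sym (trans (cong (γ 0F +F_) (Fp.zeroʳ (γ 1F ⊖F γ 0F))) (+F-identityʳ (γ 0F)))
      ... | inj₂ refl = sym (trans (cong (γ 0F +F_) (Fp.*-identityʳ (γ 1F ⊖F γ 0F)))
        (FS.solve 2 (λ x y → y FS.:+ (x FS.:- y) FS.:= x) refl (γ 1F) (γ 0F)))
    ... | no 2≢0 = ext (λ x → sym (formula (lookup x i)))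
      (add (add (const (γ 0F)) (Deg-mono (ℕ.s≤s ℕ.z≤n) (Deg-scale (δ 0F) (Deg-var i))))
        (Deg-scale (w *F b) (var* i (add (Deg-var i) (const (-F 1F))))))
      where
      w = proj₁ (inverse (1F +F 1F) 2≢0)
      w2≡1 = proj₂ (inverse (1F +F 1F) 2≢0)
      δ-formula : ∀ t → δ t ≡ δ 0F +F t *F b
      δ-formula = F-induction _ (sym (trans (cong (δ 0F +F_) (Fp.zeroˡ b)) (+F-identityʳ _)))
        λ t ih → trans (δ-step t) (trans (cong (_+F b) ih) (trans (cong (λ c → (δ 0F +F t *F b) +F c) (sym (*F-identityˡ b)))
          (FS.solve 4 (λ d t b i → (d FS.:+ t FS.:* b) FS.:+ i FS.:* b FS.:= d FS.:+ (i FS.:+ t) FS.:* b) refl (δ 0F) t b 1F)))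
      formula : ∀ t → γ t ≡ (γ 0F +F δ 0F *F t) +F (w *F b) *F (t *F (t +F -F 1F))
      formula = F-induction _
        (FS.solve 5 (λ g d w b i → g FS.:= (g FS.:+ d FS.:* FS.con (+ 0)) FS.:+ (w FS.:* b) FS.:* (FS.con (+ 0) FS.:* (FS.con (+ 0) FS.:- i)))
          refl (γ 0F) (δ 0F) w b 1F)
        λ t ih → begin
          γ (1F +F t)
            ≡⟨ trans (γ-step t) (cong₂ _+F_ ih (δ-formula t)) ⟩
          ((γ 0F +F δ 0F *F t) +F (w *F b) *F (t *F (t +F -F 1F))) +F (δ 0F +F t *F b)
            ≡⟨ cong (λ u → ((γ 0F +F δ 0F *F t) +F (w *F b) *F (t *F (t +F -F 1F))) +F (δ 0F +F t *F u))
                 (trans (sym (*F-identityˡ b)) (cong (_*F b) (sym w2≡1))) ⟩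
          ((γ 0F +F δ 0F *F t) +F (w *F b) *F (t *F (t +F -F 1F))) +F (δ 0F +F t *F ((w *F (1F +F 1F)) *F b))
            ≡⟨ FS.solve 5 (λ g d t w b → ((g FS.:+ d FS.:* t) FS.:+ (w FS.:* b) FS.:* (t FS.:* (t FS.:- FS.con (+ 1))))
                 FS.:+ (d FS.:+ t FS.:* ((w FS.:* (FS.con (+ 1) FS.:+ FS.con (+ 1))) FS.:* b))
                 FS.:= (g FS.:+ d FS.:* (FS.con (+ 1) FS.:+ t)) FS.:+ (w FS.:* b) FS.:* ((FS.con (+ 1) FS.:+ t) FS.:* ((FS.con (+ 1) FS.:+ t) FS.:- FS.con (+ 1))))
                 refl (γ 0F) (δ 0F) t w b ⟩
          (γ 0F +F δ 0F *F (1F +F t)) +F (w *F b) *F ((1F +F t) *F ((1F +F t) +F -F 1F)) ∎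
        where
        open ≡-Reasoning

    lift : ∀ {n d} {f : Fun p n} → Deg d f → Deg {suc n} d (λ x → f (Vec.tail x))
    lift D = Deg-∘ Vec.tail (λ i → ext (λ { (x ∷ xs) → refl }) (Deg-var (suc i))) D

    -- Split off the first coordinate: `f (x , xs)` is `f (0 , xs)` plus `f (x , 0) - f 0` plus the
    -- mixed second difference at 0. The latter is bilinear because third differences vanish, hence
    -- `x` times a linear form in `xs`.
    Δ³-vanishes⇒Deg-2 : ∀ {n} {f : Fun p n} → (∀ x y z a → Δ x (Δ y (Δ z f)) a ≡ 0F) → Deg 2 f
    Δ³-vanishes⇒Deg-2 {zero} {f} v = ext (λ { [] → refl }) (const (f []))
    Δ³-vanishes⇒Deg-2 {suc n} {f} v = ext split
      (add (add (lift (Δ³-vanishes⇒Deg-2 {n} {λ xs → f (0F ∷ xs)} restricted))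
                (add (Deg-2-univariate {γ} {δ} {Δ e (Δ e f) 0ᵛ} γ-step δ-step zero) (const (-F f 0ᵛ))))
           (var* zero (lift (additive⇒Deg-1 {n} {λ xs → Δ (0F ∷ xs) (Δ e f) 0ᵛ} cross-+))))
      where
      e : V (suc n)
      e = 1F ∷ 0ᵛ
      open Third {suc n} {f} (λ x y z a b → trans (v x y z a) (sym (v x y z b)))
      0+0 : ∀ {m} (x : V m) {y : V m} → _≡_ {A = V (suc m)} ((0F ∷ x) +ᵛ (0F ∷ y)) (0F ∷ (x +ᵛ y))
      0+0 x {y} = cong (_∷ (x +ᵛ y)) (+F-identityˡ 0F)
      ΔΔ-constant : ∀ h k a l → Δ h (Δ k f) (a +ᵛ l) ≡ Δ h (Δ k f) a
      ΔΔ-constant h k a l = trans (Δ²-+ h k a l) (trans (cong (Δ h (Δ k f) a +F_) (v l h k 0ᵛ)) (+F-identityʳ _))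
      ΔΔ-0 : ∀ h k a → Δ h (Δ k f) a ≡ Δ h (Δ k f) 0ᵛ
      ΔΔ-0 h k a = trans (cong (Δ h (Δ k f)) (sym (+ᵛ-identityˡ a))) (ΔΔ-constant h k 0ᵛ a)
      Δ-restrict : ∀ (g : Fun p (suc n)) h xs → Δ h (λ xs → g (0F ∷ xs)) xs ≡ Δ (0F ∷ h) g (0F ∷ xs)
      Δ-restrict g h xs = cong (λ w → g w ⊖F g (0F ∷ xs)) (sym (0+0 xs))
      restricted : ∀ x y z a → Δ x (Δ y (Δ z (λ xs → f (0F ∷ xs)))) a ≡ 0F
      restricted x y z a = trans (Δ-cong x (λ a → trans (Δ-cong y (Δ-restrict f z) a) (Δ-restrict (Δ (0F ∷ z) f) y a)) a)
        (trans (Δ-restrict (Δ (0F ∷ y) (Δ (0F ∷ z) f)) x a) (v (0F ∷ x) (0F ∷ y) (0F ∷ z) (0F ∷ a)))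
      γ δ : F p → F p
      γ t = f (t ∷ 0ᵛ)
      δ t = Δ e f (t ∷ 0ᵛ)
      shift-e : ∀ t → (t ∷ 0ᵛ) +ᵛ e ≡ (1F +F t) ∷ 0ᵛ
      shift-e t = cong₂ _∷_ (+F-comm t 1F) (+ᵛ-identityˡ 0ᵛ)
      γ-step : ∀ t → γ (1F +F t) ≡ γ t +F δ t
      γ-step t = trans (cong f (sym (shift-e t)))
        (FS.solve 2 (λ x y → x FS.:= y FS.:+ (x FS.:- y)) refl (f ((t ∷ 0ᵛ) +ᵛ e)) (γ t))
      δ-step : ∀ t → δ (1F +F t) ≡ δ t +F Δ e (Δ e f) 0ᵛ
      δ-step t = trans (cong (Δ e f) (sym (shift-e t)))
        (trans (FS.solve 2 (λ x y → x FS.:= y FS.:+ (x FS.:- y)) refl (Δ e f ((t ∷ 0ᵛ) +ᵛ e)) (δ t))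
          (cong (δ t +F_) (ΔΔ-0 e e (t ∷ 0ᵛ))))
      B : V (suc n) → V (suc n) → F p
      B h k = Δ h (Δ k f) 0ᵛ
      B-+ˡ : ∀ x y k → B (x +ᵛ y) k ≡ B x k +F B y k
      B-+ˡ x y k = trans (Δ-+ (Δ k f) x y 0ᵛ) (cong (B x k +F_) (ΔΔ-constant y k 0ᵛ x))
      cross-+ : AdditiveOn whole (λ xs → B (0F ∷ xs) e)
      cross-+ {x} {y} _ _ = trans (cong (λ w → B w e) (sym (0+0 x))) (B-+ˡ (0F ∷ x) (0F ∷ y) e)
      B-· : ∀ t k → B (t ∷ 0ᵛ) k ≡ t *F B e k
      B-· t k = trans (cong (λ w → B w k) (sym t·e)) (additive-· whole {λ h → B h k} (λ {x} {y} _ _ → B-+ˡ x y k) t {e} tt)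
        where
        t·0 : ∀ {m} → t ·ᵛ 0ᵛ {m} ≡ 0ᵛ
        t·0 {zero}  = refl
        t·0 {suc m} = cong₂ _∷_ (Fp.zeroʳ t) (t·0 {m})
        t·e : t ·ᵛ e ≡ t ∷ 0ᵛ
        t·e = cong₂ _∷_ (Fp.*-identityʳ t) t·0
      split : ∀ x → (f (0F ∷ Vec.tail x) +F (γ (lookup x zero) +F -F f 0ᵛ)) +F lookup x zero *F B (0F ∷ Vec.tail x) e ≡ f x
      split (x ∷ xs) = begin
        (f k +F (f h +F -F f 0ᵛ)) +F x *F B k e
          ≡⟨ cong ((f k +F (f h +F -F f 0ᵛ)) +F_) (trans (cong (x *F_) (Δ-comm f k e 0ᵛ)) (sym (B-· x k))) ⟩
        (f k +F (f h +F -F f 0ᵛ)) +F ((f ((0ᵛ +ᵛ h) +ᵛ k) ⊖F f (0ᵛ +ᵛ h)) ⊖F (f (0ᵛ +ᵛ k) ⊖F f 0ᵛ))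
          ≡⟨ cong₂ (λ u w → (f k +F (f h +F -F f 0ᵛ)) +F ((f (u +ᵛ k) ⊖F f u) ⊖F (f w ⊖F f 0ᵛ))) (+ᵛ-identityˡ h) (+ᵛ-identityˡ k) ⟩
        (f k +F (f h +F -F f 0ᵛ)) +F ((f (h +ᵛ k) ⊖F f h) ⊖F (f k ⊖F f 0ᵛ))
          ≡⟨ FS.solve 4 (λ a b c d → (b FS.:+ (a FS.:- c)) FS.:+ ((d FS.:- a) FS.:- (b FS.:- c)) FS.:= d) refl (f h) (f k) (f 0ᵛ) (f (h +ᵛ k)) ⟩
        f (h +ᵛ k)
          ≡⟨ cong f (cong₂ _∷_ (+F-identityʳ x) (+ᵛ-identityˡ xs)) ⟩
        f (x ∷ xs) ∎
        where
        open ≡-Reasoning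
        h k : V (suc n)
        h = x ∷ 0ᵛ
        k = 0F ∷ xs

    -- This is where minimality of the degree enters: vanishing third differences would make `f`
    -- quadratic.
    third-nonzero : ∀ {n} {f : Fun p n} → HasDegree 3 f → ∃[ x ] ∃[ y ] ∃[ z ] third f x y z ≢ 0F
    third-nonzero {n} {f} (f≤3 , least) = by-cases (∃? (λ x → ∃? (λ y → ∃? (λ z → ¬? (third f x y z FinP.≟ 0F)))))
      where
      by-cases : Dec (∃[ x ] ∃[ y ] ∃[ z ] third f x y z ≢ 0F) → ∃[ x ] ∃[ y ] ∃[ z ] third f x y z ≢ 0F
      by-cases (yes h) = h
      by-cases (no ¬h) = ⊥-elim (ℕP.<-irrefl refl (least 2 (Deg⇒DegreeAtMost (Δ³-vanishes⇒Deg-2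
        λ x y z a → trans (third-constant (DegreeAtMost⇒Deg f≤3) x y z a 0ᵛ) (zero-at x y z (third f x y z FinP.≟ 0F))))))
        where
        zero-at : ∀ x y z → Dec (third f x y z ≡ 0F) → third f x y z ≡ 0F
        zero-at x y z (yes e) = e
        zero-at x y z (no ne) = ⊥-elim (¬h (x , y , z , ne))

  -- Division by linear equations and the final form of `f`.

  module Representation where

    open Sums
    open PrimeField
    open Vectors
    open Subspaces
    open Counting
    open TrilinearForms
    open Polynomials

    module FSum where
      open import Algebra.Properties.Semiring.Sum Fp.semiring public

    ∑F-cong : ∀ {c} {s t : Fin c → F p} → (∀ j → s j ≡ t j) → ∑F s ≡ ∑F t
    ∑F-cong {zero}  e = refl
    ∑F-cong {suc c} e = cong₂ _+F_ (e zero) (∑F-cong (λ j → e (suc j)))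

    Deg-∑ : ∀ {m c d} {ℓ : Fin c → Fun p m} → (∀ j → Deg d (ℓ j)) → Deg d (λ x → ∑F (λ j → ℓ j x))
    Deg-∑ {c = zero}  D = const 0F
    Deg-∑ {c = suc c} D = add (D zero) (Deg-∑ (λ j → D (suc j)))

    -- Shifting the argument by `ℓ a` times a fixed vector changes a polynomial by a multiple of
    -- `ℓ`, with a cofactor of one degree less; for a product with a variable this is a product
    -- rule.
    factor : ∀ {m n d} {f : Fun p n} → Deg (suc d) f → (ψ : V m → V n) → Coordinatewise 1 ψ →
      ∀ {ℓ : Fun p m} → Deg 1 ℓ → (e : V n) →
      ∃[ q ] (Deg d q × (∀ a → f (ψ a) ≡ ℓ a *F q a +F f (ψ a ⊖ᵛ ℓ a ·ᵛ e)))
    factor (const c) ψ L {ℓ} Dℓ e = (λ _ → 0F) , const 0F , λ a → sym (trans (cong (_+F c) (Fp.zeroʳ (ℓ a))) (+F-identityˡ c))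
    factor {d = d} (var* {g = g} i D) ψ L {ℓ} Dℓ e = by-degree d D
      where
      rest : ∀ a → V _
      rest a = ψ a ⊖ᵛ ℓ a ·ᵛ e
      L-rest : Coordinatewise 1 rest
      L-rest = affine-⊖ ψ (λ a → ℓ a ·ᵛ e) L (affine-· e Dℓ)
      coordinate : ∀ a → lookup (ψ a) i ≡ lookup (rest a) i +F ℓ a *F lookup e i
      coordinate a = sym (trans (cong (_+F ℓ a *F lookup e i) (trans (lookup-⊖ᵛ (ψ a) (ℓ a ·ᵛ e) i) (cong (lookup (ψ a) i ⊖F_) (lookup-·ᵛ (ℓ a) e i))))
        (FS.solve 2 (λ x y → (x FS.:- y) FS.:+ y FS.:= x) refl (lookup (ψ a) i) (ℓ a *F lookup e i)))
      by-degree : ∀ d → Deg d g →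
        ∃[ q ] (Deg d q × (∀ a → lookup (ψ a) i *F g (ψ a) ≡ ℓ a *F q a +F lookup (rest a) i *F g (rest a)))
      by-degree zero D = (λ a → lookup e i *F g (ψ a)) , Deg-scale (lookup e i) (Deg-∘ ψ L D) , λ a →
        trans (cong (_*F g (ψ a)) (coordinate a))
        (trans (FS.solve 4 (λ r l e g → (r FS.:+ l FS.:* e) FS.:* g FS.:= l FS.:* (e FS.:* g) FS.:+ r FS.:* g) refl (lookup (rest a) i) (ℓ a) (lookup e i) (g (ψ a)))
          (cong (λ w → ℓ a *F (lookup e i *F g (ψ a)) +F lookup (rest a) i *F w) (Deg-0-constant D (ψ a) (rest a))))
      by-degree (suc d) D = let (q , Dq , eq) = factor D ψ L Dℓ e in
        (λ a → lookup (rest a) i *F q a +F lookup e i *F g (ψ a)) ,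
        add (Deg-* (L-rest i) Dq) (Deg-scale (lookup e i) (Deg-∘ ψ L D)) , λ a →
        trans (cong (_*F g (ψ a)) (coordinate a))
        (trans (FS.solve 4 (λ r l e g → (r FS.:+ l FS.:* e) FS.:* g FS.:= r FS.:* g FS.:+ l FS.:* (e FS.:* g)) refl (lookup (rest a) i) (ℓ a) (lookup e i) (g (ψ a)))
        (trans (cong (λ w → lookup (rest a) i *F w +F ℓ a *F (lookup e i *F g (ψ a))) (eq a))
          (FS.solve 5 (λ r l q g′ h → r FS.:* (l FS.:* q FS.:+ g′) FS.:+ l FS.:* h FS.:= l FS.:* (r FS.:* q FS.:+ h) FS.:+ r FS.:* g′) refl
            (lookup (rest a) i) (ℓ a) (q a) (g (rest a)) (lookup e i *F g (ψ a)))))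
    factor (add {f = f} {g} D E) ψ L {ℓ} Dℓ e =
      let (q , Dq , eq) = factor D ψ L Dℓ e ; (r , Dr , eq′) = factor E ψ L Dℓ e in
      (λ a → q a +F r a) , add Dq Dr , λ a → trans (cong₂ _+F_ (eq a) (eq′ a))
        (FS.solve 5 (λ l q r x y → (l FS.:* q FS.:+ x) FS.:+ (l FS.:* r FS.:+ y) FS.:= l FS.:* (q FS.:+ r) FS.:+ (x FS.:+ y)) refl
          (ℓ a) (q a) (r a) (f (ψ a ⊖ᵛ ℓ a ·ᵛ e)) (g (ψ a ⊖ᵛ ℓ a ·ᵛ e)))
    factor (ext h D) ψ L {ℓ} Dℓ e = let (q , Dq , eq) = factor D ψ L Dℓ e in
      q , Dq , λ a → trans (sym (h (ψ a))) (trans (eq a) (cong (ℓ a *F q a +F_) (h (ψ a ⊖ᵛ ℓ a ·ᵛ e))))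

    ⊖ᵛ-+ᵛ : ∀ {n} (x y z : V n) → (x ⊖ᵛ y) ⊖ᵛ z ≡ x ⊖ᵛ (y +ᵛ z)
    ⊖ᵛ-+ᵛ [] [] [] = refl
    ⊖ᵛ-+ᵛ (x ∷ xs) (y ∷ ys) (z ∷ zs) = cong₂ _∷_
      (FS.solve 3 (λ x y z → (x FS.:- y) FS.:- z FS.:= x FS.:- (y FS.:+ z)) refl x y z) (⊖ᵛ-+ᵛ xs ys zs)

    x⊖0 : ∀ {n} (x : V n) → x ⊖ᵛ 0ᵛ ≡ x
    x⊖0 x = trans (sym (+ᵛ-identityʳ _)) (x-y+y x 0ᵛ)

    factor-comb : ∀ {m n d c} {f : Fun p n} → Deg (suc d) f → (ψ : V m → V n) → Coordinatewise 1 ψ →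
      ∀ {ℓ : Fin c → Fun p m} → (∀ j → Deg 1 (ℓ j)) → (e : Fin c → V n) →
      Σ[ q ∈ (Fin c → Fun p m) ] ((∀ j → Deg d (q j)) ×
        (∀ a → f (ψ a) ≡ ∑F (λ j → ℓ j a *F q j a) +F f (ψ a ⊖ᵛ comb (λ j → ℓ j a) e)))
    factor-comb {c = zero} {f} D ψ L Dℓ e = (λ ()) , (λ ()) , λ a → sym (trans (+F-identityˡ _) (cong f (x⊖0 (ψ a))))
    factor-comb {c = suc c} {f} D ψ L {ℓ} Dℓ e =
      let (q , Dq , eq) = factor D ψ L (Dℓ zero) (e zero)
          (r , Dr , eq′) = factor-comb D (λ a → ψ a ⊖ᵛ ℓ zero a ·ᵛ e zero)
            (affine-⊖ ψ (λ a → ℓ zero a ·ᵛ e zero) L (affine-· (e zero) (Dℓ zero)))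
            {λ j → ℓ (suc j)} (λ j → Dℓ (suc j)) (λ j → e (suc j))
      in (λ { zero → q ; (suc j) → r j }) , (λ { zero → Dq ; (suc j) → Dr j }) , λ a → begin
        f (ψ a)
          ≡⟨ eq a ⟩
        ℓ zero a *F q a +F f (ψ a ⊖ᵛ ℓ zero a ·ᵛ e zero)
          ≡⟨ cong (ℓ zero a *F q a +F_) (eq′ a) ⟩
        ℓ zero a *F q a +F (S r a +F f ((ψ a ⊖ᵛ ℓ zero a ·ᵛ e zero) ⊖ᵛ E a))
          ≡⟨ cong (λ w → ℓ zero a *F q a +F (S r a +F f w)) (⊖ᵛ-+ᵛ (ψ a) (ℓ zero a ·ᵛ e zero) (E a)) ⟩
        ℓ zero a *F q a +F (S r a +F f (ψ a ⊖ᵛ (ℓ zero a ·ᵛ e zero +ᵛ E a)))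
          ≡⟨ sym (+F-assoc (ℓ zero a *F q a) (S r a) (f (ψ a ⊖ᵛ (ℓ zero a ·ᵛ e zero +ᵛ E a)))) ⟩
        (ℓ zero a *F q a +F S r a) +F f (ψ a ⊖ᵛ (ℓ zero a ·ᵛ e zero +ᵛ E a)) ∎
      where
      open ≡-Reasoning
      S : (Fin c → Fun p _) → Fun p _
      S r a = ∑F (λ j → ℓ (suc j) a *F r j a)
      E : V _ → V _
      E a = comb (λ j → ℓ (suc j) a) (λ j → e (suc j))

    record Span {s K} (w : Fin K → Fun p s) (G : Fun p s) : Set where
      constructor _,_
      field
        coefficient : Fin K → F p
        expansion   : ∀ m → G m ≡ ∑F (λ j → coefficient j *F w j m)

    open Span

    module _ {s K : ℕ} {w : Fin K → Fun p s} where

      span-+ : ∀ {G H : Fun p s} → Span w G → Span w H → Span w (λ m → G m +F H m)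
      span-+ (c , eq) (d , eq′) = (λ j → c j +F d j) , λ m → trans (cong₂ _+F_ (eq m) (eq′ m))
        (trans (sym (FSum.∑-distrib-+ (λ j → c j *F w j m) (λ j → d j *F w j m)))
          (∑F-cong (λ j → sym (Fp.distribʳ (w j m) (c j) (d j)))))

      span-ext : ∀ {G H : Fun p s} → (∀ m → G m ≡ H m) → Span w G → Span w H
      span-ext e (c , eq) = c , λ m → trans (sym (e m)) (eq m)

    unit : ∀ {K} → Fin K → Fin K → F p
    unit zero    zero    = 1F
    unit zero    (suc j) = 0F
    unit (suc i) zero    = 0F
    unit (suc i) (suc j) = unit i j

    ∑-unit : ∀ {K} (i : Fin K) (c : F p) (v : Fin K → F p) → ∑F (λ j → (c *F unit i j) *F v j) ≡ c *F v i
    ∑-unit zero c v = trans (cong₂ _+F_ (cong (_*F v zero) (Fp.*-identityʳ c)) (zeros c (λ j → v (suc j)))) (+F-identityʳ _)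
      where
      zeros : ∀ {K} c (v : Fin K → F p) → ∑F (λ j → (c *F 0F) *F v j) ≡ 0F
      zeros {zero}  c v = refl
      zeros {suc K} c v = trans (cong₂ _+F_ (trans (cong (_*F v zero) (Fp.zeroʳ c)) (Fp.zeroˡ (v zero))) (zeros c (λ j → v (suc j)))) (+F-identityˡ 0F)
    ∑-unit (suc i) c v = trans (cong₂ _+F_ (trans (cong (_*F v zero) (Fp.zeroʳ c)) (Fp.zeroˡ (v zero))) (∑-unit i c (λ j → v (suc j)))) (+F-identityˡ _)

    span-unit : ∀ {s K} {w : Fin K → Fun p s} (c : F p) i → Span w (λ m → c *F w i m)
    span-unit {w = w} c i = (λ j → c *F unit i j) , λ m → sym (∑-unit i c (λ j → w j m))

    -- The products of two entries of (1 , m₁ , … , mₛ), indexed by the pairs of positions.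
    quadratic : ∀ s → Fin (suc s ℕ.* suc s) → Fun p s
    quadratic s k m = let (i , j) = remQuot {suc s} (suc s) k in lookup (1F ∷ m) i *F lookup (1F ∷ m) j

    quadratic-combine : ∀ s i j m → quadratic s (combine i j) m ≡ lookup (1F ∷ m) i *F lookup (1F ∷ m) j
    quadratic-combine s i j m = cong (λ (i , j) → lookup (1F ∷ m) i *F lookup (1F ∷ m) j) (FinP.remQuot-combine {suc s} {suc s} i j)

    span-pair : ∀ {s} (c : F p) i j → Span (quadratic s) (λ m → c *F (lookup (1F ∷ m) i *F lookup (1F ∷ m) j))
    span-pair {s} c i j = span-ext (λ m → cong (c *F_) (quadratic-combine s i j m)) (span-unit c (combine i j))

    -- Position 0 of `(1 , m)` holds the constant 1, so affine and genuinely quadratic terms are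
    -- alike: an entry times an affine function.
    span-linear : ∀ {s} {g : Fun p s} i → Deg 1 g → Span (quadratic s) (λ m → lookup (1F ∷ m) i *F g m)
    span-linear i (const c) = span-ext (λ m → trans (cong (c *F_) (Fp.*-identityʳ (lookup (1F ∷ m) i))) (*F-comm c _)) (span-pair c i zero)
    span-linear i (var* {g = g} j D) = span-ext
      (λ m → trans (cong (λ c → c *F (lookup (1F ∷ m) i *F lookup m j)) (Deg-0-constant D 0ᵛ m))
        (FS.solve 3 (λ c x y → c FS.:* (x FS.:* y) FS.:= x FS.:* (y FS.:* c)) refl (g m) (lookup (1F ∷ m) i) (lookup m j)))
      (span-pair (g 0ᵛ) i (suc j))
    span-linear i (add {f = f} {g} D E) = span-ext (λ m → sym (Fp.distribˡ (lookup (1F ∷ m) i) (f m) (g m))) (span-+ (span-linear i D) (span-linear i E))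
    span-linear i (ext h D) = span-ext (λ m → cong (lookup (1F ∷ m) i *F_) (h m)) (span-linear i D)

    span-quadratic : ∀ {s} {g : Fun p s} → Deg 2 g → Span (quadratic s) g
    span-quadratic (const c) = span-ext (λ m → *F-identityˡ c) (span-linear zero (const c))
    span-quadratic (var* i D) = span-linear (suc i) D
    span-quadratic (add D E) = span-+ (span-quadratic D) (span-quadratic E)
    span-quadratic (ext h D) = span-ext h (span-quadratic D)

    additive-comb : ∀ {n c} (K : Sub n) {φ : V n → F p} → AdditiveOn K φ → (t : Fin c → F p) {e : Fin c → V n} →
      (∀ j → Mem K (e j)) → φ (comb t e) ≡ ∑F (λ j → t j *F φ (e j))
    additive-comb {c = zero}  K {φ} φ-+ t e∈ = additive-0 K {φ} φ-+
    additive-comb {c = suc c} K {φ} φ-+ t {e} e∈ = trans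
      (φ-+ (·∈ K (t zero) (e∈ zero)) (comb-∈ K (λ j → t (suc j)) {λ j → e (suc j)} (λ j → e∈ (suc j))))
      (cong₂ _+F_ (additive-· K {φ} φ-+ (t zero) {e zero} (e∈ zero)) (additive-comb K {φ} φ-+ (λ j → t (suc j)) (λ j → e∈ (suc j))))

    module Represent {n} {f : Fun p n} (D : Deg 3 f) (W U : Sub n) (U⊆W : U ⊆ W) (b : V n)
      (iso : ∀ {w u v} → Mem W w → Mem U u → Mem U v → third f w u v ≡ 0F)
      (flat : ∀ {u v} → Mem U u → Mem U v → Δ u (Δ v f) b ≡ 0F)
      (C₁ : Complement W whole) (C₂ : Complement U W) where

      C₃ : Complement zeroSub U
      C₃ = complement zeroSub U (λ { refl → 0∈ U })

      c₁ s K c₂ : ℕ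
      c₁ = codim C₁
      s  = codim C₂
      K  = suc s ℕ.* suc s
      c₂ = s ℕ.+ K

      sub-+ : ∀ {m} (x y a b : V m) → (x +ᵛ y) ⊖ᵛ (a +ᵛ b) ≡ (x ⊖ᵛ a) +ᵛ (y ⊖ᵛ b)
      sub-+ [] [] [] [] = refl
      sub-+ (x ∷ xs) (y ∷ ys) (a ∷ as) (b ∷ bs) = cong₂ _∷_
        (FS.solve 4 (λ x y a b → (x FS.:+ y) FS.:- (a FS.:+ b) FS.:= (x FS.:- a) FS.:+ (y FS.:- b)) refl x y a b) (sub-+ xs ys as bs)

      -- The components in `W` and in `U` along the chosen complements, additive because the
      -- coordinates are.
      π ρ : V n → V n
      π x = x ⊖ᵛ comb (λ j → coord C₁ j x) (basis C₁)
      ρ x = π x ⊖ᵛ comb (λ j → coord C₂ j (π x)) (basis C₂)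

      π∈ : ∀ x → Mem W (π x)
      π∈ x = remainder C₁ {x} tt

      ρ∈ : ∀ x → Mem U (ρ x)
      ρ∈ x = remainder C₂ (π∈ x)

      π-+ : ∀ x y → π (x +ᵛ y) ≡ π x +ᵛ π y
      π-+ x y = trans (cong ((x +ᵛ y) ⊖ᵛ_) (trans (comb-cong (basis C₁) (λ j → coord-+ C₁ j {x} {y} tt tt))
        (comb-+ (λ j → coord C₁ j x) (λ j → coord C₁ j y) (basis C₁)))) (sub-+ x y _ _)

      coord₂-+ : ∀ j x y → coord C₂ j (π (x +ᵛ y)) ≡ coord C₂ j (π x) +F coord C₂ j (π y)
      coord₂-+ j x y = trans (cong (coord C₂ j) (π-+ x y)) (coord-+ C₂ j (π∈ x) (π∈ y))

      ρ-+ : ∀ x y → ρ (x +ᵛ y) ≡ ρ x +ᵛ ρ y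
      ρ-+ x y = trans (cong₂ _⊖ᵛ_ (π-+ x y) (trans (comb-cong (basis C₂) (λ j → coord₂-+ j x y))
        (comb-+ (λ j → coord C₂ j (π x)) (λ j → coord C₂ j (π y)) (basis C₂)))) (sub-+ (π x) (π y) _ _)

      affine : ∀ {φ : V n → F p} → AdditiveOn whole φ → Deg 1 (λ a → φ (a ⊖ᵛ b))
      affine {φ} φ-+ = Deg-∘ {f = φ} (_⊖ᵛ b) (affine-⊖ (λ a → a) (λ _ → b) affine-id (affine-const b)) (additive⇒Deg-1 {n} {φ} φ-+)

      ℓ : Fin c₁ → Fun p n
      ℓ j a = coord C₁ j (a ⊖ᵛ b)

      Deg-ℓ : ∀ j → Deg 1 (ℓ j)
      Deg-ℓ j = affine {coord C₁ j} (λ {x} {y} _ _ → coord-+ C₁ j {x} {y} tt tt)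

      m : Fin s → Fun p n
      m j a = coord C₂ j (π (a ⊖ᵛ b))

      Deg-m : ∀ j → Deg 1 (m j)
      Deg-m j = affine {λ x → coord C₂ j (π x)} (λ {x} {y} _ _ → coord₂-+ j x y)

      t : Fin (codim C₃) → Fun p n
      t i a = coord C₃ i (ρ (a ⊖ᵛ b))

      Deg-t : ∀ i → Deg 1 (t i)
      Deg-t i = affine {λ x → coord C₃ i (ρ x)} (λ {x} {y} _ _ → trans (cong (coord C₃ i) (ρ-+ x y)) (coord-+ C₃ i (ρ∈ x) (ρ∈ y)))

      -- The point of `b + W` with coordinates `m` in `W / U` and no component in `U`.
      Y : V s → V n
      Y m = b +ᵛ comb (lookup m) (basis C₂)

      Y-affine : ∀ {k} {ν : V k → V s} → Coordinatewise 1 ν → Coordinatewise 1 (λ x → Y (ν x))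
      Y-affine {ν = ν} L = affine-+ (λ _ → b) (λ x → comb (lookup (ν x)) (basis C₂)) (affine-const b)
        (affine-comb {ℓ = λ j x → lookup (ν x) j} (basis C₂) L)

      -- The slope of `f` at `Y m` along the `i`-th basis vector of `U`; as a first difference of a
      -- cubic it is quadratic in `m`.
      G : Fin (codim C₃) → Fun p s
      G i m = Δ (basis C₃ i) f (Y m)

      G-span : ∀ i → Span (quadratic s) (G i)
      G-span i = span-quadratic (Deg-∘ Y (Y-affine {ν = λ m → m} affine-id) (Deg-Δ (basis C₃ i) D))

      -- The dimension of `U` is not bounded in terms of δ, but all slopes `G i` lie in the span of
      -- the `K` quadratic products. Exchanging sums in the slopes weighted by the coordinates `t i`
      -- collects everything into `K` linear functions.
      λ′ : Fin K → Fun p n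
      λ′ k a = ∑F (λ i → t i a *F coefficient (G-span i) k)

      Deg-λ′ : ∀ k → Deg 1 (λ′ k)
      Deg-λ′ k = Deg-∑ (λ i → ext (λ a → *F-comm (coefficient (G-span i) k) (t i a)) (Deg-scale (coefficient (G-span i) k) (Deg-t i)))

      ℓ′ : Fin c₂ → Fun p n
      ℓ′ i = [ m , λ′ ]′ (splitAt s i)

      Deg-ℓ′ : ∀ i → Deg 1 (ℓ′ i)
      Deg-ℓ′ i = by-cases (splitAt s i)
        where
        by-cases : ∀ x → Deg 1 ([ m , λ′ ]′ x)
        by-cases (inj₁ j) = Deg-m j
        by-cases (inj₂ k) = Deg-λ′ k

      head : V c₂ → V s
      head z = tabulate (λ j → lookup z (j ↑ˡ K))

      -- The first `s` variables stand for the `m j`, the other `K` for the `λ′ k`; each product of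
      -- a quadratic in the former with one of the latter is cubic.
      g : Fun p c₂
      g z = f (Y (head z)) +F ∑F (λ k → quadratic s k (head z) *F lookup z (s ↑ʳ k))

      head-affine : Coordinatewise 1 head
      head-affine j = ext (λ z → sym (VecP.lookup∘tabulate (λ j → lookup z (j ↑ˡ K)) j)) (Deg-var (j ↑ˡ K))

      Deg-g : Deg 3 g
      Deg-g = add (Deg-∘ {f = f} (λ z → Y (head z)) (Y-affine {ν = head} head-affine) D) (Deg-∑ (λ k → Deg-* (Deg-* (1∷head (proj₁ (remQuot {suc s} (suc s) k))) (1∷head (proj₂ (remQuot {suc s} (suc s) k)))) (Deg-var (s ↑ʳ k))))
        where
        1∷head : ∀ i → Deg 1 (λ z → lookup (1F ∷ head z) i)
        1∷head zero    = const 1F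
        1∷head (suc j) = head-affine j

      head-ℓ′ : ∀ a → head (tabulate (λ i → ℓ′ i a)) ≡ tabulate (λ j → m j a)
      head-ℓ′ a = VecP.tabulate-cong (λ j → trans (VecP.lookup∘tabulate (λ i → ℓ′ i a) (j ↑ˡ K))
        (cong (λ x → [ m , λ′ ]′ x a) (FinP.splitAt-↑ˡ s j K)))

      tail-ℓ′ : ∀ a k → lookup (tabulate (λ i → ℓ′ i a)) (s ↑ʳ k) ≡ λ′ k a
      tail-ℓ′ a k = trans (VecP.lookup∘tabulate (λ i → ℓ′ i a) (s ↑ʳ k)) (cong (λ x → [ m , λ′ ]′ x a) (FinP.splitAt-↑ʳ s K k))

      -- On b + W the second differences along U vanish, so f is affine along U there.
      Δ-additive : ∀ {w} → Mem W w → AdditiveOn U (λ u → Δ u f (b +ᵛ w))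
      Δ-additive {w} w∈ {u} {v} u∈ v∈ = trans (Δ-+ f u v (b +ᵛ w)) (cong (Δ u f (b +ᵛ w) +F_) (begin
        Δ v f ((b +ᵛ w) +ᵛ u)
          ≡⟨ FS.solve 2 (λ x y → x FS.:= y FS.:+ (x FS.:- y)) refl (Δ v f ((b +ᵛ w) +ᵛ u)) (Δ v f (b +ᵛ w)) ⟩
        Δ v f (b +ᵛ w) +F Δ u (Δ v f) (b +ᵛ w)
          ≡⟨ cong (Δ v f (b +ᵛ w) +F_) (trans (Third.Δ²-+ {n} {f} (third-constant D) u v b w) (trans (cong₂ _+F_ (flat u∈ v∈) (iso w∈ u∈ v∈)) (+F-identityˡ 0F))) ⟩
        Δ v f (b +ᵛ w) +F 0F
          ≡⟨ +F-identityʳ _ ⟩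
        Δ v f (b +ᵛ w) ∎))
        where open ≡-Reasoning

      along-U : ∀ a → Δ (ρ (a ⊖ᵛ b)) f (Y (tabulate (λ j → m j a))) ≡
        ∑F (λ k → quadratic s k (tabulate (λ j → m j a)) *F λ′ k a)
      along-U a = begin
        Δ u f (Y M)
          ≡⟨ cong (λ u → Δ u f (Y M)) u≡ ⟩
        Δ (comb (λ i → t i a) (basis C₃)) f (Y M)
          ≡⟨ additive-comb U {λ u → Δ u f (Y M)} (Δ-additive (comb-∈ W (lookup M) (basis∈ C₂))) (λ i → t i a) (basis∈ C₃) ⟩
        ∑F (λ i → t i a *F G i M)
          ≡⟨ ∑F-cong (λ i → trans (cong (t i a *F_) (expansion (G-span i) M)) (FSum.*-distribˡ-sum (t i a) (λ k → coefficient (G-span i) k *F quadratic s k M))) ⟩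
        ∑F (λ i → ∑F (λ k → t i a *F (coefficient (G-span i) k *F quadratic s k M)))
          ≡⟨ FSum.∑-comm (λ i k → t i a *F (coefficient (G-span i) k *F quadratic s k M)) ⟩
        ∑F (λ k → ∑F (λ i → t i a *F (coefficient (G-span i) k *F quadratic s k M)))
          ≡⟨ ∑F-cong (λ k → trans (∑F-cong (λ i → FS.solve 3 (λ t c w → t FS.:* (c FS.:* w) FS.:= w FS.:* (t FS.:* c)) refl
               (t i a) (coefficient (G-span i) k) (quadratic s k M))) (sym (FSum.*-distribˡ-sum (quadratic s k M) (λ i → t i a *F coefficient (G-span i) k)))) ⟩
        ∑F (λ k → quadratic s k M *F λ′ k a) ∎
        where
        open ≡-Reasoning
        M = tabulate (λ j → m j a)
        u = ρ (a ⊖ᵛ b)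
        u≡ : u ≡ comb (λ i → t i a) (basis C₃)
        u≡ = trans (sym (x-y+y u _)) (trans (cong (_+ᵛ comb (λ i → t i a) (basis C₃)) (remainder C₃ (ρ∈ (a ⊖ᵛ b)))) (+ᵛ-identityˡ _))

      -- Removing the components of `a - b` outside `W` moves `a` to `b + π (a - b)`, and
      -- `π (a - b)` splits into its part along the basis of `W / U` and its component in `U`.
      base-point : ∀ a → a ⊖ᵛ comb (λ j → ℓ j a) (basis C₁) ≡ Y (tabulate (λ j → m j a)) +ᵛ ρ (a ⊖ᵛ b)
      base-point a = trans (regroup a b e₁ e₂)
        (cong (λ w → (b +ᵛ w) +ᵛ ρ (a ⊖ᵛ b)) (comb-cong (basis C₂) (λ j → sym (VecP.lookup∘tabulate (λ j → m j a) j))))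
        where
        e₁ = comb (λ j → ℓ j a) (basis C₁)
        e₂ = comb (λ j → m j a) (basis C₂)
        regroup : ∀ {k} (a b e₁ e₂ : V k) → a ⊖ᵛ e₁ ≡ (b +ᵛ e₂) +ᵛ (((a ⊖ᵛ b) ⊖ᵛ e₁) ⊖ᵛ e₂)
        regroup [] [] [] [] = refl
        regroup (a ∷ as) (b ∷ bs) (x ∷ xs) (y ∷ ys) = cong₂ _∷_
          (FS.solve 4 (λ a b x y → a FS.:- x FS.:= (b FS.:+ y) FS.:+ (((a FS.:- b) FS.:- x) FS.:- y)) refl a b x y) (regroup as bs xs ys)

      remaining : ∀ a → f (a ⊖ᵛ comb (λ j → ℓ j a) (basis C₁)) ≡ g (tabulate (λ i → ℓ′ i a))
      remaining a = begin
        f (a ⊖ᵛ comb (λ j → ℓ j a) (basis C₁))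
          ≡⟨ cong f (base-point a) ⟩
        f (Y M +ᵛ ρ (a ⊖ᵛ b))
          ≡⟨ FS.solve 2 (λ x y → x FS.:= y FS.:+ (x FS.:- y)) refl (f (Y M +ᵛ ρ (a ⊖ᵛ b))) (f (Y M)) ⟩
        f (Y M) +F Δ (ρ (a ⊖ᵛ b)) f (Y M)
          ≡⟨ cong (f (Y M) +F_) (along-U a) ⟩
        f (Y M) +F ∑F (λ k → quadratic s k M *F λ′ k a)
          ≡⟨ cong (λ h → f (Y h) +F ∑F (λ k → quadratic s k M *F λ′ k a)) (sym (head-ℓ′ a)) ⟩
        f (Y (head Z)) +F ∑F (λ k → quadratic s k M *F λ′ k a)
          ≡⟨ cong (f (Y (head Z)) +F_) (∑F-cong (λ k → cong₂ (λ h r → quadratic s k h *F r) (sym (head-ℓ′ a)) (sym (tail-ℓ′ a k)))) ⟩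
        g Z ∎
        where
        open ≡-Reasoning
        M = tabulate (λ j → m j a)
        Z = tabulate (λ i → ℓ′ i a)

      representation : Σ[ q ∈ (Fin c₁ → Fun p n) ] Σ[ ℓ ∈ (Fin c₁ → Fun p n) ]
        Σ[ ℓ′ ∈ (Fin c₂ → Fun p n) ] Σ[ g ∈ Fun p c₂ ]
          ((∀ j → DegreeAtMost 2 (q j)) × (∀ j → DegreeAtMost 1 (ℓ j)) ×
           (∀ j → DegreeAtMost 1 (ℓ′ j)) × DegreeAtMost 3 g ×
           (∀ a → f a ≡ ∑F (λ j → ℓ j a *F q j a) +F g (tabulate (λ i → ℓ′ i a))))
      representation = let (q , Dq , eq) = factor-comb {d = 2} D (λ a → a) affine-id {ℓ} Deg-ℓ (basis C₁) in
        q , ℓ , ℓ′ , g , (λ j → Deg⇒DegreeAtMost (Dq j)) , (λ j → Deg⇒DegreeAtMost (Deg-ℓ j)) ,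
        (λ j → Deg⇒DegreeAtMost (Deg-ℓ′ j)) , Deg⇒DegreeAtMost Deg-g ,
        λ a → trans (eq a) (cong (∑F (λ j → ℓ j a *F q j a) +F_) (remaining a))

  -- The additive character of the field, and the bias expressed by it.

  module AdditiveCharacter where

    open Sums
    open Reals
    open ExponentialSeries
    open Trigonometry
    open PrimeField
    open Vectors

    -- Real and imaginary part of `x ↦ ω ^ x`, reduced to what the estimates use; `π` and the
    -- trigonometric series occur only in its construction. The field `c-⊖` is the cosine of a
    -- difference.
    record Character : Set where
      field
        c s        : F p → ℝ
        c-⊖        : ∀ x y → c (y ⊖F x) ≋ c x *ʳ c y +ʳ s x *ʳ s y
        c≼1        : ∀ x → c x ≼ 1ʳ
        vanishing  : ∑ʳ (List.allFin p) c ≋ 0ʳ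

    fromℕℚ-/ : ∀ a k .{{_ : NonZero k}} → fromℕℚ k ℚ.* (+ a / k) ≡ fromℕℚ a
    fromℕℚ-/ a (suc k) = ℚP.toℚᵘ-injective (ℚᵘP.≃-trans
      (ℚP.toℚᵘ-homo-* (fromℕℚ (suc k)) (+ a / suc k)) (ℚᵘP.≃-trans
      (ℚᵘP.*-cong (ℚP.toℚᵘ-fromℚᵘ (ℚᵘ.mkℚᵘ (+ suc k) 0)) (ℚP.toℚᵘ-fromℚᵘ (ℚᵘ.mkℚᵘ (+ a) k))) (ℚᵘP.≃-trans
      (ℚᵘ.*≡* (trans (cong (ℤ._* + 1) (ℤP.*-comm (+ suc k) (+ a)))
        (trans (ℤP.*-identityʳ (+ a ℤ.* + suc k)) (cong (λ j → + a ℤ.* + suc j) (sym (ℕP.+-identityʳ k))))))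
      (ℚᵘP.≃-sym (ℚP.toℚᵘ-fromℚᵘ (ℚᵘ.mkℚᵘ (+ a) 0))))))

    multiple : ℕ → ℝ → ℝ
    multiple zero    x = 0ʳ
    multiple (suc k) x = x +ʳ multiple k x

    seq-multiple : ∀ k x n → seq (multiple k x) n ≡ fromℕℚ k ℚ.* seq x n
    seq-multiple zero    x n = trans (seq-rat 0ℚ n) (sym (ℚP.*-zeroˡ (seq x n)))
    seq-multiple (suc k) x n = trans (seq-+ x (multiple k x) n) (trans (cong (seq x n ℚ.+_) (seq-multiple k x n))
      (trans (QS.solve 2 (λ k x → x QS.:+ k QS.:* x QS.:= (k QS.:+ QS.con (+ 1)) QS.:* x) refl (fromℕℚ k) (seq x n))
        (cong (ℚ._* seq x n) (sym (Cauchy.fromℕℚ-suc k)))))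

    Positive : ℝ → Set
    Positive x = ∃[ ε ] (0ℚ ℚ.< ε × ∃[ N ] (∀ n → N ℕ.≤ n → ε ℚ.≤ seq x n))

    -- Cancellation constructively needs an eventual positive rational lower bound on the factor,
    -- which the definition of `π` supplies for the sine of `π / p`.
    positive-cancel : ∀ {x y} → Positive x → x *ʳ y ≋ 0ʳ → y ≋ 0ʳ
    positive-cancel {x} {y} (ε₀ , 0<ε₀ , N , f) (equal h) = equal λ ε 0<ε →
      let (M , g) = h (ε₀ ℚ.* ε) (ℚP.positive⁻¹ (ε₀ ℚ.* ε) {{ℚP.pos*pos⇒pos ε₀ {{ℚ.positive 0<ε₀}} ε {{ℚ.positive 0<ε}}}})
      in N ℕ.⊔ M , λ n le → subst (λ z → ℚ.∣ z ∣ ℚ.≤ ε) (sym (minus-0 y n))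
        (ℚP.*-cancelˡ-≤-pos ε₀ {{ℚ.positive 0<ε₀}} (begin
          ε₀ ℚ.* ℚ.∣ seq y n ∣               ≤⟨ Cauchy.*-monoʳ (ℚP.0≤∣p∣ (seq y n)) (f n (ℕP.m⊔n≤o⇒m≤o N M le)) ⟩
          seq x n ℚ.* ℚ.∣ seq y n ∣          ≡⟨ cong (ℚ._* ℚ.∣ seq y n ∣) (sym (ℚP.0≤p⇒∣p∣≡p (ℚP.≤-trans (ℚP.<⇒≤ 0<ε₀) (f n (ℕP.m⊔n≤o⇒m≤o N M le))))) ⟩
          ℚ.∣ seq x n ∣ ℚ.* ℚ.∣ seq y n ∣    ≡⟨ sym (ℚP.∣p*q∣≡∣p∣*∣q∣ (seq x n) (seq y n)) ⟩
          ℚ.∣ seq x n ℚ.* seq y n ∣          ≡⟨ cong ℚ.∣_∣ (sym (trans (minus-0 (x *ʳ y) n) (seq-* x y n))) ⟩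
          ℚ.∣ seq (x *ʳ y) n ℚ.- seq 0ʳ n ∣  ≤⟨ g n (ℕP.m⊔n≤o⇒n≤o N M le) ⟩
          ε₀ ℚ.* ε                           ∎))
      where
      open ℚP.≤-Reasoning
      minus-0 : ∀ z n → seq z n ℚ.- seq 0ʳ n ≡ seq z n
      minus-0 z n = trans (cong (λ q → seq z n ℚ.- q) (seq-rat 0ℚ n)) (ℚP.+-identityʳ (seq z n))

    -- Conversions go through the sequences: comparing the Cauchy proofs is infeasible.
    opaque
      unfolding _+ʳ_ _*ʳ_ -ʳ_ rat

      +ʳ≋+ℝ : ∀ x y → x +ℝ y ≋ x +ʳ y
      +ʳ≋+ℝ x y = pointwise λ n → refl

      square≋ : ∀ x → x ^ℝ 2 ≋ x *ʳ (x *ʳ 1ʳ)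
      square≋ x = pointwise λ n → refl

      re-1 : re 1ℂ ≋ 1ʳ
      re-1 = pointwise λ n → refl

      im-1 : im 1ℂ ≋ 0ʳ
      im-1 = pointwise λ n → refl

      re-^ : ∀ w k → re (w ^ℂ suc k) ≋ re w *ʳ re (w ^ℂ k) -ʳ im w *ʳ im (w ^ℂ k)
      re-^ w k = pointwise λ n → refl

      im-^ : ∀ w k → im (w ^ℂ suc k) ≋ re w *ʳ im (w ^ℂ k) +ʳ im w *ʳ re (w ^ℂ k)
      im-^ w k = pointwise λ n → refl

      re-0 : re 0ℂ ≋ 0ʳ
      re-0 = pointwise λ n → refl

      im-0 : im 0ℂ ≋ 0ʳ
      im-0 = pointwise λ n → refl

      re-∷ : ∀ {a} {A : Set a} (h : A → ℂ) x xs → re (List.foldr (λ a s → h a +ℂ s) 0ℂ (x ∷ xs)) ≋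
        re (h x) +ʳ re (List.foldr (λ a s → h a +ℂ s) 0ℂ xs)
      re-∷ h x xs = pointwise λ n → refl

      im-∷ : ∀ {a} {A : Set a} (h : A → ℂ) x xs → im (List.foldr (λ a s → h a +ℂ s) 0ℂ (x ∷ xs)) ≋
        im (h x) +ʳ im (List.foldr (λ a s → h a +ℂ s) 0ℂ xs)
      im-∷ h x xs = pointwise λ n → refl

      re-mean : ∀ {n} (h : Vec (F p) n → ℂ) → re (mean {{nz}} h) ≋ rat (_/_ (+ 1) (p ℕ.^ n) {{ℕP.m^n≢0 p n {{nz}}}}) *ʳ re (List.foldr (λ a s → h a +ℂ s) 0ℂ (points p n))
        -ʳ 0ʳ *ʳ im (List.foldr (λ a s → h a +ℂ s) 0ℂ (points p n))
      re-mean h = pointwise λ n → refl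

      im-mean : ∀ {n} (h : Vec (F p) n → ℂ) → im (mean {{nz}} h) ≋ rat (_/_ (+ 1) (p ℕ.^ n) {{ℕP.m^n≢0 p n {{nz}}}}) *ʳ im (List.foldr (λ a s → h a +ℂ s) 0ℂ (points p n))
        +ʳ 0ʳ *ʳ re (List.foldr (λ a s → h a +ℂ s) 0ℂ (points p n))
      im-mean h = pointwise λ n → refl

    opaque
      unfolding _*ʳ_ rat cosʳ sinʳ

      re-expi : ∀ q x → re (expi (fromℚ q *ℝ x)) ≋ cosʳ (rat q *ʳ x)
      re-expi q x = pointwise λ n → refl

      im-expi : ∀ q x → im (expi (fromℚ q *ℝ x)) ≋ sinʳ (rat q *ʳ x)
      im-expi q x = pointwise λ n → refl

    modulus-square : ∀ z r → IsModulus z r → (0ʳ ≼ r) × (r *ʳ (r *ʳ 1ʳ) ≋ re z *ʳ (re z *ʳ 1ʳ) +ʳ im z *ʳ (im z *ʳ 1ʳ))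
    modulus-square z r (h , k) = below (subst (_≤ℝ r) (sym (rat≡ 0ℚ)) h) ,
      ≋-trans (≋-sym (square≋ r)) (≋-trans (equal {r ^ℝ 2} {re z ^ℝ 2 +ℝ im z ^ℝ 2} k)
        (≋-trans (+ʳ≋+ℝ (re z ^ℝ 2) (im z ^ℝ 2)) (+ʳ-cong (square≋ (re z)) (square≋ (im z)))))

    ≡⇒≋ : ∀ {x y} → x ≡ y → x ≋ y
    ≡⇒≋ refl = ≋-refl

    re-sum : ∀ {a} {A : Set a} (h : A → ℂ) xs → re (List.foldr (λ a s → h a +ℂ s) 0ℂ xs) ≋ ∑ʳ xs (λ a → re (h a))
    re-sum h []       = re-0
    re-sum h (x ∷ xs) = ≋-trans (re-∷ h x xs) (+ʳ-cong ≋-refl (re-sum h xs))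

    im-sum : ∀ {a} {A : Set a} (h : A → ℂ) xs → im (List.foldr (λ a s → h a +ℂ s) 0ℂ xs) ≋ ∑ʳ xs (λ a → im (h a))
    im-sum h []       = im-0
    im-sum h (x ∷ xs) = ≋-trans (im-∷ h x xs) (+ʳ-cong ≋-refl (im-sum h xs))

    de-moivre : ∀ w x → re w ≋ cosʳ x → im w ≋ sinʳ x → ∀ k →
      (re (w ^ℂ k) ≋ cosʳ (multiple k x)) × (im (w ^ℂ k) ≋ sinʳ (multiple k x))
    de-moivre w x e e′ zero = ≋-trans re-1 (≋-sym cos-0) , ≋-trans im-1 (≋-sym sin-0)
    de-moivre w x e e′ (suc k) =
        ≋-trans (re-^ w k) (≋-trans (+ʳ-cong (*ʳ-cong e (proj₁ ih)) (-ʳ-cong (*ʳ-cong e′ (proj₂ ih)))) (cos-+ x (multiple k x)))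
      , ≋-trans (im-^ w k) (≋-trans (+ʳ-cong (*ʳ-cong e (proj₂ ih)) (*ʳ-cong e′ (proj₁ ih)))
            (≋-trans (+ʳ-comm (cosʳ x *ʳ sinʳ (multiple k x)) (sinʳ x *ʳ cosʳ (multiple k x))) (sin-+ x (multiple k x))))
      where ih = de-moivre w x e e′ k

    module RootOfUnity (π : ℝ) (isPi : IsPi π) where

      -- The half angle `φ = π / p` lies strictly between 0 and `π` for every prime, so its sine is
      -- positive; the angle `θ = 2 π / p` itself equals `π` for `p = 2`.
      θ φ : ℝ
      θ = rat (_/_ (+ 2) p {{nz}}) *ʳ π
      φ = rat (+ 1 / p) *ʳ π

      sinπ≋0 : sinʳ π ≋ 0ʳ
      sinπ≋0 = equal (subst (λ z → z ≈ℝ 0ʳ) (sym (sinʳ≡ π)) (subst (sin π ≈ℝ_) (sym (rat≡ 0ℚ)) (proj₁ (proj₂ isPi))))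

      p⁻¹≤½ : + 1 / p ℚ.≤ ½
      p⁻¹≤½ = ℚP.*-cancelˡ-≤-pos (fromℕℚ 2) (begin
        fromℕℚ 2 ℚ.* (+ 1 / p)      ≤⟨ Cauchy.*-monoʳ (0≤p⁻¹ p) (Cauchy.fromℕℚ-mono {2} {p} 1<p) ⟩
        fromℕℚ p ℚ.* (+ 1 / p)      ≡⟨ fromℕℚ-/ 1 p ⟩
        1ℚ                          ∎)
        where
        open ℚP.≤-Reasoning
        0≤p⁻¹ : ∀ k .{{_ : NonZero k}} → 0ℚ ℚ.≤ + 1 / k
        0≤p⁻¹ (suc k) = Cauchy.0≤inv k

      0<p⁻¹ : 0ℚ ℚ.< + 1 / p
      0<p⁻¹ = positive p
        where
        positive : ∀ k .{{_ : NonZero k}} → 0ℚ ℚ.< + 1 / k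
        positive (suc k) = ℚP.positive⁻¹ (+ 1 / suc k) {{ℚP.normalize-pos 1 (suc k)}}

      seq-φ : ∀ n → seq φ n ≡ (+ 1 / p) ℚ.* seq π n
      seq-φ n = trans (seq-* (rat (+ 1 / p)) π n) (cong (ℚ._* seq π n) (seq-rat (+ 1 / p) n))

      seq-θ : ∀ n → seq θ n ≡ (+ 2 / p) ℚ.* seq π n
      seq-θ n = trans (seq-* (rat (+ 2 / p)) π n) (cong (ℚ._* seq π n) (seq-rat (+ 2 / p) n))

      φ-bounds : 0ℝ <ℝ π → (0ℝ <ℝ φ) × (φ <ℝ π)
      φ-bounds (ε , 0<ε , N , f) =
        ( (+ 1 / p) ℚ.* ε , ℚP.positive⁻¹ _ {{ℚP.pos*pos⇒pos (+ 1 / p) {{ℚ.positive 0<p⁻¹}} ε {{ℚ.positive 0<ε}}}} , N , λ n le → begin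
          0ℚ ℚ.+ (+ 1 / p) ℚ.* ε       ≡⟨ ℚP.+-identityˡ ((+ 1 / p) ℚ.* ε) ⟩
          (+ 1 / p) ℚ.* ε              ≤⟨ Cauchy.*-monoˡ (ℚP.<⇒≤ 0<p⁻¹) (π≥ n le) ⟩
          (+ 1 / p) ℚ.* seq π n        ≡⟨ sym (seq-φ n) ⟩
          seq φ n                      ∎ ) ,
        ( ½ ℚ.* ε , 0<½* 0<ε , N , λ n le → begin
          seq φ n ℚ.+ ½ ℚ.* ε                    ≡⟨ cong (ℚ._+ ½ ℚ.* ε) (seq-φ n) ⟩
          (+ 1 / p) ℚ.* seq π n ℚ.+ ½ ℚ.* ε      ≤⟨ ℚP.+-mono-≤ (Cauchy.*-monoʳ (ℚP.≤-trans (ℚP.<⇒≤ 0<ε) (π≥ n le)) p⁻¹≤½) (Cauchy.*-monoˡ (ℚP.nonNegative⁻¹ ½) (π≥ n le)) ⟩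
          ½ ℚ.* seq π n ℚ.+ ½ ℚ.* seq π n        ≡⟨ ½+½ (seq π n) ⟩
          seq π n                                ∎ )
        where
        open ℚP.≤-Reasoning
        π≥ : ∀ n → N ℕ.≤ n → ε ℚ.≤ seq π n
        π≥ n le = subst (ℚ._≤ seq π n) (ℚP.+-identityˡ ε) (f n le)

      sinφ>0 : Positive (sinʳ φ)
      sinφ>0 = from (proj₂ (proj₂ isPi) φ (proj₁ (φ-bounds (proj₁ isPi))) (proj₂ (φ-bounds (proj₁ isPi))))
        where
        from : 0ℝ <ℝ sin φ → Positive (sinʳ φ)
        from (η , 0<η , M , g) = η , 0<η , M , λ n le → subst (λ z → η ℚ.≤ seq z n) (sym (sinʳ≡ φ)) (subst (ℚ._≤ seq (sin φ) n) (ℚP.+-identityˡ η) (g n le))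

      double : ∀ x → cosʳ (x +ʳ x) ≋ 1ʳ -ʳ (sinʳ x *ʳ sinʳ x +ʳ sinʳ x *ʳ sinʳ x)
      double x = ≋-trans (≋-sym (cos-+ x x))
        (≋-trans (RS.solve 2 (λ c s → c RS.:* c RS.:- s RS.:* s RS.:= (c RS.:* c RS.:+ s RS.:* s) RS.:- (s RS.:* s RS.:+ s RS.:* s)) ≋-refl (cosʳ x) (sinʳ x))
          (+ʳ-cong (pythagoras x) ≋-refl))

      γ ς : ℕ → ℝ
      γ k = cosʳ (multiple k θ)
      ς k = sinʳ (multiple k θ)

      multiple-+ : ∀ j k n → seq (multiple j θ +ʳ multiple k θ) n ≡ seq (multiple (j ℕ.+ k) θ) n
      multiple-+ j k n = trans (seq-+ (multiple j θ) (multiple k θ) n) (trans (cong₂ ℚ._+_ (seq-multiple j θ n) (seq-multiple k θ n))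
        (trans (sym (ℚP.*-distribʳ-+ (seq θ n) (fromℕℚ j) (fromℕℚ k))) (trans (cong (ℚ._* seq θ n) (sym (fromℕℚ-+ j k))) (sym (seq-multiple (j ℕ.+ k) θ n)))))

      γ-+ : ∀ j k → γ (j ℕ.+ k) ≋ γ j *ʳ γ k -ʳ ς j *ʳ ς k
      γ-+ j k = ≋-trans (≋-sym (cos-pointwise {multiple j θ +ʳ multiple k θ} (multiple-+ j k))) (≋-sym (cos-+ (multiple j θ) (multiple k θ)))

      ς-+ : ∀ j k → ς (j ℕ.+ k) ≋ ς j *ʳ γ k +ʳ γ j *ʳ ς k
      ς-+ j k = ≋-trans (≋-sym (sin-pointwise {multiple j θ +ʳ multiple k θ} (multiple-+ j k))) (≋-sym (sin-+ (multiple j θ) (multiple k θ)))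

      multiple-p : ∀ n → seq (π +ʳ π) n ≡ seq (multiple p θ) n
      multiple-p n = trans (seq-+ π π n) (sym (trans (seq-multiple p θ n) (trans (cong (fromℕℚ p ℚ.*_) (seq-θ n))
        (trans (sym (ℚP.*-assoc (fromℕℚ p) (+ 2 / p) (seq π n))) (trans (cong (ℚ._* seq π n) (fromℕℚ-/ 2 p))
          (QS.solve 1 (λ x → (QS.con (+ 1) QS.:+ QS.con (+ 1)) QS.:* x QS.:= x QS.:+ x) refl (seq π n)))))))

      γ-p : γ p ≋ 1ʳ
      γ-p = ≋-trans (≋-sym (cos-pointwise {π +ʳ π} multiple-p)) (≋-trans (double π)
        (≋-trans (+ʳ-cong ≋-refl (-ʳ-cong (+ʳ-cong (*ʳ-cong sinπ≋0 sinπ≋0) (*ʳ-cong sinπ≋0 sinπ≋0))))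
          (RS.solve 1 (λ i → i RS.:- (RS.con (+ 0) RS.:* RS.con (+ 0) RS.:+ RS.con (+ 0) RS.:* RS.con (+ 0)) RS.:= i) ≋-refl 1ʳ)))

      ς-p : ς p ≋ 0ʳ
      ς-p = ≋-trans (≋-sym (sin-pointwise {π +ʳ π} multiple-p)) (≋-trans (≋-sym (sin-+ π π))
        (≋-trans (+ʳ-cong (*ʳ-cong sinπ≋0 ≋-refl) (*ʳ-cong ≋-refl sinπ≋0))
          (RS.solve 1 (λ c → RS.con (+ 0) RS.:* c RS.:+ c RS.:* RS.con (+ 0) RS.:= RS.con (+ 0)) ≋-refl (cosʳ π))))

      periodic : ∀ r q → (γ (r ℕ.+ q ℕ.* p) ≋ γ r) × (ς (r ℕ.+ q ℕ.* p) ≋ ς r)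
      periodic r zero = subst (λ k → (γ k ≋ γ r) × (ς k ≋ ς r)) (sym (ℕP.+-identityʳ r)) (≋-refl , ≋-refl)
      periodic r (suc q) = subst (λ k → (γ k ≋ γ r) × (ς k ≋ ς r)) (trans (ℕP.+-assoc r (q ℕ.* p) p) (cong (r ℕ.+_) (ℕP.+-comm (q ℕ.* p) p)))
        ( ≋-trans (γ-+ m p) (≋-trans (+ʳ-cong (*ʳ-cong (proj₁ ih) γ-p) (-ʳ-cong (*ʳ-cong (proj₂ ih) ς-p)))
            (RS.solve 2 (λ c s → c RS.:* RS.con (+ 1) RS.:- s RS.:* RS.con (+ 0) RS.:= c) ≋-refl (γ r) (ς r)))
        , ≋-trans (ς-+ m p) (≋-trans (+ʳ-cong (*ʳ-cong (proj₂ ih) γ-p) (*ʳ-cong (proj₁ ih) ς-p))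
            (RS.solve 2 (λ c s → s RS.:* RS.con (+ 1) RS.:+ c RS.:* RS.con (+ 0) RS.:= s) ≋-refl (γ r) (ς r))))
        where
        m = r ℕ.+ q ℕ.* p
        ih = periodic r q

      c s : F p → ℝ
      c x = γ (toℕ x)
      s x = ς (toℕ x)

      c-residue : ∀ m → c (residue m) ≋ γ m
      c-residue m = subst (λ k → γ k ≋ γ m) (sym (toℕ-residue m))
        (≋-sym (subst (λ k → γ k ≋ γ (m % p)) (sym (m≡m%n+[m/n]*n m p)) (proj₁ (periodic (m % p) (m div p)))))

      s-residue : ∀ m → s (residue m) ≋ ς m
      s-residue m = subst (λ k → ς k ≋ ς m) (sym (toℕ-residue m))
        (≋-sym (subst (λ k → ς k ≋ ς (m % p)) (sym (m≡m%n+[m/n]*n m p)) (proj₂ (periodic (m % p) (m div p)))))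

      c-+ : ∀ x y → c (x +F y) ≋ c x *ʳ c y -ʳ s x *ʳ s y
      c-+ x y = ≋-trans (c-residue (toℕ x ℕ.+ toℕ y)) (γ-+ (toℕ x) (toℕ y))

      s-+ : ∀ x y → s (x +F y) ≋ s x *ʳ c y +ʳ c x *ʳ s y
      s-+ x y = ≋-trans (s-residue (toℕ x ℕ.+ toℕ y)) (ς-+ (toℕ x) (toℕ y))

      unit-circle : ∀ x → c x *ʳ c x +ʳ s x *ʳ s x ≋ 1ʳ
      unit-circle x = pythagoras (multiple (toℕ x) θ)

      c-difference : ∀ x y → c (y ⊖F x) ≋ c x *ʳ c y +ʳ s x *ʳ s y
      c-difference x y = ≋-sym (subst (λ z → c x *ʳ c z +ʳ s x *ʳ s z ≋ c d) d+x≡y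
        (≋-trans (+ʳ-cong (*ʳ-cong ≋-refl (c-+ d x)) (*ʳ-cong ≋-refl (s-+ d x)))
        (≋-trans (RS.solve 4 (λ a b c s → a RS.:* (c RS.:* a RS.:- s RS.:* b) RS.:+ b RS.:* (s RS.:* a RS.:+ c RS.:* b) RS.:= c RS.:* (a RS.:* a RS.:+ b RS.:* b)) ≋-refl (c x) (s x) (c d) (s d))
        (≋-trans (*ʳ-cong ≋-refl (unit-circle x)) (≋-trans (R.*-comm (c d) 1ʳ) (R.*-identityˡ (c d)))))))
        where
        d = y ⊖F x
        d+x≡y : d +F x ≡ y
        d+x≡y = FS.solve 2 (λ x y → (y FS.:- x) FS.:+ x FS.:= y) refl x y

      -- On the unit circle `2 (1 - c)` equals `(1 - c)² + s²`, a sum of squares.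
      c≼1 : ∀ x → c x ≼ 1ʳ
      c≼1 x = 0≼-⇒≼ (cancel-≼ 2 (≼-resp (≋-sym (R.zeroʳ (nat 2))) (≋-trans
        (≋-trans (RS.solve 2 (λ c s → (RS.con (+ 1) RS.:- c) RS.:* (RS.con (+ 1) RS.:- c) RS.:+ s RS.:* s RS.:= RS.con (+ 1) RS.:+ (c RS.:* c RS.:+ s RS.:* s) RS.:- (c RS.:+ c)) ≋-refl (c x) (s x))
          (+ʳ-cong (+ʳ-cong ≋-refl (unit-circle x)) ≋-refl))
        (≋-trans (RS.solve 1 (λ c → RS.con (+ 1) RS.:+ RS.con (+ 1) RS.:- (c RS.:+ c) RS.:= (RS.con (+ 1) RS.:+ RS.con (+ 1)) RS.:* (RS.con (+ 1) RS.:- c)) ≋-refl (c x))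
          (*ʳ-cong (≋-sym (nat-+ 1 1)) ≋-refl)))
        (0≼+ (0≼square (1ʳ -ʳ c x)) (0≼square (s x)))))

      -- Shifting the sum by 1 multiplies `A + i B` by `ω`. Eliminating `B` from the real and
      -- imaginary parts leaves `((1 - c 1)² + (s 1)²) A = 0`, whose factor is `2 - 2 c 1`, that is,
      -- 4 times the square of the sine of `φ`; the sine is cancelled twice.
      vanishing : ∑ʳ (List.allFin p) c ≋ 0ʳ
      vanishing = positive-cancel sinφ>0 (positive-cancel sinφ>0 (cancel-≋0 4 (≋-trans
        (≋-trans (*ʳ-cong four ≋-refl)
          (RS.solve 2 (λ s a → (RS.con (+ 1) RS.:+ RS.con (+ 1) RS.:+ RS.con (+ 1) RS.:+ RS.con (+ 1)) RS.:* (s RS.:* (s RS.:* a)) RS.:=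
            (RS.con (+ 1) RS.:+ RS.con (+ 1) RS.:- ((RS.con (+ 1) RS.:- (s RS.:* s RS.:+ s RS.:* s)) RS.:+ (RS.con (+ 1) RS.:- (s RS.:* s RS.:+ s RS.:* s)))) RS.:* a) ≋-refl (sinʳ φ) A))
        (≋-trans (*ʳ-cong (+ʳ-cong (+ʳ-cong ≋-refl (≋-sym (unit-circle 1F))) (-ʳ-cong (+ʳ-cong (≋-sym c1) (≋-sym c1)))) ≋-refl)
        (≋-trans (RS.solve 4 (λ a b x y → (RS.con (+ 1) RS.:+ (x RS.:* x RS.:+ y RS.:* y) RS.:- (x RS.:+ x)) RS.:* a RS.:=
            (RS.con (+ 1) RS.:- x) RS.:* (a RS.:- (a RS.:* x RS.:- b RS.:* y)) RS.:- y RS.:* (b RS.:- (b RS.:* x RS.:+ a RS.:* y))) ≋-refl A B (c 1F) (s 1F))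
        (≋-trans (+ʳ-cong (*ʳ-cong ≋-refl (+ʳ-cong ≋-refl (-ʳ-cong (≋-sym A-shift)))) (-ʳ-cong (*ʳ-cong ≋-refl (+ʳ-cong ≋-refl (-ʳ-cong (≋-sym B-shift))))))
          (RS.solve 4 (λ a b x y → (RS.con (+ 1) RS.:- x) RS.:* (a RS.:- a) RS.:- y RS.:* (b RS.:- b) RS.:= RS.con (+ 0)) ≋-refl A B (c 1F) (s 1F))))))))
        where
        xs = List.allFin p
        A = ∑ʳ xs c
        B = ∑ʳ xs s
        four : nat 4 ≋ 1ʳ +ʳ 1ʳ +ʳ 1ʳ +ʳ 1ʳ
        four = ≋-trans (nat-+ 3 1) (+ʳ-cong (≋-trans (nat-+ 2 1) (+ʳ-cong (nat-+ 1 1) ≋-refl)) ≋-refl)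
        open PointSum R.+-commutativeMonoid using (∑-shift)
        A-shift : A ≋ A *ʳ c 1F -ʳ B *ʳ s 1F
        A-shift = ≋-trans (≋-sym (∑-shift c 1F)) (≋-trans (∑ʳ-cong xs (λ x → c-+ x 1F))
          (≋-trans (∑ʳ-distrib (λ x → c x *ʳ c 1F) (λ x → -ʳ (s x *ʳ s 1F)) xs)
          (+ʳ-cong (≋-sym (∑ʳ-*ʳ (c 1F) c xs)) (≋-trans (∑ʳ-cong xs (λ x → RS.solve 2 (λ a b → RS.:- (a RS.:* b) RS.:= a RS.:* (RS.:- b)) ≋-refl (s x) (s 1F)))
            (≋-trans (≋-sym (∑ʳ-*ʳ (-ʳ s 1F) s xs)) (RS.solve 2 (λ a b → a RS.:* (RS.:- b) RS.:= RS.:- (a RS.:* b)) ≋-refl B (s 1F)))))))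
        B-shift : B ≋ B *ʳ c 1F +ʳ A *ʳ s 1F
        B-shift = ≋-trans (≋-sym (∑-shift s 1F)) (≋-trans (∑ʳ-cong xs (λ x → s-+ x 1F))
          (≋-trans (∑ʳ-distrib (λ x → s x *ʳ c 1F) (λ x → c x *ʳ s 1F) xs)
          (+ʳ-cong (≋-sym (∑ʳ-*ʳ (c 1F) s xs)) (≋-sym (∑ʳ-*ʳ (s 1F) c xs)))))
        θ≡φ+φ : ∀ n → seq (multiple (toℕ (1F {p})) θ) n ≡ seq (φ +ʳ φ) n
        θ≡φ+φ n = trans (seq-multiple (toℕ (1F {p})) θ n) (trans (cong (λ k → fromℕℚ k ℚ.* seq θ n) toℕ-1F)
          (trans (ℚP.*-identityˡ (seq θ n)) (trans (seq-θ n) (trans (cong (ℚ._* seq π n) 2/p)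
            (trans (ℚP.*-distribʳ-+ (seq π n) (+ 1 / p) (+ 1 / p)) (sym (trans (seq-+ φ φ n) (cong₂ ℚ._+_ (seq-φ n) (seq-φ n)))))))))
          where
          2/p : + 2 / p ≡ (+ 1 / p) ℚ.+ (+ 1 / p)
          2/p = cancel p (trans (fromℕℚ-/ 2 p) (sym (trans (ℚP.*-distribˡ-+ (fromℕℚ p) (+ 1 / p) (+ 1 / p)) (cong₂ ℚ._+_ (fromℕℚ-/ 1 p) (fromℕℚ-/ 1 p)))))
            where
            cancel : ∀ k .{{_ : NonZero k}} {x y} → fromℕℚ k ℚ.* x ≡ fromℕℚ k ℚ.* y → x ≡ y
            cancel (suc k) = fromℕℚ-cancel k
        c1 : c 1F ≋ 1ʳ -ʳ (sinʳ φ *ʳ sinʳ φ +ʳ sinʳ φ *ʳ sinʳ φ)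
        c1 = ≋-trans (cos-pointwise {multiple (toℕ (1F {p})) θ} {φ +ʳ φ} θ≡φ+φ) (double φ)

      character : Character
      character = record { c = c ; s = s ; c-⊖ = c-difference ; c≼1 = c≼1 ; vanishing = vanishing }

      power-c : ∀ x → re (expi (fromℚ (_/_ (+ 2) p {{nz}}) *ℝ π) ^ℂ toℕ x) ≋ c x
      power-c x = proj₁ (de-moivre (expi (fromℚ (_/_ (+ 2) p {{nz}}) *ℝ π)) θ (re-expi (_/_ (+ 2) p {{nz}}) π) (im-expi (_/_ (+ 2) p {{nz}}) π) (toℕ x))

      power-s : ∀ x → im (expi (fromℚ (_/_ (+ 2) p {{nz}}) *ℝ π) ^ℂ toℕ x) ≋ s x
      power-s x = proj₂ (de-moivre (expi (fromℚ (_/_ (+ 2) p {{nz}}) *ℝ π)) θ (re-expi (_/_ (+ 2) p {{nz}}) π) (im-expi (_/_ (+ 2) p {{nz}}) π) (toℕ x))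

    -- The square of the modulus, cleared of the denominator `p ^ n`: no square root or division
    -- remains in the estimates.
    record Bias {n} (f : Fun p n) (δ : ℝ) : Set where
      field
        χ   : Character
        0≼δ : 0ʳ ≼ δ
      open Character χ
      field
        modulus : (nat (p ℕ.^ n) *ʳ δ) *ʳ (nat (p ℕ.^ n) *ʳ δ) ≋
          ∑ʳ (points p n) (λ a → c (f a)) *ʳ ∑ʳ (points p n) (λ a → c (f a)) +ʳ
          ∑ʳ (points p n) (λ a → s (f a)) *ʳ ∑ʳ (points p n) (λ a → s (f a))

    module Modulus {n} (χ : Character) (f : Fun p n) (X Y : ℝ)
      (X≋ : X ≋ ∑ʳ (points p n) (λ a → Character.c χ (f a))) (Y≋ : Y ≋ ∑ʳ (points p n) (λ a → Character.s χ (f a)))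
      (q : ℚ) (q-inverse : fromℕℚ (p ℕ.^ n) ℚ.* q ≡ 1ℚ)
      (z : ℂ) (re-z : re z ≋ rat q *ʳ X -ʳ 0ʳ *ʳ Y) (im-z : im z ≋ rat q *ʳ Y +ʳ 0ʳ *ʳ X) where
      open Character χ

      N : ℝ
      N = nat (p ℕ.^ n)

      Nq : N *ʳ rat q ≋ 1ʳ
      Nq = ≋-trans (≋-sym (rat-* (fromℕℚ (p ℕ.^ n)) q)) (≡⇒≋ (cong rat q-inverse))

      unscale : ∀ {X Y} → Y ≋ rat q *ʳ X → N *ʳ Y ≋ X
      unscale {X} {Y} e = ≋-trans (*ʳ-cong ≋-refl e) (≋-trans (≋-sym (*ʳ-assoc N (rat q) X)) (≋-trans (*ʳ-cong Nq ≋-refl) (*ʳ-identityˡ X)))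

      real : N *ʳ re z ≋ ∑ʳ (points p n) (λ a → c (f a))
      real = ≋-trans (unscale (≋-trans re-z
          (RS.solve 3 (λ q X Y → q RS.:* X RS.:- RS.con (+ 0) RS.:* Y RS.:= q RS.:* X) ≋-refl (rat q) X Y))) X≋

      imag : N *ʳ im z ≋ ∑ʳ (points p n) (λ a → s (f a))
      imag = ≋-trans (unscale (≋-trans im-z
          (RS.solve 3 (λ q X Y → q RS.:* Y RS.:+ RS.con (+ 0) RS.:* X RS.:= q RS.:* Y) ≋-refl (rat q) X Y))) Y≋

      modulus⇒bias : ∀ δ → IsModulus z δ → Bias f δ
      modulus⇒bias δ m = record
        { χ = χ
        ; 0≼δ = proj₁ (modulus-square z δ m)
        ; modulus = ≋-trans (RS.solve 2 (λ N d → (N RS.:* d) RS.:* (N RS.:* d) RS.:= (N RS.:* N) RS.:* (d RS.:* (d RS.:* RS.con (+ 1)))) ≋-refl N δ)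
            (≋-trans (*ʳ-cong ≋-refl (proj₂ (modulus-square z δ m)))
            (≋-trans (RS.solve 3 (λ N x y → (N RS.:* N) RS.:* (x RS.:* (x RS.:* RS.con (+ 1)) RS.:+ y RS.:* (y RS.:* RS.con (+ 1))) RS.:= (N RS.:* x) RS.:* (N RS.:* x) RS.:+ (N RS.:* y) RS.:* (N RS.:* y)) ≋-refl N (re z) (im z))
              (+ʳ-cong (*ʳ-cong real real) (*ʳ-cong imag imag)))) }

    bias-mean : ∀ {n} (χ : Character) (f : Fun p n) (h : Vec (F p) n → ℂ) →
      (∀ a → re (h a) ≋ Character.c χ (f a)) → (∀ a → im (h a) ≋ Character.s χ (f a)) →
      ∀ δ → IsModulus (mean {{nz}} h) δ → Bias f δ
    bias-mean {n} χ f h h-c h-s = Modulus.modulus⇒bias χ f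
      (re (List.foldr (λ a s → h a +ℂ s) 0ℂ (points p n))) (im (List.foldr (λ a s → h a +ℂ s) 0ℂ (points p n)))
      (≋-trans (re-sum h (points p n)) (∑ʳ-cong (points p n) h-c)) (≋-trans (im-sum h (points p n)) (∑ʳ-cong (points p n) h-s))
      (_/_ (+ 1) (p ℕ.^ n) {{ℕP.m^n≢0 p n {{nz}}}}) (fromℕℚ-/ 1 (p ℕ.^ n) {{ℕP.m^n≢0 p n {{nz}}}})
      (mean {{nz}} h) (re-mean h) (im-mean h)

    bias : ∀ {n} {f : Fun p n} {δ} → IsBias {{nz}} f δ → Bias f δ
    bias {n} {f} {δ} (π , isPi , m) =
      bias-mean (RootOfUnity.character π isPi) f (λ a → expi (fromℚ (_/_ (+ 2) p {{nz}}) *ℝ π) ^ℂ toℕ (f a))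
        (λ a → RootOfUnity.power-c π isPi (f a)) (λ a → RootOfUnity.power-s π isPi (f a)) δ m

  -- Exponential sums of quadratics on subspaces and of cubics.

  module FourierBounds where

    open Sums
    open Reals
    open PrimeField
    open Vectors
    open Subspaces
    open Counting
    open TrilinearForms
    open Polynomials
    open AdditiveCharacter

    open PointSum R.+-commutativeMonoid using (∑-shift; ∑-translate)

    module _ {n} (U : Sub n) where

      ι : V n → ℝ
      ι x = nat (𝟙 (mem? U x))

      ι-yes : ∀ {x} → Mem U x → ι x ≋ 1ʳ
      ι-yes {x} x∈ = ≡⇒≋ (cong nat (𝟙-yes (mem? U x) x∈))

      ι-no : ∀ {x} → ¬ Mem U x → ι x ≋ 0ʳ
      ι-no {x} x∉ = ≡⇒≋ (cong nat (𝟙-no (mem? U x) x∉))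

      ∑ι : ∑ʳ (points p n) ι ≋ nat (# (mem? U))
      ∑ι = ≋-trans (≋-sym (nat-∑ (λ x → 𝟙 (mem? U x)) (points p n))) (≡⇒≋ (cong nat (sym (#≡count (mem? U)))))

    module Fourier (χ : Character) {n : ℕ} where
      open Character χ

      pts : List (V n)
      pts = points p n

      energy : (V n → ℝ) → (V n → F p) → ℝ
      energy w f = ∑ʳ pts (λ x → w x *ʳ c (f x)) *ʳ ∑ʳ pts (λ x → w x *ʳ c (f x)) +ʳ
                   ∑ʳ pts (λ x → w x *ʳ s (f x)) *ʳ ∑ʳ pts (λ x → w x *ʳ s (f x))

      correlation : (V n → ℝ) → (V n → F p) → V n → ℝ
      correlation w f h = ∑ʳ pts (λ x → (w x *ʳ w (x +ᵛ h)) *ʳ c (f (x +ᵛ h) ⊖F f x))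

      -- Weyl differencing: expand the squares into a double sum, combine cosines and sines by
      -- `c-⊖`, and substitute `y = x + h`.
      autocorrelation : ∀ w f → energy w f ≋ ∑ʳ pts (correlation w f)
      autocorrelation w f = ≋-trans (+ʳ-cong (∑ʳ-product (λ x → w x *ʳ c (f x)) (λ x → w x *ʳ c (f x)) pts pts) (∑ʳ-product (λ x → w x *ʳ s (f x)) (λ x → w x *ʳ s (f x)) pts pts))
        (≋-trans (≋-sym (∑ʳ-distrib (λ x → ∑ʳ pts (λ y → (w x *ʳ c (f x)) *ʳ (w y *ʳ c (f y)))) (λ x → ∑ʳ pts (λ y → (w x *ʳ s (f x)) *ʳ (w y *ʳ s (f y)))) pts))
        (≋-trans (∑ʳ-cong pts row) (∑ʳ-swap (λ x h → (w x *ʳ w (x +ᵛ h)) *ʳ c (f (x +ᵛ h) ⊖F f x)) pts pts)))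
        where
        g : V n → V n → ℝ
        g x y = (w x *ʳ w y) *ʳ c (f y ⊖F f x)
        row : ∀ x → ∑ʳ pts (λ y → (w x *ʳ c (f x)) *ʳ (w y *ʳ c (f y))) +ʳ ∑ʳ pts (λ y → (w x *ʳ s (f x)) *ʳ (w y *ʳ s (f y))) ≋
          ∑ʳ pts (λ h → g x (x +ᵛ h))
        row x = ≋-trans (≋-sym (∑ʳ-distrib (λ y → (w x *ʳ c (f x)) *ʳ (w y *ʳ c (f y))) (λ y → (w x *ʳ s (f x)) *ʳ (w y *ʳ s (f y))) pts))
          (≋-trans (∑ʳ-cong pts (λ y → ≋-trans
              (RS.solve 6 (λ a b x y u v → (a RS.:* x) RS.:* (b RS.:* y) RS.:+ (a RS.:* u) RS.:* (b RS.:* v) RS.:= (a RS.:* b) RS.:* (x RS.:* y RS.:+ u RS.:* v)) ≋-refl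
                (w x) (w y) (c (f x)) (c (f y)) (s (f x)) (s (f y)))
              (*ʳ-cong ≋-refl (≋-sym (c-⊖ (f x) (f y))))))
          (≋-trans (≋-sym (∑-translate (g x) x)) (∑ʳ-cong pts (λ h → ≡⇒≋ (cong (g x) (+ᵛ-comm h x))))))

      ∑-c-shift : ∀ a → ∑ʳ (List.allFin p) (λ t → c (t +F a)) ≋ 0ʳ
      ∑-c-shift a = ≋-trans (∑-shift c a) vanishing

      module Quadratic (U : Sub n) (f : V n → F p) (β : V n → V n → F p) (κ : V n → F p)
        (β-+ : ∀ {h} → Mem U h → AdditiveOn U (β h))
        (expand : ∀ {h u} → Mem U h → Mem U u → f (u +ᵛ h) ⊖F f u ≡ β h u +F κ h) where

        Rad : V n → Set
        Rad h = Mem U h × (∀ u → Mem U u → β h u ≡ 0F)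

        Rad? : Decidable Rad
        Rad? h = mem? U h ×-dec ∀? (λ u → mem? U u →-dec (β h u FinP.≟ 0F))

        outside : ∀ {h} → ¬ Mem U h → correlation (ι U) f h ≋ 0ʳ
        outside {h} h∉ = ≋-trans (∑ʳ-cong pts (λ x → ≋-trans (*ʳ-cong (zero-weight x (mem? U x)) ≋-refl) (R.zeroˡ (c (f (x +ᵛ h) ⊖F f x))))) (∑ʳ-0 pts)
          where
          zero-weight : ∀ x → Dec (Mem U x) → ι U x *ʳ ι U (x +ᵛ h) ≋ 0ʳ
          zero-weight x (no x∉)  = ≋-trans (*ʳ-cong (ι-no U x∉) ≋-refl) (R.zeroˡ (ι U (x +ᵛ h)))
          zero-weight x (yes x∈) = ≋-trans (*ʳ-cong ≋-refl (ι-no U λ xh∈ → h∉ (subst (Mem U) (trans (cong (_⊖ᵛ x) (+ᵛ-comm x h)) (x+y-y h x)) (⊖∈ U xh∈ x∈)))) (R.zeroʳ (ι U x))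

        inside : ∀ {h} → Mem U h → correlation (ι U) f h ≋ ∑ʳ pts (λ x → ι U x *ʳ c (β h x +F κ h))
        inside {h} h∈ = ∑ʳ-cong pts (λ x → term-eq x (mem? U x))
          where
          zero-term : ∀ {x} → ¬ Mem U x → ∀ y → ι U x *ʳ y ≋ 0ʳ
          zero-term x∉ y = ≋-trans (*ʳ-cong (ι-no U x∉) ≋-refl) (R.zeroˡ y)
          term-eq : ∀ x → Dec (Mem U x) → (ι U x *ʳ ι U (x +ᵛ h)) *ʳ c (f (x +ᵛ h) ⊖F f x) ≋ ι U x *ʳ c (β h x +F κ h)
          term-eq x (no x∉)  = ≋-trans (*ʳ-assoc (ι U x) (ι U (x +ᵛ h)) (c (f (x +ᵛ h) ⊖F f x)))
            (≋-trans (zero-term x∉ (ι U (x +ᵛ h) *ʳ c (f (x +ᵛ h) ⊖F f x))) (≋-sym (zero-term x∉ (c (β h x +F κ h)))))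
          term-eq x (yes x∈) = *ʳ-cong (≋-trans (*ʳ-cong ≋-refl (ι-yes U (+∈ U x∈ h∈))) (R.*-identityʳ (ι U x))) (≡⇒≋ (cong c (expand h∈ x∈)))

        -- Translating by `t k` adds `t` to the phase and preserves `U`. Averaged over all `t` the
        -- phase runs through the field, where the character sums to 0.
        cancelling : ∀ {h k} → Mem U h → Mem U k → β h k ≡ 1F → ∑ʳ pts (λ x → ι U x *ʳ c (β h x +F κ h)) ≋ 0ʳ
        cancelling {h} {k} h∈ k∈ βk≡1 = cancel-≋0 p (≋-trans (*ʳ-cong (≡⇒≋ (cong nat (sym (ListP.length-tabulate {n = p} (λ i → i))))) ≋-refl)
          (≋-trans (≋-sym (∑ʳ-const (∑ʳ pts G) (List.allFin p)))
          (≋-trans (∑ʳ-cong (List.allFin p) (λ t → ≋-sym (∑-translate G (t ·ᵛ k))))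
          (≋-trans (∑ʳ-swap (λ t x → G (x +ᵛ t ·ᵛ k)) (List.allFin p) pts)
          (≋-trans (∑ʳ-cong pts column) (∑ʳ-0 pts))))))
          where
          G : V n → ℝ
          G x = ι U x *ʳ c (β h x +F κ h)
          ι-shift : ∀ x t → ι U (x +ᵛ t ·ᵛ k) ≡ ι U x
          ι-shift x t = cong nat (𝟙-cong (mem? U (x +ᵛ t ·ᵛ k)) (mem? U x)
            (λ h → subst (Mem U) (x+y-y x (t ·ᵛ k)) (⊖∈ U h (·∈ U t k∈))) (λ h → +∈ U h (·∈ U t k∈)))
          shifted : ∀ x t → G (x +ᵛ t ·ᵛ k) ≋ ι U x *ʳ c (t +F (β h x +F κ h))
          shifted x t = ≋-trans (*ʳ-cong (≡⇒≋ (ι-shift x t)) ≋-refl) (on-U x (mem? U x))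
            where
            on-U : ∀ x → Dec (Mem U x) → ι U x *ʳ c (β h (x +ᵛ t ·ᵛ k) +F κ h) ≋ ι U x *ʳ c (t +F (β h x +F κ h))
            on-U x (no x∉) = ≋-trans (*ʳ-cong (ι-no U x∉) ≋-refl) (≋-trans (R.zeroˡ _) (≋-sym (≋-trans (*ʳ-cong (ι-no U x∉) ≋-refl) (R.zeroˡ _))))
            on-U x (yes x∈) = *ʳ-cong ≋-refl (≡⇒≋ (cong c (trans (cong (_+F κ h) (trans (β-+ h∈ x∈ (·∈ U t k∈))
              (cong (β h x +F_) (trans (additive-· U {β h} (β-+ h∈) t k∈) (trans (cong (t *F_) βk≡1) (Fp.*-identityʳ t))))))
              (FS.solve 3 (λ a t b → (a FS.:+ t) FS.:+ b FS.:= t FS.:+ (a FS.:+ b)) refl (β h x) t (κ h)))))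
          column : ∀ x → ∑ʳ (List.allFin p) (λ t → G (x +ᵛ t ·ᵛ k)) ≋ 0ʳ
          column x = ≋-trans (∑ʳ-cong (List.allFin p) (shifted x)) (≋-trans (≋-sym (∑ʳ-*ˡ (ι U x) (λ t → c (t +F (β h x +F κ h))) (List.allFin p)))
            (≋-trans (*ʳ-cong ≋-refl (∑-c-shift (β h x +F κ h))) (R.zeroʳ (ι U x))))

        correlation-≼ : ∀ h → correlation (ι U) f h ≼ nat (𝟙 (Rad? h)) *ʳ nat (# (mem? U))
        correlation-≼ h = by-cases (mem? U h) (Rad? h)
          where
          0≼ : ∀ {x} → x ≋ 0ʳ → ∀ (d : Dec (Rad h)) → x ≼ nat (𝟙 d) *ʳ nat (# (mem? U))
          0≼ e d = ≼-trans (≼-reflexive e) (0≼* (0≼nat (𝟙 d)) (0≼nat (# (mem? U))))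
          by-cases : Dec (Mem U h) → (d : Dec (Rad h)) → correlation (ι U) f h ≼ nat (𝟙 d) *ʳ nat (# (mem? U))
          by-cases (no h∉) d = 0≼ (outside h∉) d
          by-cases (yes h∈) (yes _) = ≼-trans (≼-reflexive (inside h∈)) (≼-trans
            (∑ʳ-mono pts (λ x → ≼-trans (*ʳ-monoˡ (0≼nat (𝟙 (mem? U x))) (c≼1 (β h x +F κ h))) (≼-reflexive (R.*-identityʳ (ι U x)))))
            (≼-reflexive (≋-trans (∑ι U) (≋-sym (R.*-identityˡ (nat (# (mem? U))))))))
          by-cases (yes h∈) (no ¬rad) = 0≼ (≋-trans (inside h∈) (cancels (∃? (λ u → mem? U u ×-dec ¬? (β h u FinP.≟ 0F))))) (no ¬rad)
            where
            cancels : Dec (∃[ u ] (Mem U u × β h u ≢ 0F)) → ∑ʳ pts (λ x → ι U x *ʳ c (β h x +F κ h)) ≋ 0ʳ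
            cancels (yes (u , u∈ , βu≢0)) = let (k , k∈ , βk≡1) = normalise U {β h} (β-+ h∈) u∈ βu≢0 in cancelling h∈ k∈ βk≡1
            cancels (no ¬ex) = ⊥-elim (¬rad (h∈ , λ u u∈ → decide u u∈ (β h u FinP.≟ 0F)))
              where
              decide : ∀ u → Mem U u → Dec (β h u ≡ 0F) → β h u ≡ 0F
              decide u u∈ (yes e) = e
              decide u u∈ (no ne) = ⊥-elim (¬ex (u , u∈ , ne))

        -- The Gauss sum bound: after differencing, only the `h` in the radical contribute, each at
        -- most the size of `U`.
        energy-≼ : energy (ι U) f ≼ nat (# Rad?) *ʳ nat (# (mem? U))
        energy-≼ = ≼-trans (≼-reflexive (autocorrelation (ι U) f)) (≼-trans (∑ʳ-mono pts correlation-≼)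
          (≼-reflexive (≋-trans (≋-sym (∑ʳ-*ʳ (nat (# (mem? U))) (λ h → nat (𝟙 (Rad? h))) pts))
            (*ʳ-cong (≋-trans (≋-sym (nat-∑ (λ h → 𝟙 (Rad? h)) pts)) (≡⇒≋ (cong nat (sym (#≡count Rad?))))) ≋-refl))))

      cauchy-schwarzᵥ : ∀ (g : V n → ℝ) → ∑ʳ pts g *ʳ ∑ʳ pts g ≼ nat (p ℕ.^ n) *ʳ ∑ʳ pts (λ x → g x *ʳ g x)
      cauchy-schwarzᵥ g = subst (λ k → ∑ʳ pts g *ʳ ∑ʳ pts g ≼ nat k *ʳ ∑ʳ pts (λ x → g x *ʳ g x)) (length-points n) (cauchy-schwarz g pts)

      ∑ʳ-constᵥ : ∀ k → ∑ʳ pts (λ _ → k) ≋ nat (p ℕ.^ n) *ʳ k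
      ∑ʳ-constᵥ k = subst (λ l → ∑ʳ pts (λ _ → k) ≋ nat l *ʳ k) (length-points n) (∑ʳ-const k pts)

      1-weight : ∀ (g : V n → ℝ) → ∑ʳ pts (λ x → 1ʳ *ʳ g x) ≋ ∑ʳ pts g
      1-weight g = ∑ʳ-cong pts (λ x → R.*-identityˡ (g x))

      plain : (V n → F p) → ℝ
      plain f = ∑ʳ pts (λ x → c (f x)) *ʳ ∑ʳ pts (λ x → c (f x)) +ʳ ∑ʳ pts (λ x → s (f x)) *ʳ ∑ʳ pts (λ x → s (f x))

      module Cubic {f : Fun p n} (third-const : ∀ x y z a b → Δ x (Δ y (Δ z f)) a ≡ Δ x (Δ y (Δ z f)) b) where
        T : Trilinear (third f)
        T = Third.trilinear {n} {f} third-const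

        Δ²-+ : ∀ h k a l → Δ h (Δ k f) (a +ᵛ l) ≡ Δ h (Δ k f) a +F third f l h k
        Δ²-+ = Third.Δ²-+ {n} {f} third-const

        Z N : ℕ
        Z = Structure.Z T
        N = p ℕ.^ n

        ker : V n → Sub n
        ker = Structure.ker T

        -- The derivative `Δ h f` is quadratic with bilinear form `third f h`, whose radical is the
        -- kernel of that form; the square of the sine sum is added to reach the full energy.
        row-≼ : ∀ h → ∑ʳ pts (λ x → c (Δ h f x)) *ʳ ∑ʳ pts (λ x → c (Δ h f x)) ≼ nat (# (mem? (ker h))) *ʳ nat N
        row-≼ h = ≼-trans (≼-trans (≼-reflexive (*ʳ-cong unweighted unweighted)) drop)
          (≼-trans (Quadratic.energy-≼ whole (Δ h f) (third f h) κ additive expand) (≼-reflexive (*ʳ-cong (≡⇒≋ (cong nat rad≡)) (≡⇒≋ (cong nat (#-all (mem? (whole {n})) (λ _ → tt)))))))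
          where
          open Trilinear T
          κ : V n → F p
          κ k = Δ k (Δ h f) 0ᵛ
          additive : ∀ {k} → Mem (whole {n}) k → AdditiveOn whole (third f h k)
          additive {k} _ {x} {y} _ _ = Biadditive.+ʳ (biadditive h) k x y
          expand : ∀ {k u} → Mem (whole {n}) k → Mem (whole {n}) u → Δ h f (u +ᵛ k) ⊖F Δ h f u ≡ third f h k u +F κ k
          expand {k} {u} _ _ = trans (trans (cong (Δ k (Δ h f)) (sym (+ᵛ-identityˡ u))) (Δ²-+ k h 0ᵛ u))
            (trans (+F-comm (κ k) (third f u k h)) (cong (_+F κ k) (trans (s₂₃ u k h) (trans (s₁₂ u h k) (s₂₃ h u k)))))
          Rad? : Decidable (Quadratic.Rad whole (Δ h f) (third f h) κ additive expand)
          Rad? = Quadratic.Rad? whole (Δ h f) (third f h) κ additive expand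
          rad≡ : # Rad? ≡ # (mem? (ker h))
          rad≡ = ℕP.≤-antisym (#-mono Rad? (mem? (ker h)) (λ r → r)) (#-mono (mem? (ker h)) Rad? (λ r → r))
          X Y : ℝ
          X = ∑ʳ pts (λ x → ι whole x *ʳ c (Δ h f x))
          Y = ∑ʳ pts (λ x → ι whole x *ʳ s (Δ h f x))
          unweighted : ∑ʳ pts (λ x → c (Δ h f x)) ≋ X
          unweighted = ≋-sym (∑ʳ-cong pts (λ x → ≋-trans (*ʳ-cong (ι-yes whole {x} tt) ≋-refl) (R.*-identityˡ (c (Δ h f x)))))
          drop : X *ʳ X ≼ X *ʳ X +ʳ Y *ʳ Y
          drop = ≼-resp (R.+-identityʳ (X *ʳ X)) ≋-refl (+ʳ-mono (≼-refl {X *ʳ X}) (0≼square Y))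

        -- One differencing turns `plain f` into a sum over `h`, and Cauchy-Schwarz in `h` reduces
        -- its square to the rows. With `plain f = N² δ²` this reads `N² δ⁴ ≤ Z`.
        plain-square : plain f *ʳ plain f ≼ nat N *ʳ (nat Z *ʳ nat N)
        plain-square = ≼-trans (≼-reflexive (*ʳ-cong rows rows)) (≼-trans (cauchy-schwarzᵥ (λ h → ∑ʳ pts (λ x → c (Δ h f x))))
          (*ʳ-monoˡ (0≼nat N) (≼-trans (∑ʳ-mono pts row-≼) (≼-reflexive (≋-trans (≋-sym (∑ʳ-*ʳ (nat N) (λ h → nat (# (mem? (ker h)))) pts))
            (*ʳ-cong (≋-sym (nat-∑ (λ h → # (mem? (ker h))) pts)) ≋-refl))))))
          where
          rows : plain f ≋ ∑ʳ pts (λ h → ∑ʳ pts (λ x → c (Δ h f x)))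
          rows = ≋-trans (+ʳ-cong (*ʳ-cong (≋-sym (1-weight (λ x → c (f x)))) (≋-sym (1-weight (λ x → c (f x))))) (*ʳ-cong (≋-sym (1-weight (λ x → s (f x)))) (≋-sym (1-weight (λ x → s (f x))))))
            (≋-trans (autocorrelation (λ _ → 1ʳ) f) (∑ʳ-cong pts (λ h → ∑ʳ-cong pts (λ x →
              ≋-trans (*ʳ-cong (R.*-identityˡ 1ʳ) ≋-refl) (R.*-identityˡ (c (Δ h f x)))))))

        module Coset (U : Sub n) (flat : ∀ {u v w} → Mem U u → Mem U v → Mem U w → third f u v w ≡ 0F) where

          -- Moving the base point by a vector of `U` changes the second difference along `U` by a
          -- value of `third f` on `U`, which is zero.
          Δ²-additive : ∀ x {h} → Mem U h → AdditiveOn U (λ u → Δ u (Δ h f) x)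
          Δ²-additive x {h} h∈ {u} {v} u∈ v∈ = trans (Δ-+ (Δ h f) u v x)
            (cong (Δ u (Δ h f) x +F_) (trans (Δ²-+ v h x u) (trans (cong (Δ v (Δ h f) x +F_) (flat u∈ v∈ h∈)) (+F-identityʳ (Δ v (Δ h f) x)))))

          -- The radical of the bilinear form of `u ↦ f (x + u)` on `U`. It can vary with `x`, since
          -- `third f x` need not vanish on `U` for arbitrary `x`.
          radical : V n → Sub n
          radical x = record
            { Mem = λ h → Mem U h × (∀ u → Mem U u → Δ u (Δ h f) x ≡ 0F)
            ; mem? = λ h → mem? U h ×-dec ∀? (λ u → mem? U u →-dec (Δ u (Δ h f) x FinP.≟ 0F))
            ; 0∈ = 0∈ U , λ u u∈ → trans (Δ-comm f u 0ᵛ x) (additive-0 U {λ v → Δ v (Δ u f) x} (Δ²-additive x u∈))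
            ; +∈ = λ {h} {k} (h∈ , fh) (k∈ , fk) → +∈ U h∈ k∈ , λ u u∈ →
                trans (Δ-comm f u (h +ᵛ k) x) (trans (Δ²-additive x u∈ h∈ k∈)
                  (trans (cong₂ _+F_ (trans (Δ-comm f h u x) (fh u u∈)) (trans (Δ-comm f k u x) (fk u u∈))) (+F-identityˡ 0F))) }

          coset-≼ : ∀ x → energy (ι U) (λ u → f (x +ᵛ u)) ≼ nat (# (mem? (radical x))) *ʳ nat (# (mem? U))
          coset-≼ x = ≼-trans (Quadratic.energy-≼ U (λ u → f (x +ᵛ u)) β κ (λ h∈ → Δ²-additive x h∈) expand)
              (≼-reflexive (*ʳ-cong (≡⇒≋ (cong nat rad≡)) ≋-refl))
            where
            β : V n → V n → F p
            β h u = Δ u (Δ h f) x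
            κ : V n → F p
            κ h = Δ h f x
            expand : ∀ {h u} → Mem U h → Mem U u → f (x +ᵛ (u +ᵛ h)) ⊖F f (x +ᵛ u) ≡ β h u +F κ h
            expand {h} {u} h∈ u∈ = trans (cong (λ z → f z ⊖F f (x +ᵛ u)) (sym (+ᵛ-assoc x u h)))
              (FS.solve 2 (λ a b → a FS.:= (a FS.:- b) FS.:+ b) refl (Δ h f (x +ᵛ u)) (Δ h f x))
            Rad? : Decidable (Quadratic.Rad U (λ u → f (x +ᵛ u)) β κ (λ h∈ → Δ²-additive x h∈) expand)
            Rad? = Quadratic.Rad? U (λ u → f (x +ᵛ u)) β κ (λ h∈ → Δ²-additive x h∈) expand
            rad≡ : # Rad? ≡ # (mem? (radical x))
            rad≡ = ℕP.≤-antisym (#-mono Rad? (mem? (radical x)) (λ r → r)) (#-mono (mem? (radical x)) Rad? (λ r → r))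

          average : ∀ (φ : F p → ℝ) → nat (# (mem? U)) *ʳ ∑ʳ pts (λ x → φ (f x)) ≋ ∑ʳ pts (λ x → ∑ʳ pts (λ u → ι U u *ʳ φ (f (x +ᵛ u))))
          average φ = ≋-trans (*ʳ-cong (≋-sym (∑ι U)) ≋-refl) (≋-trans (∑ʳ-*ʳ (∑ʳ pts (λ x → φ (f x))) (ι U) pts)
            (≋-trans (∑ʳ-cong pts (λ u → ≋-trans (*ʳ-cong ≋-refl (≋-sym (∑-translate (λ x → φ (f x)) u))) (∑ʳ-*ˡ (ι U u) (λ x → φ (f (x +ᵛ u))) pts)))
              (∑ʳ-swap (λ u x → ι U u *ʳ φ (f (x +ᵛ u))) pts pts)))

          -- Write each sum over the space as an average over translates of `U`, apply
          -- Cauchy-Schwarz over the base points, and bound each translate by its radical. In terms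
          -- of δ the result is δ² ≤ `M` divided by the size of `U`.
          plain-≼ : ∀ M → (∀ x → # (mem? (radical x)) ℕ.≤ M) →
            (nat (# (mem? U)) *ʳ nat (# (mem? U))) *ʳ plain f ≼ nat N *ʳ (nat N *ʳ (nat M *ʳ nat (# (mem? U))))
          plain-≼ M max = ≼-trans (≼-reflexive (≋-trans
              (RS.solve 3 (λ u a b → (u RS.:* u) RS.:* (a RS.:* a RS.:+ b RS.:* b) RS.:= (u RS.:* a) RS.:* (u RS.:* a) RS.:+ (u RS.:* b) RS.:* (u RS.:* b)) ≋-refl
                (nat (# (mem? U))) (∑ʳ pts (λ x → c (f x))) (∑ʳ pts (λ x → s (f x))))
              (+ʳ-cong (*ʳ-cong (average c) (average c)) (*ʳ-cong (average s) (average s)))))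
            (≼-trans (+ʳ-mono (cauchy-schwarzᵥ A) (cauchy-schwarzᵥ B))
            (≼-trans (≼-reflexive (≋-trans (≋-sym (R.distribˡ (nat N) (∑ʳ pts (λ x → A x *ʳ A x)) (∑ʳ pts (λ x → B x *ʳ B x))))
                (*ʳ-cong ≋-refl (≋-sym (∑ʳ-distrib (λ x → A x *ʳ A x) (λ x → B x *ʳ B x) pts)))))
              (*ʳ-monoˡ (0≼nat N) (≼-trans (∑ʳ-mono pts (λ x → ≼-trans (coset-≼ x) (*ʳ-monoʳ (0≼nat (# (mem? U))) (nat-mono (max x)))))
                (≼-reflexive (∑ʳ-constᵥ (nat M *ʳ nat (# (mem? U)))))))))
            where
            A B : V n → ℝ
            A x = ∑ʳ pts (λ u → ι U u *ʳ c (f (x +ᵛ u)))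
            B x = ∑ʳ pts (λ u → ι U u *ʳ s (f (x +ᵛ u)))

  -- Choice of parameters and logarithmic bounds.

  module Conclusion where

    open Sums
    open Reals
    open ExponentialSeries
    open Trigonometry
    open Logarithm
    open PrimeField
    open Vectors
    open Subspaces
    open Counting
    open TrilinearForms
    open Polynomials
    open Representation
    open AdditiveCharacter
    open FourierBounds

    n≤p^n : ∀ n → n ℕ.≤ p ℕ.^ n
    n≤p^n zero    = ℕ.z≤n
    n≤p^n (suc n) = ℕP.≤-trans (ℕP.+-mono-≤ (p^>0 n) (ℕP.≤-trans (n≤p^n n) (ℕP.≤-reflexive (sym (ℕP.*-identityˡ (p ℕ.^ n))))))
      (ℕP.≤-trans (ℕP.≤-reflexive (cong (p ℕ.^ n ℕ.+_) refl)) (ℕP.*-monoˡ-≤ (p ℕ.^ n) 1<p))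

    -- The integral logarithm of `Q / Z` to base `p`. Its upper estimate feeds the density of low
    -- rank forms, its lower one bounds `k` by the logarithm of `1 / δ`.
    scale-exponent : ∀ Z Q → 0 ℕ.< Z → Z ℕ.≤ Q → ∃[ k ] (Z ℕ.* p ℕ.^ k ℕ.≤ Q × Q ℕ.≤ Z ℕ.* p ℕ.^ suc k)
    scale-exponent Z Q 0<Z Z≤Q = go Q 0 (ℕP.≤-trans (ℕP.≤-reflexive (ℕP.*-identityʳ Z)) Z≤Q)
      (ℕP.≤-trans (ℕP.≤-trans (n≤p^n Q) (ℕP.≤-reflexive (sym (ℕP.*-identityˡ (p ℕ.^ Q)))))
        (ℕP.*-mono-≤ 0<Z (ℕP.≤-reflexive (cong (p ℕ.^_) (sym (ℕP.+-identityʳ Q))))))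
      where
      go : ∀ fuel k → Z ℕ.* p ℕ.^ k ℕ.≤ Q → Q ℕ.≤ Z ℕ.* p ℕ.^ (fuel ℕ.+ k) → ∃[ k ] (Z ℕ.* p ℕ.^ k ℕ.≤ Q × Q ℕ.≤ Z ℕ.* p ℕ.^ suc k)
      go zero k lo hi = k , lo , ℕP.≤-trans hi (ℕP.*-monoʳ-≤ Z (p^-mono (ℕP.n≤1+n k)))
      go (suc fuel) k lo hi with Q ℕP.≤? Z ℕ.* p ℕ.^ suc k
      ... | yes h = k , lo , h
      ... | no ¬h = go fuel (suc k) (ℕP.<⇒≤ (ℕP.≰⇒> ¬h)) (ℕP.≤-trans hi (ℕP.≤-reflexive (cong (λ e → Z ℕ.* p ℕ.^ e) (sym (ℕP.+-suc fuel k)))))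

    seq-^ℝ : ∀ x k n → seq (x ^ℝ k) n ≡ seq x n ^ℚ k
    seq-^ℝ x zero    n = refl
    seq-^ℝ x (suc k) n = cong (seq x n ℚ.*_) (seq-^ℝ x k n)

    scaled-power : ∀ C x k → nat C *ʳ x ^ʳ k ≋ fromℕ C *ℝ x ^ℝ k
    scaled-power C x k = pointwise λ n → trans (seq-* (nat C) (x ^ʳ k) n)
      (trans (cong₂ ℚ._*_ (seq-rat (fromℕℚ C) n) (seq-^ x k n)) (cong (fromℕℚ C ℚ.*_) (sym (seq-^ℝ x k n))))

    opaque
      unfolding _*ʳ_ rat expʳ

      exp*-≋ : ∀ x y → expʳ x *ʳ y ≋ exp x *ℝ y
      exp*-≋ x y = pointwise λ n → refl

      1-≋ : 1ℝ ≋ 1ʳ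
      1-≋ = pointwise λ n → refl

    log-inverse : ∀ {δ L} → IsLogInverse δ L → expʳ L *ʳ δ ≋ 1ʳ
    log-inverse {δ} {L} h = ≋-trans (exp*-≋ L δ) (≋-trans (equal {exp L *ℝ δ} {1ℝ} h) 1-≋)

    logBound : ∀ c C k δ → (∀ L → expʳ L *ʳ δ ≋ 1ʳ → nat c ≼ nat C *ʳ L ^ʳ k) → LogBound c C k δ
    logBound c C k δ h L inv = eventually-≤ (≼-trans (≼-reflexive (≡⇒≋ (sym (rat≡ (fromℕℚ c)))))
      (≼-trans (h L (log-inverse {δ} {L} inv)) (≼-reflexive (scaled-power C L k))))

    ^ʳ-mono : ∀ {x y} k → 0ʳ ≼ x → x ≼ y → (0ʳ ≼ x ^ʳ k) × (0ʳ ≼ y ^ʳ k) × (x ^ʳ k ≼ y ^ʳ k)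
    ^ʳ-mono zero    0≼x x≼y = 0≼nat 1 , 0≼nat 1 , ≼-refl
    ^ʳ-mono (suc k) 0≼x x≼y = let (a , b , c) = ^ʳ-mono k 0≼x x≼y in
      0≼* 0≼x a , 0≼* (≼-trans 0≼x x≼y) b , *ʳ-mono 0≼x b x≼y c

    ^ʳ-* : ∀ x y k → (x *ʳ y) ^ʳ k ≋ x ^ʳ k *ʳ y ^ʳ k
    ^ʳ-* x y zero    = ≋-sym (R.*-identityˡ 1ʳ)
    ^ʳ-* x y (suc k) = ≋-trans (*ʳ-cong ≋-refl (^ʳ-* x y k))
      (RS.solve 4 (λ x y a b → (x RS.:* y) RS.:* (a RS.:* b) RS.:= (x RS.:* a) RS.:* (y RS.:* b)) ≋-refl x y (x ^ʳ k) (y ^ʳ k))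

    nat-^ : ∀ a k → nat (a ℕ.^ k) ≋ nat a ^ʳ k
    nat-^ a zero    = ≋-refl
    nat-^ a (suc k) = ≋-trans (nat-* a (a ℕ.^ k)) (*ʳ-cong ≋-refl (nat-^ a k))

    power-log : ∀ {m L} c A k → c ℕ.≤ A ℕ.* m ℕ.^ k → nat m ≼ nat 108 *ʳ L → nat c ≼ nat (A ℕ.* 108 ℕ.^ k) *ʳ L ^ʳ k
    power-log {m} {L} c A k c≤ m≼ = ≼-trans (nat-mono c≤) (≼-trans
      (≼-reflexive (≋-trans (nat-* A (m ℕ.^ k)) (*ʳ-cong ≋-refl (nat-^ m k))))
      (≼-trans (*ʳ-monoˡ (0≼nat A) (proj₂ (proj₂ (^ʳ-mono k (0≼nat m) m≼))))
      (≼-reflexive (≋-trans (*ʳ-cong ≋-refl (^ʳ-* (nat 108) L k)) (≋-trans (≋-sym (R.*-assoc (nat A) (nat 108 ^ʳ k) (L ^ʳ k)))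
        (*ʳ-cong (≋-trans (*ʳ-cong ≋-refl (≋-sym (nat-^ 108 k))) (≋-sym (nat-* A (108 ℕ.^ k)))) ≋-refl))))))

    invert : ∀ {a b d e} → 0ʳ ≼ e → e *ʳ d ≋ 1ʳ → a *ʳ d ≼ b → a ≼ b *ʳ e
    invert {a} {b} {d} {e} 0≼e ed h = ≼-trans (≼-reflexive (≋-sym (≋-trans
      (RS.solve 3 (λ a d e → (a RS.:* d) RS.:* e RS.:= a RS.:* (e RS.:* d)) ≋-refl a d e)
      (≋-trans (*ʳ-cong ≋-refl ed) (R.*-identityʳ a))))) (*ʳ-monoʳ 0≼e h)

    -- With `E = 1 / δ` the hypotheses give `p ^ ρ ≤ E²`, `p ^ k ≤ E⁴` and `4/3 ≤ E⁴`. The last of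
    -- these, cubed, gives `2 ≤ E ^ 12`, which pays for the summand 1 in the exponent; altogether
    -- `12 + 4 + 2 = 18`.
    exp-bound : ∀ {δ L} k ρ → expʳ L *ʳ δ ≋ 1ʳ → nat (p ℕ.^ ρ) *ʳ (δ *ʳ δ) ≼ 1ʳ →
      nat (p ℕ.^ k) *ʳ ((δ *ʳ δ) *ʳ (δ *ʳ δ)) ≼ 1ʳ → nat 4 *ʳ ((δ *ʳ δ) *ʳ (δ *ʳ δ)) ≼ nat 3 →
      nat (2 ℕ.^ suc (k ℕ.+ ρ)) ≼ expʳ L ^ʳ 18
    exp-bound {δ} {L} k ρ Eδ hρ hk h4 = ≼-trans (nat-mono sizes) (≼-trans (≼-reflexive
        (≋-trans (nat-* 2 (p ℕ.^ k ℕ.* p ℕ.^ ρ)) (*ʳ-cong ≋-refl (nat-* (p ℕ.^ k) (p ℕ.^ ρ)))))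
      (≼-trans (*ʳ-mono (0≼nat 2) (0≼* 0≼E₄ 0≼E₂) two (*ʳ-mono (0≼nat (p ℕ.^ k)) 0≼E₂ pk pρ))
        (≼-reflexive power)))
      where
      E E₂ E₄ : ℝ
      E = expʳ L
      E₂ = E *ʳ E
      E₄ = E₂ *ʳ E₂
      0≼E₂ = 0≼square E
      0≼E₄ = 0≼square E₂
      E₂δ₂ : E₂ *ʳ (δ *ʳ δ) ≋ 1ʳ
      E₂δ₂ = ≋-trans (RS.solve 2 (λ e d → (e RS.:* e) RS.:* (d RS.:* d) RS.:= (e RS.:* d) RS.:* (e RS.:* d)) ≋-refl E δ)
        (≋-trans (*ʳ-cong Eδ Eδ) (R.*-identityˡ 1ʳ))
      E₄δ₄ : E₄ *ʳ ((δ *ʳ δ) *ʳ (δ *ʳ δ)) ≋ 1ʳ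
      E₄δ₄ = ≋-trans (RS.solve 2 (λ e d → (e RS.:* e) RS.:* (d RS.:* d) RS.:= (e RS.:* d) RS.:* (e RS.:* d)) ≋-refl E₂ (δ *ʳ δ))
        (≋-trans (*ʳ-cong E₂δ₂ E₂δ₂) (R.*-identityˡ 1ʳ))
      pρ : nat (p ℕ.^ ρ) ≼ E₂
      pρ = ≼-trans (invert 0≼E₂ E₂δ₂ hρ) (≼-reflexive (R.*-identityˡ E₂))
      pk : nat (p ℕ.^ k) ≼ E₄
      pk = ≼-trans (invert 0≼E₄ E₄δ₄ hk) (≼-reflexive (R.*-identityˡ E₄))
      four : nat 4 ≼ nat 3 *ʳ E₄
      four = invert 0≼E₄ E₄δ₄ h4
      0≼3E₄ = 0≼* (0≼nat 3) 0≼E₄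
      two : nat 2 ≼ E₄ *ʳ (E₄ *ʳ E₄)
      -- Cubing `4 ≤ 3 E₄` gives `64 ≤ 27 E₄³`, and `54 ≤ 64`; a square would not do, as `16/9 < 2`.
      two = cancel-≼ 27 (≼-trans (≼-reflexive (≋-sym (nat-* 27 2))) (≼-trans (nat-mono {54} {64} (ℕP.m≤m+n 54 10))
        (≼-trans (≼-reflexive (≋-trans (nat-* 4 16) (*ʳ-cong ≋-refl (nat-* 4 4))))
        (≼-trans (*ʳ-mono (0≼nat 4) (0≼* 0≼3E₄ 0≼3E₄) four (*ʳ-mono (0≼nat 4) 0≼3E₄ four four))
        (≼-reflexive (≋-trans (RS.solve 2 (λ a e → (a RS.:* e) RS.:* ((a RS.:* e) RS.:* (a RS.:* e)) RS.:= (a RS.:* (a RS.:* a)) RS.:* (e RS.:* (e RS.:* e))) ≋-refl (nat 3) E₄)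
          (*ʳ-cong (≋-sym (≋-trans (nat-* 3 9) (*ʳ-cong ≋-refl (nat-* 3 3)))) ≋-refl)))))))
      sizes : 2 ℕ.^ suc (k ℕ.+ ρ) ℕ.≤ 2 ℕ.* (p ℕ.^ k ℕ.* p ℕ.^ ρ)
      sizes = ℕP.*-monoʳ-≤ 2 (ℕP.≤-trans (ℕP.≤-reflexive (ℕP.^-distribˡ-+-* 2 k ρ)) (ℕP.*-mono-≤ (ℕP.^-monoˡ-≤ k 1<p) (ℕP.^-monoˡ-≤ ρ 1<p)))
      power : (E₄ *ʳ (E₄ *ʳ E₄)) *ʳ (E₄ *ʳ E₂) ≋ E ^ʳ 18
      power = ≋-trans (RS.solve 1 (λ e → (((e RS.:* e) RS.:* (e RS.:* e)) RS.:* (((e RS.:* e) RS.:* (e RS.:* e)) RS.:* ((e RS.:* e) RS.:* (e RS.:* e)))) RS.:* (((e RS.:* e) RS.:* (e RS.:* e)) RS.:* (e RS.:* e))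
        RS.:= e RS.:* (e RS.:* (e RS.:* (e RS.:* (e RS.:* (e RS.:* (e RS.:* (e RS.:* (e RS.:* (e RS.:* (e RS.:* (e RS.:* (e RS.:* (e RS.:* (e RS.:* (e RS.:* (e RS.:* (e RS.:* RS.con (+ 1))))))))))))))))))) ≋-refl E) ≋-refl

    module Main {n} (f : Fun p n) (hd : HasDegree {{nz}} 3 f) where

      D : Deg 3 f
      D = DegreeAtMost⇒Deg (proj₁ hd)

      T : Trilinear (third f)
      T = Third.trilinear {n} {f} (third-constant D)

      N Z : ℕ
      N = p ℕ.^ n
      Z = Structure.Z T

      ker : V n → Sub n
      ker = Structure.ker T

      0<N : 0 ℕ.< N
      0<N = p^>0 n

      N≤Z : N ℕ.≤ Z
      N≤Z = ℕP.≤-trans (ℕP.≤-reflexive (sym (trans (∑ℕ-const 1 (points p n)) (trans (ℕP.*-identityʳ _) (length-points n)))))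
        (∑ℕ-mono (points p n) (λ h → 0<# (ker h)))

      Z≤N² : Z ℕ.≤ N ℕ.* N
      Z≤N² = ℕP.≤-trans (∑ℕ-mono (points p n) (λ h → #≤p^n (mem? (ker h))))
        (ℕP.≤-reflexive (trans (∑ℕ-const N (points p n)) (cong (ℕ._* N) (length-points n))))

      4Z≤3N² : 4 ℕ.* Z ℕ.≤ 3 ℕ.* (N ℕ.* N)
      4Z≤3N² = let (x , y , z , T≢0) = third-nonzero hd in Structure.Z-gap T T≢0

      -- What depends on `f` alone; the value δ of the bias enters later through the estimates.
      record Choice : Set₁ where
        field
          k       : ℕ
          k-lower : Z ℕ.* p ℕ.^ k ℕ.≤ N ℕ.* N
          W U     : Sub n
          U⊆W     : U ⊆ W
          W-size  : N ℕ.≤ p ℕ.^ suc (suc k) ℕ.* # (mem? W)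
          U-size  : # (mem? W) ℕ.≤ p ℕ.^ (2 ℕ.* ((3 ℕ.* suc (suc k) ℕ.+ 2) ℕ.* suc (suc k))) ℕ.* # (mem? U)
          iso     : Structure.Isotropic T W U

      choice : Choice
      choice =
        let (k , lo , hi) = scale-exponent Z (N ℕ.* N) (ℕP.≤-trans 0<N N≤Z) Z≤N²
            (W , U , U⊆W , W-size , U-size , iso) = Structure.structure T k hi
        in record { k = k ; k-lower = lo ; W = W ; U = U ; U⊆W = U⊆W ; W-size = W-size ; U-size = U-size ; iso = iso }

      module Chosen (ch : Choice) where
        open Choice ch

        flat : ∀ {u v w} → Mem U u → Mem U v → Mem U w → third f u v w ≡ 0F
        flat u∈ v∈ w∈ = iso (U⊆W u∈) v∈ w∈

        module Biased {δ} (B : Bias f δ) where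
          open Bias B
          radical : V n → Sub n
          radical = Fourier.Cubic.Coset.radical χ {n} {f} (third-constant D) U flat

          #U : ℕ
          #U = # (mem? U)

          deepest : ∃[ b ] (∀ x → # (mem? (radical x)) ℕ.≤ # (mem? (radical b)))
          -- A base point with the largest radical is found by minimising the number of vectors
          -- outside it.
          deepest = let (b , _ , min) = argmin whole (λ x → N ℕ.∸ # (mem? (radical x))) in
            b , λ x → ℕP.≮⇒≥ λ lt → ℕP.<⇒≱ (ℕP.∸-monoʳ-< lt (#≤p^n (mem? (radical x)))) (min x tt)

          b : V n
          b = proj₁ deepest

          U′ : Sub n
          U′ = radical b

          U′⊆U : U′ ⊆ U
          U′⊆U = proj₁

          Cρ : Complement U′ U
          Cρ = complement U′ U U′⊆U

          C₁ : Complement W whole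
          C₁ = complement W whole (λ _ → tt)

          C₂ : Complement U′ W
          C₂ = complement U′ W (λ h → U⊆W (U′⊆U h))

          ρ c₁ s r R : ℕ
          ρ  = codim Cρ
          c₁ = codim C₁
          s  = codim C₂
          r  = suc (suc k)
          R  = (3 ℕ.* r ℕ.+ 2) ℕ.* r

          c₁≤r : c₁ ℕ.≤ r
          c₁≤r = p^-cancel-≤ (cancelʳ (0<# W) (ℕP.≤-trans (ℕP.≤-reflexive (index C₁)) (ℕP.≤-trans (#≤p^n (mem? (whole {n}))) W-size)))

          s≤ : s ℕ.≤ 2 ℕ.* R ℕ.+ ρ
          s≤ = p^-cancel-≤ (cancelʳ (0<# U′) (ℕP.≤-trans (ℕP.≤-reflexive (index C₂)) (ℕP.≤-trans U-size
            (ℕP.≤-reflexive (trans (cong (p ℕ.^ (2 ℕ.* R) ℕ.*_) (sym (index Cρ)))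
              (trans (sym (ℕP.*-assoc (p ℕ.^ (2 ℕ.* R)) (p ℕ.^ ρ) (# (mem? U′)))) (cong (ℕ._* # (mem? U′)) (sym (ℕP.^-distribˡ-+-* p (2 ℕ.* R) ρ)))))))))

          δ₂ δ₄ : ℝ
          δ₂ = δ *ʳ δ
          δ₄ = δ₂ *ʳ δ₂

          N>0 : ℕ.NonZero N
          N>0 = ℕ.>-nonZero 0<N

          Z-bound : nat N *ʳ (nat N *ʳ δ₄) ≼ nat Z
          Z-bound = cancel-≼ N {{N>0}} (cancel-≼ N {{N>0}} (≼-trans (≼-reflexive
              (≋-trans (RS.solve 2 (λ N d → N RS.:* (N RS.:* (N RS.:* (N RS.:* ((d RS.:* d) RS.:* (d RS.:* d))))) RS.:= ((N RS.:* d) RS.:* (N RS.:* d)) RS.:* ((N RS.:* d) RS.:* (N RS.:* d))) ≋-refl (nat N) δ)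
                (*ʳ-cong modulus modulus)))
            (≼-trans (Fourier.Cubic.plain-square χ {n} {f} (third-constant D)) (≼-reflexive (*ʳ-cong ≋-refl (*ʳ-comm (nat Z) (nat N)))))))

          -- Any bound on `Z / N²` becomes one on δ⁴. It is applied to the choice of `k` and to the
          -- gap `3/4`.
          Z-scale : ∀ a c → a ℕ.* Z ℕ.≤ c ℕ.* (N ℕ.* N) → nat a *ʳ δ₄ ≼ nat c
          Z-scale a c h = cancel-≼ N {{N>0}} (cancel-≼ N {{N>0}} (≼-trans
            (≼-reflexive (RS.solve 3 (λ N a d → N RS.:* (N RS.:* (a RS.:* d)) RS.:= a RS.:* (N RS.:* (N RS.:* d))) ≋-refl (nat N) (nat a) δ₄))
            (≼-trans (*ʳ-monoˡ (0≼nat a) Z-bound) (≼-trans (≼-reflexive (≋-sym (nat-* a Z))) (≼-trans (nat-mono h) (≼-reflexive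
              (≋-trans (nat-* c (N ℕ.* N)) (≋-trans (*ʳ-cong ≋-refl (nat-* N N))
                (RS.solve 2 (λ N c → c RS.:* (N RS.:* N) RS.:= N RS.:* (N RS.:* c)) ≋-refl (nat N) (nat c))))))))))

          U-bound : nat #U *ʳ δ₂ ≼ nat (# (mem? U′))
          U-bound = cancel-≼ N {{N>0}} (cancel-≼ N {{N>0}} (cancel-≼ #U {{ℕ.>-nonZero (0<# U)}} (≼-trans (≼-reflexive
              (≋-trans (RS.solve 3 (λ u N d → u RS.:* (N RS.:* (N RS.:* (u RS.:* (d RS.:* d)))) RS.:= (u RS.:* u) RS.:* ((N RS.:* d) RS.:* (N RS.:* d))) ≋-refl (nat #U) (nat N) δ)
                (*ʳ-cong ≋-refl modulus)))
            (≼-trans (Fourier.Cubic.Coset.plain-≼ χ {n} {f} (third-constant D) U flat (# (mem? U′)) (proj₂ deepest)) (≼-reflexive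
              (RS.solve 3 (λ N m u → N RS.:* (N RS.:* (m RS.:* u)) RS.:= u RS.:* (N RS.:* (N RS.:* m))) ≋-refl (nat N) (nat (# (mem? U′))) (nat #U)))))))

          -- `U-bound` divided by the size of `U′`, as `p ^ ρ` is the index of `U′` in `U`.
          ρ-bound : nat (p ℕ.^ ρ) *ʳ δ₂ ≼ 1ʳ
          ρ-bound = cancel-≼ (# (mem? U′)) {{ℕ.>-nonZero (0<# U′)}} (≼-trans (≼-reflexive (≋-trans
              (RS.solve 3 (λ m q d → m RS.:* (q RS.:* d) RS.:= (q RS.:* m) RS.:* d) ≋-refl (nat (# (mem? U′))) (nat (p ℕ.^ ρ)) δ₂)
              (*ʳ-cong (≋-trans (≋-sym (nat-* (p ℕ.^ ρ) (# (mem? U′)))) (≡⇒≋ (cong nat (index Cρ)))) ≋-refl)))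
            (≼-trans U-bound (≼-reflexive (≋-sym (R.*-identityʳ (nat (# (mem? U′))))))))

          -- The single quantity compared with the logarithm. Its summand 1 absorbs the additive
          -- constants in `r = k + 2` and in the bounds for `s` and `c₂`.
          m : ℕ
          m = suc (k ℕ.+ ρ)

          m-bound : ∀ L → expʳ L *ʳ δ ≋ 1ʳ → nat m ≼ nat 108 *ʳ L
          m-bound L inv = log-bound L (k ℕ.+ ρ) (exp-bound {δ} {L} k ρ inv ρ-bound
            (Z-scale (p ℕ.^ k) 1 (ℕP.≤-trans (ℕP.≤-reflexive (ℕP.*-comm (p ℕ.^ k) Z)) (ℕP.≤-trans k-lower (ℕP.≤-reflexive (sym (ℕP.*-identityˡ (N ℕ.* N)))))))
            (Z-scale 4 3 4Z≤3N²))

          r≤2m : r ℕ.≤ 2 ℕ.* m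
          r≤2m = ℕP.≤-trans (ℕP.m≤m+n r (k ℕ.+ (ρ ℕ.+ ρ))) (ℕP.≤-reflexive
            (solve 2 (λ k ρ → (con 2 :+ k) :+ (k :+ (ρ :+ ρ)) := con 2 :* (con 1 :+ (k :+ ρ))) refl k ρ))
            where open +-*-Solver

          s≤33m² : s ℕ.≤ 33 ℕ.* (m ℕ.* m)
          s≤33m² = begin
            s                                                ≤⟨ s≤ ⟩
            -- From `r ≤ 2 m` and `1 ≤ m` follows `3 r + 2 ≤ 8 m`, so the bound is
            -- `2 · 8 m · 2 m + m² = 33 m²`.
            2 ℕ.* ((3 ℕ.* r ℕ.+ 2) ℕ.* r) ℕ.+ ρ              ≤⟨ ℕP.+-mono-≤ (ℕP.*-monoʳ-≤ 2 (ℕP.*-mono-≤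
                (ℕP.+-mono-≤ (ℕP.*-monoʳ-≤ 3 r≤2m) (ℕP.*-monoʳ-≤ 2 1≤m)) r≤2m)) ρ≤m² ⟩
            2 ℕ.* ((3 ℕ.* (2 ℕ.* m) ℕ.+ 2 ℕ.* m) ℕ.* (2 ℕ.* m)) ℕ.+ m ℕ.* m
              ≡⟨ solve 1 (λ m → con 2 :* ((con 3 :* (con 2 :* m) :+ con 2 :* m) :* (con 2 :* m)) :+ m :* m := con 33 :* (m :* m)) refl m ⟩
            33 ℕ.* (m ℕ.* m)                                 ∎
            where
            open ℕP.≤-Reasoning
            open +-*-Solver
            1≤m : 1 ℕ.≤ m
            1≤m = ℕ.s≤s ℕ.z≤n
            ρ≤m² : ρ ℕ.≤ m ℕ.* m
            ρ≤m² = ℕP.≤-trans (ℕP.≤-trans (ℕP.m≤n+m ρ (suc k)) (ℕP.≤-reflexive (sym (ℕP.*-identityˡ m)))) (ℕP.*-monoˡ-≤ m 1≤m)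

          c₂≤ : s ℕ.+ suc s ℕ.* suc s ℕ.≤ 1225 ℕ.* m ℕ.^ 4
          c₂≤ = begin
            -- Adding `s + 3` completes the square `(s + 2)²`, and `s + 2 ≤ 35 m²` explains
            -- `1225 = 35²`.
            s ℕ.+ suc s ℕ.* suc s                            ≤⟨ ℕP.m≤m+n _ (s ℕ.+ 3) ⟩
            s ℕ.+ suc s ℕ.* suc s ℕ.+ (s ℕ.+ 3)              ≡⟨ solve 1 (λ s → s :+ (con 1 :+ s) :* (con 1 :+ s) :+ (s :+ con 3) := (s :+ con 2) :* (s :+ con 2)) refl s ⟩
            (s ℕ.+ 2) ℕ.* (s ℕ.+ 2)                          ≤⟨ ℕP.*-mono-≤ s+2≤ s+2≤ ⟩
            (33 ℕ.* (m ℕ.* m) ℕ.+ 2 ℕ.* (m ℕ.* m)) ℕ.* (33 ℕ.* (m ℕ.* m) ℕ.+ 2 ℕ.* (m ℕ.* m))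
              ≡⟨ solve 1 (λ m → (con 33 :* (m :* m) :+ con 2 :* (m :* m)) :* (con 33 :* (m :* m) :+ con 2 :* (m :* m))
                   := con 1225 :* (m :* (m :* (m :* (m :* con 1))))) refl m ⟩
            1225 ℕ.* m ℕ.^ 4                                 ∎
            where
            open ℕP.≤-Reasoning
            open +-*-Solver
            s+2≤ : s ℕ.+ 2 ℕ.≤ 33 ℕ.* (m ℕ.* m) ℕ.+ 2 ℕ.* (m ℕ.* m)
            s+2≤ = ℕP.+-mono-≤ s≤33m² (ℕP.*-monoʳ-≤ 2 (ℕP.*-mono-≤ (ℕ.s≤s (ℕ.z≤n {k ℕ.+ ρ})) (ℕ.s≤s (ℕ.z≤n {k ℕ.+ ρ}))))

          c₂ : ℕ
          c₂ = s ℕ.+ suc s ℕ.* suc s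

          bound₁ : LogBound c₁ (2 ℕ.* 108 ℕ.^ 1) 1 δ
          bound₁ = logBound c₁ (2 ℕ.* 108 ℕ.^ 1) 1 δ (λ L inv → power-log {m} {L} c₁ 2 1
            (ℕP.≤-trans c₁≤r (ℕP.≤-trans r≤2m (ℕP.≤-reflexive (cong (2 ℕ.*_) (sym (ℕP.*-identityʳ m)))))) (m-bound L inv))

          bound₂ : LogBound c₂ (1225 ℕ.* 108 ℕ.^ 4) 4 δ
          bound₂ = logBound c₂ (1225 ℕ.* 108 ℕ.^ 4) 4 δ (λ L inv → power-log {m} {L} c₂ 1225 4 c₂≤ (m-bound L inv))

          conclusion : ∃[ c₁ ] ∃[ c₂ ] (LogBound c₁ (2 ℕ.* 108 ℕ.^ 1) 1 δ × LogBound c₂ (1225 ℕ.* 108 ℕ.^ 4) 4 δ ×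
            (Σ[ q ∈ (Fin c₁ → Fun p n) ] Σ[ ℓ ∈ (Fin c₁ → Fun p n) ]
             Σ[ ℓ′ ∈ (Fin c₂ → Fun p n) ] Σ[ g ∈ Fun p c₂ ]
               ((∀ j → DegreeAtMost 2 (q j)) × (∀ j → DegreeAtMost 1 (ℓ j)) ×
                (∀ j → DegreeAtMost 1 (ℓ′ j)) × DegreeAtMost 3 g ×
                ((a : Vec (F p) n) →
                  f a ≡ ∑F (λ j → ℓ j a *F q j a) +F g (tabulate (λ j → ℓ′ j a))))))
          conclusion = c₁ , c₂ , bound₁ , bound₂ ,
            -- The representation is built on the radical `U′` in place of `U`: there the second
            -- differences at `b` vanish, and isotropy is inherited from `U`.
            Represent.representation {n} {f} D W U′ (λ h → U⊆W (U′⊆U h)) b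
              (λ w∈ u∈ v∈ → iso w∈ (U′⊆U u∈) (U′⊆U v∈)) (λ {u} u∈ v∈ → proj₂ v∈ u (U′⊆U u∈)) C₁ C₂

theorem1 : (p : ℕ) .{{_ : NonZero p}} → Prime p →
    ∃[ C₁ ] ∃[ C₂ ]
    ((n : ℕ) (f : Fun p n) → HasDegree 3 f → (δ : ℝ) → IsBias f δ →
    ∃[ c₁ ] ∃[ c₂ ] (LogBound c₁ C₁ 1 δ × LogBound c₂ C₂ 4 δ ×
    (Σ[ q ∈ (Fin c₁ → Fun p n) ] Σ[ ℓ ∈ (Fin c₁ → Fun p n) ]
    Σ[ ℓ′ ∈ (Fin c₂ → Fun p n) ] Σ[ g ∈ Fun p c₂ ]
    ((∀ j → DegreeAtMost 2 (q j)) × (∀ j → DegreeAtMost 1 (ℓ j)) ×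
    (∀ j → DegreeAtMost 1 (ℓ′ j)) × DegreeAtMost 3 g ×
    ((a : Vec (F p) n) →
    f a ≡ ∑F (λ j → ℓ j a *F q j a) +F g (tabulate (λ j → ℓ′ j a)))))))
-- The constants are uniform in `p`: the comparison with the logarithm uses only `2 ≤ p`.
theorem1 p p-prime = 2 ℕ.* 108 ℕ.^ 1 , 1225 ℕ.* 108 ℕ.^ 4 , λ n f hd δ isBias →
  Proof.Conclusion.Main.Chosen.Biased.conclusion p p-prime f hd
    (Proof.Conclusion.Main.choice p p-prime f hd)
    (Proof.AdditiveCharacter.bias p p-prime {n} {f} {δ} isBias)
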